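{- Let $q$ be a prime power and let $\mathcal{T}$ be a triangle in $\mathrm{PG}(2,q)$, i.e. the union of the point sets of three non-concurrent lines (so $|\mathcal{T}|=3q$). There do not exist a set $H\subseteq\mathcal{T}$ with $|H|=6$ and a set $M$ of points of $\mathrm{PG}(2,q)$ with $M\cap\mathcal{T}=\emptyset$ and $|M|=5$ such that $(\mathcal{T}\setminus H)\cup M$ (a set of $3q-1$ points) is a double blocking set of $\mathrm{PG}(2,q)$.
   Context: A double blocking set of $\mathrm{PG}(2,q)$ is a set of points meeting every line in at least two points. -}

module Defs where

open import Level using (0ℓ)
open import Algebra.Bundles using (CommutativeRing)
open import Data.Nat using (ℕ; suc; _^_)
open import Data.Nat.Primality using (Prime)
open import Data.Fin using (Fin)
open import Data.Product using (Σ; ∃; ∃₂; _×_; _,_)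
open import Data.Sum using (_⊎_)
open import Data.List using (List)
open import Data.List.Relation.Unary.Any using (Any)
open import Data.List.Relation.Unary.AllPairs using (AllPairs)
open import Relation.Nullary using (¬_)
open import Relation.Binary.PropositionalEquality using (_≡_)

PrimePower : ℕ → Set
PrimePower q = ∃₂ λ p k → Prime p × q ≡ p ^ suc k

IsField : CommutativeRing 0ℓ 0ℓ → Set
IsField F = (1# ≉ 0#) × (∀ x → x ≉ 0# → ∃ λ y → x * y ≈ 1#)
  where open CommutativeRing F

HasOrder : CommutativeRing 0ℓ 0ℓ → ℕ → Set
HasOrder F q = Σ (Fin q → Carrier) λ e →
    (∀ i j → e i ≈ e j → i ≡ j) × (∀ x → ∃ λ i → e i ≈ x)
  where open CommutativeRing F

-- The projective plane PG(2,F): points (and lines) are represented by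
-- nonzero vectors of F³, identified up to nonzero scalar multiples.
module PG (F : CommutativeRing 0ℓ 0ℓ) where
  open CommutativeRing F

  record NZVec : Set where
    constructor vec
    field
      x y z   : Carrier
      nonzero : ¬ (x ≈ 0# × y ≈ 0# × z ≈ 0#)

  Point : Set
  Point = NZVec

  Line : Set
  Line = NZVec

  _~_ : NZVec → NZVec → Set
  vec x y z _ ~ vec x' y' z' _ =
    ∃ λ c → (x' ≈ c * x) × (y' ≈ c * y) × (z' ≈ c * z)

  _I_ : Point → Line → Set
  vec x y z _ I vec a b c _ = a * x + b * y + c * z ≈ 0#

  PointSet : Set₁
  PointSet = Point → Set

  _∈ₚ_ : Point → List Point → Set
  p ∈ₚ L = Any (λ r → p ~ r) L

  -- a list of pairwise distinct points (so its length is the size of the set)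
  Distinct : List Point → Set
  Distinct = AllPairs (λ p r → ¬ (p ~ r))

  NonConcurrent : Line → Line → Line → Set
  NonConcurrent l₁ l₂ l₃ = ∀ p → ¬ (p I l₁ × p I l₂ × p I l₃)

  Triangle : Line → Line → Line → PointSet
  Triangle l₁ l₂ l₃ p = p I l₁ ⊎ p I l₂ ⊎ p I l₃

  Modify : PointSet → List Point → List Point → PointSet
  Modify T H M p = (T p × ¬ (p ∈ₚ H)) ⊎ p ∈ₚ M

  DoubleBlocking : PointSet → Set
  DoubleBlocking S = ∀ (ℓ : Line) → ∃₂ λ p r →
    S p × S r × p I ℓ × r I ℓ × ¬ (p ~ r)

{-# OPTIONS --safe #-}
-- In coordinates in which the triangle is XYZ = 0, a point off it is given by u = Z/Y, v = X/Z, w = Y/X with uvw = 1.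
-- Every line joining a deleted point of a side to the opposite vertex, or to a deleted point of another side, must be
-- compensated by points of M. In the pencil of a deleted point α this is an inclusion between multisets of field
-- elements, the slopes uw - αw of the points of M being affine in α, so that their elementary symmetric functions are
-- polynomials of low degree in α with several prescribed values.
-- If no vertex is deleted, counting in the pencils leaves the distributions (4,2,0), (3,3,0), (2,2,2) of the deleted
-- points on the sides. The first two are excluded by e₁ and e₂. In the third, for each vertex, the coordinates of the
-- three points of M on no line joining it to a deleted point have e₁ = e₂ = 0, hence equal cubes. This leaves three
-- patterns: the two points of M compensating the vertex lines are the same for all three vertices
-- ("parallel"), or any two vertices share exactly one of them ("triangle"), or two vertices share one and the third is
-- disjoint from both ("ω"). After normalising one point of M, each contradicts the remaining pencil equations.
-- If a vertex is deleted, then q is 4 or 5. The case q = 5 yields to the same symmetric functions. If q = 4, then the ten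
-- points outside the double blocking set lie at most three on a line, so through each of them there are four lines
-- with three and one with two of these points; hence 40 would be divisible by 3.

module Submission where

open import Defs
open import Level using (0ℓ)
open import Algebra.Bundles using (CommutativeRing; RawRing)
open import Algebra.Morphism.Structures using (IsRingMonomorphism)
import Algebra.Morphism.RingMonomorphism as RingMonomorphism
import Algebra.Properties.Ring as RingProperties
import Algebra.Properties.Semiring.Mult.TCOptimised as Multiples
import Algebra.Solver.Ring as RingSolver
open import Algebra.Solver.Ring.AlmostCommutativeRing using (AlmostCommutativeRing; fromCommutativeRing; _-Raw-AlmostCommutative⟶_)
open import Algebra.Structures using (IsCommutativeRing)
open import Data.Bool using (Bool; true; false)
open import Data.Empty using (⊥; ⊥-elim)
open import Data.Fin as Fin using (Fin)
open import Data.Fin.Patterns using (0F; 1F; 2F)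
import Data.Fin.Properties as Finₚ
open import Data.Integer as ℤ using (ℤ; +_; -[1+_])
import Data.Integer.Properties as ℤₚ
open import Data.List using (List; []; _∷_; _++_; allFin; cartesianProductWith; length; lookup; map; replicate)
open import Data.List.Membership.Propositional using (_∈_; _∉_; find)
open import Data.List.Membership.Propositional.Properties using (∈-∃++; ∈-map⁺; ∈-map⁻; ∈-++⁻; ∈-++⁺ˡ; ∈-++⁺ʳ; ∈-allFin; ∈-lookup; ∈-cartesianProductWith⁺; ∈-cartesianProductWith⁻)
import Data.List.Properties as Listₚ
open import Data.List.Relation.Binary.Permutation.Propositional using (_↭_; refl; prep; swap; trans; ↭-sym; ↭-trans; ↭-reflexive; ↭⇒↭ₛ)
import Data.List.Relation.Binary.Permutation.Propositional.Properties as ↭ₚ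
import Data.List.Relation.Binary.Permutation.Setoid.Properties as ↭ₛₚ
open import Data.List.Relation.Unary.All as All using (All; []; _∷_)
import Data.List.Relation.Unary.All.Properties as Allₚ
open import Data.List.Relation.Unary.AllPairs as AllPairs using (AllPairs; []; _∷_)
import Data.List.Relation.Unary.AllPairs.Properties as AllPairsₚ
open import Data.List.Relation.Unary.Any as Any using (Any; here; there)
open import Data.List.Relation.Unary.Any.Properties using (lookup-index)
open import Data.List.Relation.Unary.Unique.Propositional using (Unique)
import Data.List.Relation.Unary.Unique.Propositional.Properties as Uniqueₚ
open import Data.Maybe using (Maybe; just; nothing)
import Data.Maybe.Properties as Maybeₚ
open import Data.Nat as ℕ using (ℕ; zero; suc; z≤n; s≤s; _^_)
open import Data.Nat.Divisibility using (_∣_; _∣?_; divides; ∣⇒≤)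
open import Data.Nat.Primality using (Prime; prime?)
import Data.Nat.Properties as ℕₚ
open import Data.Nat.Tactic.RingSolver using (solve-∀)
open import Data.Product as Product using (∃; _×_; _,_; proj₁; proj₂)
open import Data.Sum as Sum using (_⊎_; inj₁; inj₂)
open import Data.Unit using (⊤; tt)
open import Function using (_∘_)
open import Relation.Binary.Definitions using (DecidableEquality)
open import Relation.Binary.PropositionalEquality as ≡ using (_≡_; _≢_; cong; cong₂; subst; subst₂; sym)
import Relation.Binary.Reasoning.Setoid
open import Relation.Nullary using (¬_; Dec; yes; no)
open import Relation.Nullary.Decidable using (_→-dec_; _×-dec_; _⊎-dec_; from-yes; from-no)

-- The lines through a deleted point `α` of the side X = 0 are told apart by (Z - αY)/X = uw - αw,
-- and the points of M offer only five such values. In every pencil whose symmetric functions are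
-- used, at most one of the five is not prescribed. The k-th symmetric function of the slopes has
-- degree at most k in `α`, so a side with more than k deleted points determines all its
-- coefficients; coefficients known beforehand lower this threshold, and thus two deleted points on
-- a side can suffice for degree two as well.
--
-- A deleted vertex bounds the order from both directions. Each of the q - 1 lines through it other
-- than the sides needs a point of M, whence q ≤ 6. Each side keeps two of its q + 1 points, and
-- deleted vertices lie on two sides, whence 3q ≥ 10. The value 6 is not a prime power.
--
-- The characteristic is arbitrary. All eliminations are therefore identities over ℤ with explicit
-- cofactors, nothing is divided by an integer, and characteristic 2 appears only as a derived
-- equation.

record FinField : Set₁ where
  infixl 6 _+_
  infixl 7 _*_
  infix 8 -_
  infix 9 _⁻¹
  field
    K : Set
    _+_ _*_ : K → K → K
    -_ _⁻¹ : K → K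
    0# 1# : K
    isCommutativeRing : IsCommutativeRing _≡_ _+_ _*_ -_ 0# 1#
    1≢0 : 1# ≢ 0#
    *-inverse : ∀ x → x ≢ 0# → x * x ⁻¹ ≡ 1#
    _≟_ : DecidableEquality K
    elements : List K
    elements-unique : Unique elements
    elements-complete : ∀ x → x ∈ elements

  infixl 6 _-_
  _-_ : K → K → K
  x - y = x + - y

-- Polynomial identities with integer coefficients.

module IntegerCoefficients (R : CommutativeRing 0ℓ 0ℓ) where
  open CommutativeRing R hiding (refl; sym; trans)
  open RingProperties ring
  open Multiples semiring using () renaming (_×_ to _·_; ×-homo-+ to ·-homo-+; ×1-homo-* to ·1-homo-*; 1+× to 1+·)
  import Relation.Binary.Reasoning.Setoid setoid as ≈R
  open CommutativeRing R using () renaming (refl to ≈refl; sym to ≈sym; trans to ≈trans)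

  ι : ℤ → Carrier
  ι (+ n) = n · 1#
  ι -[1+ n ] = - (suc n · 1#)

  ι-⊖ : ∀ m n → ι (m ℤ.⊖ n) ≈ m · 1# - n · 1#
  ι-⊖ m zero = ≈trans (≈sym (+-identityʳ _)) (+-congˡ (≈sym -0#≈0#))
  ι-⊖ zero (suc n) = ≈sym (+-identityˡ _)
  ι-⊖ (suc m) (suc n) = begin
    ι (suc m ℤ.⊖ suc n)                   ≡⟨ cong ι (ℤₚ.[1+m]⊖[1+n]≡m⊖n m n) ⟩
    ι (m ℤ.⊖ n)                           ≈⟨ ι-⊖ m n ⟩
    m · 1# - n · 1#                       ≈⟨ +-congʳ (+-identityʳ _) ⟨
    (m · 1# + 0#) - n · 1#                ≈⟨ +-congʳ (+-congˡ (-‿inverseʳ 1#)) ⟨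
    (m · 1# + (1# - 1#)) - n · 1#         ≈⟨ +-congʳ (+-assoc _ _ _) ⟨
    ((m · 1# + 1#) - 1#) - n · 1#         ≈⟨ +-assoc _ _ _ ⟩
    (m · 1# + 1#) + (- 1# - n · 1#)       ≈⟨ +-cong (+-comm _ _) (-‿+-comm _ _) ⟩
    (1# + m · 1#) - (1# + n · 1#)         ≈⟨ +-cong (1+· m 1#) (-‿cong (1+· n 1#)) ⟨
    suc m · 1# - suc n · 1#               ∎
    where open ≈R

  ι-+ : ∀ x y → ι (x ℤ.+ y) ≈ ι x + ι y
  ι-+ (+ m) (+ n) = ·-homo-+ 1# m n
  ι-+ (+ m) -[1+ n ] = ι-⊖ m (suc n)
  ι-+ -[1+ m ] (+ n) = ≈trans (ι-⊖ n (suc m)) (+-comm _ _)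
  ι-+ -[1+ m ] -[1+ n ] = ≈trans
    (-‿cong (≈trans (reflexive (cong (λ k → suc k · 1#) (sym (ℕₚ.+-suc m n)))) (·-homo-+ 1# (suc m) (suc n))))
    (≈sym (-‿+-comm _ _))

  ι-neg : ∀ x → ι (ℤ.- x) ≈ - ι x
  ι-neg (+ zero) = ≈sym -0#≈0#
  ι-neg (+ suc n) = ≈refl
  ι-neg -[1+ n ] = ≈sym (-‿involutive _)

  ι-*⁺ : ∀ m y → ι (+ m ℤ.* y) ≈ m · 1# * ι y
  ι-*⁺ m (+ n) = ≈trans (reflexive (cong ι (sym (ℤₚ.pos-* m n)))) (·1-homo-* m n)
  ι-*⁺ m -[1+ n ] = begin
    ι (+ m ℤ.* -[1+ n ])        ≡⟨ cong ι (ℤₚ.neg-distribʳ-* (+ m) (+ suc n)) ⟨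
    ι (ℤ.- (+ m ℤ.* + suc n))   ≈⟨ ι-neg (+ m ℤ.* + suc n) ⟩
    - ι (+ m ℤ.* + suc n)       ≈⟨ -‿cong (ι-*⁺ m (+ suc n)) ⟩
    - (m · 1# * (suc n · 1#))   ≈⟨ -‿distribʳ-* _ _ ⟩
    m · 1# * - (suc n · 1#)     ∎
    where open ≈R

  ι-* : ∀ x y → ι (x ℤ.* y) ≈ ι x * ι y
  ι-* (+ m) y = ι-*⁺ m y
  ι-* -[1+ m ] y = begin
    ι (-[1+ m ] ℤ.* y)          ≡⟨ cong ι (ℤₚ.neg-distribˡ-* (+ suc m) y) ⟨
    ι (ℤ.- (+ suc m ℤ.* y))     ≈⟨ ι-neg (+ suc m ℤ.* y) ⟩
    - ι (+ suc m ℤ.* y)         ≈⟨ -‿cong (ι-*⁺ (suc m) y) ⟩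
    - (suc m · 1# * ι y)        ≈⟨ -‿distribˡ-* _ _ ⟩
    - (suc m · 1#) * ι y        ∎
    where open ≈R

  almostCommutativeRing : AlmostCommutativeRing 0ℓ 0ℓ
  almostCommutativeRing = fromCommutativeRing R

  ι-morphism : ℤ.+-*-rawRing -Raw-AlmostCommutative⟶ almostCommutativeRing
  ι-morphism = record
    { ⟦_⟧ = ι ; +-homo = ι-+ ; *-homo = ι-* ; -‿homo = ι-neg
    ; 0-homo = ≈refl ; 1-homo = ≈refl }

  -- Coefficients are compared in ℤ and not in the ring, so every identity that is found holds in
  -- all commutative rings and never depends on the characteristic.
  weaklyEqual : ∀ x y → Maybe (ι x ≈ ι y)
  weaklyEqual x y with x ℤₚ.≟ y
  ... | yes ≡.refl = just ≈refl
  ... | no _ = nothing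

  open RingSolver ℤ.+-*-rawRing almostCommutativeRing ι-morphism weaklyEqual public

-- Field arithmetic and certificates of vanishing.

module FieldTheory (𝔽 : FinField) where
  open FinField 𝔽

  commutativeRing : CommutativeRing 0ℓ 0ℓ
  commutativeRing = record { isCommutativeRing = isCommutativeRing }

  open IntegerCoefficients commutativeRing public using (ι; Polynomial; solve; _:=_; _:+_; _:*_; _:-_; :-_; con)
  open IsCommutativeRing isCommutativeRing public
    using (+-identityˡ; +-identityʳ; *-identityˡ; *-identityʳ; zeroˡ; zeroʳ; +-comm; *-comm; +-assoc; *-assoc)

  :0 :1 :2 : ∀ {n} → Polynomial n
  :0 = con (+ 0)
  :1 = con (+ 1)
  :2 = con (+ 2)

  -- The pairs are a cofactor and a generator, so a value of this shape lies in the ideal of the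
  -- generators. With `vanish` and its short forms, each elimination below becomes a single
  -- polynomial identity.
  combination : List (K × K) → K
  combination [] = 0#
  combination ((c , p) ∷ L) = c * p + combination L

  abstract
    difference : ∀ {x y} → x ≡ y → x - y ≡ 0#
    difference {x} ≡.refl = solve 1 (λ x → x :- x := :0) ≡.refl x

    equal : ∀ {x y} → x - y ≡ 0# → x ≡ y
    equal {x} {y} x-y≡0 = begin
      x            ≡⟨ solve 2 (λ x y → x := (x :- y) :+ y) ≡.refl x y ⟩
      (x - y) + y  ≡⟨ cong (_+ y) x-y≡0 ⟩
      0# + y       ≡⟨ +-identityˡ y ⟩
      y            ∎
      where open ≡.≡-Reasoning

    vanish : ∀ {t} L → All (λ cp → proj₂ cp ≡ 0#) L → t ≡ combination L → t ≡ 0#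
    vanish L zeros t≡ = ≡.trans t≡ (go L zeros)
      where
      go : ∀ L → All (λ cp → proj₂ cp ≡ 0#) L → combination L ≡ 0#
      go [] [] = ≡.refl
      go ((c , p) ∷ L) (p≡0 ∷ zeros) = ≡.trans (cong₂ _+_ (≡.trans (cong (c *_) p≡0) (zeroʳ c)) (go L zeros)) (+-identityˡ 0#)

    vanish₁ : ∀ {t p} c → t ≡ c * p → p ≡ 0# → t ≡ 0#
    vanish₁ c t≡ ≡.refl = ≡.trans t≡ (zeroʳ c)

    vanish₂ : ∀ {t p q} c d → t ≡ c * p + d * q → p ≡ 0# → q ≡ 0# → t ≡ 0#
    vanish₂ c d t≡ ≡.refl ≡.refl = ≡.trans t≡ (solve 2 (λ c d → c :* :0 :+ d :* :0 := :0) ≡.refl c d)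

    vanish₃ : ∀ {t p q r} c d e → t ≡ c * p + d * q + e * r → p ≡ 0# → q ≡ 0# → r ≡ 0# → t ≡ 0#
    vanish₃ c d e t≡ ≡.refl ≡.refl ≡.refl =
      ≡.trans t≡ (solve 3 (λ c d e → c :* :0 :+ d :* :0 :+ e :* :0 := :0) ≡.refl c d e)

    vanish₄ : ∀ {t p q r s} c d e f → t ≡ c * p + d * q + e * r + f * s →
      p ≡ 0# → q ≡ 0# → r ≡ 0# → s ≡ 0# → t ≡ 0#
    vanish₄ c d e f t≡ ≡.refl ≡.refl ≡.refl ≡.refl =
      ≡.trans t≡ (solve 4 (λ c d e f → c :* :0 :+ d :* :0 :+ e :* :0 :+ f :* :0 := :0) ≡.refl c d e f)

    zero-product : ∀ {x y} → x * y ≡ 0# → x ≡ 0# ⊎ y ≡ 0#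
    zero-product {x} {y} xy≡0 with x ≟ 0#
    ... | yes x≡0 = inj₁ x≡0
    ... | no x≢0 = inj₂ (begin
      y                        ≡⟨ *-identityˡ y ⟨
      1# * y                   ≡⟨ cong (_* y) (*-inverse x x≢0) ⟨
      (x * x ⁻¹) * y           ≡⟨ solve 3 (λ x x′ y → (x :* x′) :* y := x′ :* (x :* y)) ≡.refl x (x ⁻¹) y ⟩
      x ⁻¹ * (x * y)           ≡⟨ cong (x ⁻¹ *_) xy≡0 ⟩
      x ⁻¹ * 0#                ≡⟨ zeroʳ _ ⟩
      0#                       ∎)
      where open ≡.≡-Reasoning

    product-≢0 : ∀ {x y} → x ≢ 0# → y ≢ 0# → x * y ≢ 0#
    product-≢0 x≢0 y≢0 xy≡0 with zero-product xy≡0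
    ... | inj₁ x≡0 = x≢0 x≡0
    ... | inj₂ y≡0 = y≢0 y≡0

    cancelˡ : ∀ {x y} → x ≢ 0# → x * y ≡ 0# → y ≡ 0#
    cancelˡ x≢0 xy≡0 with zero-product xy≡0
    ... | inj₁ x≡0 = ⊥-elim (x≢0 x≡0)
    ... | inj₂ y≡0 = y≡0

    difference-≢0 : ∀ {x y} → x ≢ y → x - y ≢ 0#
    difference-≢0 x≢y x-y≡0 = x≢y (equal x-y≡0)

    unit-≢0 : ∀ {x y} → x * y ≡ 1# → x ≢ 0#
    unit-≢0 {y = y} xy≡1 ≡.refl = 1≢0 (≡.trans (sym xy≡1) (zeroˡ y))

    ⁻¹-≢0 : ∀ {x} → x ≢ 0# → x ⁻¹ ≢ 0#
    ⁻¹-≢0 {x} x≢0 = unit-≢0 (≡.trans (*-comm _ x) (*-inverse x x≢0))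

    ⁻¹-unique : ∀ {x y} → x * y ≡ 1# → y ≡ x ⁻¹
    ⁻¹-unique {x} {y} xy≡1 = equal (vanish₂ (- (x ⁻¹)) y
      (solve 3 (λ x y z → y :- z := (:- z) :* (:1 :- x :* y) :+ y :* (:1 :- x :* z)) ≡.refl x y (x ⁻¹))
      (difference (sym xy≡1)) (difference (sym (*-inverse x (unit-≢0 xy≡1)))))

    ⁻¹-injective : ∀ {x y} → x ≢ 0# → y ≢ 0# → x ⁻¹ ≡ y ⁻¹ → x ≡ y
    ⁻¹-injective {x} {y} x≢0 y≢0 x⁻¹≡y⁻¹ = ≡.trans
      (⁻¹-unique (≡.trans (*-comm _ x) (*-inverse x x≢0)))
      (≡.trans (cong _⁻¹ x⁻¹≡y⁻¹) (sym (⁻¹-unique (≡.trans (*-comm _ y) (*-inverse y y≢0)))))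

    -- A polynomial of degree one with two different roots is zero. This is the passage from
    -- equations at two deleted points of a side to equations that no longer mention the deleted
    -- point.
    linear-form-zero : ∀ {x y a b} → a ≢ b → x - a * y ≡ 0# → x - b * y ≡ 0# → x ≡ 0# × y ≡ 0#
    linear-form-zero {x} {y} {a} {b} a≢b at-a at-b = x≡0 , y≡0
      where
      y≡0 : y ≡ 0#
      y≡0 = cancelˡ (difference-≢0 a≢b) (vanish₂ (- 1#) 1#
        (solve 4 (λ x y a b → (a :- b) :* y := (:- :1) :* (x :- a :* y) :+ :1 :* (x :- b :* y)) ≡.refl x y a b) at-a at-b)
      x≡0 : x ≡ 0#
      x≡0 = vanish₂ 1# a (solve 3 (λ x y a → x := :1 :* (x :- a :* y) :+ a :* y) ≡.refl x y a) at-a y≡0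

    scale-injective : ∀ {l x y} → l ≢ 0# → l * x ≡ l * y → x ≡ y
    scale-injective {l} {x} {y} l≢0 h = equal (cancelˡ l≢0 (vanish₁ 1#
      (solve 3 (λ l x y → l :* (x :- y) := :1 :* (l :* x :- l :* y)) ≡.refl l x y) (difference h)))

-- Finite lists as sets and multisets.

module Lists where

  private variable
    𝒜 ℬ : Set

  abstract
    ∈-split : {x : 𝒜} {xs : List 𝒜} → x ∈ xs → ∃ λ ys → xs ↭ x ∷ ys
    ∈-split x∈xs with ys , zs , ≡.refl ← ∈-∃++ x∈xs = ys ++ zs , ↭ₚ.shift _ ys zs

    Unique-resp-↭ : {xs ys : List 𝒜} → xs ↭ ys → Unique xs → Unique ys
    Unique-resp-↭ xs↭ys = ↭ₛₚ.Unique-resp-↭ (≡.setoid _) (↭⇒↭ₛ xs↭ys)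

    -- Each element of `xs` is removed from `ys` at one occurrence; the later elements of `xs`
    -- differ from it and so survive the removal.
    embed-unique : (xs ys : List 𝒜) → Unique xs → (∀ {x} → x ∈ xs → x ∈ ys) → ∃ λ rest → ys ↭ xs ++ rest
    embed-unique [] ys _ _ = ys , refl
    embed-unique (x ∷ xs) ys (x∉ ∷ xs!) xs⊆ys with ∈-split (xs⊆ys (here ≡.refl))
    ... | ys′ , ys↭ with embed-unique xs ys′ xs! (λ y∈xs → tail (All.lookup x∉ y∈xs) (↭ₚ.∈-resp-↭ ys↭ (xs⊆ys (there y∈xs))))
      where
      tail : ∀ {y} → x ≢ y → y ∈ x ∷ ys′ → y ∈ ys′
      tail x≢y (here y≡x) = ⊥-elim (x≢y (sym y≡x))
      tail x≢y (there y∈) = y∈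
    ... | rest , ys′↭ = rest , ↭-trans ys↭ (prep x ys′↭)

    length-split : {xs ys : List 𝒜} (rest : List 𝒜) → ys ↭ xs ++ rest → length ys ≡ length xs ℕ.+ length rest
    length-split {xs = xs} rest ys↭ = ≡.trans (↭ₚ.↭-length ys↭) (Listₚ.length-++ xs)

    Unique-length-≤ : (xs ys : List 𝒜) → Unique xs → (∀ {x} → x ∈ xs → x ∈ ys) → length xs ℕ.≤ length ys
    Unique-length-≤ xs ys xs! xs⊆ys with rest , ys↭ ← embed-unique xs ys xs! xs⊆ys =
      ≡.subst (length xs ℕ.≤_) (sym (length-split rest ys↭)) (ℕₚ.m≤m+n _ _)

    Unique-↭ : (xs ys : List 𝒜) → Unique xs → (∀ {x} → x ∈ xs → x ∈ ys) → length xs ≡ length ys → ys ↭ xs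
    Unique-↭ xs ys xs! xs⊆ys len with embed-unique xs ys xs! xs⊆ys
    ... | [] , ys↭ = ≡.subst (ys ↭_) (Listₚ.++-identityʳ xs) ys↭
    ... | z ∷ rest , ys↭ = ⊥-elim (ℕₚ.m≢1+m+n (length xs)
      (≡.trans len (≡.trans (length-split (z ∷ rest) ys↭) (ℕₚ.+-suc _ _))))

    ++-disjoint : (xs : List 𝒜) {ys : List 𝒜} → Unique (xs ++ ys) → ∀ {x} → x ∈ xs → x ∈ ys → ⊥
    ++-disjoint (x ∷ xs) (x∉ ∷ _) (here ≡.refl) x∈ys = All.lookup (Allₚ.++⁻ʳ xs x∉) x∈ys ≡.refl
    ++-disjoint (x ∷ xs) (_ ∷ u) (there x∈xs) x∈ys = ++-disjoint xs u x∈xs x∈ys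

    ++-Uniqueʳ : (xs : List 𝒜) {ys : List 𝒜} → Unique (xs ++ ys) → Unique ys
    ++-Uniqueʳ [] u = u
    ++-Uniqueʳ (x ∷ xs) (_ ∷ u) = ++-Uniqueʳ xs u

    unique-map : (f : 𝒜 → ℬ) (L : List 𝒜) → (∀ {x y} → x ∈ L → y ∈ L → f x ≡ f y → x ≡ y) → Unique L → Unique (map f L)
    unique-map f [] _ _ = []
    unique-map f (x ∷ L) inj (x∉ ∷ L!) =
      All.tabulate (λ fy∈ fx≡ → let y , y∈ , e = ∈-map⁻ f fy∈ in All.lookup x∉ y∈ (inj (here ≡.refl) (there y∈) (≡.trans fx≡ e))) ∷
      unique-map f L (λ x∈ y∈ → inj (there x∈) (there y∈)) L!

open Lists

module Counting {A : Set} (_≟_ : DecidableEquality A) where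

  indicator : ∀ {P : Set} → Dec P → ℕ
  indicator (yes _) = 1
  indicator (no _) = 0

  count : A → List A → ℕ
  count t [] = 0
  count t (x ∷ xs) = indicator (t ≟ x) ℕ.+ count t xs

  abstract
    count-↭ : ∀ {t xs ys} → xs ↭ ys → count t xs ≡ count t ys
    count-↭ refl = ≡.refl
    count-↭ {t} (prep x p) = cong (indicator (t ≟ x) ℕ.+_) (count-↭ p)
    count-↭ {t} (swap {xs} {ys} x y p) = ≡.trans (≡.sym (ℕₚ.+-assoc (indicator (t ≟ x)) _ _)) (≡.trans
      (cong₂ ℕ._+_ (ℕₚ.+-comm (indicator (t ≟ x)) (indicator (t ≟ y))) (count-↭ p))
      (ℕₚ.+-assoc (indicator (t ≟ y)) _ _))
    count-↭ (trans p q) = ≡.trans (count-↭ p) (count-↭ q)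

    count-++ : ∀ t xs ys → count t (xs ++ ys) ≡ count t xs ℕ.+ count t ys
    count-++ t [] ys = ≡.refl
    count-++ t (x ∷ xs) ys = ≡.trans (cong (indicator (t ≟ x) ℕ.+_) (count-++ t xs ys)) (sym (ℕₚ.+-assoc (indicator (t ≟ x)) _ _))

    count-here : ∀ t xs → count t (t ∷ xs) ≡ suc (count t xs)
    count-here t xs with t ≟ t
    ... | yes _ = ≡.refl
    ... | no t≢t = ⊥-elim (t≢t ≡.refl)

    count-∉ : ∀ {t} xs → t ∉ xs → count t xs ≡ 0
    count-∉ [] _ = ≡.refl
    count-∉ {t} (x ∷ xs) t∉ with t ≟ x
    ... | yes t≡x = ⊥-elim (t∉ (here t≡x))
    ... | no _ = count-∉ xs (t∉ ∘ there)

    count-∈ : ∀ {t} xs → 1 ℕ.≤ count t xs → t ∈ xs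
    count-∈ {t} (x ∷ xs) c with t ≟ x
    ... | yes t≡x = here t≡x
    ... | no _ = there (count-∈ xs c)

    ∈-count : ∀ {t xs} → t ∈ xs → 1 ℕ.≤ count t xs
    ∈-count {t} {x ∷ xs} t∈ with t ≟ x
    ... | yes _ = s≤s z≤n
    ∈-count (here t≡x) | no t≢x = ⊥-elim (t≢x t≡x)
    ∈-count (there t∈) | no _ = ∈-count t∈

    count-unique : ∀ {t} xs → Unique xs → count t xs ℕ.≤ 1
    count-unique [] _ = z≤n
    count-unique {t} (x ∷ xs) (x∉ ∷ xs!) with t ≟ x
    ... | yes ≡.refl = s≤s (ℕₚ.≤-reflexive (count-∉ xs (λ t∈ → All.lookup x∉ t∈ ≡.refl)))
    ... | no _ = count-unique xs xs!

    -- Incidence geometry yields only lower bounds for multiplicities. Here they become a splitting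
    -- of the whole list, on which symmetric functions can be evaluated.
    embed : ∀ xs ys → (∀ t → count t xs ℕ.≤ count t ys) → ∃ λ rest → ys ↭ xs ++ rest
    embed [] ys _ = ys , refl
    embed (x ∷ xs) ys c≤ with ∈-split (count-∈ ys (ℕₚ.≤-trans (∈-count (here {xs = xs} ≡.refl)) (c≤ x)))
    ... | ys′ , ys↭ with embed xs ys′ (λ t → ℕₚ.+-cancelˡ-≤ (indicator (t ≟ x)) _ _ (≡.subst (_ ℕ.≤_) (count-↭ ys↭) (c≤ t)))
    ... | rest , ys′↭ = rest , ↭-trans ys↭ (prep x ys′↭)

-- Elementary symmetric functions of lists.

module SymmetricFunctions (𝔽 : FinField) where
  open FinField 𝔽
  open FieldTheory 𝔽

  e : ℕ → List K → K
  e zero _ = 1#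
  e (suc k) [] = 0#
  e (suc k) (x ∷ xs) = e (suc k) xs + x * e k xs

  -- The same recursion on solver syntax, so that symmetric functions of explicit lists can occur in
  -- polynomial identities.
  :e : ∀ {n} → ℕ → List (Polynomial n) → Polynomial n
  :e zero _ = :1
  :e (suc k) [] = :0
  :e (suc k) (x ∷ xs) = :e (suc k) xs :+ x :* :e k xs

  abstract
    e-↭ : ∀ k {xs ys} → xs ↭ ys → e k xs ≡ e k ys
    e-↭ zero _ = ≡.refl
    e-↭ (suc k) refl = ≡.refl
    e-↭ (suc k) (prep x p) = cong₂ (λ s t → s + x * t) (e-↭ (suc k) p) (e-↭ k p)
    e-↭ (suc zero) (swap x y p) = ≡.trans
      (solve 3 (λ s x y → (s :+ y :* :1) :+ x :* :1 := (s :+ x :* :1) :+ y :* :1) ≡.refl _ x y)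
      (cong (λ s → (s + x * 1#) + y * 1#) (e-↭ 1 p))
    e-↭ (suc (suc k)) (swap x y p) = ≡.trans
      (solve 5 (λ s t u x y → (s :+ y :* t) :+ x :* (t :+ y :* u) := (s :+ x :* t) :+ y :* (t :+ x :* u)) ≡.refl _ _ _ x y)
      (cong₂ (λ s f → s + f) (cong₂ (λ s t → s + x * t) (e-↭ (suc (suc k)) p) (e-↭ (suc k) p))
         (cong₂ (λ t u → y * (t + x * u)) (e-↭ (suc k) p) (e-↭ k p)))
    e-↭ (suc k) (trans p q) = ≡.trans (e-↭ (suc k) p) (e-↭ (suc k) q)

  pow : K → ℕ → K
  pow c zero = 1#
  pow c (suc k) = c * pow c k

  abstract
    e-scale : ∀ c k xs → e k (map (c *_) xs) ≡ pow c k * e k xs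
    e-scale c zero xs = sym (*-identityˡ 1#)
    e-scale c (suc k) [] = sym (zeroʳ _)
    e-scale c (suc k) (x ∷ xs) = ≡.trans
      (cong₂ (λ s t → s + c * x * t) (e-scale c (suc k) xs) (e-scale c k xs))
      (solve 5 (λ c x p s t → c :* p :* s :+ c :* x :* (p :* t) := c :* p :* (s :+ x :* t)) ≡.refl c x (pow c k) _ _)

    e₁-++ : ∀ xs ys → e 1 (xs ++ ys) ≡ e 1 xs + e 1 ys
    e₁-++ [] ys = sym (+-identityˡ _)
    e₁-++ (x ∷ xs) ys = ≡.trans (cong (_+ x * 1#) (e₁-++ xs ys))
      (solve 3 (λ s t x → (s :+ t) :+ x :* :1 := (s :+ x :* :1) :+ t) ≡.refl _ _ x)

    e₂-++ : ∀ xs ys → e 2 (xs ++ ys) ≡ e 2 xs + e 1 xs * e 1 ys + e 2 ys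
    e₂-++ [] ys = solve 2 (λ s t → s := :0 :+ :0 :* t :+ s) ≡.refl _ _
    e₂-++ (x ∷ xs) ys = ≡.trans (cong₂ (λ s t → s + x * t) (e₂-++ xs ys) (e₁-++ xs ys))
      (solve 5 (λ s t x a b → (s :+ a :* b :+ t) :+ x :* (a :+ b) := (s :+ x :* a) :+ (a :+ x :* :1) :* b :+ t) ≡.refl _ _ x _ _)

  module _ {I : Set} (f g : I → K) (a : K) where

    abstract
      e₁-linear : ∀ L → e 1 (map (λ i → f i - a * g i) L) ≡ e 1 (map f L) - a * e 1 (map g L)
      e₁-linear [] = solve 1 (λ a → :0 := :0 :- a :* :0) ≡.refl a
      e₁-linear (i ∷ L) = ≡.trans (cong (_+ (f i - a * g i) * 1#) (e₁-linear L))
        (solve 5 (λ s t x y a → (s :- a :* t) :+ (x :- a :* y) :* :1 := (s :+ x :* :1) :- a :* (t :+ y :* :1)) ≡.refl _ _ (f i) (g i) a)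

      -- The coefficient of `a` comes from the mixed products of `f` and `g` at different indices:
      -- all mixed products, minus those at equal indices.
      e₂-quadratic : ∀ L → e 2 (map (λ i → f i - a * g i) L) ≡
        e 2 (map f L) - a * (e 1 (map f L) * e 1 (map g L) - e 1 (map (λ i → f i * g i) L)) + a * a * e 2 (map g L)
      e₂-quadratic [] = solve 1 (λ a → :0 := :0 :- a :* (:0 :* :0 :- :0) :+ a :* a :* :0) ≡.refl a
      e₂-quadratic (i ∷ L) = ≡.trans (cong₂ (λ s t → s + (f i - a * g i) * t) (e₂-quadratic L) (e₁-linear L))
        (solve 8 (λ s₂ t₂ s t d x y a →
          (s₂ :- a :* (s :* t :- d) :+ a :* a :* t₂) :+ (x :- a :* y) :* (s :- a :* t) :=
          (s₂ :+ x :* s) :- a :* ((s :+ x :* :1) :* (t :+ y :* :1) :- (d :+ x :* y :* :1)) :+ a :* a :* (t₂ :+ y :* t))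
          ≡.refl _ _ _ _ _ (f i) (g i) a)

-- Arrangements of the five points of M.

module FiveIndices where

  abstract
    five : List (Fin 5)
    five = allFin 5

    five-complete : ∀ m → m ∈ five
    five-complete = ∈-allFin

    five-unique : Unique five
    five-unique = Uniqueₚ.allFin⁺ 5

    five-length : length five ≡ 5
    five-length = ≡.refl

  list₁ : {A : Set} (xs : List A) → length xs ≡ 1 → ∃ λ x → xs ≡ x ∷ []
  list₁ (x ∷ []) _ = x , ≡.refl

  list₂ : {A : Set} (xs : List A) → length xs ≡ 2 → ∃ λ x → ∃ λ y → xs ≡ x ∷ y ∷ []
  list₂ (x ∷ xs) l with y , ≡.refl ← list₁ xs (cong ℕ.pred l) = x , y , ≡.refl

  list₃ : {A : Set} (xs : List A) → length xs ≡ 3 → ∃ λ x → ∃ λ y → ∃ λ z → xs ≡ x ∷ y ∷ z ∷ []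
  list₃ (x ∷ xs) l with y , z , ≡.refl ← list₂ xs (cong ℕ.pred l) = x , y , z , ≡.refl

  list₄ : {A : Set} (xs : List A) → length xs ≡ 4 → ∃ λ x → ∃ λ y → ∃ λ z → ∃ λ t → xs ≡ x ∷ y ∷ z ∷ t ∷ []
  list₄ (x ∷ xs) l with y , z , t , ≡.refl ← list₃ xs (cong ℕ.pred l) = x , y , z , t , ≡.refl

  abstract
    arrange : (L : List (Fin 5)) → Unique L → ∃ λ rest → five ↭ L ++ rest × length L ℕ.+ length rest ≡ 5
    arrange L L! with rest , p ← embed-unique L five L! (λ {x} _ → five-complete x) =
      rest , p , ≡.trans (sym (length-split rest p)) five-length

    arranged-unique : {L : List (Fin 5)} → five ↭ L → Unique L
    arranged-unique p = Unique-resp-↭ p five-unique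

  arrange₂ : ∀ {i j} → i ≢ j → ∃ λ x → ∃ λ y → ∃ λ z → five ↭ i ∷ j ∷ x ∷ y ∷ z ∷ []
  arrange₂ {i} {j} i≢j with rest , p , l ← arrange (i ∷ j ∷ []) ((i≢j ∷ []) ∷ [] ∷ [])
    with x , y , z , ≡.refl ← list₃ rest (cong (ℕ._∸ 2) l) = x , y , z , p

  arrange₃ : ∀ {i j x} → i ≢ j → i ≢ x → j ≢ x → ∃ λ y → ∃ λ z → five ↭ i ∷ j ∷ x ∷ y ∷ z ∷ []
  arrange₃ {i} {j} {x} i≢j i≢x j≢x
    with rest , p , l ← arrange (i ∷ j ∷ x ∷ []) ((i≢j ∷ i≢x ∷ []) ∷ (j≢x ∷ []) ∷ [] ∷ [])
    with y , z , ≡.refl ← list₂ rest (cong (ℕ._∸ 3) l) = y , z , p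

  arrange₄ : ∀ {i j x y} → i ≢ j → i ≢ x → j ≢ x → i ≢ y → j ≢ y → x ≢ y →
    ∃ λ z → five ↭ i ∷ j ∷ x ∷ y ∷ z ∷ []
  arrange₄ {i} {j} {x} {y} i≢j i≢x j≢x i≢y j≢y x≢y
    with rest , p , l ← arrange (i ∷ j ∷ x ∷ y ∷ [])
      ((i≢j ∷ i≢x ∷ i≢y ∷ []) ∷ (j≢x ∷ j≢y ∷ []) ∷ (x≢y ∷ []) ∷ [] ∷ [])
    with z , ≡.refl ← list₁ rest (cong (ℕ._∸ 4) l) = z , p

  arranged-distinct : ∀ {a b c d e : Fin 5} → five ↭ a ∷ b ∷ c ∷ d ∷ e ∷ [] →
    (a ≢ b × a ≢ c × a ≢ d × a ≢ e) × (b ≢ c × b ≢ d × b ≢ e) × (c ≢ d × c ≢ e) × d ≢ e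
  arranged-distinct p with arranged-unique p
  ... | (ab ∷ ac ∷ ad ∷ ae ∷ []) ∷ (bc ∷ bd ∷ be ∷ []) ∷ (cd ∷ ce ∷ []) ∷ (de ∷ []) ∷ [] ∷ [] =
    (ab , ac , ad , ae) , (bc , bd , be) , (cd , ce) , de

open FiveIndices

-- The distribution (2,2,2): null triples, marked points and tight pencils.

module TwoTwoTwo (𝔽 : FinField) where
  open FinField 𝔽
  open FieldTheory 𝔽
  open SymmetricFunctions 𝔽

  cube : K → K
  cube x = x * x * x

  abstract
    null-triple-square : ∀ {a b c} → a + b + c ≡ 0# → a * b + a * c + b * c ≡ 0# → a * a ≡ b * c
    null-triple-square {a} {b} {c} s p = equal (vanish₂ a (- 1#)
      (solve 3 (λ a b c → a :* a :- b :* c := a :* (a :+ b :+ c) :+ (:- :1) :* (a :* b :+ a :* c :+ b :* c)) ≡.refl a b c) s p)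

    rotate-sum : ∀ {a b c} → a + b + c ≡ 0# → b + c + a ≡ 0#
    rotate-sum {a} {b} {c} = ≡.trans (solve 3 (λ a b c → b :+ c :+ a := a :+ b :+ c) ≡.refl a b c)

    rotate-products : ∀ {a b c} → a * b + a * c + b * c ≡ 0# → b * c + b * a + c * a ≡ 0#
    rotate-products {a} {b} {c} = ≡.trans
      (solve 3 (λ a b c → b :* c :+ b :* a :+ c :* a := a :* b :+ a :* c :+ b :* c) ≡.refl a b c)

    -- If e₁ = e₂ = 0, the monic cubic with roots a, b, c is T³ - abc.
    null-triple-cube : ∀ {a b c} → a + b + c ≡ 0# → a * b + a * c + b * c ≡ 0# → cube a ≡ a * b * c
    null-triple-cube {a} {b} {c} s p = ≡.trans (≡.trans (*-assoc a a a) (cong (a *_) (null-triple-square s p))) (sym (*-assoc a b c))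

    null-triple-cubes : ∀ {a b c} → a + b + c ≡ 0# → a * b + a * c + b * c ≡ 0# → cube a ≡ cube b
    null-triple-cubes {a} {b} {c} s p = ≡.trans (null-triple-cube s p) (sym (≡.trans
      (null-triple-cube (rotate-sum s) (rotate-products p))
      (solve 3 (λ a b c → b :* c :* a := a :* b :* c) ≡.refl a b c)))

    -- For a null triple (T - a)(T - b)(T - c) equals T³ - a³, so the three entries are the only
    -- elements with that cube, in every characteristic.
    null-triple-root : ∀ {a b c t} → a + b + c ≡ 0# → a * b + a * c + b * c ≡ 0# → cube t ≡ cube a →
      t ≡ a ⊎ t ≡ b ⊎ t ≡ c
    null-triple-root {a} {b} {c} {t} s p t³≡a³ =
      Sum.map equal (Sum.map equal equal ∘ zero-product) (zero-product factored)
      where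
      factored : (t - a) * ((t - b) * (t - c)) ≡ 0#
      factored = vanish₄ (- (t * t)) t 1# 1#
        (solve 4 (λ a b c t → (t :- a) :* ((t :- b) :* (t :- c)) :=
          (:- (t :* t)) :* (a :+ b :+ c) :+ t :* (a :* b :+ a :* c :+ b :* c)
          :+ :1 :* (t :* t :* t :- a :* a :* a) :+ :1 :* (a :* a :* a :- a :* b :* c)) ≡.refl a b c t)
        s p (difference t³≡a³) (difference (null-triple-cube s p))

    e₁-five : ∀ x y z s t → e 1 (x ∷ y ∷ z ∷ s ∷ t ∷ []) ≡ x + y + z + s + t
    e₁-five = solve 5 (λ x y z s t → :e 1 (x ∷ y ∷ z ∷ s ∷ t ∷ []) := x :+ y :+ z :+ s :+ t) ≡.refl

    e₄-zero : ∀ x y z t → e 4 (0# ∷ x ∷ y ∷ z ∷ t ∷ []) ≡ x * y * z * t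
    e₄-zero = solve 4 (λ x y z t → :e 4 (:0 ∷ x ∷ y ∷ z ∷ t ∷ []) := x :* y :* z :* t) ≡.refl

    pencil-sum : ∀ a b₁ b₂ c₁ c₂ {X Y} → X - a * Y ≡ e 1 (0# ∷ b₁ ∷ b₂ ∷ - (a * c₁) ∷ - (a * c₂) ∷ []) →
      (X - (b₁ + b₂)) - a * (Y - (c₁ + c₂)) ≡ 0#
    pencil-sum a b₁ b₂ c₁ c₂ {X} {Y} h = vanish₂ 1# 1#
      (solve 7 (λ a b₁ b₂ c₁ c₂ X Y → (X :- (b₁ :+ b₂)) :- a :* (Y :- (c₁ :+ c₂)) :=
        :1 :* ((X :- a :* Y) :- (:0 :+ b₁ :+ b₂ :+ :- (a :* c₁) :+ :- (a :* c₂))) :+ :1 :* :0) ≡.refl a b₁ b₂ c₁ c₂ X Y)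
      (difference (≡.trans h (e₁-five _ _ _ _ _))) ≡.refl

    pencil-e₄ : ∀ {r} x y z t b₁ b₂ a c₁ c₂ → e 4 (r ∷ x ∷ y ∷ z ∷ t ∷ []) ≡ e 4 (0# ∷ b₁ ∷ b₂ ∷ - (a * c₁) ∷ - (a * c₂) ∷ []) →
      r ≡ 0# → x * y * z * t ≡ b₁ * b₂ * (a * c₁) * (a * c₂)
    pencil-e₄ x y z t b₁ b₂ a c₁ c₂ h ≡.refl = ≡.trans (sym (e₄-zero x y z t)) (≡.trans h (≡.trans (e₄-zero _ _ _ _)
      (solve 5 (λ a b₁ b₂ c₁ c₂ → b₁ :* b₂ :* (:- (a :* c₁)) :* (:- (a :* c₂)) := b₁ :* b₂ :* (a :* c₁) :* (a :* c₂)) ≡.refl a b₁ b₂ c₁ c₂)))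

  -- The two deleted points of one side, each with the index of a point of M on the line joining it
  -- to the opposite vertex. That this index is the only possible one is a later consequence,
  -- `only-i₁`.
  record Marks (x : Fin 5 → K) : Set where
    field
      a₁ a₂ : K
      a₁≢0 : a₁ ≢ 0#
      a₂≢0 : a₂ ≢ 0#
      a₁≢a₂ : a₁ ≢ a₂
      i₁ i₂ : Fin 5
      at-i₁ : x i₁ ≡ a₁
      at-i₂ : x i₂ ≡ a₂

    i₁≢i₂ : i₁ ≢ i₂
    i₁≢i₂ i₁≡i₂ = a₁≢a₂ (≡.trans (sym at-i₁) (≡.trans (cong x i₁≡i₂) at-i₂))

  open Marks

  -- The slope (x - a)z is 0 on the line to the opposite vertex, b⁻¹ on the line to the deleted
  -- point b of the next side and -ac on the line to the deleted point c of the third side.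
  Pencil : (x y z : Fin 5 → K) → Marks x → Marks y → Marks z → Set
  Pencil x y z A B C = ∀ {a} → a ≡ a₁ A ⊎ a ≡ a₂ A →
    map (λ m → x m * z m - a * z m) five ↭
      0# ∷ a₁ B ⁻¹ ∷ a₂ B ⁻¹ ∷ - (a * a₁ C) ∷ - (a * a₂ C) ∷ []

  -- Two deleted points on each side and no deleted vertex; the pencil inclusions are then equalities.
  record Balanced : Set where
    field
      u v w : Fin 5 → K
      uvw : ∀ m → u m * v m * w m ≡ 1#
      separated : ∀ {m n} → u m ≡ u n → v m ≡ v n → m ≡ n
      A : Marks u
      B : Marks v
      C : Marks w
      pencilA : Pencil u v w A B C
      pencilB : Pencil v w u B C A
      pencilC : Pencil w u v C A B

  open Balanced

  vwu : (R : Balanced) → ∀ m → v R m * w R m * u R m ≡ 1#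
  vwu R m = ≡.trans (solve 3 (λ u v w → v :* w :* u := u :* v :* w) ≡.refl (u R m) (v R m) (w R m)) (uvw R m)

  rot : Balanced → Balanced
  rot R = record
    { u = v R ; v = w R ; w = u R
    ; uvw = vwu R
    -- The coordinates `v` and `w` determine `u`, because the product of the three is 1.
    ; separated = λ {m} {n} vv ww → separated R (equal (cancelˡ (product-≢0 (v≢0 m) (w≢0 m)) (vanish₄ 1# (- (u R n * w R n)) (- 1# * (v R m * u R n)) 0#
        (solve 6 (λ u v w u′ v′ w′ → v :* w :* (u :- u′) :=
          :1 :* (u :* v :* w :- u′ :* v′ :* w′) :+ (:- (u′ :* w′)) :* (v :- v′) :+ (:- :1 :* (v :* u′)) :* (w :- w′) :+ :0 :* :0) ≡.refl
          (u R m) (v R m) (w R m) (u R n) (v R n) (w R n))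
        (difference (≡.trans (uvw R m) (sym (uvw R n)))) (difference vv) (difference ww) ≡.refl))) vv
    ; A = B R ; B = C R ; C = A R
    ; pencilA = pencilB R ; pencilB = pencilC R ; pencilC = pencilA R }
    where
    v≢0 : ∀ m → v R m ≢ 0#
    v≢0 m = unit-≢0 (≡.trans (sym (*-assoc _ _ _)) (vwu R m))
    w≢0 : ∀ m → w R m ≢ 0#
    w≢0 m = unit-≢0 {y = u R m * v R m} (≡.trans (*-comm _ _) (uvw R m))

  swapMarks : ∀ {x} → Marks x → Marks x
  swapMarks A = record
    { a₁ = a₂ A ; a₂ = a₁ A ; a₁≢0 = a₂≢0 A ; a₂≢0 = a₁≢0 A ; a₁≢a₂ = a₁≢a₂ A ∘ sym
    ; i₁ = i₂ A ; i₂ = i₁ A ; at-i₁ = at-i₂ A ; at-i₂ = at-i₁ A }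

  swapA : Balanced → Balanced
  swapA R = record
    { u = u R ; v = v R ; w = w R ; uvw = uvw R ; separated = separated R
    ; A = swapMarks (A R) ; B = B R ; C = C R
    ; pencilA = λ a∈ → pencilA R (Sum.swap a∈)
    ; pencilB = λ b∈ → ↭-trans (pencilB R b∈) (prep _ (prep _ (prep _ (swap _ _ refl))))
    ; pencilC = λ c∈ → ↭-trans (pencilC R c∈) (prep _ (swap _ _ refl)) }

  swapB swapC : Balanced → Balanced
  swapB R = rot (rot (swapA (rot R)))
  swapC R = rot (swapA (rot (rot R)))

  module Facts (R : Balanced) where

    module A = Marks (A R)
    module B = Marks (B R)
    module C = Marks (C R)

    u-unit : ∀ m → u R m * (w R m * v R m) ≡ 1#
    u-unit m = ≡.trans (solve 3 (λ u v w → u :* (w :* v) := u :* v :* w) ≡.refl (u R m) (v R m) (w R m)) (uvw R m)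

    abstract
      pencil-sum′ : ∀ {a} → a ≡ A.a₁ ⊎ a ≡ A.a₂ →
        (e 1 (map (λ m → u R m * w R m) five) - (B.a₁ ⁻¹ + B.a₂ ⁻¹)) - a * (e 1 (map (w R) five) - (C.a₁ + C.a₂)) ≡ 0#
      pencil-sum′ {a} a∈ = pencil-sum a _ _ _ _ (≡.trans (sym (e₁-linear (λ m → u R m * w R m) (w R) a five)) (e-↭ 1 (pencilA R a∈)))

    abstract
      u≢0 : ∀ m → u R m ≢ 0#
      u≢0 m = unit-≢0 (u-unit m)

      -- The sum of the slopes is affine in the deleted point and agrees with the sum of the targets
      -- at both deleted points of the side. The two equations compare constant and linear
      -- coefficients.
      sums : e 1 (map (λ m → u R m * w R m) five) ≡ B.a₁ ⁻¹ + B.a₂ ⁻¹ × e 1 (map (w R) five) ≡ C.a₁ + C.a₂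
      sums = Product.map equal equal (linear-form-zero A.a₁≢a₂ (pencil-sum′ (inj₁ ≡.refl)) (pencil-sum′ (inj₂ ≡.refl)))

      -- The lines joining the hole a to the points of M off V₁a are those joining it to the other holes.
      pencil-product : ∀ {a} → a ≡ A.a₁ ⊎ a ≡ A.a₂ → ∀ {m n o p q} → five ↭ m ∷ n ∷ o ∷ p ∷ q ∷ [] → u R m ≡ a →
        (u R n * w R n - a * w R n) * (u R o * w R o - a * w R o) * (u R p * w R p - a * w R p) * (u R q * w R q - a * w R q)
        ≡ B.a₁ ⁻¹ * B.a₂ ⁻¹ * (a * C.a₁) * (a * C.a₂)
      pencil-product {a} a∈ {m} {n} {o} {p} {q} perm ≡.refl =
        pencil-e₄ _ _ _ _ _ _ a _ _ (≡.trans (e-↭ 4 (↭ₚ.map⁺ (λ m → u R m * w R m - a * w R m) (↭-sym perm))) (e-↭ 4 (pencilA R a∈))) (difference ≡.refl)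

-- Null triples among the coordinates, and the weighted sum.

module TwoTwoTwoFacts (𝔽 : FinField) where
  open FinField 𝔽
  open FieldTheory 𝔽
  open SymmetricFunctions 𝔽
  open TwoTwoTwo 𝔽
  open Balanced

  abstract
    e₁-null : ∀ (f : Fin 5 → K) {m n x y z} → five ↭ m ∷ n ∷ x ∷ y ∷ z ∷ [] →
      e 1 (map f five) ≡ f m + f n → f x + f y + f z ≡ 0#
    e₁-null f {m} {n} {x} {y} {z} p s = vanish₁ (- 1#)
      (solve 5 (λ m n x y z → x :+ y :+ z := (:- :1) :* ((m :+ n) :- (m :+ n :+ x :+ y :+ z))) ≡.refl (f m) (f n) (f x) (f y) (f z))
      (difference (≡.trans (sym s) (≡.trans (e-↭ 1 (↭ₚ.map⁺ f p)) (e₁-five _ _ _ _ _))))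

    zero-factor : ∀ {x y z t} → x ≡ 0# → x * y * z * t ≡ 0#
    zero-factor {y = y} {z} {t} ≡.refl = solve 3 (λ y z t → :0 :* y :* z :* t := :0) ≡.refl y z t

    -- e₂ of a triple is e₃ times the sum of the inverses.
    inverse-triple : ∀ {a b c a′ b′ c′} → a * a′ ≡ 1# → b * b′ ≡ 1# → c * c′ ≡ 1# →
      a′ + b′ + c′ ≡ 0# → a * b + a * c + b * c ≡ 0#
    inverse-triple {a} {b} {c} {a′} {b′} {c′} aa′ bb′ cc′ s = vanish₄ (a * b * c) (- (b * c)) (- (a * c)) (- (a * b))
      (solve 6 (λ a b c a′ b′ c′ → a :* b :+ a :* c :+ b :* c :=
        a :* b :* c :* (a′ :+ b′ :+ c′) :+ (:- (b :* c)) :* (a :* a′ :- :1) :+ (:- (a :* c)) :* (b :* b′ :- :1)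
        :+ (:- (a :* b)) :* (c :* c′ :- :1)) ≡.refl a b c a′ b′ c′)
      s (difference aa′) (difference bb′) (difference cc′)

    e₂-five : ∀ m n x y z → e 2 (m ∷ n ∷ x ∷ y ∷ z ∷ []) ≡ m * n + (m + n) * (x + y + z) + (x * y + x * z + y * z)
    e₂-five = solve 5 (λ m n x y z → :e 2 (m ∷ n ∷ x ∷ y ∷ z ∷ []) := m :* n :+ (m :+ n) :* (x :+ y :+ z) :+ (x :* y :+ x :* z :+ y :* z)) ≡.refl

    -- The values at `m` and `n` already account for the sums of values and of inverses, so the
    -- other three values have e₁ = e₂ = 0 and contribute nothing to e₂ of all five.
    e₂-null : ∀ (f g : Fin 5 → K) → (∀ m → f m * g m ≡ 1#) → ∀ {m n} → m ≢ n →
      e 1 (map f five) ≡ f m + f n → e 1 (map g five) ≡ g m + g n → e 2 (map f five) ≡ f m * f n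
    e₂-null f g fg {m} {n} m≢n sf sg = let x , y , z , p = arrange₂ m≢n in
      ≡.trans (≡.trans (e-↭ 2 (↭ₚ.map⁺ f p)) (e₂-five _ _ _ _ _)) (equal (vanish₂ (f m + f n) 1#
        (solve 5 (λ m n x y z → (m :* n :+ (m :+ n) :* (x :+ y :+ z) :+ (x :* y :+ x :* z :+ y :* z)) :- m :* n :=
          (m :+ n) :* (x :+ y :+ z) :+ :1 :* (x :* y :+ x :* z :+ y :* z)) ≡.refl (f m) (f n) (f x) (f y) (f z))
        (e₁-null f p sf) (inverse-triple (fg x) (fg y) (fg z) (e₁-null g p sg))))

    -- Once e₁ and e₂ of both coordinate lists agree with those of the targets, all terms of e₂ of
    -- the pencil cancel except the sum of products at equal indices.
    pencil-e₂ : ∀ a b₁ b₂ c₁ c₂ {P₁ P₂ W₁ W₂ D} → a ≢ 0# →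
      P₂ - a * (P₁ * W₁ - D) + a * a * W₂ ≡ e 2 (0# ∷ b₁ ∷ b₂ ∷ - (a * c₁) ∷ - (a * c₂) ∷ []) →
      P₁ ≡ b₁ + b₂ → P₂ ≡ b₁ * b₂ → W₁ ≡ c₁ + c₂ → W₂ ≡ c₁ * c₂ → D ≡ 0#
    pencil-e₂ a b₁ b₂ c₁ c₂ {D = D} a≢0 h ≡.refl ≡.refl ≡.refl ≡.refl = cancelˡ a≢0 (vanish₁ 1#
      (solve 6 (λ a b₁ b₂ c₁ c₂ D → a :* D := :1 :*
        ((b₁ :* b₂ :- a :* ((b₁ :+ b₂) :* (c₁ :+ c₂) :- D) :+ a :* a :* (c₁ :* c₂)) :-
          :e 2 (:0 ∷ b₁ ∷ b₂ ∷ :- (a :* c₁) ∷ :- (a :* c₂) ∷ []))) ≡.refl a b₁ b₂ c₁ c₂ D)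
      (difference h))

  module _ (R : Balanced) where
    private
      module A = Marks (A R)
      module B = Marks (B R)
      module C = Marks (C R)

    open Facts using (sums; u-unit)

    u-at-i₁⁻¹ : (w R A.i₁ * v R A.i₁) ≡ A.a₁ ⁻¹
    u-at-i₁⁻¹ = ⁻¹-unique (≡.trans (cong (_* (w R A.i₁ * v R A.i₁)) (sym A.at-i₁)) (u-unit R A.i₁))

    u-at-i₂⁻¹ : (w R A.i₂ * v R A.i₂) ≡ A.a₂ ⁻¹
    u-at-i₂⁻¹ = ⁻¹-unique (≡.trans (cong (_* (w R A.i₂ * v R A.i₂)) (sym A.at-i₂)) (u-unit R A.i₂))

    abstract
      u-sum : e 1 (map (u R) five) ≡ u R A.i₁ + u R A.i₂
      u-sum = ≡.trans (proj₂ (sums (rot R))) (sym (cong₂ _+_ A.at-i₁ A.at-i₂))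

      u⁻¹-sum : e 1 (map (λ m → w R m * v R m) five) ≡ w R A.i₁ * v R A.i₁ + w R A.i₂ * v R A.i₂
      u⁻¹-sum = ≡.trans (proj₁ (sums (rot (rot R)))) (sym (cong₂ _+_ u-at-i₁⁻¹ u-at-i₂⁻¹))

      u-null-sum : ∀ {x y z} → five ↭ A.i₁ ∷ A.i₂ ∷ x ∷ y ∷ z ∷ [] → u R x + u R y + u R z ≡ 0#
      u-null-sum p = e₁-null (u R) p u-sum

      u-null-products : ∀ {x y z} → five ↭ A.i₁ ∷ A.i₂ ∷ x ∷ y ∷ z ∷ [] → u R x * u R y + u R x * u R z + u R y * u R z ≡ 0#
      u-null-products p = inverse-triple (u-unit R _) (u-unit R _) (u-unit R _) (e₁-null (λ m → w R m * v R m) p u⁻¹-sum)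

      u-e₂ : e 2 (map (u R) five) ≡ A.a₁ * A.a₂
      u-e₂ = ≡.trans (e₂-null (u R) (λ m → w R m * v R m) (u-unit R) A.i₁≢i₂ u-sum u⁻¹-sum) (cong₂ _*_ A.at-i₁ A.at-i₂)

      u⁻¹-e₂ : e 2 (map (λ m → w R m * v R m) five) ≡ A.a₁ ⁻¹ * A.a₂ ⁻¹
      u⁻¹-e₂ = ≡.trans (e₂-null (λ m → w R m * v R m) (u R) (λ m → ≡.trans (*-comm _ _) (u-unit R m)) A.i₁≢i₂ u⁻¹-sum u-sum)
        (cong₂ _*_ u-at-i₁⁻¹ u-at-i₂⁻¹)

      -- A second point of M on the line from `a₁` to the vertex would put a zero factor into
      -- `pencil-product`, whose value is a product of nonzero elements.
      only-i₁ : ∀ {m} → u R m ≡ A.a₁ → m ≡ A.i₁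
      only-i₁ {m} um≡a₁ = decide (m Fin.≟ A.i₁)
        where
        impossible : m ≢ A.i₁ → (∃ λ x → ∃ λ y → ∃ λ z → five ↭ A.i₁ ∷ m ∷ x ∷ y ∷ z ∷ []) → ⊥
        impossible m≢i₁ (x , y , z , p) = product-≢0 (product-≢0 (product-≢0 (⁻¹-≢0 B.a₁≢0) (⁻¹-≢0 B.a₂≢0))
            (product-≢0 A.a₁≢0 C.a₁≢0)) (product-≢0 A.a₁≢0 C.a₂≢0)
          (≡.trans (sym (Facts.pencil-product R (inj₁ ≡.refl) p A.at-i₁))
            (zero-factor (difference (cong (_* w R m) um≡a₁))))
        decide : Dec (m ≡ A.i₁) → m ≡ A.i₁
        decide (yes m≡i₁) = m≡i₁
        decide (no m≢i₁) = ⊥-elim (impossible m≢i₁ (arrange₂ (m≢i₁ ∘ sym)))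

      outside-cubes : ∀ {m n} → m ≢ A.i₁ → m ≢ A.i₂ → n ≢ A.i₁ → n ≢ A.i₂ → cube (u R m) ≡ cube (u R n)
      outside-cubes {m} {n} m≢i₁ m≢i₂ n≢i₁ n≢i₂ = decide (m Fin.≟ n)
        where
        decide : Dec (m ≡ n) → cube (u R m) ≡ cube (u R n)
        decide (yes ≡.refl) = ≡.refl
        decide (no m≢n) =
          let z , p = arrange₄ A.i₁≢i₂ (m≢i₁ ∘ sym) (m≢i₂ ∘ sym) (n≢i₁ ∘ sym) (n≢i₂ ∘ sym) m≢n
          in null-triple-cubes (u-null-sum p) (u-null-products p)

      -- Three unmarked coordinates form a null triple, so an element with their cube is one of
      -- them. For `a₁` this would give a further point on its vertex line, against `only-i₁`.
      mark-cube : ∀ {n} → n ≢ A.i₁ → n ≢ A.i₂ → cube A.a₁ ≢ cube (u R n)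
      mark-cube {n} n≢i₁ n≢i₂ cubes = go (arrange₃ A.i₁≢i₂ (n≢i₁ ∘ sym) (n≢i₂ ∘ sym))
        where
        go : (∃ λ y → ∃ λ z → five ↭ A.i₁ ∷ A.i₂ ∷ n ∷ y ∷ z ∷ []) → ⊥
        go (y , z , p) =
          let (_ , i≢n , i≢y , i≢z) , _ = arranged-distinct p
          in Sum.[ (λ h → i≢n (sym (only-i₁ (sym h)))) , Sum.[ (λ h → i≢y (sym (only-i₁ (sym h)))) , (λ h → i≢z (sym (only-i₁ (sym h)))) ] ]
            (null-triple-root (u-null-sum p) (u-null-products p) cubes)

  module _ (R : Balanced) where
    private
      module A = Marks (A R)
    open Facts using (sums)

    abstract
      -- The surviving sum of `pencil-e₂` is Σ uw². It links different coordinates of the same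
      -- point, which the null triples treat one at a time.
      weighted-sum : e 1 (map (λ m → u R m * w R m * w R m) five) ≡ 0#
      weighted-sum = pencil-e₂ A.a₁ _ _ _ _ A.a₁≢0
        (≡.trans (sym (e₂-quadratic (λ m → u R m * w R m) (w R) A.a₁ five)) (e-↭ 2 (pencilA R (inj₁ ≡.refl))))
        (proj₁ (sums R)) (u⁻¹-e₂ (rot R)) (proj₂ (sums R)) (u-e₂ (rot (rot R)))

      mark-cube₂ : ∀ {n} → n ≢ A.i₁ → n ≢ A.i₂ → cube A.a₂ ≢ cube (u R n)
      mark-cube₂ n≢i₁ n≢i₂ = mark-cube (swapA R) n≢i₂ n≢i₁

-- Diagonal scalings, which fix the triangle.

module TwoTwoTwoScaling (𝔽 : FinField) where
  open FinField 𝔽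
  open FieldTheory 𝔽
  open SymmetricFunctions 𝔽
  open TwoTwoTwo 𝔽
  open Balanced
  open Marks

  scaleMarks : ∀ {x} l → l ≢ 0# → Marks x → Marks (λ m → l * x m)
  scaleMarks l l≢0 A = record
    { a₁ = l * a₁ A ; a₂ = l * a₂ A
    ; a₁≢0 = product-≢0 l≢0 (a₁≢0 A) ; a₂≢0 = product-≢0 l≢0 (a₂≢0 A)
    ; a₁≢a₂ = a₁≢a₂ A ∘ scale-injective l≢0
    ; i₁ = i₁ A ; i₂ = i₂ A ; at-i₁ = cong (l *_) (at-i₁ A) ; at-i₂ = cong (l *_) (at-i₂ A) }

  abstract
    -- The slopes (x - a)z and the targets -ac are multiplied by ln. So are the targets b⁻¹, since
    -- ln is the inverse of m.
    scalePencil : ∀ {x y z} l m n (l≢0 : l ≢ 0#) (m≢0 : m ≢ 0#) (n≢0 : n ≢ 0#) → l * m * n ≡ 1# →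
      (A : Marks x) (B : Marks y) (C : Marks z) → Pencil x y z A B C →
      Pencil (λ i → l * x i) (λ i → m * y i) (λ i → n * z i) (scaleMarks l l≢0 A) (scaleMarks m m≢0 B) (scaleMarks n n≢0 C)
    scalePencil {x} {y} {z} l m n l≢0 m≢0 n≢0 lmn A B C p a∈ =
      Sum.[ (λ { ≡.refl → at (inj₁ ≡.refl) }) , (λ { ≡.refl → at (inj₂ ≡.refl) }) ] a∈
      where
      inverse : ∀ {b} → b ≢ 0# → l * n * b ⁻¹ ≡ (m * b) ⁻¹
      inverse {b} b≢0 = ⁻¹-unique (equal (vanish₂ (b * b ⁻¹) 1#
        (solve 5 (λ l m n b b′ → (m :* b) :* (l :* n :* b′) :- :1 := (b :* b′) :* (l :* m :* n :- :1) :+ :1 :* (b :* b′ :- :1))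
          ≡.refl l m n b (b ⁻¹)) (difference lmn) (difference (*-inverse b b≢0))))
      product : ∀ a c → l * n * - (a * c) ≡ - ((l * a) * (n * c))
      product a c = solve 4 (λ l n a c → l :* n :* (:- (a :* c)) := :- ((l :* a) :* (n :* c))) ≡.refl l n a c
      targets : ∀ a → map (l * n *_) (0# ∷ a₁ B ⁻¹ ∷ a₂ B ⁻¹ ∷ - (a * a₁ C) ∷ - (a * a₂ C) ∷ []) ≡
        0# ∷ (m * a₁ B) ⁻¹ ∷ (m * a₂ B) ⁻¹ ∷ - ((l * a) * (n * a₁ C)) ∷ - ((l * a) * (n * a₂ C)) ∷ []
      targets a = cong₂ _∷_ (zeroʳ _) (cong₂ _∷_ (inverse (a₁≢0 B)) (cong₂ _∷_ (inverse (a₂≢0 B))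
        (cong₂ _∷_ (product a (a₁ C)) (cong₂ _∷_ (product a (a₂ C)) ≡.refl))))
      sources : ∀ a → map (λ i → (l * x i) * (n * z i) - (l * a) * (n * z i)) five ≡ map (l * n *_) (map (λ i → x i * z i - a * z i) five)
      sources a = ≡.trans (Listₚ.map-cong (λ i → solve 5 (λ l n x a z → (l :* x) :* (n :* z) :- (l :* a) :* (n :* z) :=
        l :* n :* (x :* z :- a :* z)) ≡.refl l n (x i) a (z i)) five) (Listₚ.map-∘ five)
      at : ∀ {a} → a ≡ a₁ A ⊎ a ≡ a₂ A → map (λ i → (l * x i) * (n * z i) - (l * a) * (n * z i)) five ↭
        0# ∷ (m * a₁ B) ⁻¹ ∷ (m * a₂ B) ⁻¹ ∷ - ((l * a) * (n * a₁ C)) ∷ - ((l * a) * (n * a₂ C)) ∷ []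
      at {a} a∈ = ↭-trans (↭-reflexive (sources a)) (↭-trans (↭ₚ.map⁺ (l * n *_) (p a∈)) (↭-reflexive (targets a)))

  scale : ∀ (R : Balanced) l m n → l * m * n ≡ 1# → Balanced
  scale R l m n lmn = record
    { u = λ i → l * u R i ; v = λ i → m * v R i ; w = λ i → n * w R i
    ; uvw = λ i → equal (vanish₂ (u R i * v R i * w R i) 1#
        (solve 6 (λ l m n u v w → (l :* u) :* (m :* v) :* (n :* w) :- :1 := (u :* v :* w) :* (l :* m :* n :- :1) :+ :1 :* (u :* v :* w :- :1))
          ≡.refl l m n (u R i) (v R i) (w R i)) (difference lmn) (difference (uvw R i)))
    ; separated = λ uu vv → separated R (scale-injective l≢0 uu) (scale-injective m≢0 vv)
    ; A = scaleMarks l l≢0 (A R) ; B = scaleMarks m m≢0 (B R) ; C = scaleMarks n n≢0 (C R)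
    ; pencilA = scalePencil l m n l≢0 m≢0 n≢0 lmn (A R) (B R) (C R) (pencilA R)
    ; pencilB = scalePencil m n l m≢0 n≢0 l≢0 mnl (B R) (C R) (A R) (pencilB R)
    ; pencilC = scalePencil n l m n≢0 l≢0 m≢0 nlm (C R) (A R) (B R) (pencilC R) }
    where
    mnl : m * n * l ≡ 1#
    mnl = ≡.trans (solve 3 (λ l m n → m :* n :* l := l :* m :* n) ≡.refl l m n) lmn
    nlm : n * l * m ≡ 1#
    nlm = ≡.trans (solve 3 (λ l m n → n :* l :* m := l :* m :* n) ≡.refl l m n) lmn
    l≢0 = unit-≢0 (≡.trans (sym (*-assoc l m n)) lmn)
    m≢0 = unit-≢0 (≡.trans (sym (*-assoc m n l)) mnl)
    n≢0 = unit-≢0 (≡.trans (sym (*-assoc n l m)) nlm)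

  -- The factors vw, wu, uv are the inverses of u, v, w at the chosen point, so that point becomes
  -- (1,1,1). Their product is (uvw)² = 1.
  normalise : (R : Balanced) → Fin 5 → Balanced
  normalise R i = scale R (v R i * w R i) (w R i * u R i) (u R i * v R i) (equal (vanish₁ (u R i * v R i * w R i + 1#)
    (solve 3 (λ u v w → (v :* w) :* (w :* u) :* (u :* v) :- :1 := (u :* v :* w :+ :1) :* (u :* v :* w :- :1)) ≡.refl (u R i) (v R i) (w R i))
    (difference (uvw R i))))

  abstract
    normalise-u : ∀ R i → u (normalise R i) i ≡ 1#
    normalise-u R i = ≡.trans (*-comm _ _) (≡.trans (sym (*-assoc _ _ _)) (uvw R i))

    normalise-v : ∀ R i → v (normalise R i) i ≡ 1#
    normalise-v R i = ≡.trans (solve 3 (λ u v w → w :* u :* v := u :* v :* w) ≡.refl (u R i) (v R i) (w R i)) (uvw R i)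

    normalise-w : ∀ R i → w (normalise R i) i ≡ 1#
    normalise-w R i = uvw R i

-- The eliminations for the three patterns.

module TwoTwoTwoAlgebra (𝔽 : FinField) where
  open FinField 𝔽
  open FieldTheory 𝔽

  abstract
    zero-square : ∀ {x} → x * x ≡ 0# → x ≡ 0#
    zero-square h = Sum.[ (λ z → z) , (λ z → z) ] (zero-product h)

    omega-cube : ∀ {o} → o * o + o + 1# ≡ 0# → o * o * o - 1# ≡ 0#
    omega-cube {o} h = vanish₁ (o - 1#)
      (solve 1 (λ o → o :* o :* o :- :1 := (o :- :1) :* (o :* o :+ o :+ :1)) ≡.refl o) h

    -- The ω pattern after normalisation: M consists of (r,s,w), (p,o²,x), (o²,q,y), (1,1,1) and
    -- (o,o,o), and the last two compensate the lines through the third vertex. The equations `E₁`,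
    -- `E₂`, `E₃` are the three weighted sums, and w, x, y form a null triple.
    module _ {o r s w p x q y : K} (omega : o * o + o + 1# ≡ 0#) (rsw : r * s * w ≡ 1#)
      (pox : p * (o * o) * x ≡ 1#) (oqy : o * o * q * y ≡ 1#)
      (sum : w + x + y ≡ 0#) (products : w * x + w * y + x * y ≡ 0#) (w³≢1 : w * w * w ≢ 1#)
      (E₁ : r * w * w + p * x * x + o * o * y * y + 1# + o * o * o ≡ 0#)
      (E₂ : s * r * r + o * o * p * p + q * (o * o) * (o * o) + 1# + o * o * o ≡ 0#)
      (E₃ : w * s * s + x * (o * o) * (o * o) + y * q * q + 1# + o * o * o ≡ 0#) where
      private
        w≢0 : w ≢ 0#
        w≢0 = unit-≢0 (≡.trans (*-comm w (r * s)) rsw)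

        o³ : o * o * o - 1# ≡ 0#
        o³ = omega-cube omega

        px : p * x - o ≡ 0#
        px = vanish ((o , p * (o * o) * x - 1#) ∷ (- (p * x) , o * o * o - 1#) ∷ [])
          (difference pox ∷ o³ ∷ [])
          (solve 3 (λ o p x → p :* x :- o := o :* (p :* (o :* o) :* x :- :1) :+ ((:- (p :* x)) :* (o :* o :* o :- :1) :+ :0)) ≡.refl o p x)

        qy : q * y - o ≡ 0#
        qy = vanish ((o , o * o * q * y - 1#) ∷ (- (q * y) , o * o * o - 1#) ∷ [])
          (difference oqy ∷ o³ ∷ [])
          (solve 3 (λ o q y → q :* y :- o := o :* (o :* o :* q :* y :- :1) :+ ((:- (q :* y)) :* (o :* o :* o :- :1) :+ :0)) ≡.refl o q y)

        yy : y * y - w * x ≡ 0#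
        yy = vanish₂ y (- 1#) (solve 3 (λ w x y → y :* y :- w :* x :=
          y :* (w :+ x :+ y) :+ (:- :1) :* (w :* x :+ w :* y :+ x :* y)) ≡.refl w x y) sum products

        ww : w * w - x * y ≡ 0#
        ww = vanish₂ w (- 1#) (solve 3 (λ w x y → w :* w :- x :* y :=
          w :* (w :+ x :+ y) :+ (:- :1) :* (w :* x :+ w :* y :+ x :* y)) ≡.refl w x y) sum products

        xx : x * x - w * y ≡ 0#
        xx = vanish₂ x (- 1#) (solve 3 (λ w x y → x :* x :- w :* y :=
          x :* (w :+ x :+ y) :+ (:- :1) :* (w :* x :+ w :* y :+ x :* y)) ≡.refl w x y) sum products

        x³ : x * x * x - w * w * w ≡ 0#
        x³ = vanish₂ x (- w) (solve 3 (λ w x y → x :* x :* x :- w :* w :* w :=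
          x :* (x :* x :- w :* y) :+ (:- w) :* (w :* w :- x :* y)) ≡.refl w x y) xx ww

        pw² : p * (w * w) - o * y ≡ 0#
        pw² = vanish₂ p y (solve 5 (λ p w x y o → p :* (w :* w) :- o :* y := p :* (w :* w :- x :* y) :+ y :* (p :* x :- o)) ≡.refl p w x y o) ww px

        qw² : q * (w * w) - o * x ≡ 0#
        qw² = vanish₂ q x (solve 5 (λ q w x y o → q :* (w :* w) :- o :* x := q :* (w :* w :- x :* y) :+ x :* (q :* y :- o)) ≡.refl q w x y o) ww qy

        F₁ : r * w * w + o * x + o * o * w * x + (1# + 1#) ≡ 0#
        F₁ = vanish₄ 1# (- x) (- (o * o)) (- 1#)
          (solve 6 (λ o r w p x y → r :* w :* w :+ o :* x :+ o :* o :* w :* x :+ (:1 :+ :1) :=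
            :1 :* (r :* w :* w :+ p :* x :* x :+ o :* o :* y :* y :+ :1 :+ o :* o :* o) :+ (:- x) :* (p :* x :- o)
            :+ (:- (o :* o)) :* (y :* y :- w :* x) :+ (:- :1) :* (o :* o :* o :- :1)) ≡.refl o r w p x y)
          E₁ px yy o³

        -- `E₂` times w⁴, reduced by rsw = 1, pw² = oy and qw² = ox, and divided by w. It differs
        -- from `F₁` only in having 2w³ where `F₁` has 2, so subtraction gives 2(w³ - 1) = 0.
        F₂ : r * w * w + o * x + o * o * w * x + (1# + 1#) * (w * w * w) ≡ 0#
        F₂ = cancelˡ w≢0 (vanish
          ((w * w * w * w , s * r * r + o * o * p * p + q * (o * o) * (o * o) + 1# + o * o * o) ∷
           (- (w * w * w * r) , r * s * w - 1#) ∷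
           (- (o * o * (p * (w * w) + o * y)) , p * (w * w) - o * y) ∷
           (- (o * o * o * o) , y * y - w * x) ∷
           (- (o * w * x) , o * o * o - 1#) ∷
           (- (o * o * o * o * (w * w)) , q * (w * w) - o * x) ∷
           (- (o * o * w * w * x) , o * o * o - 1#) ∷
           (- (w * w * w * w) , o * o * o - 1#) ∷ [])
          (E₂ ∷ difference rsw ∷ pw² ∷ yy ∷ o³ ∷ qw² ∷ o³ ∷ o³ ∷ [])
          (solve 8 (λ o r s w p x q y →
            w :* (r :* w :* w :+ o :* x :+ o :* o :* w :* x :+ (:1 :+ :1) :* (w :* w :* w)) :=
            (w :* w :* w :* w) :* (s :* r :* r :+ o :* o :* p :* p :+ q :* (o :* o) :* (o :* o) :+ :1 :+ o :* o :* o) :+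
            ((:- (w :* w :* w :* r)) :* (r :* s :* w :- :1) :+
            ((:- (o :* o :* (p :* (w :* w) :+ o :* y))) :* (p :* (w :* w) :- o :* y) :+
            ((:- (o :* o :* o :* o)) :* (y :* y :- w :* x) :+
            ((:- (o :* w :* x)) :* (o :* o :* o :- :1) :+
            ((:- (o :* o :* o :* o :* (w :* w))) :* (q :* (w :* w) :- o :* x) :+
            ((:- (o :* o :* w :* w :* x)) :* (o :* o :* o :- :1) :+
            ((:- (w :* w :* w :* w)) :* (o :* o :* o :- :1) :+ :0)))))))) ≡.refl o r s w p x q y))

        two≡0 : 1# + 1# ≡ 0#
        two≡0 = cancelˡ (difference-≢0 w³≢1) (vanish₂ 1# (- 1#)
          (solve 4 (λ o r w x → (w :* w :* w :- :1) :* (:1 :+ :1) :=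
            :1 :* (r :* w :* w :+ o :* x :+ o :* o :* w :* x :+ (:1 :+ :1) :* (w :* w :* w)) :+
            (:- :1) :* (r :* w :* w :+ o :* x :+ o :* o :* w :* x :+ (:1 :+ :1))) ≡.refl o r w x) F₂ F₁)

        -- `E₃` times r²w². The term ws² becomes w(rsw)² = w, so `s` disappears, and the constant 1
        -- + o³ dies in characteristic 2.
        F₃ : w + r * r * (w * w) * (o * x) + r * r * (o * o * x) ≡ 0#
        F₃ = vanish
          ((r * r * (w * w) , w * s * s + x * (o * o) * (o * o) + y * q * q + 1# + o * o * o) ∷
           (- (w * (r * s * w + 1#)) , r * s * w - 1#) ∷
           (- (r * r * (w * w) * (x * o)) , o * o * o - 1#) ∷
           (- (r * r * (w * w) * q) , q * y - o) ∷
           (- (r * r * o) , q * (w * w) - o * x) ∷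
           (- (r * r * (w * w)) , 1# + 1#) ∷
           (- (r * r * (w * w)) , o * o * o - 1#) ∷ [])
          (E₃ ∷ difference rsw ∷ o³ ∷ qy ∷ qw² ∷ two≡0 ∷ o³ ∷ [])
          (solve 7 (λ o r s w x q y →
            w :+ r :* r :* (w :* w) :* (o :* x) :+ r :* r :* (o :* o :* x) :=
            (r :* r :* (w :* w)) :* (w :* s :* s :+ x :* (o :* o) :* (o :* o) :+ y :* q :* q :+ :1 :+ o :* o :* o) :+
            ((:- (w :* (r :* s :* w :+ :1))) :* (r :* s :* w :- :1) :+
            ((:- (r :* r :* (w :* w) :* (x :* o))) :* (o :* o :* o :- :1) :+
            ((:- (r :* r :* (w :* w) :* q)) :* (q :* y :- o) :+
            ((:- (r :* r :* o)) :* (q :* (w :* w) :- o :* x) :+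
            ((:- (r :* r :* (w :* w))) :* (:1 :+ :1) :+
            ((:- (r :* r :* (w :* w))) :* (o :* o :* o :- :1) :+ :0))))))) ≡.refl o r s w x q y)

        -- In characteristic 2, `F₁` reads rw² = x(o + o²w). Substituted into w⁴ times `F₃`, it
        -- leaves x only as x³ = w³, and a factor w³ can be cancelled.
        F₄ : w * w + (o + o * o * w) * (o + o * o * w) * (o * (w * w) + o * o) ≡ 0#
        F₄ = cancelˡ w≢0 (cancelˡ w≢0 (cancelˡ w≢0 (vanish
          ((w * w * w * w , w + r * r * (w * w) * (o * x) + r * r * (o * o * x)) ∷
           (- ((w * w * (o * x) + o * o * x) * (r * w * w - (o * x + o * o * w * x))) ,
             r * w * w + o * x + o * o * w * x + (1# + 1#)) ∷
           ((w * w * (o * x) + o * o * x) * (r * w * w - (o * x + o * o * w * x)) , 1# + 1#) ∷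
           (- ((o + o * o * w) * (o + o * o * w) * (o * (w * w) + o * o)) , x * x * x - w * w * w) ∷ [])
          (F₃ ∷ F₁ ∷ two≡0 ∷ x³ ∷ [])
          (solve 4 (λ o r w x →
            w :* (w :* (w :* (w :* w :+ (o :+ o :* o :* w) :* (o :+ o :* o :* w) :* (o :* (w :* w) :+ o :* o)))) :=
            (w :* w :* w :* w) :* (w :+ r :* r :* (w :* w) :* (o :* x) :+ r :* r :* (o :* o :* x)) :+
            ((:- ((w :* w :* (o :* x) :+ o :* o :* x) :* (r :* w :* w :- (o :* x :+ o :* o :* w :* x)))) :*
              (r :* w :* w :+ o :* x :+ o :* o :* w :* x :+ (:1 :+ :1)) :+
            (((w :* w :* (o :* x) :+ o :* o :* x) :* (r :* w :* w :- (o :* x :+ o :* o :* w :* x))) :* (:1 :+ :1) :+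
            ((:- ((o :+ o :* o :* w) :* (o :+ o :* o :* w) :* (o :* (w :* w) :+ o :* o))) :* (x :* x :* x :- w :* w :* w) :+ :0))))
            ≡.refl o r w x))))

        F₅ : o * o * (w * w) * (w * w) + w * w + o ≡ 0#
        F₅ = vanish₃ 1#
          (- (w * w + (o * o * o + 1#) * (w * w) + o + o * o * (w * w) * (w * w)))
          (- (w * w + o * o * o * o * (w * w * w) + o * o * o * o * o * w))
          (solve 2 (λ o w → o :* o :* (w :* w) :* (w :* w) :+ w :* w :+ o :=
            :1 :* (w :* w :+ (o :+ o :* o :* w) :* (o :+ o :* o :* w) :* (o :* (w :* w) :+ o :* o)) :+
            (:- (w :* w :+ (o :* o :* o :+ :1) :* (w :* w) :+ o :+ o :* o :* (w :* w) :* (w :* w))) :* (o :* o :* o :- :1) :+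
            (:- (w :* w :+ o :* o :* o :* o :* (w :* w :* w) :+ o :* o :* o :* o :* o :* w)) :* (:1 :+ :1)) ≡.refl o w)
          F₄ o³ two≡0

      -- Up to the factor o², the left side of `F₅` is the cofactor w⁴ + ow² + o² of w² - o in w⁶ -
      -- o³. As o³ = 1, this gives w⁶ = 1, which in characteristic 2 is (w³ - 1)² = 0.
      ω-pattern-impossible : ⊥
      ω-pattern-impossible = w³≢1 (equal (zero-square (vanish₃ (o * (w * w - o))
        (o * (w * w) * (w * w) - w * w * w * (w * w * w) + 1#) (- (w * w * w - 1#))
        (solve 2 (λ o w → (w :* w :* w :- :1) :* (w :* w :* w :- :1) :=
          (o :* (w :* w :- o)) :* (o :* o :* (w :* w) :* (w :* w) :+ w :* w :+ o) :+
          (o :* (w :* w) :* (w :* w) :- w :* w :* w :* (w :* w :* w) :+ :1) :* (o :* o :* o :- :1) :+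
          (:- (w :* w :* w :- :1)) :* (:1 :+ :1)) ≡.refl o w)
        F₅ o³ two≡0)))

    module _ {A A′ B B′ G : K} (AA′ : A * A′ ≡ 1#) (BB′ : B * B′ ≡ 1#)
      (E : B + G + A′ * A′ + 1# + 1# ≡ 0#)
      (P : (1# - A * G) * (1# - A * A * A) ≡ A * A * A * G * B′) where

      -- A combination of a weighted sum and a pencil product in which the inverses A′ and B′
      -- cancel. Apart from the terms B and AG it is symmetric in A, B, G, so the differences of its
      -- rotations factor.
      cyclic-quotient : (A * B * G - B) * (A + B + G + 1# + 1#) - A * G ≡ 0#
      cyclic-quotient = cancelˡ (product-≢0 (unit-≢0 AA′) (unit-≢0 AA′)) (vanish
        ((B * (A * G - 1#) * (A * A) , B + G + A′ * A′ + 1# + 1#) ∷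
         (- (B * (A * G - 1#) * (A * A′ + 1#)) , A * A′ - 1#) ∷
         (B , (1# - A * G) * (1# - A * A * A) - A * A * A * G * B′) ∷
         (A * A * A * G , B * B′ - 1#) ∷ [])
        (E ∷ difference AA′ ∷ difference P ∷ difference BB′ ∷ [])
        (solve 5 (λ A A′ B B′ G → A :* A :* ((A :* B :* G :- B) :* (A :+ B :+ G :+ :1 :+ :1) :- A :* G) :=
          (B :* (A :* G :- :1) :* (A :* A)) :* (B :+ G :+ A′ :* A′ :+ :1 :+ :1) :+
          ((:- (B :* (A :* G :- :1) :* (A :* A′ :+ :1))) :* (A :* A′ :- :1) :+
          (B :* ((:1 :- A :* G) :* (:1 :- A :* A :* A) :- A :* A :* A :* G :* B′) :+
          ((A :* A :* A :* G) :* (B :* B′ :- :1) :+ :0)))) ≡.refl A A′ B B′ G))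

    -- The Euclidean algorithm over ℤ for two cubics with no common root in any field.
    diagonal-impossible : ∀ {A A′} → A * A′ ≡ 1# → A + A + A′ * A′ + 1# + 1# ≡ 0# →
      (A * A * A - A) * (A + A + A + 1# + 1#) - A * A ≡ 0# → ⊥
    diagonal-impossible {A} {A′} AA′ E Q = 1≢0 (vanish₂ 1# (- ι (+ 3))
      (solve 1 (λ A → :1 := :1 :* (con (+ 3) :* A :+ con (+ 4)) :+ (:- con (+ 3)) :* (A :+ :1)) ≡.refl A) t₈ t₉)
      where
      t₁ : ι (+ 2) * (A * A * A) + ι (+ 2) * (A * A) + 1# ≡ 0#
      t₁ = vanish₂ (A * A) (- (A * A′ + 1#))
        (solve 2 (λ A A′ → con (+ 2) :* (A :* A :* A) :+ con (+ 2) :* (A :* A) :+ :1 :=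
          (A :* A) :* (A :+ A :+ A′ :* A′ :+ :1 :+ :1) :+ (:- (A :* A′ :+ :1)) :* (A :* A′ :- :1)) ≡.refl A A′)
        E (difference AA′)
      t₂ : (A * A - 1#) * (A + A + A + 1# + 1#) - A ≡ 0#
      t₂ = cancelˡ (unit-≢0 AA′) (vanish₁ 1# (solve 1 (λ A → A :* ((A :* A :- :1) :* (A :+ A :+ A :+ :1 :+ :1) :- A) :=
        :1 :* ((A :* A :* A :- A) :* (A :+ A :+ A :+ :1 :+ :1) :- A :* A)) ≡.refl A) Q)
      t₃ : A * A * A - ι (+ 4) * A - ι (+ 3) ≡ 0#
      t₃ = vanish₂ 1# (- 1#) (solve 1 (λ A → A :* A :* A :- con (+ 4) :* A :- con (+ 3) :=
        :1 :* ((A :* A :- :1) :* (A :+ A :+ A :+ :1 :+ :1) :- A) :+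
        (:- :1) :* (con (+ 2) :* (A :* A :* A) :+ con (+ 2) :* (A :* A) :+ :1)) ≡.refl A) t₂ t₁
      t₄ : ι (+ 2) * (A * A) + ι (+ 8) * A + ι (+ 7) ≡ 0#
      t₄ = vanish₂ 1# (- ι (+ 2)) (solve 1 (λ A → con (+ 2) :* (A :* A) :+ con (+ 8) :* A :+ con (+ 7) :=
        :1 :* (con (+ 2) :* (A :* A :* A) :+ con (+ 2) :* (A :* A) :+ :1) :+
        (:- con (+ 2)) :* (A :* A :* A :- con (+ 4) :* A :- con (+ 3))) ≡.refl A) t₁ t₃
      t₅ : ι (+ 8) * (A * A) + ι (+ 15) * A + ι (+ 6) ≡ 0#
      t₅ = vanish₂ A (- ι (+ 2)) (solve 1 (λ A → con (+ 8) :* (A :* A) :+ con (+ 15) :* A :+ con (+ 6) :=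
        A :* (con (+ 2) :* (A :* A) :+ con (+ 8) :* A :+ con (+ 7)) :+
        (:- con (+ 2)) :* (A :* A :* A :- con (+ 4) :* A :- con (+ 3))) ≡.refl A) t₄ t₃
      t₆ : ι (+ 17) * A + ι (+ 22) ≡ 0#
      t₆ = vanish₂ (ι (+ 4)) (- 1#) (solve 1 (λ A → con (+ 17) :* A :+ con (+ 22) :=
        con (+ 4) :* (con (+ 2) :* (A :* A) :+ con (+ 8) :* A :+ con (+ 7)) :+
        (:- :1) :* (con (+ 8) :* (A :* A) :+ con (+ 15) :* A :+ con (+ 6))) ≡.refl A) t₄ t₅
      t₇ : ι (+ 7) * A + ι (+ 9) ≡ 0#
      t₇ = vanish₂ (ι (+ 17)) (- (ι (+ 2) * A + ι (+ 5))) (solve 1 (λ A → con (+ 7) :* A :+ con (+ 9) :=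
        con (+ 17) :* (con (+ 2) :* (A :* A) :+ con (+ 8) :* A :+ con (+ 7)) :+
        (:- (con (+ 2) :* A :+ con (+ 5))) :* (con (+ 17) :* A :+ con (+ 22))) ≡.refl A) t₄ t₆
      t₈ : ι (+ 3) * A + ι (+ 4) ≡ 0#
      t₈ = vanish₂ 1# (- ι (+ 2)) (solve 1 (λ A → con (+ 3) :* A :+ con (+ 4) :=
        :1 :* (con (+ 17) :* A :+ con (+ 22)) :+ (:- con (+ 2)) :* (con (+ 7) :* A :+ con (+ 9))) ≡.refl A) t₆ t₇
      t₉ : A + 1# ≡ 0#
      t₉ = vanish₂ 1# (- ι (+ 2)) (solve 1 (λ A → A :+ :1 :=
        :1 :* (con (+ 7) :* A :+ con (+ 9)) :+ (:- con (+ 2)) :* (con (+ 3) :* A :+ con (+ 4))) ≡.refl A) t₇ t₈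

    -- The triangle pattern after scaling: the marked points are (A,A′,1), (G′,1,G), (1,B,B′) and
    -- the unmarked ones (o,o,o), (o²,o²,o²). The hypotheses `E₁`, `E₂`, `E₃` are the weighted sums,
    -- and `Pa`, `Pb`, `Pc` the pencil products at A, B and G.
    module _ {A A′ B B′ G G′ : K} (AA′ : A * A′ ≡ 1#) (BB′ : B * B′ ≡ 1#) (GG′ : G * G′ ≡ 1#)
      (E₁ : A + G + B′ * B′ + 1# + 1# ≡ 0#) (E₂ : A + B + G′ * G′ + 1# + 1# ≡ 0#) (E₃ : B + G + A′ * A′ + 1# + 1# ≡ 0#)
      (Pa : (1# - A * G) * (1# - A * A * A) ≡ A * A * A * G * B′)
      (Pb : (1# - B * A) * (1# - B * B * B) ≡ B * B * B * A * G′)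
      (Pc : (1# - G * B) * (1# - G * G * G) ≡ G * G * G * B * A′) where
      private
        Qa : (A * B * G - B) * (A + B + G + 1# + 1#) - A * G ≡ 0#
        Qa = cyclic-quotient AA′ BB′ E₃ Pa

        Qb : (A * B * G - G) * (A + B + G + 1# + 1#) - A * B ≡ 0#
        Qb = ≡.trans (solve 3 (λ A B G → (A :* B :* G :- G) :* (A :+ B :+ G :+ :1 :+ :1) :- A :* B :=
          (B :* G :* A :- G) :* (B :+ G :+ A :+ :1 :+ :1) :- B :* A) ≡.refl A B G)
          (cyclic-quotient BB′ GG′ (≡.trans (cong (λ t → t + B′ * B′ + 1# + 1#) (+-comm G A)) E₁) Pb)

        Qc : (A * B * G - A) * (A + B + G + 1# + 1#) - B * G ≡ 0#
        Qc = ≡.trans (solve 3 (λ A B G → (A :* B :* G :- A) :* (A :+ B :+ G :+ :1 :+ :1) :- B :* G :=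
          (G :* A :* B :- A) :* (G :+ A :+ B :+ :1 :+ :1) :- G :* B) ≡.refl A B G)
          (cyclic-quotient GG′ AA′ E₂ Pc)

        AB : (A - B) * (A + B + 1# + 1#) ≡ 0#
        AB = vanish₂ 1# (- 1#) (solve 3 (λ A B G → (A :- B) :* (A :+ B :+ :1 :+ :1) :=
          :1 :* ((A :* B :* G :- B) :* (A :+ B :+ G :+ :1 :+ :1) :- A :* G) :+
          (:- :1) :* ((A :* B :* G :- A) :* (A :+ B :+ G :+ :1 :+ :1) :- B :* G)) ≡.refl A B G) Qa Qc

        BG : (B - G) * (B + G + 1# + 1#) ≡ 0#
        BG = vanish₂ 1# (- 1#) (solve 3 (λ A B G → (B :- G) :* (B :+ G :+ :1 :+ :1) :=
          :1 :* ((A :* B :* G :- G) :* (A :+ B :+ G :+ :1 :+ :1) :- A :* B) :+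
          (:- :1) :* ((A :* B :* G :- B) :* (A :+ B :+ G :+ :1 :+ :1) :- A :* G)) ≡.refl A B G) Qb Qa

        -- The other factor of `AB` or `BG` is a weighted sum without its square, so it could vanish
        -- only if an inverse were zero.
        square-term : ∀ {x y z} → z ≢ 0# → x + y + z * z + 1# + 1# ≡ 0# → x + y + 1# + 1# ≢ 0#
        square-term {x} {y} {z} z≢0 E h = z≢0 (zero-square (vanish₂ 1# (- 1#)
          (solve 3 (λ x y z → z :* z := :1 :* (x :+ y :+ z :* z :+ :1 :+ :1) :+ (:- :1) :* (x :+ y :+ :1 :+ :1)) ≡.refl x y z) E h))

        A≡B : A ≡ B
        A≡B = Sum.[ equal , (λ h → ⊥-elim (square-term (unit-≢0 (≡.trans (*-comm G′ G) GG′)) E₂ h)) ] (zero-product AB)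

        B≡G : B ≡ G
        B≡G = Sum.[ equal , (λ h → ⊥-elim (square-term (unit-≢0 (≡.trans (*-comm A′ A) AA′)) E₃ h)) ] (zero-product BG)

        conclude : A ≡ B → B ≡ G → ⊥
        conclude ≡.refl ≡.refl = diagonal-impossible AA′ E₃ Qa

      triangle-pattern-impossible : ⊥
      triangle-pattern-impossible = conclude A≡B B≡G

    -- The parallel pattern: A, B, G are the ratios of the coordinates of the two marked points, and
    -- `c` is uw² at the first of them. The hypotheses `H₁` to `H₄` come from `mark-line`, squared
    -- because the sign there is not known; `E` is the weighted sum, in which the three unmarked
    -- points contribute 1 each.
    module _ {A B G c : K} (ABG : A * B * G ≡ 1#) (A≢1 : A ≢ 1#)
      (H₁ : (1# - A) * (1# - A) ≡ (A * G) * (A * G)) (H₂ : (1# - B) * (1# - B) ≡ (B * A) * (B * A))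
      (H₃ : (1# - G) * (1# - G) ≡ (G * B) * (G * B)) (H₄ : (1# - B * G) * (1# - B * G) ≡ B * B)
      (E : c + c * (A * (G * G)) + (1# + 1# + 1#) ≡ 0#) where
      private
        δ : A * B * G - 1# ≡ 0#
        δ = difference ABG

        A≢0 : A ≢ 0#
        A≢0 = unit-≢0 (≡.trans (sym (*-assoc A B G)) ABG)

        h₁ : (1# - A) * (1# - A) - (A * G) * (A * G) ≡ 0#
        h₁ = difference H₁

        h₂ : (A * G - 1#) * (A * G - 1#) - A * A ≡ 0#
        h₂ = vanish₂ ((A * G) * (A * G))
          ((1# + 1#) * (A * G - 1#) - (A * B * G - 1#) + A * A * (1# + 1# + (A * B * G - 1#)))
          (solve 3 (λ A B G → (A :* G :- :1) :* (A :* G :- :1) :- A :* A :=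
            ((A :* G) :* (A :* G)) :* ((:1 :- B) :* (:1 :- B) :- (B :* A) :* (B :* A)) :+
            ((:1 :+ :1) :* (A :* G :- :1) :- (A :* B :* G :- :1) :+ A :* A :* (:1 :+ :1 :+ (A :* B :* G :- :1))) :* (A :* B :* G :- :1))
            ≡.refl A B G) (difference H₂) δ

        h₃ : (A - A * G) * (A - A * G) - 1# ≡ 0#
        h₃ = vanish₂ (A * A) (A * B * G + 1#)
          (solve 3 (λ A B G → (A :- A :* G) :* (A :- A :* G) :- :1 :=
            (A :* A) :* ((:1 :- G) :* (:1 :- G) :- (G :* B) :* (G :* B)) :+ (A :* B :* G :+ :1) :* (A :* B :* G :- :1)) ≡.refl A B G)
          (difference H₃) δ

        -- The squared relations combine to 4A(A - 1) = 0. In characteristic 2 the lost signs do not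
        -- matter, and the squares can be replaced by linear relations again.
        two≡0 : 1# + 1# ≡ 0#
        two≡0 = zero-square (cancelˡ (difference-≢0 A≢1) (cancelˡ A≢0 (vanish₃ (1# - A) (- A) 1#
          (solve 2 (λ A G → A :* ((A :- :1) :* ((:1 :+ :1) :* (:1 :+ :1))) :=
            (:1 :- A) :* ((:1 :- A) :* (:1 :- A) :- (A :* G) :* (A :* G)) :+
            (:- A) :* ((A :* G :- :1) :* (A :* G :- :1) :- A :* A) :+
            :1 :* ((A :- A :* G) :* (A :- A :* G) :- :1)) ≡.refl A G) h₁ h₂ h₃)))

        g₁ : A * G - 1# + A ≡ 0#
        g₁ = zero-square (vanish₂ (- 1#) ((1# - A) * (1# - A) - A * G * (1# - A))
          (solve 2 (λ A G → (A :* G :- :1 :+ A) :* (A :* G :- :1 :+ A) :=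
            (:- :1) :* ((:1 :- A) :* (:1 :- A) :- (A :* G) :* (A :* G)) :+
            ((:1 :- A) :* (:1 :- A) :- A :* G :* (:1 :- A)) :* (:1 :+ :1)) ≡.refl A G) h₁ two≡0)

        g₄ : 1# - B * G - B ≡ 0#
        g₄ = zero-square (vanish₂ 1# (B * B - B * (1# - B * G))
          (solve 2 (λ B G → (:1 :- B :* G :- B) :* (:1 :- B :* G :- B) :=
            :1 :* ((:1 :- B :* G) :* (:1 :- B :* G) :- B :* B) :+ (B :* B :- B :* (:1 :- B :* G)) :* (:1 :+ :1)) ≡.refl B G)
          (difference H₄) two≡0)

        g₅ : A * B - A + 1# ≡ 0#
        g₅ = vanish₂ (- A) (- 1#) (solve 3 (λ A B G → A :* B :- A :+ :1 :=
          (:- A) :* (:1 :- B :* G :- B) :+ (:- :1) :* (A :* B :* G :- :1)) ≡.refl A B G) g₄ δ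

        g₆ : A * A + A + 1# ≡ 0#
        g₆ = vanish₄ (A * G) (A - 1#) (- A) A
          (solve 3 (λ A B G → A :* A :+ A :+ :1 :=
            (A :* G) :* (A :* B :- A :+ :1) :+ (A :- :1) :* (A :* G :- :1 :+ A) :+ (:- A) :* (A :* B :* G :- :1) :+ A :* (:1 :+ :1))
            ≡.refl A B G) g₅ g₁ δ two≡0

        G≡A : G ≡ A
        G≡A = equal (cancelˡ A≢0 (vanish₃ 1# (- 1#) 1#
          (solve 2 (λ A G → A :* (G :- A) := :1 :* (A :* G :- :1 :+ A) :+ (:- :1) :* (A :* A :+ A :+ :1) :+ :1 :* (:1 :+ :1)) ≡.refl A G)
          g₁ g₆ two≡0))

        -- With G = A and A³ = 1 the weighted sum is 2c + 3, which is 1 in characteristic 2.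
        conclude : G ≡ A → ⊥
        conclude ≡.refl = 1≢0 (vanish₃ 1# (- (c * (A - 1#))) (- (c + 1#))
          (solve 2 (λ A c → :1 := :1 :* (c :+ c :* (A :* (A :* A)) :+ (:1 :+ :1 :+ :1)) :+
            (:- (c :* (A :- :1))) :* (A :* A :+ A :+ :1) :+ (:- (c :+ :1)) :* (:1 :+ :1)) ≡.refl A c) E g₆ two≡0)

      parallel-pattern-impossible : ⊥
      parallel-pattern-impossible = conclude G≡A

-- The three patterns reduced to their eliminations.

module TwoTwoTwoPatterns (𝔽 : FinField) where
  open FinField 𝔽
  open FieldTheory 𝔽
  open SymmetricFunctions 𝔽
  open TwoTwoTwo 𝔽
  open TwoTwoTwoFacts 𝔽
  open TwoTwoTwoScaling 𝔽
  open TwoTwoTwoAlgebra 𝔽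
  open Balanced
  open Marks

  abstract
    -- A null triple containing 1 consists of roots of T³ - 1; the other two are the roots of T² + T
    -- + 1, which may both be 1 in characteristic 3.
    null-omega : ∀ {x o} → x + 1# + o ≡ 0# → x * 1# + x * o + 1# * o ≡ 0# → o * o + o + 1# ≡ 0# × x ≡ o * o
    null-omega {x} {o} s p = omega , equal (vanish₂ 1# (- 1#)
        (solve 2 (λ x o → x :- o :* o := :1 :* (x :+ :1 :+ o) :+ (:- :1) :* (o :* o :+ o :+ :1)) ≡.refl x o) s omega)
      where
      omega : o * o + o + 1# ≡ 0#
      omega = vanish₂ (1# + o) (- 1#)
        (solve 2 (λ x o → o :* o :+ o :+ :1 := (:1 :+ o) :* (x :+ :1 :+ o) :+ (:- :1) :* (x :* :1 :+ x :* o :+ :1 :* o)) ≡.refl x o) s p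

    -- The roots of T² + T + 1 are `o` and -1 - o = o². If `p` were the second one, then op = 1 and
    -- hence t = 1.
    same-omega : ∀ {o p t} → o * o + o + 1# ≡ 0# → p * p + p + 1# ≡ 0# → o * p * t ≡ 1# → t ≢ 1# → p ≡ o × t ≡ o
    same-omega {o} {p} {t} ho hp opt t≢1 = Sum.[ (λ h → sym (equal h) , t≡o (sym (equal h))) , (λ h → ⊥-elim (t≢1 (t≡1 h))) ] (zero-product {o - p} {o + p + 1#} factored)
      where
      factored : (o - p) * (o + p + 1#) ≡ 0#
      factored = vanish₂ 1# (- 1#) (solve 2 (λ o p → (o :- p) :* (o :+ p :+ :1) :=
        :1 :* (o :* o :+ o :+ :1) :+ (:- :1) :* (p :* p :+ p :+ :1)) ≡.refl o p) ho hp
      t≡o : p ≡ o → t ≡ o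
      t≡o ≡.refl = equal (vanish₂ (- t) o (solve 2 (λ o t → t :- o :=
        (:- t) :* (o :* o :* o :- :1) :+ o :* (o :* o :* t :- :1)) ≡.refl o t) (omega-cube ho) (difference opt))
      t≡1 : o + p + 1# ≡ 0# → t ≡ 1#
      t≡1 h = equal (vanish₃ 1# (t * (- o)) t (solve 3 (λ o p t → t :- :1 :=
        :1 :* (o :* p :* t :- :1) :+ (t :* (:- o)) :* (o :+ p :+ :1) :+ t :* (o :* o :+ o :+ :1)) ≡.refl o p t)
        (difference opt) h ho)

    -- In characteristic 3, T² + T + 1 = (T - 1)².
    omega-one : ∀ {o} → o * o + o + 1# ≡ 0# → 1# + 1# + 1# ≡ 0# → o ≡ 1#
    omega-one {o} h three = equal (zero-square (vanish₂ 1# (- o)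
      (solve 1 (λ o → (o :- :1) :* (o :- :1) := :1 :* (o :* o :+ o :+ :1) :+ (:- o) :* (:1 :+ :1 :+ :1)) ≡.refl o) h three))

    -- The value t = 1 is a root of T² + T + 1 only in characteristic 3, where `o` and `p` would be
    -- 1 too; the point would then coincide with the normalised one. So `same-omega` applies.
    coincident-omega : ∀ {o p t} → o * o + o + 1# ≡ 0# → p * p + p + 1# ≡ 0# → t * t + t + 1# ≡ 0# → o * p * t ≡ 1# →
      ¬ (o ≡ 1# × p ≡ 1#) → p ≡ o × t ≡ o
    coincident-omega {o} {p} {t} ho hp ht opt distinct = same-omega ho hp opt
      (λ t≡1 → let three = three≡0 t≡1 in distinct (omega-one ho three , omega-one hp three))
      where
      three≡0 : t ≡ 1# → 1# + 1# + 1# ≡ 0#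
      three≡0 ≡.refl = ≡.trans (cong (λ s → s + 1# + 1#) (sym (*-identityˡ 1#))) ht

    weighted-five : ∀ R {a b c d e′} → five ↭ a ∷ b ∷ c ∷ d ∷ e′ ∷ [] →
      u R a * w R a * w R a + u R b * w R b * w R b + u R c * w R c * w R c + u R d * w R d * w R d + u R e′ * w R e′ * w R e′ ≡ 0#
    weighted-five R p = ≡.trans (sym (≡.trans (e-↭ 1 (↭ₚ.map⁺ (λ m → u R m * w R m * w R m) p)) (e₁-five _ _ _ _ _))) (weighted-sum R)

    -- The suffixes name the points of M: a is marked on the first two sides, b only on the first, c
    -- only on the second, d and e on the third. Hence c, d, e are a null triple in u, b, d, e in v,
    -- and a, b, c in w.
    ω-core : ∀ {ua va wa ub vb wb uc vc wc ud vd wd ue ve we} → ud ≡ 1# → vd ≡ 1# → wd ≡ 1# →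
      ua * va * wa ≡ 1# → ub * vb * wb ≡ 1# → uc * vc * wc ≡ 1# → ue * ve * we ≡ 1# →
      uc + ud + ue ≡ 0# → uc * ud + uc * ue + ud * ue ≡ 0# →
      vb + vd + ve ≡ 0# → vb * vd + vb * ve + vd * ve ≡ 0# →
      wa + wb + wc ≡ 0# → wa * wb + wa * wc + wb * wc ≡ 0# →
      we ≢ 1# → wa * wa * wa ≢ 1# →
      ua * wa * wa + ub * wb * wb + uc * wc * wc + ud * wd * wd + ue * we * we ≡ 0# →
      va * ua * ua + vb * ub * ub + vc * uc * uc + vd * ud * ud + ve * ue * ue ≡ 0# →
      wa * va * va + wb * vb * vb + wc * vc * vc + wd * vd * vd + we * ve * ve ≡ 0# → ⊥
    ω-core {ua} {va} {wa} {ub} {vb} {wb} {uc} {vc} {wc} {ue = o} ≡.refl ≡.refl ≡.refl ha hb hc he us up vs vp ws wp we≢1 wa³≢1 E₁ E₂ E₃ =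
      let ho , uc≡ = null-omega us up
          hv , vb≡ = null-omega vs vp
          ve≡ , we≡ = same-omega ho hv he we≢1
      in go ho ve≡ we≡ uc≡ vb≡ E₁ E₂ E₃ hb hc
      where
      one : ∀ x y → x + 1# * 1# * 1# + y ≡ x + 1# + y
      one = solve 2 (λ x y → x :+ :1 :* :1 :* :1 :+ y := x :+ :1 :+ y) ≡.refl
      go : ∀ {ve we uc vb} → o * o + o + 1# ≡ 0# → ve ≡ o → we ≡ o → uc ≡ o * o → vb ≡ ve * ve →
        ua * wa * wa + ub * wb * wb + uc * wc * wc + 1# * 1# * 1# + o * we * we ≡ 0# →
        va * ua * ua + vb * ub * ub + vc * uc * uc + 1# * 1# * 1# + ve * o * o ≡ 0# →
        wa * va * va + wb * vb * vb + wc * vc * vc + 1# * 1# * 1# + we * ve * ve ≡ 0# →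
        ub * vb * wb ≡ 1# → uc * vc * wc ≡ 1# → ⊥
      go ho ≡.refl ≡.refl ≡.refl ≡.refl E₁ E₂ E₃ hb hc = ω-pattern-impossible ho ha hb hc ws wp wa³≢1
        (≡.trans (sym (one _ _)) E₁) (≡.trans (sym (one _ _)) E₂) (≡.trans (sym (one _ _)) E₃)

  abstract
    ω-pattern-normalised : ∀ (R : Balanced) → five ↭ i₁ (A R) ∷ i₂ (A R) ∷ i₂ (B R) ∷ i₁ (C R) ∷ i₂ (C R) ∷ [] →
      i₁ (B R) ≡ i₁ (A R) → u R (i₁ (C R)) ≡ 1# → v R (i₁ (C R)) ≡ 1# → w R (i₁ (C R)) ≡ 1# → ⊥
    ω-pattern-normalised R p ba ud vd wd = ω-core ud vd wd (uvw R _) (uvw R _) (uvw R _) (uvw R _)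
      (u-null-sum R p) (u-null-products R p) (u-null-sum (rot R) pB) (u-null-products (rot R) pB)
      (u-null-sum (rot (rot R)) pC) (u-null-products (rot (rot R)) pC)
      (λ we → a₁≢a₂ (C R) (≡.trans (sym (at-i₁ (C R))) (≡.trans wd (≡.trans (sym we) (at-i₂ (C R))))))
      -- At the normalised point the third coordinate is the mark `c₁` = 1, and `mark-cube` keeps
      -- its cube apart from the cubes of the unmarked third coordinates.
      (λ wa³ → let (_ , _ , ad , ae) , _ = arranged-distinct p in
        mark-cube (rot (rot R)) ad ae (≡.trans (cong cube (≡.trans (sym (at-i₁ (C R))) wd))
          (≡.trans (≡.trans (cong (_* 1#) (*-identityˡ 1#)) (*-identityˡ 1#)) (sym wa³))))
      (weighted-five R p) (weighted-five (rot R) p) (weighted-five (rot (rot R)) p)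
      where
      pB : five ↭ i₁ (B R) ∷ i₂ (B R) ∷ i₂ (A R) ∷ i₁ (C R) ∷ i₂ (C R) ∷ []
      pB = subst (λ j → five ↭ j ∷ i₂ (B R) ∷ i₂ (A R) ∷ i₁ (C R) ∷ i₂ (C R) ∷ []) (sym ba) (↭-trans p (prep _ (swap _ _ refl)))
      pC : five ↭ i₁ (C R) ∷ i₂ (C R) ∷ i₁ (A R) ∷ i₂ (A R) ∷ i₂ (B R) ∷ []
      pC = ↭-trans p (↭ₚ.++-comm (i₁ (A R) ∷ i₂ (A R) ∷ i₂ (B R) ∷ []) (i₁ (C R) ∷ i₂ (C R) ∷ []))

    ω-pattern : ∀ (R : Balanced) → five ↭ i₁ (A R) ∷ i₂ (A R) ∷ i₂ (B R) ∷ i₁ (C R) ∷ i₂ (C R) ∷ [] →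
      i₁ (B R) ≡ i₁ (A R) → ⊥
    ω-pattern R p ba = ω-pattern-normalised (normalise R d) p ba (normalise-u R d) (normalise-v R d) (normalise-w R d)
      where
      d : Fin 5
      d = i₁ (C R)

    -- The slopes of the unmarked points (o,o,o) and (o²,o²,o²) multiply to (o - X)(o² - X) = 1 + X
    -- + X², which completes the factor 1 - X to 1 - X³.
    pencil-product-core : ∀ {o X Y Z W f₁ f₂ f₃ f₄ r} → o * o * o - 1# ≡ 0# → o * o + o + 1# ≡ 0# → Z ≢ 0# →
      f₁ * f₂ * f₃ * f₄ ≡ r →
      f₁ * f₂ ≡ (1# - X * Y) * (Z * (1# - X)) → f₃ ≡ o * o - X * o → f₄ ≡ o * o * (o * o) - X * (o * o) →
      r ≡ Z * (X * X * X * Y * W) →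
      (1# - X * Y) * (1# - X * X * X) ≡ X * X * X * Y * W
    pencil-product-core {o} {X} {Y} {Z} {W} o³ ho Z≢0 h h₁₂ ≡.refl ≡.refl hr = equal (cancelˡ Z≢0 (vanish₃ 1#
      (- ((1# - X * Y) * (Z * (1# - X)) * (o * o * o + 1# - X * o - X * (o * o) + X * X)))
      (X * ((1# - X * Y) * (Z * (1# - X))))
      (solve 5 (λ o X Y Z W → Z :* ((:1 :- X :* Y) :* (:1 :- X :* X :* X) :- X :* X :* X :* Y :* W) :=
        :1 :* ((:1 :- X :* Y) :* (Z :* (:1 :- X)) :* (o :* o :- X :* o) :* (o :* o :* (o :* o) :- X :* (o :* o)) :- Z :* (X :* X :* X :* Y :* W)) :+
        (:- ((:1 :- X :* Y) :* (Z :* (:1 :- X)) :* (o :* o :* o :+ :1 :- X :* o :- X :* (o :* o) :+ X :* X))) :* (o :* o :* o :- :1) :+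
        (X :* ((:1 :- X :* Y) :* (Z :* (:1 :- X)))) :* (o :* o :+ o :+ :1)) ≡.refl o X Y Z W)
      (difference (≡.trans (cong (λ z → z * (o * o - X * o) * (o * o * (o * o) - X * (o * o))) (sym h₁₂)) (≡.trans h hr)))
      o³ ho))

    two-cancel : ∀ {x y} → x * 1# * y ≡ 1# → x * y ≡ 1#
    two-cancel {x} {y} = ≡.trans (cong (_* y) (sym (*-identityʳ x)))

    -- The suffixes name the points: a lacks a mark only on the third side, b only on the second, c
    -- only on the first, and d, e are unmarked. The coordinate where a mark is missing has been
    -- scaled to 1.
    triangle-core : ∀ {ua va wa ub vb wb uc vc wc ud vd wd ue ve we o} → uc ≡ 1# → vb ≡ 1# → wa ≡ 1# →
      ud ≡ o → vd ≡ o → wd ≡ o → ue ≡ o * o → ve ≡ o * o → we ≡ o * o → o * o + o + 1# ≡ 0# →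
      ua * va * wa ≡ 1# → ub * vb * wb ≡ 1# → uc * vc * wc ≡ 1# →
      ua * wa * wa + ub * wb * wb + uc * wc * wc + ud * wd * wd + ue * we * we ≡ 0# →
      va * ua * ua + vb * ub * ub + vc * uc * uc + vd * ud * ud + ve * ue * ue ≡ 0# →
      wa * va * va + wb * vb * vb + wc * vc * vc + wd * vd * vd + we * ve * ve ≡ 0# →
      (ub * wb - ua * wb) * (uc * wc - ua * wc) * (ud * wd - ua * wd) * (ue * we - ua * we)
        ≡ va ⁻¹ * vc ⁻¹ * (ua * wb) * (ua * wc) →
      (va * ua - vc * ua) * (vb * ub - vc * ub) * (vd * ud - vc * ud) * (ve * ue - vc * ue)
        ≡ wb ⁻¹ * wc ⁻¹ * (vc * ua) * (vc * ub) →
      (wa * va - wb * va) * (wc * vc - wb * vc) * (wd * vd - wb * vd) * (we * ve - wb * ve)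
        ≡ ua ⁻¹ * ub ⁻¹ * (wb * va) * (wb * vc) → ⊥
    triangle-core {A} {A′} {_} {G′} {_} {G} {_} {B} {B′} {o = o} ≡.refl ≡.refl ≡.refl ≡.refl ≡.refl ≡.refl ≡.refl ≡.refl ≡.refl ho ha hb hc E₁ E₂ E₃ PA PB PC =
      triangle-pattern-impossible AA′ BB′ GG′ e₁′ e₂′ e₃′
        (pencil-product-core o³ ho (unit-≢0 (≡.trans (*-comm B′ B) BB′)) PA
          (equal (vanish₁ (B′ * (1# - A)) (solve 4 (λ A G G′ B′ →
            (G′ :* G :- A :* G) :* (:1 :* B′ :- A :* B′) :- (:1 :- A :* G) :* (B′ :* (:1 :- A)) :=
            (B′ :* (:1 :- A)) :* (G :* G′ :- :1)) ≡.refl A G G′ B′) (difference GG′)))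
          ≡.refl ≡.refl
          (≡.trans (cong₂ (λ s t → s * t * (A * G) * (A * B′)) (sym (⁻¹-unique (≡.trans (*-comm A′ A) AA′))) (sym (⁻¹-unique BB′)))
            (solve 3 (λ A B′ G → A :* B′ :* (A :* G) :* (A :* B′) := B′ :* (A :* A :* A :* G :* B′)) ≡.refl A B′ G)))
        (pencil-product-core o³ ho (unit-≢0 (≡.trans (*-comm G′ G) GG′)) PB
          (equal (vanish₁ (G′ * (1# - B)) (solve 4 (λ A A′ B G′ →
            (A′ :* A :- B :* A) :* (:1 :* G′ :- B :* G′) :- (:1 :- B :* A) :* (G′ :* (:1 :- B)) :=
            (G′ :* (:1 :- B)) :* (A :* A′ :- :1)) ≡.refl A A′ B G′) (difference AA′)))
          ≡.refl ≡.refl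
          (≡.trans (cong₂ (λ s t → s * t * (B * A) * (B * G′)) (sym (⁻¹-unique GG′)) (sym (⁻¹-unique (≡.trans (*-comm B′ B) BB′))))
            (solve 3 (λ A B G′ → G′ :* B :* (B :* A) :* (B :* G′) := G′ :* (B :* B :* B :* A :* G′)) ≡.refl A B G′)))
        (pencil-product-core o³ ho (unit-≢0 (≡.trans (*-comm A′ A) AA′)) PC
          (equal (vanish₁ (A′ * (1# - G)) (solve 4 (λ B B′ G A′ →
            (:1 :* A′ :- G :* A′) :* (B′ :* B :- G :* B) :- (:1 :- G :* B) :* (A′ :* (:1 :- G)) :=
            (A′ :* (:1 :- G)) :* (B :* B′ :- :1)) ≡.refl B B′ G A′) (difference BB′)))
          ≡.refl ≡.refl
          (≡.trans (cong₂ (λ s t → s * t * (G * A′) * (G * B)) (sym (⁻¹-unique AA′)) (sym (⁻¹-unique (≡.trans (*-comm G′ G) GG′))))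
            (solve 3 (λ A′ B G → A′ :* G :* (G :* A′) :* (G :* B) := A′ :* (G :* G :* G :* B :* A′)) ≡.refl A′ B G)))
      where
      o³ : o * o * o - 1# ≡ 0#
      o³ = omega-cube ho
      AA′ : A * A′ ≡ 1#
      AA′ = ≡.trans (sym (*-identityʳ _)) ha
      BB′ : B * B′ ≡ 1#
      BB′ = ≡.trans (cong (_* B′) (sym (*-identityˡ B))) hc
      GG′ : G * G′ ≡ 1#
      GG′ = ≡.trans (*-comm G G′) (two-cancel hb)
      e₁′ : A + G + B′ * B′ + 1# + 1# ≡ 0#
      e₁′ = vanish₃ 1# (- G) (- (o * o * o + 1# + 1#))
        (solve 5 (λ A G G′ B′ o → A :+ G :+ B′ :* B′ :+ :1 :+ :1 :=
          :1 :* (A :* :1 :* :1 :+ G′ :* G :* G :+ :1 :* B′ :* B′ :+ o :* o :* o :+ o :* o :* (o :* o) :* (o :* o)) :+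
          (:- G) :* (G :* G′ :- :1) :+ (:- (o :* o :* o :+ :1 :+ :1)) :* (o :* o :* o :- :1)) ≡.refl A G G′ B′ o)
        E₁ (difference GG′) o³
      e₂′ : A + B + G′ * G′ + 1# + 1# ≡ 0#
      e₂′ = vanish₃ 1# (- A) (- (o * o * o + 1# + 1#))
        (solve 5 (λ A A′ B G′ o → A :+ B :+ G′ :* G′ :+ :1 :+ :1 :=
          :1 :* (A′ :* A :* A :+ :1 :* G′ :* G′ :+ B :* :1 :* :1 :+ o :* o :* o :+ o :* o :* (o :* o) :* (o :* o)) :+
          (:- A) :* (A :* A′ :- :1) :+ (:- (o :* o :* o :+ :1 :+ :1)) :* (o :* o :* o :- :1)) ≡.refl A A′ B G′ o)
        E₂ (difference AA′) o³
      e₃′ : B + G + A′ * A′ + 1# + 1# ≡ 0#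
      e₃′ = vanish₃ 1# (- B) (- (o * o * o + 1# + 1#))
        (solve 5 (λ A′ B B′ G o → B :+ G :+ A′ :* A′ :+ :1 :+ :1 :=
          :1 :* (:1 :* A′ :* A′ :+ G :* :1 :* :1 :+ B′ :* B :* B :+ o :* o :* o :+ o :* o :* (o :* o) :* (o :* o)) :+
          (:- B) :* (B :* B′ :- :1) :+ (:- (o :* o :* o :+ :1 :+ :1)) :* (o :* o :* o :- :1)) ≡.refl A′ B B′ G o)
        E₃ (difference BB′) o³

  abstract
    triangle-pattern-scaled : ∀ (R : Balanced) {d e′ o} → five ↭ i₁ (A R) ∷ i₂ (A R) ∷ i₂ (B R) ∷ d ∷ e′ ∷ [] →
      i₁ (B R) ≡ i₁ (A R) → i₁ (C R) ≡ i₂ (A R) → i₂ (C R) ≡ i₂ (B R) →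
      u R (i₂ (B R)) ≡ 1# → v R (i₂ (A R)) ≡ 1# → w R (i₁ (A R)) ≡ 1# →
      u R d ≡ o → v R d ≡ o → w R d ≡ o → u R e′ ≡ o * o → v R e′ ≡ o * o → w R e′ ≡ o * o → o * o + o + 1# ≡ 0# → ⊥
    triangle-pattern-scaled R {d} {e′} p ba ca cb uc vb wa ud vd wd ue ve we ho =
      triangle-core uc vb wa ud vd wd ue ve we ho (uvw R _) (uvw R _) (uvw R _)
        (weighted-five R p) (weighted-five (rot R) p) (weighted-five (rot (rot R)) p)
        (≡.trans (Facts.pencil-product R (inj₁ (at-i₁ (A R))) p ≡.refl)
          (targets (b₁≡ ba) (sym (at-i₂ (B R))) (c₁≡ ca) (c₂≡ cb)))
        (≡.trans (Facts.pencil-product (rot R) (inj₂ (at-i₂ (B R))) (↭-trans p (↭ₚ.shift (i₂ (B R)) (i₁ (A R) ∷ i₂ (A R) ∷ []) (d ∷ e′ ∷ []))) ≡.refl)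
          (targets (c₁≡ ca) (c₂≡ cb) (sym (at-i₁ (A R))) (sym (at-i₂ (A R)))))
        (≡.trans (Facts.pencil-product (rot (rot R)) (inj₁ (sym (c₁≡ ca))) (↭-trans p (swap _ _ refl)) ≡.refl)
          (targets (sym (at-i₁ (A R))) (sym (at-i₂ (A R))) (b₁≡ ba) (sym (at-i₂ (B R)))))
      where
      b₁≡ : ∀ {i} → i₁ (B R) ≡ i → a₁ (B R) ≡ v R i
      b₁≡ ≡.refl = sym (at-i₁ (B R))
      c₁≡ : ∀ {i} → i₁ (C R) ≡ i → a₁ (C R) ≡ w R i
      c₁≡ ≡.refl = sym (at-i₁ (C R))
      c₂≡ : ∀ {i} → i₂ (C R) ≡ i → a₂ (C R) ≡ w R i
      c₂≡ ≡.refl = sym (at-i₂ (C R))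
      targets : ∀ {s x y z t x′ y′ z′ t′} → x ≡ x′ → y ≡ y′ → z ≡ z′ → t ≡ t′ →
        x ⁻¹ * y ⁻¹ * (s * z) * (s * t) ≡ x′ ⁻¹ * y′ ⁻¹ * (s * z′) * (s * t′)
      targets ≡.refl ≡.refl ≡.refl ≡.refl = ≡.refl

    triangle-pattern : ∀ (R : Balanced) {d e′} → five ↭ i₁ (A R) ∷ i₂ (A R) ∷ i₂ (B R) ∷ d ∷ e′ ∷ [] →
      i₁ (B R) ≡ i₁ (A R) → i₁ (C R) ≡ i₂ (A R) → i₂ (C R) ≡ i₂ (B R) → ⊥
    triangle-pattern R {d} {e′} p ba ca cb =
      let ho , uc = null-omega (at₁ (normalise-u R d) (u-null-sum S p)) (at₂ (normalise-u R d) (u-null-products S p))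
          hp , vb = null-omega (at₁ (normalise-v R d) (u-null-sum (rot S) pB)) (at₂ (normalise-v R d) (u-null-products (rot S) pB))
          ht , wa = null-omega (at₁ (normalise-w R d) (u-null-sum (rot (rot S)) pC)) (at₂ (normalise-w R d) (u-null-products (rot (rot S)) pC))
          ve , we = coincident-omega ho hp ht (uvw S e′)
            (λ h → d≢e (separated S (≡.trans (normalise-u R d) (sym (proj₁ h))) (≡.trans (normalise-v R d) (sym (proj₂ h)))))
          o³ = omega-cube ho
      -- After normalisation d = (1,1,1), e′ = (o,o,o), and the unmarked coordinates of the marked
      -- points are o². The second scaling by `o` in all coordinates turns these into 1; it is
      -- allowed since o³ = 1.
      in triangle-pattern-scaled (scale S (u S e′) (u S e′) (u S e′) (equal o³)) p ba ca cb
        (unit ≡.refl uc o³) (unit ve vb o³) (unit we wa o³)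
        (one (normalise-u R d)) (one (normalise-v R d)) (one (normalise-w R d))
        ≡.refl (cong (u S e′ *_) ve) (cong (u S e′ *_) we) ho
      where
      S : Balanced
      S = normalise R d
      d≢e : d ≢ e′
      d≢e = proj₂ (proj₂ (proj₂ (arranged-distinct p)))
      pB : five ↭ i₁ (B R) ∷ i₂ (B R) ∷ i₂ (A R) ∷ d ∷ e′ ∷ []
      pB = subst (λ j → five ↭ j ∷ i₂ (B R) ∷ i₂ (A R) ∷ d ∷ e′ ∷ []) (sym ba) (↭-trans p (prep _ (swap _ _ refl)))
      pC : five ↭ i₁ (C R) ∷ i₂ (C R) ∷ i₁ (A R) ∷ d ∷ e′ ∷ []
      pC = subst₂ (λ j k → five ↭ j ∷ k ∷ i₁ (A R) ∷ d ∷ e′ ∷ []) (sym ca) (sym cb)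
        (↭-trans p (↭-sym (↭ₚ.shift (i₁ (A R)) (i₂ (A R) ∷ i₂ (B R) ∷ []) (d ∷ e′ ∷ []))))
      at₁ : ∀ {x y z} → y ≡ 1# → x + y + z ≡ 0# → x + 1# + z ≡ 0#
      at₁ ≡.refl h = h
      at₂ : ∀ {x y z} → y ≡ 1# → x * y + x * z + y * z ≡ 0# → x * 1# + x * z + 1# * z ≡ 0#
      at₂ ≡.refl h = h
      unit : ∀ {x y o} → y ≡ o → x ≡ y * y → o * o * o - 1# ≡ 0# → o * x ≡ 1#
      unit {o = o} ≡.refl ≡.refl h = ≡.trans (sym (*-assoc o o o)) (equal h)
      one : ∀ {x o} → x ≡ 1# → o * x ≡ o
      one ≡.refl = *-identityʳ _

    -- The point of M with coordinates (a₁,b₁,c₁) lies on the line joining the holes a₂ and b₂ or a₂ and c₂.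
    mark-line : ∀ (R : Balanced) → w R (i₁ (A R)) ≡ a₁ (C R) → a₁ (A R) * a₁ (B R) * a₁ (C R) ≡ 1# → a₂ (A R) * a₂ (B R) * a₂ (C R) ≡ 1# →
      (a₁ (A R) * a₁ (C R) - a₂ (A R) * a₁ (C R)) * (a₁ (A R) * a₁ (C R) - a₂ (A R) * a₁ (C R)) ≡ (a₂ (A R) * a₂ (C R)) * (a₂ (A R) * a₂ (C R))
    mark-line R wa abc a′b′c′ = go (at-i₁ (A R)) wa
      (↭ₚ.∈-resp-↭ (pencilA R (inj₂ ≡.refl)) (∈-map⁺ (λ m → u R m * w R m - a₂ (A R) * w R m) (five-complete (i₁ (A R)))))
      (sym (⁻¹-unique (≡.trans (solve 3 (λ a b c → b :* (a :* c) := a :* b :* c) ≡.refl _ _ _) abc)))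
      (sym (⁻¹-unique (≡.trans (solve 3 (λ a b c → b :* (a :* c) := a :* b :* c) ≡.refl _ _ _) a′b′c′)))
      (a₁≢0 (A R)) (a₂≢0 (A R)) (a₁≢a₂ (A R)) (a₁≢0 (C R))
      where
      go : ∀ {ua wa a c a′ c′ b⁻ b′⁻} → ua ≡ a → wa ≡ c →
        ua * wa - a′ * wa ∈ 0# ∷ b⁻ ∷ b′⁻ ∷ - (a′ * c) ∷ - (a′ * c′) ∷ [] → b⁻ ≡ a * c → b′⁻ ≡ a′ * c′ →
        a ≢ 0# → a′ ≢ 0# → a ≢ a′ → c ≢ 0# →
        (a * c - a′ * c) * (a * c - a′ * c) ≡ (a′ * c′) * (a′ * c′)
      go {a = a} {c} {a′} ≡.refl ≡.refl (here h) _ _ a≢0 a′≢0 a≢a′ c≢0 =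
        ⊥-elim (product-≢0 (difference-≢0 a≢a′) c≢0 (≡.trans (solve 3 (λ a a′ c → (a :- a′) :* c := a :* c :- a′ :* c) ≡.refl a a′ c) h))
      go {a = a} {c} {a′} ≡.refl ≡.refl (there (here h)) ≡.refl _ a≢0 a′≢0 a≢a′ c≢0 =
        ⊥-elim (product-≢0 a′≢0 c≢0 (vanish₁ (- 1#) (solve 3 (λ a a′ c → a′ :* c := (:- :1) :* ((a :* c :- a′ :* c) :- a :* c)) ≡.refl a a′ c) (difference h)))
      go ≡.refl ≡.refl (there (there (here h))) _ ≡.refl _ _ _ _ = cong₂ _*_ h h
      go {a = a} {c} {a′} ≡.refl ≡.refl (there (there (there (here h)))) _ _ a≢0 a′≢0 a≢a′ c≢0 =
        ⊥-elim (product-≢0 a≢0 c≢0 (vanish₁ 1# (solve 3 (λ a a′ c → a :* c := :1 :* ((a :* c :- a′ :* c) :- (:- (a′ :* c)))) ≡.refl a a′ c) (difference h)))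
      go ≡.refl ≡.refl (there (there (there (there (here h))))) _ _ _ _ _ _ =
        ≡.trans (cong₂ _*_ h h) (solve 2 (λ a c → (:- (a :* c)) :* (:- (a :* c)) := (a :* c) :* (a :* c)) ≡.refl _ _)

    -- Since abc = 1, the product b * c stands for a⁻¹. The three arguments are therefore the ratios
    -- a′/a, b′/b and c′/c, and the relations are rewritten in these ratios.
    parallel-core : ∀ {a b c a′ b′ c′} → a * b * c ≡ 1# → a′ * b′ * c′ ≡ 1# → a ≢ a′ →
      (a * c - a′ * c) * (a * c - a′ * c) ≡ (a′ * c′) * (a′ * c′) →
      (b * a - b′ * a) * (b * a - b′ * a) ≡ (b′ * a′) * (b′ * a′) →
      (c * b - c′ * b) * (c * b - c′ * b) ≡ (c′ * b′) * (c′ * b′) →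
      (a′ * c′ - a * c′) * (a′ * c′ - a * c′) ≡ (a * c) * (a * c) →
      a * c * c + a′ * c′ * c′ + (1# + 1# + 1#) ≡ 0# → ⊥
    parallel-core {a} {b} {c} {a′} {b′} {c′} abc a′b′c′ a≢a′ M₁ M₂ M₃ M₄ E =
      parallel-pattern-impossible {A = a′ * (b * c)} {B = b′ * (c * a)} {G = c′ * (a * b)} {c = a * c * c}
        (equal (vanish₂ (a * b * c * (a * b * c)) (a * b * c + 1#)
          (solve 6 (λ a b c a′ b′ c′ → (a′ :* (b :* c)) :* (b′ :* (c :* a)) :* (c′ :* (a :* b)) :- :1 :=
            (a :* b :* c :* (a :* b :* c)) :* (a′ :* b′ :* c′ :- :1) :+ (a :* b :* c :+ :1) :* (a :* b :* c :- :1)) ≡.refl a b c a′ b′ c′)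
          (difference a′b′c′) δ))
        (λ A≡1 → a≢a′ (equal (vanish₂ (- a) a′
          (solve 4 (λ a b c a′ → a :- a′ := (:- a) :* (a′ :* (b :* c) :- :1) :+ a′ :* (a :* b :* c :- :1)) ≡.refl a b c a′)
          (difference A≡1) δ)))
        (cleared abc M₁) (cleared bca M₂) (cleared cab M₃)
        (equal (vanish₃ (b′ * b′)
          (- (1# + 1# - b′ * (c * a) * (c′ * (a * b)) + (a′ * b′ * c′ - 1#) - a * b′ * c′))
          (- (a * b′ * c′ * (1# + 1# - b′ * (c * a) * (c′ * (a * b)) + (a′ * b′ * c′ - 1#) - a * b′ * c′)))
          (solve 6 (λ a b c a′ b′ c′ →
            (:1 :- b′ :* (c :* a) :* (c′ :* (a :* b))) :* (:1 :- b′ :* (c :* a) :* (c′ :* (a :* b))) :- b′ :* (c :* a) :* (b′ :* (c :* a)) :=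
            (b′ :* b′) :* ((a′ :* c′ :- a :* c′) :* (a′ :* c′ :- a :* c′) :- (a :* c) :* (a :* c)) :+
            (:- (:1 :+ :1 :- b′ :* (c :* a) :* (c′ :* (a :* b)) :+ (a′ :* b′ :* c′ :- :1) :- a :* b′ :* c′)) :* (a′ :* b′ :* c′ :- :1) :+
            (:- (a :* b′ :* c′ :* (:1 :+ :1 :- b′ :* (c :* a) :* (c′ :* (a :* b)) :+ (a′ :* b′ :* c′ :- :1) :- a :* b′ :* c′))) :* (a :* b :* c :- :1))
            ≡.refl a b c a′ b′ c′)
          (difference M₄) (difference a′b′c′) δ))
        (vanish₂ 1# (a′ * c′ * c′ * (a * b * c * (a * b * c) + a * b * c + 1#))
          (solve 5 (λ a b c a′ c′ →
            a :* c :* c :+ a :* c :* c :* (a′ :* (b :* c) :* (c′ :* (a :* b) :* (c′ :* (a :* b)))) :+ (:1 :+ :1 :+ :1) :=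
            :1 :* (a :* c :* c :+ a′ :* c′ :* c′ :+ (:1 :+ :1 :+ :1)) :+
            (a′ :* c′ :* c′ :* (a :* b :* c :* (a :* b :* c) :+ a :* b :* c :+ :1)) :* (a :* b :* c :- :1)) ≡.refl a b c a′ c′)
          E δ)
      where
      δ : a * b * c - 1# ≡ 0#
      δ = difference abc
      bca : b * c * a ≡ 1#
      bca = ≡.trans (solve 3 (λ a b c → b :* c :* a := a :* b :* c) ≡.refl a b c) abc
      cab : c * a * b ≡ 1#
      cab = ≡.trans (solve 3 (λ a b c → c :* a :* b := a :* b :* c) ≡.refl a b c) abc
      cleared : ∀ {a b c a′ c′} → a * b * c ≡ 1# → (a * c - a′ * c) * (a * c - a′ * c) ≡ (a′ * c′) * (a′ * c′) →
        (1# - a′ * (b * c)) * (1# - a′ * (b * c)) ≡ (a′ * (b * c) * (c′ * (a * b))) * (a′ * (b * c) * (c′ * (a * b)))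
      cleared {a} {b} {c} {a′} {c′} abc M = equal (vanish₂ (b * b)
        (- ((1# + 1#) * (1# - a′ * (b * c))) - (a * b * c - 1#) - (a′ * c′ * b) * (a′ * c′ * b) * (a * b * c + 1#))
        (solve 5 (λ a b c a′ c′ →
          (:1 :- a′ :* (b :* c)) :* (:1 :- a′ :* (b :* c)) :- (a′ :* (b :* c) :* (c′ :* (a :* b))) :* (a′ :* (b :* c) :* (c′ :* (a :* b))) :=
          (b :* b) :* ((a :* c :- a′ :* c) :* (a :* c :- a′ :* c) :- (a′ :* c′) :* (a′ :* c′)) :+
          (:- ((:1 :+ :1) :* (:1 :- a′ :* (b :* c))) :- (a :* b :* c :- :1) :- (a′ :* c′ :* b) :* (a′ :* c′ :* b) :* (a :* b :* c :+ :1)) :* (a :* b :* c :- :1))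
          ≡.refl a b c a′ c′)
        (difference M) (difference abc))

    -- As the marked indices coincide, (a₁,b₁,c₁) and (a₂,b₂,c₂) are themselves points of M, so each
    -- of them has a slope in the pencils of the marks of the other.
    parallel-pattern : ∀ (R : Balanced) {x y z} → five ↭ i₁ (A R) ∷ i₂ (A R) ∷ x ∷ y ∷ z ∷ [] →
      i₁ (B R) ≡ i₁ (A R) → i₂ (B R) ≡ i₂ (A R) → i₁ (C R) ≡ i₁ (A R) → i₂ (C R) ≡ i₂ (A R) → ⊥
    parallel-pattern R {x} {y} {z} p ba₁ ba₂ ca₁ ca₂ =
      let ho , uz = null-omega (at₁ (normalise-u R x) (u-null-sum S q)) (at₂ (normalise-u R x) (u-null-products S q))
          hp , vz = null-omega (at₁ (normalise-v R x) (u-null-sum (rot S) qB)) (at₂ (normalise-v R x) (u-null-products (rot S) qB))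
          ht , wz = null-omega (at₁ (normalise-w R x) (u-null-sum (rot (rot S)) qC)) (at₂ (normalise-w R x) (u-null-products (rot (rot S)) qC))
          vy , wy = coincident-omega ho hp ht (uvw S y)
            (λ h → x≢y (separated S (≡.trans (normalise-u R x) (sym (proj₁ h))) (≡.trans (normalise-v R x) (sym (proj₂ h)))))
      in parallel-core {a₁ (A S)} {a₁ (B S)} {a₁ (C S)} {a₂ (A S)} {a₂ (B S)} {a₂ (C S)} abc a′b′c′ (a₁≢a₂ (A S))
        (mark-line S wa abc a′b′c′)
        (mark-line (rot S) (≡.trans (cong (u S) ba₁) (at-i₁ (A S))) (cycle abc) (cycle a′b′c′))
        (mark-line (rot (rot S)) (≡.trans (cong (v S) (≡.trans ca₁ (sym ba₁))) (at-i₁ (B S))) (cycle (cycle abc)) (cycle (cycle a′b′c′)))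
        -- Swapping the marks on all three sides exchanges the two marked points and gives the
        -- fourth relation.
        (mark-line (swapA (swapB (swapC S))) wa′ a′b′c′ abc)
        (sum (at-i₁ (A S)) (at-i₂ (A S)) wa wa′ (normalise-u R x) (normalise-w R x) wy uz wz (omega-cube ho) (weighted-five S q))
      where
      S : Balanced
      S = normalise R x
      x≢y : x ≢ y
      x≢y = proj₁ (proj₁ (proj₂ (proj₂ (arranged-distinct p))))
      q : five ↭ i₁ (A R) ∷ i₂ (A R) ∷ z ∷ x ∷ y ∷ []
      q = ↭-trans p (prep _ (prep _ (↭ₚ.++-comm (x ∷ y ∷ []) (z ∷ []))))
      qB : five ↭ i₁ (B R) ∷ i₂ (B R) ∷ z ∷ x ∷ y ∷ []
      qB = subst₂ (λ j k → five ↭ j ∷ k ∷ z ∷ x ∷ y ∷ []) (sym ba₁) (sym ba₂) q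
      qC : five ↭ i₁ (C R) ∷ i₂ (C R) ∷ z ∷ x ∷ y ∷ []
      qC = subst₂ (λ j k → five ↭ j ∷ k ∷ z ∷ x ∷ y ∷ []) (sym ca₁) (sym ca₂) q
      at₁ : ∀ {x y z} → y ≡ 1# → x + y + z ≡ 0# → x + 1# + z ≡ 0#
      at₁ ≡.refl h = h
      at₂ : ∀ {x y z} → y ≡ 1# → x * y + x * z + y * z ≡ 0# → x * 1# + x * z + 1# * z ≡ 0#
      at₂ ≡.refl h = h
      cycle : ∀ {a b c} → a * b * c ≡ 1# → b * c * a ≡ 1#
      cycle {a} {b} {c} h = ≡.trans (solve 3 (λ a b c → b :* c :* a := a :* b :* c) ≡.refl a b c) h
      marks : ∀ {i j k} → j ≡ i → k ≡ i → u S i * v S j * w S k ≡ 1#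
      marks {i} ≡.refl ≡.refl = uvw S i
      triple : ∀ {x y z a b c} → x ≡ a → y ≡ b → z ≡ c → x * y * z ≡ 1# → a * b * c ≡ 1#
      triple ≡.refl ≡.refl ≡.refl h = h
      abc : a₁ (A S) * a₁ (B S) * a₁ (C S) ≡ 1#
      abc = triple (at-i₁ (A S)) (at-i₁ (B S)) (at-i₁ (C S)) (marks ba₁ ca₁)
      a′b′c′ : a₂ (A S) * a₂ (B S) * a₂ (C S) ≡ 1#
      a′b′c′ = triple (at-i₂ (A S)) (at-i₂ (B S)) (at-i₂ (C S)) (marks ba₂ ca₂)
      wa : w S (i₁ (A S)) ≡ a₁ (C S)
      wa = ≡.trans (cong (w S) (sym ca₁)) (at-i₁ (C S))
      wa′ : w S (i₂ (A S)) ≡ a₂ (C S)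
      wa′ = ≡.trans (cong (w S) (sym ca₂)) (at-i₂ (C S))
      sum : ∀ {ua ub wa wb uz wz ux wx uy wy a b c d} → ua ≡ a → ub ≡ b → wa ≡ c → wb ≡ d → ux ≡ 1# → wx ≡ 1# → wy ≡ uy → uz ≡ uy * uy → wz ≡ wy * wy →
        uy * uy * uy - 1# ≡ 0# → ua * wa * wa + ub * wb * wb + uz * wz * wz + ux * wx * wx + uy * wy * wy ≡ 0# →
        a * c * c + b * d * d + (1# + 1# + 1#) ≡ 0#
      sum {a} {b} {c} {d} {uy = o} ≡.refl ≡.refl ≡.refl ≡.refl ≡.refl ≡.refl ≡.refl ≡.refl ≡.refl o³ h = vanish₂ 1# (- (o * o * o + 1# + 1#))
        (solve 5 (λ a b c d o → a :* c :* c :+ b :* d :* d :+ (:1 :+ :1 :+ :1) :=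
          :1 :* (a :* c :* c :+ b :* d :* d :+ o :* o :* (o :* o) :* (o :* o) :+ :1 :* :1 :* :1 :+ o :* o :* o) :+
          (:- (o :* o :* o :+ :1 :+ :1)) :* (o :* o :* o :- :1)) ≡.refl a b c d o) h o³

-- Three marked pairs among five indices.

module TwoTwoTwoImpossible (𝔽 : FinField) where
  open FinField 𝔽
  open FieldTheory 𝔽
  open TwoTwoTwo 𝔽
  open TwoTwoTwoFacts 𝔽
  open TwoTwoTwoPatterns 𝔽
  open Balanced
  open Marks

  _marks_ : ∀ {x} → Marks x → Fin 5 → Set
  A marks m = m ≡ i₁ A ⊎ m ≡ i₂ A

  unmarked : ∀ {x} (A : Marks x) {m} → m ≢ i₁ A → m ≢ i₂ A → ¬ (A marks m)
  unmarked A m≢i₁ m≢i₂ = Sum.[ m≢i₁ , m≢i₂ ]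

  abstract
    third-cubes : ∀ {u v w u′ v′ w′} → u * v * w ≡ 1# → u′ * v′ * w′ ≡ 1# → cube u ≡ cube u′ → cube v ≡ cube v′ → cube w ≡ cube w′
    third-cubes {u} {v} {w} {u′} {v′} {w′} h h′ hu hv = equal (cancelˡ (unit-≢0 {y = cube w′} uvw′) (vanish₃ 1# (- (cube v * cube w)) (- (cube u′ * cube w))
      (solve 6 (λ u v w u′ v′ w′ → u′ :* v′ :* (w :- w′) := :1 :* (u :* v :* w :- u′ :* v′ :* w′) :+
        (:- (v :* w)) :* (u :- u′) :+ (:- (u′ :* w)) :* (v :- v′)) ≡.refl (cube u) (cube v) (cube w) (cube u′) (cube v′) (cube w′))
      (difference (≡.trans uvw³ (sym uvw′))) (difference hu) (difference hv)))
      where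
      cubes : ∀ {u v w} → u * v * w ≡ 1# → cube u * cube v * cube w ≡ 1#
      cubes {u} {v} {w} h = ≡.trans (solve 3 (λ u v w → u :* u :* u :* (v :* v :* v) :* (w :* w :* w) :=
        (u :* v :* w) :* (u :* v :* w) :* (u :* v :* w)) ≡.refl u v w)
        (≡.trans (cong cube h) (≡.trans (cong (_* 1#) (*-identityˡ 1#)) (*-identityˡ 1#)))
      uvw³ : cube u * cube v * cube w ≡ 1#
      uvw³ = cubes h
      uvw′ : cube u′ * cube v′ * cube w′ ≡ 1#
      uvw′ = cubes h′

    -- Two indices unmarked on both of the first sides have equal cubes of u and of v, hence of w.
    -- By `mark-cube` the cube at a marked index is never the cube at an unmarked one.
    third-marked : ∀ R {m n} → ¬ (A R marks m) → ¬ (B R marks m) → ¬ (A R marks n) → ¬ (B R marks n) → C R marks m → C R marks n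
    third-marked R {m} {n} Am Bm An Bn Cm = decide (n Fin.≟ i₁ (C R)) (n Fin.≟ i₂ (C R))
      where
      cubes : cube (w R m) ≡ cube (w R n)
      cubes = third-cubes (uvw R m) (uvw R n) (outside-cubes R (Am ∘ inj₁) (Am ∘ inj₂) (An ∘ inj₁) (An ∘ inj₂))
        (outside-cubes (rot R) (Bm ∘ inj₁) (Bm ∘ inj₂) (Bn ∘ inj₁) (Bn ∘ inj₂))
      impossible : ∀ {m} → C R marks m → cube (w R m) ≡ cube (w R n) → n ≢ i₁ (C R) → n ≢ i₂ (C R) → ⊥
      impossible (inj₁ ≡.refl) cubes n≢i₁ n≢i₂ = mark-cube (rot (rot R)) n≢i₁ n≢i₂ (≡.trans (cong cube (sym (at-i₁ (C R)))) cubes)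
      impossible (inj₂ ≡.refl) cubes n≢i₁ n≢i₂ = mark-cube₂ (rot (rot R)) n≢i₁ n≢i₂ (≡.trans (cong cube (sym (at-i₂ (C R)))) cubes)
      decide : Dec (n ≡ i₁ (C R)) → Dec (n ≡ i₂ (C R)) → C R marks n
      decide (yes p) _ = inj₁ p
      decide (no _) (yes p) = inj₂ p
      decide (no n≢i₁) (no n≢i₂) = ⊥-elim (impossible Cm cubes n≢i₁ n≢i₂)

  two-marks : ∀ {x} (A : Marks x) {l m n} → l ≢ m → l ≢ n → m ≢ n → A marks l → A marks m → A marks n → ⊥
  two-marks A l≢m l≢n m≢n (inj₁ ≡.refl) (inj₁ ≡.refl) _ = l≢m ≡.refl
  two-marks A l≢m l≢n m≢n (inj₁ ≡.refl) (inj₂ ≡.refl) (inj₁ ≡.refl) = l≢n ≡.refl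
  two-marks A l≢m l≢n m≢n (inj₁ ≡.refl) (inj₂ ≡.refl) (inj₂ ≡.refl) = m≢n ≡.refl
  two-marks A l≢m l≢n m≢n (inj₂ ≡.refl) (inj₂ ≡.refl) _ = l≢m ≡.refl
  two-marks A l≢m l≢n m≢n (inj₂ ≡.refl) (inj₁ ≡.refl) (inj₁ ≡.refl) = m≢n ≡.refl
  two-marks A l≢m l≢n m≢n (inj₂ ≡.refl) (inj₁ ≡.refl) (inj₂ ≡.refl) = l≢n ≡.refl

  unmarked′ : ∀ {x} (B : Marks x) {a c m} → i₁ B ≡ a → i₂ B ≡ c → a ≢ m → c ≢ m → ¬ (B marks m)
  unmarked′ B ≡.refl ≡.refl a≢m c≢m = unmarked B (a≢m ∘ sym) (c≢m ∘ sym)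

  -- By `third-marked`, C marks all or none of the three indices outside the common pair. It marks
  -- only two indices altogether, so it marks none of them and equals that pair.
  coincident-pairs : ∀ R → i₁ (B R) ≡ i₁ (A R) → i₂ (B R) ≡ i₂ (A R) → ⊥
  coincident-pairs R ba₁ ba₂ = go (arrange₂ (i₁≢i₂ (A R)))
    where
    go : (∃ λ x → ∃ λ y → ∃ λ z → five ↭ i₁ (A R) ∷ i₂ (A R) ∷ x ∷ y ∷ z ∷ []) → ⊥
    go (x , y , z , p) = conclude (position (inj₁ ≡.refl) (at _)) (position (inj₂ ≡.refl) (at _))
      where
      distinct = arranged-distinct p
      at : ∀ m → m ∈ i₁ (A R) ∷ i₂ (A R) ∷ x ∷ y ∷ z ∷ []
      at m = ↭ₚ.∈-resp-↭ p (five-complete m)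
      Aˡ : ∀ {m} → i₁ (A R) ≢ m → i₂ (A R) ≢ m → ¬ (A R marks m)
      Aˡ = unmarked′ (A R) ≡.refl ≡.refl
      Bˡ : ∀ {m} → i₁ (A R) ≢ m → i₂ (A R) ≢ m → ¬ (B R marks m)
      Bˡ = unmarked′ (B R) ba₁ ba₂
      outside : ∀ {l m n} → i₁ (A R) ≢ l → i₂ (A R) ≢ l → i₁ (A R) ≢ m → i₂ (A R) ≢ m → i₁ (A R) ≢ n → i₂ (A R) ≢ n →
        l ≢ m → l ≢ n → m ≢ n → C R marks l → ⊥
      outside l₁ l₂ m₁ m₂ n₁ n₂ l≢m l≢n m≢n Cl = two-marks (C R) l≢m l≢n m≢n Cl
        (third-marked R (Aˡ l₁ l₂) (Bˡ l₁ l₂) (Aˡ m₁ m₂) (Bˡ m₁ m₂) Cl) (third-marked R (Aˡ l₁ l₂) (Bˡ l₁ l₂) (Aˡ n₁ n₂) (Bˡ n₁ n₂) Cl)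
      position : ∀ {m} → C R marks m → m ∈ i₁ (A R) ∷ i₂ (A R) ∷ x ∷ y ∷ z ∷ [] → A R marks m
      position Cm (here m≡) = inj₁ m≡
      position Cm (there (here m≡)) = inj₂ m≡
      position Cm (there (there (here ≡.refl))) =
        let (_ , ax , ay , az) , (bx , by , bz) , (xy , xz) , yz = distinct in ⊥-elim (outside ax bx ay by az bz xy xz yz Cm)
      position Cm (there (there (there (here ≡.refl)))) =
        let (_ , ax , ay , az) , (bx , by , bz) , (xy , xz) , yz = distinct in ⊥-elim (outside ay by ax bx az bz (xy ∘ sym) yz xz Cm)
      position Cm (there (there (there (there (here ≡.refl))))) =
        let (_ , ax , ay , az) , (bx , by , bz) , (xy , xz) , yz = distinct in ⊥-elim (outside az bz ax bx ay by (xz ∘ sym) (yz ∘ sym) xy Cm)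
      conclude : A R marks i₁ (C R) → A R marks i₂ (C R) → ⊥
      conclude (inj₁ c₁) (inj₁ c₂) = i₁≢i₂ (C R) (≡.trans c₁ (sym c₂))
      conclude (inj₂ c₁) (inj₂ c₂) = i₁≢i₂ (C R) (≡.trans c₁ (sym c₂))
      conclude (inj₁ c₁) (inj₂ c₂) = parallel-pattern R p ba₁ ba₂ c₁ c₂
      conclude (inj₂ c₁) (inj₁ c₂) = parallel-pattern (swapC R) p ba₁ ba₂ c₂ c₁

  -- The pairs A and B cover three indices, and C marks both or neither of the remaining two. If
  -- both, the pattern is ω. If neither, C lies in the union; it differs from A and from B, which
  -- leaves the triangle.
  crossing-pairs : ∀ R → i₁ (B R) ≡ i₁ (A R) → i₂ (B R) ≢ i₂ (A R) → ⊥
  crossing-pairs R ba₁ ba₂ = go (arrange₃ (i₁≢i₂ (A R)) (λ h → i₁≢i₂ (B R) (≡.trans ba₁ h)) (ba₂ ∘ sym))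
    where
    go : (∃ λ d → ∃ λ e → five ↭ i₁ (A R) ∷ i₂ (A R) ∷ i₂ (B R) ∷ d ∷ e ∷ []) → ⊥
    go (d , e , p) = conclude (at (i₁ (C R))) (at (i₂ (C R)))
      where
      L : List (Fin 5)
      L = i₁ (A R) ∷ i₂ (A R) ∷ i₂ (B R) ∷ d ∷ e ∷ []
      at : ∀ m → m ∈ L
      at m = ↭ₚ.∈-resp-↭ p (five-complete m)
      ab = proj₁ (proj₁ (arranged-distinct p))
      ac = proj₁ (proj₂ (proj₁ (arranged-distinct p)))
      ad = proj₁ (proj₂ (proj₂ (proj₁ (arranged-distinct p))))
      ae = proj₂ (proj₂ (proj₂ (proj₁ (arranged-distinct p))))
      bc = proj₁ (proj₁ (proj₂ (arranged-distinct p)))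
      bd = proj₁ (proj₂ (proj₁ (proj₂ (arranged-distinct p))))
      be = proj₂ (proj₂ (proj₁ (proj₂ (arranged-distinct p))))
      cd = proj₁ (proj₁ (proj₂ (proj₂ (arranged-distinct p))))
      ce = proj₂ (proj₁ (proj₂ (proj₂ (arranged-distinct p))))
      de = proj₂ (proj₂ (proj₂ (arranged-distinct p)))
      d→e : C R marks d → C R marks e
      d→e = third-marked R (unmarked′ (A R) ≡.refl ≡.refl ad bd) (unmarked′ (B R) ba₁ ≡.refl ad cd)
        (unmarked′ (A R) ≡.refl ≡.refl ae be) (unmarked′ (B R) ba₁ ≡.refl ae ce)
      e→d : C R marks e → C R marks d
      e→d = third-marked R (unmarked′ (A R) ≡.refl ≡.refl ae be) (unmarked′ (B R) ba₁ ≡.refl ae ce)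
        (unmarked′ (A R) ≡.refl ≡.refl ad bd) (unmarked′ (B R) ba₁ ≡.refl ad cd)
      both : ∀ {j k} → j ≡ d → k ≡ e → five ↭ i₁ (A R) ∷ i₂ (A R) ∷ i₂ (B R) ∷ j ∷ k ∷ []
      both ≡.refl ≡.refl = p
      both′ : ∀ {j k} → j ≡ e → k ≡ d → five ↭ i₁ (A R) ∷ i₂ (A R) ∷ i₂ (B R) ∷ j ∷ k ∷ []
      both′ ≡.refl ≡.refl = ↭-trans p (prep _ (prep _ (prep _ (swap _ _ refl))))
      first-at-d : i₁ (C R) ≡ d → C R marks e → ⊥
      first-at-d c₁ (inj₁ e≡) = de (≡.trans (sym c₁) (sym e≡))
      first-at-d c₁ (inj₂ e≡) = ω-pattern R (both c₁ (sym e≡)) ba₁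
      first-at-e : i₁ (C R) ≡ e → C R marks d → ⊥
      first-at-e c₁ (inj₁ d≡) = de (≡.trans d≡ c₁)
      first-at-e c₁ (inj₂ d≡) = ω-pattern R (both′ c₁ (sym d≡)) ba₁
      second-at-d : i₂ (C R) ≡ d → i₁ (C R) ≢ e → C R marks e → ⊥
      second-at-d c₂ c₁≢e (inj₁ e≡) = c₁≢e (sym e≡)
      second-at-d c₂ c₁≢e (inj₂ e≡) = de (≡.trans (sym c₂) (sym e≡))
      second-at-e : i₂ (C R) ≡ e → i₁ (C R) ≢ d → C R marks d → ⊥
      second-at-e c₂ c₁≢d (inj₁ d≡) = c₁≢d (sym d≡)
      second-at-e c₂ c₁≢d (inj₂ d≡) = de (≡.trans d≡ c₂)
      -- If C and A were the same pair, `i₂ (B R)` and `d` would both be unmarked for C and A; B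
      -- marks the first and so would have to mark the second.
      C≡A : ∀ {j k} → i₁ (C R) ≡ j → i₂ (C R) ≡ k → j ≢ i₂ (B R) → k ≢ i₂ (B R) → j ≢ d → k ≢ d → ⊥
      C≡A c₁ c₂ jc kc jd kd = unmarked′ (B R) ba₁ ≡.refl ad cd
        (third-marked (rot (rot R)) (unmarked′ (C R) c₁ c₂ jc kc) (unmarked′ (A R) ≡.refl ≡.refl ac bc)
          (unmarked′ (C R) c₁ c₂ jd kd) (unmarked′ (A R) ≡.refl ≡.refl ad bd) (inj₂ ≡.refl))
      C≡B : ∀ {j k} → i₁ (C R) ≡ j → i₂ (C R) ≡ k → j ≢ i₂ (A R) → k ≢ i₂ (A R) → j ≢ d → k ≢ d → ⊥
      C≡B c₁ c₂ jb kb jd kd = unmarked′ (A R) ≡.refl ≡.refl ad bd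
        (third-marked (rot R) (unmarked′ (B R) ba₁ ≡.refl ab (bc ∘ sym)) (unmarked′ (C R) c₁ c₂ jb kb)
          (unmarked′ (B R) ba₁ ≡.refl ad cd) (unmarked′ (C R) c₁ c₂ jd kd) (inj₂ ≡.refl))
      conclude : i₁ (C R) ∈ L → i₂ (C R) ∈ L → ⊥
      conclude (there (there (there (here c₁)))) _ = first-at-d c₁ (d→e (inj₁ (sym c₁)))
      conclude (there (there (there (there (here c₁))))) _ = first-at-e c₁ (e→d (inj₁ (sym c₁)))
      conclude (here c₁) (there (there (there (here c₂)))) = second-at-d c₂ (λ c₁≡e → ae (≡.trans (sym c₁) c₁≡e)) (d→e (inj₂ (sym c₂)))
      conclude (there (here c₁)) (there (there (there (here c₂)))) = second-at-d c₂ (λ c₁≡e → be (≡.trans (sym c₁) c₁≡e)) (d→e (inj₂ (sym c₂)))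
      conclude (there (there (here c₁))) (there (there (there (here c₂)))) = second-at-d c₂ (λ c₁≡e → ce (≡.trans (sym c₁) c₁≡e)) (d→e (inj₂ (sym c₂)))
      conclude (here c₁) (there (there (there (there (here c₂))))) = second-at-e c₂ (λ c₁≡d → ad (≡.trans (sym c₁) c₁≡d)) (e→d (inj₂ (sym c₂)))
      conclude (there (here c₁)) (there (there (there (there (here c₂))))) = second-at-e c₂ (λ c₁≡d → bd (≡.trans (sym c₁) c₁≡d)) (e→d (inj₂ (sym c₂)))
      conclude (there (there (here c₁))) (there (there (there (there (here c₂))))) = second-at-e c₂ (λ c₁≡d → cd (≡.trans (sym c₁) c₁≡d)) (e→d (inj₂ (sym c₂)))
      conclude (here c₁) (here c₂) = i₁≢i₂ (C R) (≡.trans c₁ (sym c₂))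
      conclude (there (here c₁)) (there (here c₂)) = i₁≢i₂ (C R) (≡.trans c₁ (sym c₂))
      conclude (there (there (here c₁))) (there (there (here c₂))) = i₁≢i₂ (C R) (≡.trans c₁ (sym c₂))
      conclude (here c₁) (there (here c₂)) = C≡A c₁ c₂ ac bc ad bd
      conclude (there (here c₁)) (here c₂) = C≡A c₁ c₂ bc ac bd ad
      conclude (here c₁) (there (there (here c₂))) = C≡B c₁ c₂ ab (bc ∘ sym) ad cd
      conclude (there (there (here c₁))) (here c₂) = C≡B c₁ c₂ (bc ∘ sym) ab cd ad
      conclude (there (here c₁)) (there (there (here c₂))) = triangle-pattern R p ba₁ c₁ c₂
      conclude (there (there (here c₁))) (there (here c₂)) = triangle-pattern (swapC R) p ba₁ c₂ c₁

  meeting : ∀ R → i₁ (B R) ≢ i₁ (A R)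
  meeting R ba₁ with i₂ (B R) Fin.≟ i₂ (A R)
  ... | yes ba₂ = coincident-pairs R ba₁ ba₂
  ... | no ba₂ = crossing-pairs R ba₁ ba₂

  -- Six marks cannot be distinct among five indices. Rotations and swaps carry every possible
  -- coincidence of marks of two sides to the one excluded by `meeting`.
  balanced-impossible : Balanced → ⊥
  balanced-impossible R = ℕₚ.<-irrefl ≡.refl (subst (6 ℕ.≤_) five-length
    (Unique-length-≤ (i₁ (A R) ∷ i₂ (A R) ∷ i₁ (B R) ∷ i₂ (B R) ∷ i₁ (C R) ∷ i₂ (C R) ∷ []) five
      ((i₁≢i₂ (A R) ∷ m₁ R ∷ m₂ R ∷ m₃ R ∷ m₄ R ∷ []) ∷ (m₅ R ∷ m₆ R ∷ m₇ R ∷ m₈ R ∷ []) ∷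
       (i₁≢i₂ (B R) ∷ m₁ (rot R) ∷ m₂ (rot R) ∷ []) ∷ (m₅ (rot R) ∷ m₆ (rot R) ∷ []) ∷ (i₁≢i₂ (C R) ∷ []) ∷ [] ∷ [])
      (λ {m} _ → five-complete m)))
    where
    m₁ : ∀ R → i₁ (A R) ≢ i₁ (B R)
    m₁ R h = meeting R (sym h)
    m₂ : ∀ R → i₁ (A R) ≢ i₂ (B R)
    m₂ R h = meeting (swapB R) (sym h)
    m₅ : ∀ R → i₂ (A R) ≢ i₁ (B R)
    m₅ R h = meeting (swapA R) (sym h)
    m₆ : ∀ R → i₂ (A R) ≢ i₂ (B R)
    m₆ R h = meeting (swapA (swapB R)) (sym h)
    m₃ : ∀ R → i₁ (A R) ≢ i₁ (C R)
    m₃ R h = m₁ (rot (rot R)) (sym h)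
    m₄ : ∀ R → i₁ (A R) ≢ i₂ (C R)
    m₄ R h = m₅ (rot (rot R)) (sym h)
    m₇ : ∀ R → i₂ (A R) ≢ i₁ (C R)
    m₇ R h = m₂ (rot (rot R)) (sym h)
    m₈ : ∀ R → i₂ (A R) ≢ i₂ (C R)
    m₈ R h = m₆ (rot (rot R)) (sym h)

-- Configurations of deleted and added points, and their pencils.

module Configurations (𝔽 : FinField) where
  open FinField 𝔽
  open FieldTheory 𝔽
  open SymmetricFunctions 𝔽
  open Counting _≟_
  open import Data.List.Membership.DecPropositional _≟_ using (_∈?_)

  ♯ : Bool → ℕ
  ♯ false = 0
  ♯ true = 1

  TwoOf : Set → Set → Set → Set
  TwoOf P Q R = P × Q ⊎ Q × R ⊎ R × P

  -- The equation x m ≡ t puts the m-th point of M on the line from a vertex to the point t of the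
  -- opposite side. That line meets the triangle in these two points only, so it needs one point of
  -- M if one of them is deleted and two if both are.
  AtVertex : (Fin 5 → K) → List K → Bool → Set
  AtVertex x A a =
    (∀ {t} → t ≢ 0# → t ∈ A ⊎ a ≡ true → ∃ λ m → x m ≡ t) ×
    (∀ {t} → t ∈ A → a ≡ true → ∃ λ m → ∃ λ n → m ≢ n × x m ≡ t × x n ≡ t)

  -- Collinearity with the points α and β of two sides; by Menelaus that line meets the third side in γ with αβγ = -1.
  Joins : (x y : Fin 5 → K) → K → K → Fin 5 → Set
  Joins x y α β m = β * x m ≡ x m * y m + α * β

  -- The slopes u, v, w of the points of M, the slopes A, B, C of the deleted points on the three sides, and the flags
  -- a, b, c of the deleted vertices.
  record Config : Set where
    field
      u v w : Fin 5 → K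
      uvw : ∀ m → u m * v m * w m ≡ 1#
      separated : ∀ {m n} → u m ≡ u n → v m ≡ v n → m ≡ n
      A B C : List K
      A! : Unique A
      B! : Unique B
      C! : Unique C
      A≢0 : ∀ {t} → t ∈ A → t ≢ 0#
      B≢0 : ∀ {t} → t ∈ B → t ≢ 0#
      C≢0 : ∀ {t} → t ∈ C → t ≢ 0#
      a b c : Bool
      size : length A ℕ.+ length B ℕ.+ length C ℕ.+ (♯ a ℕ.+ ♯ b ℕ.+ ♯ c) ≡ 6
      -- A side has q + 1 points, contains no point of M and must keep at least two of its own.
      sideA : length A ℕ.+ (♯ b ℕ.+ ♯ c) ℕ.< length elements
      sideB : length B ℕ.+ (♯ c ℕ.+ ♯ a) ℕ.< length elements
      sideC : length C ℕ.+ (♯ a ℕ.+ ♯ b) ℕ.< length elements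
      vertexA : AtVertex u A a
      vertexB : AtVertex v B b
      vertexC : AtVertex w C c
      join : ∀ {α β γ} → α * β * γ ≡ - 1# → TwoOf (α ∈ A) (β ∈ B) (γ ∈ C) → ∃ λ m → Joins u v α β m
      join₃ : ∀ {α β γ} → α * β * γ ≡ - 1# → α ∈ A → β ∈ B → γ ∈ C →
        ∃ λ m → ∃ λ n → m ≢ n × Joins u v α β m × Joins u v α β n

  open Config

  abstract
    rotate-unit : ∀ {u v w} → u * v * w ≡ 1# → v * w * u ≡ 1#
    rotate-unit {u} {v} {w} h = ≡.trans (solve 3 (λ u v w → v :* w :* u := u :* v :* w) ≡.refl u v w) h

    -- By αβγ = -1 the line is the same whichever two of its three points on the sides are used to
    -- write it down.
    rotate-joins : ∀ {x y z α β γ} → x * y * z ≡ 1# → α * β * γ ≡ - 1# → β * x ≡ x * y + α * β → γ * y ≡ y * z + β * γ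
    rotate-joins {x} {y} {z} {α} {β} {γ} xyz αβγ h = equal (vanish₃ (- (γ * (y * z))) (β * γ - γ * y) (- (y * z))
      (solve 6 (λ x y z α β γ → γ :* y :- (y :* z :+ β :* γ) :=
        (:- (γ :* (y :* z))) :* (β :* x :- (x :* y :+ α :* β)) :+ (β :* γ :- γ :* y) :* (x :* y :* z :- :1) :+
        (:- (y :* z)) :* (α :* β :* γ :- :- :1)) ≡.refl x y z α β γ)
      (difference h) (difference xyz) (difference αβγ))

    separated-rot : ∀ {x y z x′ y′ z′} → x * y * z ≡ 1# → x′ * y′ * z′ ≡ 1# → y ≡ y′ → z ≡ z′ → x ≡ x′
    separated-rot {x} {y} {z} {x′} h h′ ≡.refl ≡.refl = scale-injective {y * z} (unit-≢0 {y = x} (rotate-unit h))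
      (≡.trans (*-comm _ x) (≡.trans (sym (*-assoc x y z)) (≡.trans h (≡.trans (sym h′) (≡.trans (*-assoc x′ y z) (*-comm x′ _))))))

  rot : Config → Config
  rot Γ = record
    { u = v Γ ; v = w Γ ; w = u Γ ; uvw = λ m → rotate-unit (uvw Γ m)
    ; separated = λ {m} {n} vv ww → separated Γ (separated-rot (uvw Γ m) (uvw Γ n) vv ww) vv
    ; A = B Γ ; B = C Γ ; C = A Γ ; A! = B! Γ ; B! = C! Γ ; C! = A! Γ
    ; A≢0 = B≢0 Γ ; B≢0 = C≢0 Γ ; C≢0 = A≢0 Γ ; a = b Γ ; b = c Γ ; c = a Γ
    ; size = ≡.trans (rotate (length (A Γ)) (length (B Γ)) (length (C Γ)) (♯ (a Γ)) (♯ (b Γ)) (♯ (c Γ))) (size Γ)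
    ; sideA = sideB Γ ; sideB = sideC Γ ; sideC = sideA Γ
    ; vertexA = vertexB Γ ; vertexB = vertexC Γ ; vertexC = vertexA Γ
    ; join = λ {β} {γ} {α} βγα two → Product.map₂ (λ {m} → rotate-joins (uvw Γ m) (unrotate βγα)) (join Γ (unrotate βγα) (untwo two))
    ; join₃ = λ βγα β∈ γ∈ α∈ → let m , n , m≢n , jm , jn = join₃ Γ (unrotate βγα) α∈ β∈ γ∈ in
        m , n , m≢n , rotate-joins (uvw Γ m) (unrotate βγα) jm , rotate-joins (uvw Γ n) (unrotate βγα) jn }
    where
    rotate : ∀ x y z s t r → y ℕ.+ z ℕ.+ x ℕ.+ (t ℕ.+ r ℕ.+ s) ≡ x ℕ.+ y ℕ.+ z ℕ.+ (s ℕ.+ t ℕ.+ r)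
    rotate x y z s t r = cong₂ ℕ._+_ (≡.trans (ℕₚ.+-comm (y ℕ.+ z) x) (sym (ℕₚ.+-assoc x y z)))
      (≡.trans (ℕₚ.+-comm (t ℕ.+ r) s) (sym (ℕₚ.+-assoc s t r)))
    unrotate : ∀ {α β γ} → β * γ * α ≡ - 1# → α * β * γ ≡ - 1#
    unrotate {α} {β} {γ} h = ≡.trans (solve 3 (λ α β γ → α :* β :* γ := β :* γ :* α) ≡.refl α β γ) h
    untwo : ∀ {P Q R} → TwoOf Q R P → TwoOf P Q R
    untwo (inj₁ qr) = inj₂ (inj₁ qr)
    untwo (inj₂ (inj₁ rp)) = inj₂ (inj₂ rp)
    untwo (inj₂ (inj₂ pq)) = inj₁ pq

  abstract
    count-one : ∀ (f : Fin 5 → K) {t} → (∃ λ m → f m ≡ t) → 1 ℕ.≤ count t (map f five)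
    count-one f (m , ≡.refl) = ∈-count (∈-map⁺ f (five-complete m))

    count-two : ∀ (f : Fin 5 → K) {t} → (∃ λ m → ∃ λ n → m ≢ n × f m ≡ t × f n ≡ t) → 2 ℕ.≤ count t (map f five)
    count-two f (m , n , m≢n , ≡.refl , fn) = let x , y , z , p = arrange₂ m≢n in
      subst (2 ℕ.≤_) (sym (count-↭ (↭ₚ.map⁺ f p))) (at-head {xs = f x ∷ f y ∷ f z ∷ []} fn)
      where
      at-head : ∀ {s t} {xs : List K} → s ≡ t → 2 ℕ.≤ count t (t ∷ s ∷ xs)
      at-head {t = t} {xs} ≡.refl = subst (2 ℕ.≤_) (sym (≡.trans (count-here t (t ∷ xs)) (cong suc (count-here t xs)))) (s≤s (s≤s z≤n))

    count-zero-replicate : ∀ k xs → count 0# (replicate k 0# ++ xs) ≡ k ℕ.+ count 0# xs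
    count-zero-replicate zero xs = ≡.refl
    count-zero-replicate (suc k) xs = ≡.trans (count-here 0# (replicate k 0# ++ xs)) (cong suc (count-zero-replicate k xs))

    count-nonzero-replicate : ∀ {t} k xs → t ≢ 0# → count t (replicate k 0# ++ xs) ≡ count t xs
    count-nonzero-replicate zero xs t≢0 = ≡.refl
    count-nonzero-replicate {t} (suc k) xs t≢0 = ≡.trans (drop (t ≟ 0#)) (count-nonzero-replicate k xs t≢0)
      where
      drop : ∀ (d : Dec (t ≡ 0#)) → indicator d ℕ.+ count t (replicate k 0# ++ xs) ≡ count t (replicate k 0# ++ xs)
      drop (yes t≡0) = ⊥-elim (t≢0 t≡0)
      drop (no _) = ≡.refl

  -- The pencil of the deleted point α: 0 is the line to the opposite vertex, β⁻¹ the line to β, and - α γ the line to γ.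
  ρ : (x z : Fin 5 → K) → K → Fin 5 → K
  ρ x z α m = x m * z m - α * z m

  -- The number `k` is the multiplicity required of the line to the opposite vertex: one, or two if
  -- that vertex is deleted as well.
  targets : ℕ → K → List K → List K → List K
  targets k α B C = replicate k 0# ++ map _⁻¹ B ++ map (λ γ → - (α * γ)) C

  module Pencils (Γ : Config) where
    inverses : List K
    inverses = map _⁻¹ (B Γ)

    scaled : K → List K
    scaled α = map (λ γ → - (α * γ)) (C Γ)

    abstract
      w≢0 : ∀ m → w Γ m ≢ 0#
      w≢0 m = unit-≢0 (≡.trans (sym (*-assoc _ _ _)) (rotate-unit (rotate-unit (uvw Γ m))))

      ρ-at-vertex : ∀ {α m} → u Γ m ≡ α → ρ (u Γ) (w Γ) α m ≡ 0#
      ρ-at-vertex ≡.refl = difference ≡.refl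

      ρ-vertex : ∀ {α m} → ρ (u Γ) (w Γ) α m ≡ 0# → u Γ m ≡ α
      ρ-vertex {α} {m} h = equal (cancelˡ (w≢0 m) (vanish₁ 1# (solve 3 (λ u w α → w :* (u :- α) := :1 :* (u :* w :- α :* w)) ≡.refl (u Γ m) (w Γ m) α) h))

      ρ-joined : ∀ {α β t m} → β * t ≡ 1# → Joins (u Γ) (v Γ) α β m → ρ (u Γ) (w Γ) α m ≡ t
      ρ-joined {α} {β} {t} {m} βt h = equal (vanish₃ (t * w Γ m) t (- (u Γ m * w Γ m - α * w Γ m))
        (solve 6 (λ u v w α β t → (u :* w :- α :* w) :- t :=
          (t :* w) :* (β :* u :- (u :* v :+ α :* β)) :+ t :* (u :* v :* w :- :1) :+ (:- (u :* w :- α :* w)) :* (β :* t :- :1)) ≡.refl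
          (u Γ m) (v Γ m) (w Γ m) α β t)
        (difference h) (difference (uvw Γ m)) (difference βt))

      -- A nonzero target occurs twice exactly when β⁻¹ = -αγ, that is αβγ = -1. Then three deleted
      -- points are collinear, their line keeps no point of the triangle, and `join₃` supplies two
      -- points of M.
      pencil-count : ∀ {α} → α ∈ A Γ → ∀ t →
        count t (targets (suc (♯ (a Γ))) α (B Γ) (C Γ)) ℕ.≤ count t (map (ρ (u Γ) (w Γ) α) five)
      pencil-count {α} α∈ t = decide (t ≟ 0#)
        where
        α≢0 : α ≢ 0#
        α≢0 = A≢0 Γ α∈
        neg-product : ∀ {γ} → - (α * γ) ≡ 0# → γ ≡ 0#
        neg-product {γ} h = cancelˡ α≢0 (vanish₁ (- 1#) (solve 2 (λ α γ → α :* γ := (:- :1) :* (:- (α :* γ))) ≡.refl α γ) h)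
        zero∉ : 0# ∉ inverses ++ scaled α
        zero∉ h = Sum.[ (λ h₁ → let β , β∈ , e = ∈-map⁻ _⁻¹ h₁ in ⁻¹-≢0 (B≢0 Γ β∈) (sym e))
                      , (λ h₂ → let γ , γ∈ , e = ∈-map⁻ (λ γ → - (α * γ)) h₂ in C≢0 Γ γ∈ (neg-product (sym e))) ] (∈-++⁻ inverses h)
        at-zero : ∀ k → a Γ ≡ k → suc (♯ k) ℕ.≤ count 0# (map (ρ (u Γ) (w Γ) α) five)
        at-zero false _ = count-one (ρ (u Γ) (w Γ) α) (let m , h = proj₁ (vertexA Γ) α≢0 (inj₁ α∈) in m , ρ-at-vertex h)
        at-zero true a≡ = count-two (ρ (u Γ) (w Γ) α) (let m , n , m≢n , h , h′ = proj₂ (vertexA Γ) α∈ a≡ in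
          m , n , m≢n , ρ-at-vertex h , ρ-at-vertex h′)
        inverses! : Unique inverses
        inverses! = unique-map _⁻¹ (B Γ) (λ x∈ y∈ → ⁻¹-injective (B≢0 Γ x∈) (B≢0 Γ y∈)) (B! Γ)
        scaled! : Unique (scaled α)
        scaled! = unique-map (λ γ → - (α * γ)) (C Γ) (λ {x} {y} _ _ h → equal (cancelˡ α≢0 (vanish₁ (- 1#)
          (solve 3 (λ α x y → α :* (x :- y) := (:- :1) :* ((:- (α :* x)) :- (:- (α :* y)))) ≡.refl α x y) (difference h)))) (C! Γ)
        module _ (t≢0 : t ≢ 0#) where
          -- The points in which the line of slope `t` through `α` meets the other two sides.
          β γ : K
          β = t ⁻¹
          γ = - (t * α ⁻¹)
          αβγ : α * β * γ ≡ - 1#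
          αβγ = equal (vanish₂ (- (t * t ⁻¹)) (- 1#) (solve 4 (λ α α′ t t′ → α :* t′ :* (:- (t :* α′)) :- (:- :1) :=
            (:- (t :* t′)) :* (α :* α′ :- :1) :+ (:- :1) :* (t :* t′ :- :1)) ≡.refl α (α ⁻¹) t (t ⁻¹))
            (difference (*-inverse α α≢0)) (difference (*-inverse t t≢0)))
          βt : β * t ≡ 1#
          βt = ≡.trans (*-comm β t) (*-inverse t t≢0)
          β∈ : t ∈ inverses → β ∈ B Γ
          β∈ h = let β′ , β′∈ , e = ∈-map⁻ _⁻¹ h in
            subst (_∈ B Γ) (⁻¹-unique (≡.trans (cong (_* β′) e) (≡.trans (*-comm _ β′) (*-inverse β′ (B≢0 Γ β′∈))))) β′∈
          γ∈ : t ∈ scaled α → γ ∈ C Γ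
          γ∈ h = let γ′ , γ′∈ , e = ∈-map⁻ (λ γ → - (α * γ)) h in
            subst (_∈ C Γ) (equal (vanish₂ (α ⁻¹) (- γ′) (solve 4 (λ α α′ t γ → γ :- (:- (t :* α′)) :=
              α′ :* (t :- (:- (α :* γ))) :+ (:- γ) :* (α :* α′ :- :1)) ≡.refl α (α ⁻¹) t γ′)
              (difference e) (difference (*-inverse α α≢0)))) γ′∈
          joined : TwoOf (α ∈ A Γ) (β ∈ B Γ) (γ ∈ C Γ) → 1 ℕ.≤ count t (map (ρ (u Γ) (w Γ) α) five)
          joined two = count-one (ρ (u Γ) (w Γ) α) (let m , h = join Γ αβγ two in m , ρ-joined βt h)
          joined₃ : β ∈ B Γ → γ ∈ C Γ → 2 ℕ.≤ count t (map (ρ (u Γ) (w Γ) α) five)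
          joined₃ β∈ γ∈ = count-two (ρ (u Γ) (w Γ) α) (let m , n , m≢n , h , h′ = join₃ Γ αβγ α∈ β∈ γ∈ in
            m , n , m≢n , ρ-joined βt h , ρ-joined βt h′)
          at-nonzero : Dec (t ∈ inverses) → Dec (t ∈ (scaled α)) → count t inverses ℕ.+ count t (scaled α) ℕ.≤ count t (map (ρ (u Γ) (w Γ) α) five)
          at-nonzero (yes p) (yes q) = ℕₚ.≤-trans (ℕₚ.+-mono-≤ (count-unique inverses inverses!) (count-unique (scaled α) scaled!)) (joined₃ (β∈ p) (γ∈ q))
          at-nonzero (yes p) (no q) = ℕₚ.≤-trans (ℕₚ.+-mono-≤ (count-unique inverses inverses!) (ℕₚ.≤-reflexive (count-∉ (scaled α) q))) (joined (inj₁ (α∈ , β∈ p)))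
          at-nonzero (no p) (yes q) = ℕₚ.≤-trans (ℕₚ.+-mono-≤ (ℕₚ.≤-reflexive (count-∉ inverses p)) (count-unique (scaled α) scaled!)) (joined (inj₂ (inj₂ (γ∈ q , α∈))))
          at-nonzero (no p) (no q) = ℕₚ.≤-trans (ℕₚ.≤-reflexive (cong₂ ℕ._+_ (count-∉ inverses p) (count-∉ (scaled α) q))) z≤n
        decide : Dec (t ≡ 0#) → count t (targets (suc (♯ (a Γ))) α (B Γ) (C Γ)) ℕ.≤ count t (map (ρ (u Γ) (w Γ) α) five)
        decide (yes ≡.refl) = ℕₚ.≤-trans (ℕₚ.≤-reflexive (≡.trans (count-zero-replicate (suc (♯ (a Γ))) (inverses ++ scaled α))
          (≡.trans (cong (suc (♯ (a Γ)) ℕ.+_) (count-∉ (inverses ++ scaled α) zero∉)) (ℕₚ.+-identityʳ _)))) (at-zero (a Γ) ≡.refl)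
        decide (no t≢0) = ℕₚ.≤-trans (ℕₚ.≤-reflexive (≡.trans (count-nonzero-replicate (suc (♯ (a Γ))) (inverses ++ scaled α) t≢0) (count-++ t inverses (scaled α))))
          (at-nonzero t≢0 (t ∈? inverses) (t ∈? (scaled α)))

      pencil : ∀ {α} → α ∈ A Γ → ∃ λ rest → map (ρ (u Γ) (w Γ) α) five ↭ targets (suc (♯ (a Γ))) α (B Γ) (C Γ) ++ rest
      pencil α∈ = embed _ _ (pencil-count α∈)

-- Coordinates of M compared with deleted points, and quadratic relations.

module ConfigurationFacts (𝔽 : FinField) where
  open FinField 𝔽
  open FieldTheory 𝔽
  open SymmetricFunctions 𝔽
  open Counting _≟_
  open Configurations 𝔽
  open Config

  abstract
    nonzero-split : ∃ λ xs → elements ↭ 0# ∷ xs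
    nonzero-split = ∈-split (elements-complete 0#)

  nonzero : List K
  nonzero = proj₁ nonzero-split

  abstract
    nonzero-length : length elements ≡ suc (length nonzero)
    nonzero-length = ↭ₚ.↭-length (proj₂ nonzero-split)

    zero∷nonzero-unique : Unique (0# ∷ nonzero)
    zero∷nonzero-unique = Unique-resp-↭ (proj₂ nonzero-split) elements-unique

    nonzero-unique : Unique nonzero
    nonzero-unique = ++-Uniqueʳ (0# ∷ []) zero∷nonzero-unique

    nonzero-≢0 : ∀ {t} → t ∈ nonzero → t ≢ 0#
    nonzero-≢0 t∈ ≡.refl = ++-disjoint (0# ∷ []) zero∷nonzero-unique (here ≡.refl) t∈

    nonzero-complete : ∀ {t} → t ≢ 0# → t ∈ nonzero
    nonzero-complete {t} t≢0 = tail (↭ₚ.∈-resp-↭ (proj₂ nonzero-split) (elements-complete t))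
      where
      tail : t ∈ 0# ∷ nonzero → t ∈ nonzero
      tail (here t≡0) = ⊥-elim (t≢0 t≡0)
      tail (there t∈) = t∈

    map-five-length : ∀ (f : Fin 5 → K) → length (map f five) ≡ 5
    map-five-length f = ≡.trans (Listₚ.length-map f five) five-length

    targets-length : ∀ k α B C → length (targets k α B C) ≡ k ℕ.+ (length B ℕ.+ length C)
    targets-length k α B C = ≡.trans (Listₚ.length-++ (replicate k 0#)) (cong₂ ℕ._+_ (Listₚ.length-replicate k)
      (≡.trans (Listₚ.length-++ (map _⁻¹ B)) (cong₂ ℕ._+_ (Listₚ.length-map _ B) (Listₚ.length-map _ C))))

    e₁-scaled : ∀ α C → e 1 (map (λ γ → - (α * γ)) C) ≡ - (α * e 1 C)
    e₁-scaled α [] = solve 1 (λ α → :0 := :- (α :* :0)) ≡.refl α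
    e₁-scaled α (γ ∷ C) = ≡.trans (cong (_+ - (α * γ) * 1#) (e₁-scaled α C))
      (solve 3 (λ α γ s → :- (α :* s) :+ (:- (α :* γ)) :* :1 := :- (α :* (s :+ γ :* :1))) ≡.refl α γ _)

    e₁-replicate : ∀ k xs → e 1 (replicate k 0# ++ xs) ≡ e 1 xs
    e₁-replicate zero xs = ≡.refl
    e₁-replicate (suc k) xs = ≡.trans (solve 1 (λ s → s :+ :0 :* :1 := s) ≡.refl _) (e₁-replicate k xs)

    e₁-targets : ∀ k α B C → e 1 (targets k α B C) ≡ e 1 (map _⁻¹ B) - α * e 1 C
    e₁-targets k α B C = ≡.trans (e₁-replicate k _) (≡.trans (e₁-++ (map _⁻¹ B) _) (cong (λ s → e 1 (map _⁻¹ B) + s) (e₁-scaled α C)))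

  module ListFacts (Γ : Config) where
    open Pencils Γ

    abstract
      u≢0 : ∀ m → u Γ m ≢ 0#
      u≢0 m = unit-≢0 (≡.trans (sym (*-assoc _ _ _)) (uvw Γ m))

      image-≢0 : ∀ {x} → x ∈ map (u Γ) five → x ≢ 0#
      image-≢0 x∈ x≡0 = let m , _ , e = ∈-map⁻ (u Γ) x∈ in u≢0 m (≡.trans (sym e) x≡0)

      inverse-u : ∀ m → w Γ m * v Γ m ≡ u Γ m ⁻¹
      inverse-u m = ⁻¹-unique (≡.trans (solve 3 (λ u v w → u :* (w :* v) := u :* v :* w) ≡.refl (u Γ m) (v Γ m) (w Γ m)) (uvw Γ m))

      inverse-image : map (λ m → w Γ m * v Γ m) five ≡ map _⁻¹ (map (u Γ) five)
      inverse-image = ≡.trans (Listₚ.map-cong inverse-u five) (Listₚ.map-∘ five)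

      pencil-length : ∀ {α} (α∈ : α ∈ A Γ) → suc (♯ (a Γ)) ℕ.+ (length (B Γ) ℕ.+ length (C Γ)) ℕ.+ length (proj₁ (pencil α∈)) ≡ 5
      pencil-length {α} α∈ = ≡.trans (cong (ℕ._+ length (proj₁ (pencil α∈))) (sym (targets-length (suc (♯ (a Γ))) α (B Γ) (C Γ))))
        (≡.trans (sym (length-split (proj₁ (pencil α∈)) (proj₂ (pencil α∈)))) (map-five-length _))

      pencil-bound : ∀ {α} → α ∈ A Γ → suc (♯ (a Γ)) ℕ.+ (length (B Γ) ℕ.+ length (C Γ)) ℕ.≤ 5
      pencil-bound α∈ = ℕₚ.≤-trans (ℕₚ.m≤m+n _ _) (ℕₚ.≤-reflexive (pencil-length α∈))

      pencil-rest : ∀ {α} → α ∈ A Γ → ∀ n → suc (♯ (a Γ)) ℕ.+ (length (B Γ) ℕ.+ length (C Γ)) ℕ.+ n ≡ 5 →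
        ∃ λ rest → length rest ≡ n × map (ρ (u Γ) (w Γ) α) five ↭ targets (suc (♯ (a Γ))) α (B Γ) (C Γ) ++ rest
      pencil-rest α∈ n h = proj₁ (pencil α∈) , ℕₚ.+-cancelˡ-≡ (suc (♯ (a Γ)) ℕ.+ (length (B Γ) ℕ.+ length (C Γ))) _ _ (≡.trans (pencil-length α∈) (sym h)) , proj₂ (pencil α∈)

      tight-pencil : ∀ {α} → α ∈ A Γ → suc (♯ (a Γ)) ℕ.+ (length (B Γ) ℕ.+ length (C Γ)) ≡ 5 →
        map (ρ (u Γ) (w Γ) α) five ↭ targets (suc (♯ (a Γ))) α (B Γ) (C Γ)
      tight-pencil {α} α∈ h = let rest , l , p = pencil-rest α∈ 0 (≡.trans (ℕₚ.+-identityʳ _) h) in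
        ↭-trans p (↭-reflexive (empty rest l))
        where
        empty : ∀ rest → length rest ≡ 0 → targets (suc (♯ (a Γ))) α (B Γ) (C Γ) ++ rest ≡ targets (suc (♯ (a Γ))) α (B Γ) (C Γ)
        empty [] _ = Listₚ.++-identityʳ _

      pencil-e₁ : ∀ {α rest} → map (ρ (u Γ) (w Γ) α) five ↭ targets (suc (♯ (a Γ))) α (B Γ) (C Γ) ++ rest →
        e 1 (map (λ m → u Γ m * w Γ m) five) - α * e 1 (map (w Γ) five) ≡ e 1 (map _⁻¹ (B Γ)) - α * e 1 (C Γ) + e 1 rest
      pencil-e₁ {α} {rest} p = ≡.trans (sym (e₁-linear (λ m → u Γ m * w Γ m) (w Γ) α five)) (≡.trans (e-↭ 1 p)
        (≡.trans (e₁-++ (targets (suc (♯ (a Γ))) α (B Γ) (C Γ)) rest) (cong (_+ e 1 rest) (e₁-targets (suc (♯ (a Γ))) α (B Γ) (C Γ)))))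

      tight-e₁ : ∀ {α} → α ∈ A Γ → suc (♯ (a Γ)) ℕ.+ (length (B Γ) ℕ.+ length (C Γ)) ≡ 5 →
        (e 1 (map (λ m → u Γ m * w Γ m) five) - e 1 (map _⁻¹ (B Γ))) - α * (e 1 (map (w Γ) five) - e 1 (C Γ)) ≡ 0#
      tight-e₁ {α} α∈ h = vanish₁ 1#
        (solve 5 (λ P B α W C → (P :- B) :- α :* (W :- C) := :1 :* ((P :- α :* W) :- (B :- α :* C :+ :0))) ≡.refl _ _ α _ _)
        (difference (pencil-e₁ {rest = []} (↭-trans (tight-pencil α∈ h) (↭-reflexive (sym (Listₚ.++-identityʳ _))))))

      vertex-list : ∃ λ rest → map (u Γ) five ↭ A Γ ++ rest
      vertex-list = embed-unique (A Γ) _ (A! Γ) (λ α∈ → let m , h = proj₁ (vertexA Γ) (A≢0 Γ α∈) (inj₁ α∈) in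
        subst (_∈ map (u Γ) five) h (∈-map⁺ (u Γ) (five-complete m)))

      vertex-list-length : length (A Γ) ℕ.+ length (proj₁ vertex-list) ≡ 5
      vertex-list-length = ≡.trans (sym (length-split (proj₁ vertex-list) (proj₂ vertex-list))) (map-five-length (u Γ))

      vertex-rest : ∀ n → length (A Γ) ℕ.+ n ≡ 5 → ∃ λ rest → length rest ≡ n × map (u Γ) five ↭ A Γ ++ rest
      vertex-rest n h = proj₁ vertex-list , ℕₚ.+-cancelˡ-≡ (length (A Γ)) _ _ (≡.trans vertex-list-length (sym h)) , proj₂ vertex-list

      -- Through a deleted vertex every line other than the two sides needs a point of M, and those
      -- to deleted points of the opposite side need a second one. This later bounds the order by 6.
      full-vertex-count : a Γ ≡ true → ∀ t → count t (nonzero ++ A Γ) ℕ.≤ count t (map (u Γ) five)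
      full-vertex-count a≡ t = decide (t ≟ 0#) (t ∈? A Γ)
        where
        open import Data.List.Membership.DecPropositional _≟_ using (_∈?_)
        decide : Dec (t ≡ 0#) → Dec (t ∈ A Γ) → count t (nonzero ++ A Γ) ℕ.≤ count t (map (u Γ) five)
        decide (yes ≡.refl) _ = ℕₚ.≤-trans (ℕₚ.≤-reflexive (count-∉ (nonzero ++ A Γ) (λ h → Sum.[ (λ p → nonzero-≢0 p ≡.refl) , (λ p → A≢0 Γ p ≡.refl) ] (∈-++⁻ nonzero h)))) z≤n
        decide (no t≢0) (yes t∈) = ℕₚ.≤-trans (ℕₚ.≤-reflexive (count-++ t nonzero (A Γ)))
          (ℕₚ.≤-trans (ℕₚ.+-mono-≤ (count-unique nonzero nonzero-unique) (count-unique (A Γ) (A! Γ))) (count-two (u Γ) (proj₂ (vertexA Γ) t∈ a≡)))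
        decide (no t≢0) (no t∉) = ℕₚ.≤-trans (ℕₚ.≤-reflexive (count-++ t nonzero (A Γ)))
          (ℕₚ.≤-trans (ℕₚ.+-mono-≤ (count-unique nonzero nonzero-unique) (ℕₚ.≤-reflexive (count-∉ (A Γ) t∉))) (count-one (u Γ) (proj₁ (vertexA Γ) t≢0 (inj₂ a≡))))

      full-vertex : a Γ ≡ true → ∃ λ rest → map (u Γ) five ↭ (nonzero ++ A Γ) ++ rest
      full-vertex a≡ = embed _ _ (full-vertex-count a≡)

      full-vertex-length : (a≡ : a Γ ≡ true) → length nonzero ℕ.+ length (A Γ) ℕ.+ length (proj₁ (full-vertex a≡)) ≡ 5
      full-vertex-length a≡ = ≡.trans (cong (ℕ._+ length (proj₁ (full-vertex a≡))) (sym (Listₚ.length-++ nonzero)))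
        (≡.trans (sym (length-split (proj₁ (full-vertex a≡)) (proj₂ (full-vertex a≡)))) (map-five-length (u Γ)))

      full-vertex-rest : a Γ ≡ true → ∀ n → length nonzero ℕ.+ length (A Γ) ℕ.+ n ≡ 5 →
        ∃ λ rest → length rest ≡ n × map (u Γ) five ↭ (nonzero ++ A Γ) ++ rest
      full-vertex-rest a≡ n h = proj₁ (full-vertex a≡) , ℕₚ.+-cancelˡ-≡ (length nonzero ℕ.+ length (A Γ)) _ _ (≡.trans (full-vertex-length a≡) (sym h)) , proj₂ (full-vertex a≡)

      full-vertex-bound : a Γ ≡ true → length nonzero ℕ.+ length (A Γ) ℕ.≤ 5
      full-vertex-bound a≡ = ℕₚ.≤-trans (ℕₚ.m≤m+n _ _) (ℕₚ.≤-reflexive (full-vertex-length a≡))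

  abstract
    -- Vieta's relations for two different roots, stated without division because the leading
    -- coefficient may be zero.
    quadratic-roots : ∀ {c Z E g h} → g ≢ h → c - g * Z + g * g * E ≡ 0# → c - h * Z + h * h * E ≡ 0# →
      Z - (g + h) * E ≡ 0# × c - g * h * E ≡ 0#
    quadratic-roots {c} {Z} {E} {g} {h} g≢h hg hh = zZ , vanish₂ 1# g
      (solve 5 (λ c Z E g h → c :- g :* h :* E := :1 :* (c :- g :* Z :+ g :* g :* E) :+ g :* (Z :- (g :+ h) :* E)) ≡.refl c Z E g h) hg zZ
      where
      zZ : Z - (g + h) * E ≡ 0#
      zZ = cancelˡ (difference-≢0 g≢h) (vanish₂ (- 1#) 1#
        (solve 5 (λ c Z E g h → (g :- h) :* (Z :- (g :+ h) :* E) :=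
          (:- :1) :* (c :- g :* Z :+ g :* g :* E) :+ :1 :* (c :- h :* Z :+ h :* h :* E)) ≡.refl c Z E g h) hg hh)

    -- A multiset contained in its sheared images at g; comparing e₂ makes y₁ y₂ the constant term of a quadratic in g.
    shear-quadratic : ∀ (r s : Fin 5 → K) D {g x y₁ y₂} →
      map (λ m → r m - g * s m) five ↭ 0# ∷ D ++ x ∷ [] → map r five ↭ D ++ y₁ ∷ y₂ ∷ [] →
      y₁ * y₂ - g * (e 1 (map r five) * e 1 (map s five) - e 1 (map (λ m → r m * s m) five) - e 1 D * e 1 (map s five)) + g * g * e 2 (map s five) ≡ 0#
    shear-quadratic r s D {g} {x} {y₁} {y₂} p q = vanish₄ 1# (- 1#) (- e 1 D) (e 1 D)
      (solve 11 (λ y₁ y₂ g R₁ R₂ S₁ S₂ X D₁ D₂ x →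
        y₁ :* y₂ :- g :* (R₁ :* S₁ :- X :- D₁ :* S₁) :+ g :* g :* S₂ :=
        :1 :* ((R₂ :- g :* (R₁ :* S₁ :- X) :+ g :* g :* S₂) :- (D₂ :+ D₁ :* (:0 :+ x :* :1) :+ (:0 :+ x :* :0) :+ :0 :* (D₁ :+ (:0 :+ x :* :1)))) :+
        (:- :1) :* (R₂ :- (D₂ :+ D₁ :* ((:0 :+ y₂ :* :1) :+ y₁ :* :1) :+ (((:0 :+ y₂ :* :0) :+ y₁ :* (:0 :+ y₂ :* :1))))) :+
        (:- D₁) :* ((R₁ :- g :* S₁) :- (D₁ :+ (:0 :+ x :* :1) :+ :0 :* :1)) :+
        D₁ :* (R₁ :- (D₁ :+ ((:0 :+ y₂ :* :1) :+ y₁ :* :1)))) ≡.refl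
        y₁ y₂ g (e 1 (map r five)) (e 2 (map r five)) (e 1 (map s five)) (e 2 (map s five)) (e 1 (map (λ m → r m * s m) five)) (e 1 D) (e 2 D) x)
      (difference (≡.trans (sym (e₂-quadratic r s g five)) (≡.trans (e-↭ 2 p)
        (cong₂ (λ a b → a + 0# * b) (e₂-++ D (x ∷ [])) (e₁-++ D (x ∷ []))))))
      (difference (≡.trans (e-↭ 2 q) (e₂-++ D (y₁ ∷ y₂ ∷ []))))
      (difference (≡.trans (sym (e₁-linear r s g five)) (≡.trans (e-↭ 1 p) (cong (_+ 0# * 1#) (e₁-++ D (x ∷ []))))))
      (difference (≡.trans (e-↭ 1 q) (e₁-++ D (y₁ ∷ y₂ ∷ []))))

module SixHoles where

  Pattern : ℕ → ℕ → ℕ → Set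
  Pattern x y z = (x ≡ 2 × y ≡ 2 × z ≡ 2) ⊎
    (x ≡ 2 × y ℕ.+ z ≡ 4 × (y ≡ 4 ⊎ z ≡ 4)) ⊎ (y ≡ 2 × z ℕ.+ x ≡ 4 × (z ≡ 4 ⊎ x ≡ 4)) ⊎ (z ≡ 2 × x ℕ.+ y ≡ 4 × (x ≡ 4 ⊎ y ≡ 4)) ⊎
    (x ≡ 3 × y ≡ 3 × z ≡ 0) ⊎ (y ≡ 3 × z ≡ 3 × x ≡ 0) ⊎ (z ≡ 3 × x ≡ 3 × y ≡ 0)

  pattern? : ∀ x y z → Dec (Pattern x y z)
  pattern? x y z =
    (x ℕₚ.≟ 2 ×-dec y ℕₚ.≟ 2 ×-dec z ℕₚ.≟ 2) ⊎-dec
    (x ℕₚ.≟ 2 ×-dec y ℕ.+ z ℕₚ.≟ 4 ×-dec (y ℕₚ.≟ 4 ⊎-dec z ℕₚ.≟ 4)) ⊎-dec (y ℕₚ.≟ 2 ×-dec z ℕ.+ x ℕₚ.≟ 4 ×-dec (z ℕₚ.≟ 4 ⊎-dec x ℕₚ.≟ 4)) ⊎-dec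
    (z ℕₚ.≟ 2 ×-dec x ℕ.+ y ℕₚ.≟ 4 ×-dec (x ℕₚ.≟ 4 ⊎-dec y ℕₚ.≟ 4)) ⊎-dec
    (x ℕₚ.≟ 3 ×-dec y ℕₚ.≟ 3 ×-dec z ℕₚ.≟ 0) ⊎-dec (y ℕₚ.≟ 3 ×-dec z ℕₚ.≟ 3 ×-dec x ℕₚ.≟ 0) ⊎-dec (z ℕₚ.≟ 3 ×-dec x ℕₚ.≟ 3 ×-dec y ℕₚ.≟ 0)

  abstract
    -- A side with a deleted point has a pencil of five slopes, one of them spent on the opposite
    -- vertex, so at most four deleted points lie on the other two sides. The finitely many sizes
    -- are enumerated.
    patterns : ∀ {x y z} → x ℕ.≤ 5 → y ℕ.≤ 5 → z ℕ.≤ 5 → x ℕ.+ y ℕ.+ z ≡ 6 →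
      (x ≡ 0 ⊎ y ℕ.+ z ℕ.≤ 4) → (y ≡ 0 ⊎ z ℕ.+ x ℕ.≤ 4) → (z ≡ 0 ⊎ x ℕ.+ y ℕ.≤ 4) → Pattern x y z
    patterns {x} {y} {z} x≤5 y≤5 z≤5 = from-yes (ℕₚ.allUpTo? (λ x → ℕₚ.allUpTo? (λ y → ℕₚ.allUpTo? (λ z →
        (x ℕ.+ y ℕ.+ z ℕₚ.≟ 6) →-dec ((x ℕₚ.≟ 0) ⊎-dec (y ℕ.+ z ℕₚ.≤? 4)) →-dec ((y ℕₚ.≟ 0) ⊎-dec (z ℕ.+ x ℕₚ.≤? 4)) →-dec
        ((z ℕₚ.≟ 0) ⊎-dec (x ℕ.+ y ℕₚ.≤? 4)) →-dec pattern? x y z) 6) 6) 6) (s≤s x≤5) (s≤s y≤5) (s≤s z≤5)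

open SixHoles

-- No deleted vertex: the distributions (4,2,0), (3,3,0) and (2,2,2).

module NoVertexHole (𝔽 : FinField) where
  open FinField 𝔽
  open FieldTheory 𝔽
  open SymmetricFunctions 𝔽
  open Configurations 𝔽
  open ConfigurationFacts 𝔽
  open Config
  open TwoTwoTwo 𝔽 using (Marks; Balanced)
  open TwoTwoTwoImpossible 𝔽 using (balanced-impossible)

  abstract
    list-length₀ : (xs : List K) → length xs ≡ 0 → xs ≡ []
    list-length₀ [] _ = ≡.refl

  Open : Config → Set
  Open Γ = a Γ ≡ false × b Γ ≡ false × c Γ ≡ false

  module _ (Γ : Config) (o : Open Γ) where
    open ListFacts Γ

    abstract
      open-bound : ∀ {α} → α ∈ A Γ → length (B Γ) ℕ.+ length (C Γ) ℕ.≤ 4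
      open-bound α∈ = ℕₚ.≤-pred (subst (λ k → suc (♯ k) ℕ.+ (length (B Γ) ℕ.+ length (C Γ)) ℕ.≤ 5) (proj₁ o) (pencil-bound α∈))

      open-size : length (A Γ) ℕ.+ length (B Γ) ℕ.+ length (C Γ) ≡ 6
      open-size = ≡.trans (sym (ℕₚ.+-identityʳ _)) (≡.trans (cong (length (A Γ) ℕ.+ length (B Γ) ℕ.+ length (C Γ) ℕ.+_) (sym flags)) (size Γ))
        where
        flags : ♯ (a Γ) ℕ.+ ♯ (b Γ) ℕ.+ ♯ (c Γ) ≡ 0
        flags = cong₂ ℕ._+_ (cong₂ ℕ._+_ (cong ♯ (proj₁ o)) (cong ♯ (proj₁ (proj₂ o)))) (cong ♯ (proj₂ (proj₂ o)))

      list-bound : length (A Γ) ℕ.≤ 5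
      list-bound = ℕₚ.≤-trans (ℕₚ.m≤m+n _ _) (ℕₚ.≤-reflexive vertex-list-length)

      empty-or-bound : length (A Γ) ≡ 0 ⊎ length (B Γ) ℕ.+ length (C Γ) ℕ.≤ 4
      empty-or-bound = go (A Γ) ≡.refl
        where
        go : ∀ L → A Γ ≡ L → length L ≡ 0 ⊎ length (B Γ) ℕ.+ length (C Γ) ℕ.≤ 4
        go [] _ = inj₁ ≡.refl
        go (α ∷ L) A≡ = inj₂ (open-bound (subst (α ∈_) (sym A≡) (here ≡.refl)))

      tightness : length (B Γ) ℕ.+ length (C Γ) ≡ 4 → suc (♯ (a Γ)) ℕ.+ (length (B Γ) ℕ.+ length (C Γ)) ≡ 5
      tightness h = cong₂ (λ k n → suc (♯ k) ℕ.+ n) (proj₁ o) h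

      pair-sums : length (A Γ) ≡ 2 → length (B Γ) ℕ.+ length (C Γ) ≡ 4 →
        e 1 (map (λ m → u Γ m * w Γ m) five) - e 1 (map _⁻¹ (B Γ)) ≡ 0# × e 1 (map (w Γ) five) - e 1 (C Γ) ≡ 0#
      pair-sums l h = let α , α′ , A≡ = list₂ (A Γ) l in
        linear-form-zero (All.lookup (first-unique (subst Unique A≡ (A! Γ))) (here ≡.refl))
          (tight-e₁ (subst (α ∈_) (sym A≡) (here ≡.refl)) (tightness h))
          (tight-e₁ (subst (α′ ∈_) (sym A≡) (there (here ≡.refl))) (tightness h))
        where
        first-unique : ∀ {x : K} {xs} → Unique (x ∷ xs) → All (x ≢_) xs
        first-unique (p ∷ _) = p

  module _ (Γ : Config) (o : Open Γ) where
    private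
      module R = ListFacts (rot Γ)
      module RR = ListFacts (rot (rot Γ))

    abstract
      e₁-last : ∀ D r → e 1 (D ++ r ∷ []) - e 1 D ≡ 0# → r ≡ 0#
      e₁-last D r h = vanish₂ 1# (- 1#) (solve 3 (λ s D r → r := :1 :* (s :- D) :+ (:- :1) :* (s :- (D :+ (:0 :+ r :* :1)))) ≡.refl (e 1 (D ++ r ∷ [])) (e 1 D) r)
        h (difference (e₁-++ D (r ∷ [])))

      -- Four deleted points on a side give four of the five coordinates there. The tight pencils of
      -- the side with two deleted points equate the sum of all five, or of their inverses, with
      -- that of the four; the fifth would be zero.
      pair-four : length (A Γ) ≡ 2 → length (B Γ) ℕ.+ length (C Γ) ≡ 4 → length (B Γ) ≡ 4 ⊎ length (C Γ) ≡ 4 → ⊥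
      pair-four l h (inj₂ four) = let rest , lr , p = RR.vertex-rest 1 (cong (ℕ._+ 1) four) ; r , rest≡ = list₁ rest lr in
        last r (subst (λ z → map (w Γ) five ↭ C Γ ++ z) rest≡ p)
        where
        last : ∀ r → map (w Γ) five ↭ C Γ ++ r ∷ [] → ⊥
        last r p = RR.image-≢0 (↭ₚ.∈-resp-↭ (↭-sym p) (∈-++⁺ʳ (C Γ) (here ≡.refl)))
          (e₁-last (C Γ) r (≡.trans (cong (_- e 1 (C Γ)) (sym (e-↭ 1 p))) (proj₂ (pair-sums Γ o l h))))
      pair-four l h (inj₁ four) = let rest , lr , p = R.vertex-rest 1 (cong (ℕ._+ 1) four) ; r , rest≡ = list₁ rest lr in
        last r (subst (λ z → map (v Γ) five ↭ B Γ ++ z) rest≡ p)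
        where
        last : ∀ r → map (v Γ) five ↭ B Γ ++ r ∷ [] → ⊥
        last r p = ⁻¹-≢0 (R.image-≢0 (↭ₚ.∈-resp-↭ (↭-sym p) (∈-++⁺ʳ (B Γ) (here ≡.refl))))
          (e₁-last (map _⁻¹ (B Γ)) (r ⁻¹) (≡.trans (cong (_- e 1 (map _⁻¹ (B Γ)))
            (sym (≡.trans (cong (e 1) R.inverse-image) (≡.trans (e-↭ 1 (↭ₚ.map⁺ _⁻¹ p)) (cong (e 1) (Listₚ.map-++ _⁻¹ (B Γ) (r ∷ [])))))))
            (proj₁ (pair-sums Γ o l h))))

  module _ (Γ : Config) where
    private
      module R = ListFacts (rot Γ)

    module _ (a≡ : a Γ ≡ false) (lB : length (B Γ) ≡ 3) (lC : length (C Γ) ≡ 0) where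
      private
        r : Fin 5 → K
        r m = u Γ m * w Γ m
        D : List K
        D = map _⁻¹ (B Γ)

      -- The linear coefficient in `shear-quadratic`. It does not involve the deleted point, so that
      -- all deleted points of the side are roots of one quadratic.
      shear-middle : K
      shear-middle = e 1 (map r five) * e 1 (map (w Γ) five) - e 1 (map (λ m → r m * w Γ m) five) - e 1 D * e 1 (map (w Γ) five)

      abstract
        shear-root : ∀ {α y₁ y₂} → α ∈ A Γ → map (v Γ) five ↭ B Γ ++ y₁ ∷ y₂ ∷ [] →
          y₁ ⁻¹ * y₂ ⁻¹ - α * shear-middle + α * α * e 2 (map (w Γ) five) ≡ 0#
        shear-root {α} {y₁} {y₂} α∈ q = let rest , lr , p = ListFacts.pencil-rest Γ α∈ 1 bounds ; x , rest≡ = list₁ rest lr in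
          shear-quadratic r (w Γ) D (↭-trans p (↭-reflexive (≡.trans (source rest) (cong (λ z → 0# ∷ D ++ z) rest≡))))
            (↭-trans (↭-reflexive R.inverse-image) (↭-trans (↭ₚ.map⁺ _⁻¹ q) (↭-reflexive (Listₚ.map-++ _⁻¹ (B Γ) (y₁ ∷ y₂ ∷ [])))))
          where
          bounds : suc (♯ (a Γ)) ℕ.+ (length (B Γ) ℕ.+ length (C Γ)) ℕ.+ 1 ≡ 5
          bounds = cong₂ (λ k n → suc (♯ k) ℕ.+ n ℕ.+ 1) a≡ (cong₂ ℕ._+_ lB lC)
          source : ∀ rest → targets (suc (♯ (a Γ))) α (B Γ) (C Γ) ++ rest ≡ 0# ∷ D ++ rest
          source rest = ≡.trans (cong₂ (λ k C → targets (suc (♯ k)) α (B Γ) C ++ rest) a≡ (list-length₀ (C Γ) lC))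
            (cong (λ L → 0# ∷ L ++ rest) (Listₚ.++-identityʳ D))

  module _ (Γ : Config) (o : Open Γ) where
    private
      module R = ListFacts (rot Γ)

    abstract
      -- The three deleted points of the first side are different roots of one quadratic, so its
      -- constant term vanishes; but this is the product of two inverses of coordinates.
      three-three : length (A Γ) ≡ 3 → length (B Γ) ≡ 3 → length (C Γ) ≡ 0 → ⊥
      three-three lA lB lC = let α₁ , α₂ , α₃ , A≡ = list₃ (A Γ) lA ; rest , lr , p = R.vertex-rest 2 (cong (ℕ._+ 2) lB) ; y₁ , y₂ , rest≡ = list₂ rest lr in
        go A≡ (subst Unique A≡ (A! Γ)) (subst (λ z → map (v Γ) five ↭ B Γ ++ z) rest≡ p)
        where
        conclude : ∀ {α₁ α₂ α₃ c Z E} → α₁ ≢ 0# → α₁ ≢ α₂ → α₁ ≢ α₃ → α₂ ≢ α₃ → c ≢ 0# →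
          c - α₁ * Z + α₁ * α₁ * E ≡ 0# → c - α₂ * Z + α₂ * α₂ * E ≡ 0# → c - α₃ * Z + α₃ * α₃ * E ≡ 0# → ⊥
        conclude {α₁} {α₂} {α₃} {c} {Z} {E} α₁≢0 α₁≢α₂ α₁≢α₃ α₂≢α₃ c≢0 h₁ h₂ h₃ = c≢0 (equal′ (proj₂ (quadratic-roots α₁≢α₂ h₁ h₂)) E≡0)
          where
          E≡0 : E ≡ 0#
          E≡0 = cancelˡ (difference-≢0 α₂≢α₃) (vanish₂ (- 1#) 1#
            (solve 5 (λ Z E a b c → (b :- c) :* E := (:- :1) :* (Z :- (a :+ b) :* E) :+ :1 :* (Z :- (a :+ c) :* E)) ≡.refl Z E α₁ α₂ α₃)
            (proj₁ (quadratic-roots α₁≢α₂ h₁ h₂)) (proj₁ (quadratic-roots α₁≢α₃ h₁ h₃)))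
          equal′ : c - α₁ * α₂ * E ≡ 0# → E ≡ 0# → c ≡ 0#
          equal′ h E≡0 = vanish₂ 1# (α₁ * α₂) (solve 4 (λ c a b E → c := :1 :* (c :- a :* b :* E) :+ (a :* b) :* E) ≡.refl c α₁ α₂ E) h E≡0
        go : ∀ {α₁ α₂ α₃ y₁ y₂} → A Γ ≡ α₁ ∷ α₂ ∷ α₃ ∷ [] → Unique (α₁ ∷ α₂ ∷ α₃ ∷ []) → map (v Γ) five ↭ B Γ ++ y₁ ∷ y₂ ∷ [] → ⊥
        go {α₁} {α₂} {α₃} {y₁} {y₂} A≡ ((α₁₂ ∷ α₁₃ ∷ []) ∷ (α₂₃ ∷ []) ∷ _) p =
          conclude (A≢0 Γ (mem (here ≡.refl))) α₁₂ α₁₃ α₂₃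
            (product-≢0 (⁻¹-≢0 (image (here ≡.refl))) (⁻¹-≢0 (image (there (here ≡.refl)))))
            (root (here ≡.refl)) (root (there (here ≡.refl))) (root (there (there (here ≡.refl))))
          where
          mem : ∀ {α} → α ∈ α₁ ∷ α₂ ∷ α₃ ∷ [] → α ∈ A Γ
          mem = subst (_ ∈_) (sym A≡)
          image : ∀ {y} → y ∈ y₁ ∷ y₂ ∷ [] → y ≢ 0#
          image y∈ = R.image-≢0 (↭ₚ.∈-resp-↭ (↭-sym p) (∈-++⁺ʳ (B Γ) y∈))
          root : ∀ {α} → α ∈ α₁ ∷ α₂ ∷ α₃ ∷ [] → y₁ ⁻¹ * y₂ ⁻¹ - α * shear-middle Γ (proj₁ o) lB lC + α * α * e 2 (map (w Γ) five) ≡ 0#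
          root α∈ = shear-root Γ (proj₁ o) lB lC (mem α∈) p

  marks : ∀ Γ {α₁ α₂} → A Γ ≡ α₁ ∷ α₂ ∷ [] → Marks (u Γ)
  marks Γ {α₁} {α₂} A≡ = record
    { a₁ = α₁ ; a₂ = α₂
    ; a₁≢0 = A≢0 Γ α₁∈ ; a₂≢0 = A≢0 Γ α₂∈
    ; a₁≢a₂ = distinct (subst Unique A≡ (A! Γ))
    ; i₁ = proj₁ at₁ ; i₂ = proj₁ at₂ ; at-i₁ = proj₂ at₁ ; at-i₂ = proj₂ at₂ }
    where
    α₁∈ : α₁ ∈ A Γ
    α₁∈ = subst (α₁ ∈_) (sym A≡) (here ≡.refl)
    α₂∈ : α₂ ∈ A Γ
    α₂∈ = subst (α₂ ∈_) (sym A≡) (there (here ≡.refl))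
    at₁ = proj₁ (vertexA Γ) (A≢0 Γ α₁∈) (inj₁ α₁∈)
    at₂ = proj₁ (vertexA Γ) (A≢0 Γ α₂∈) (inj₁ α₂∈)
    distinct : Unique (α₁ ∷ α₂ ∷ []) → α₁ ≢ α₂
    distinct ((p ∷ _) ∷ _) = p

  abstract
    balanced-pencil : ∀ Γ → a Γ ≡ false → ∀ {α₁ α₂ β₁ β₂ γ₁ γ₂} →
      A Γ ≡ α₁ ∷ α₂ ∷ [] → B Γ ≡ β₁ ∷ β₂ ∷ [] → C Γ ≡ γ₁ ∷ γ₂ ∷ [] → ∀ {α} → α ≡ α₁ ⊎ α ≡ α₂ →
      map (λ m → u Γ m * w Γ m - α * w Γ m) five ↭ 0# ∷ β₁ ⁻¹ ∷ β₂ ⁻¹ ∷ - (α * γ₁) ∷ - (α * γ₂) ∷ []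
    balanced-pencil Γ a≡ {α₁} {α₂} {β₁} {β₂} {γ₁} {γ₂} A≡ B≡ C≡ {α} α∈ = subst (map (ρ (u Γ) (w Γ) α) five ↭_) explicit
      (ListFacts.tight-pencil Γ (subst (α ∈_) (sym A≡) (member α∈)) (cong₂ (λ k n → suc (♯ k) ℕ.+ n) a≡ (cong₂ ℕ._+_ (cong length B≡) (cong length C≡))))
      where
      member : α ≡ α₁ ⊎ α ≡ α₂ → α ∈ α₁ ∷ α₂ ∷ []
      member (inj₁ h) = here h
      member (inj₂ h) = there (here h)
      explicit : targets (suc (♯ (a Γ))) α (B Γ) (C Γ) ≡ targets 1 α (β₁ ∷ β₂ ∷ []) (γ₁ ∷ γ₂ ∷ [])
      explicit = ≡.trans (cong (λ k → targets (suc (♯ k)) α (B Γ) (C Γ)) a≡) (cong₂ (targets 1 α) B≡ C≡)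

  balanced : ∀ Γ → Open Γ → ∀ {α₁ α₂ β₁ β₂ γ₁ γ₂} → A Γ ≡ α₁ ∷ α₂ ∷ [] → B Γ ≡ β₁ ∷ β₂ ∷ [] → C Γ ≡ γ₁ ∷ γ₂ ∷ [] → Balanced
  balanced Γ (a≡ , b≡ , c≡) A≡ B≡ C≡ = record
    { u = u Γ ; v = v Γ ; w = w Γ ; uvw = uvw Γ ; separated = separated Γ
    ; A = marks Γ A≡ ; B = marks (rot Γ) B≡ ; C = marks (rot (rot Γ)) C≡
    ; pencilA = balanced-pencil Γ a≡ A≡ B≡ C≡
    ; pencilB = balanced-pencil (rot Γ) b≡ B≡ C≡ A≡
    ; pencilC = balanced-pencil (rot (rot Γ)) c≡ C≡ A≡ B≡ }

  rotate-open : ∀ {Γ} → Open Γ → Open (rot Γ)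
  rotate-open (a≡ , b≡ , c≡) = b≡ , c≡ , a≡

  no-vertex-hole : ∀ Γ → ¬ Open Γ
  no-vertex-hole Γ o = conclude (patterns (list-bound Γ o) (list-bound (rot Γ) o′) (list-bound (rot (rot Γ)) o″)
      (open-size Γ o) (empty-or-bound Γ o) (empty-or-bound (rot Γ) o′) (empty-or-bound (rot (rot Γ)) o″))
    where
    o′ : Open (rot Γ)
    o′ = rotate-open {Γ} o
    o″ : Open (rot (rot Γ))
    o″ = rotate-open {rot Γ} o′
    conclude : Pattern (length (A Γ)) (length (B Γ)) (length (C Γ)) → ⊥
    conclude (inj₁ (lA , lB , lC)) = let _ , _ , A≡ = list₂ (A Γ) lA ; _ , _ , B≡ = list₂ (B Γ) lB ; _ , _ , C≡ = list₂ (C Γ) lC in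
      balanced-impossible (balanced Γ o A≡ B≡ C≡)
    conclude (inj₂ (inj₁ (l , h , four))) = pair-four Γ o l h four
    conclude (inj₂ (inj₂ (inj₁ (l , h , four)))) = pair-four (rot Γ) o′ l h four
    conclude (inj₂ (inj₂ (inj₂ (inj₁ (l , h , four))))) = pair-four (rot (rot Γ)) o″ l h four
    conclude (inj₂ (inj₂ (inj₂ (inj₂ (inj₁ (lA , lB , lC)))))) = three-three Γ o lA lB lC
    conclude (inj₂ (inj₂ (inj₂ (inj₂ (inj₂ (inj₁ (lB , lC , lA))))))) = three-three (rot Γ) o′ lB lC lA
    conclude (inj₂ (inj₂ (inj₂ (inj₂ (inj₂ (inj₂ (lC , lA , lB))))))) = three-three (rot (rot Γ)) o″ lC lA lB

module SmallSums where

  abstract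
    split-4 : ∀ {x y z} → x ℕ.≤ 1 → y ℕ.≤ 1 → z ℕ.≤ 2 → x ℕ.+ y ℕ.+ z ≡ 4 → x ≡ 1 × y ≡ 1 × z ≡ 2
    split-4 x≤1 y≤1 z≤2 = from-yes (ℕₚ.allUpTo? (λ x → ℕₚ.allUpTo? (λ y → ℕₚ.allUpTo? (λ z →
      (x ℕ.+ y ℕ.+ z ℕₚ.≟ 4) →-dec ((x ℕₚ.≟ 1) ×-dec (y ℕₚ.≟ 1) ×-dec (z ℕₚ.≟ 2))) 3) 2) 2) (s≤s x≤1) (s≤s y≤1) (s≤s z≤2)

    split-3 : ∀ {x y z} → x ℕ.≤ 1 → y ℕ.≤ 1 → z ℕ.≤ 1 → x ℕ.+ y ℕ.+ z ≡ 3 → x ≡ 1 × y ≡ 1 × z ≡ 1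
    split-3 x≤1 y≤1 z≤1 = from-yes (ℕₚ.allUpTo? (λ x → ℕₚ.allUpTo? (λ y → ℕₚ.allUpTo? (λ z →
      (x ℕ.+ y ℕ.+ z ℕₚ.≟ 3) →-dec ((x ℕₚ.≟ 1) ×-dec (y ℕₚ.≟ 1) ×-dec (z ℕₚ.≟ 1))) 2) 2) 2) (s≤s x≤1) (s≤s y≤1) (s≤s z≤1)

    split-5 : ∀ {y z} → y ℕ.≤ 3 → z ℕ.≤ 3 → y ℕ.+ z ≡ 5 → (y ≡ 2 × z ≡ 3) ⊎ (y ≡ 3 × z ≡ 2)
    split-5 y≤3 z≤3 = from-yes (ℕₚ.allUpTo? (λ y → ℕₚ.allUpTo? (λ z →
      (y ℕ.+ z ℕₚ.≟ 5) →-dec (((y ℕₚ.≟ 2) ×-dec (z ℕₚ.≟ 3)) ⊎-dec ((y ℕₚ.≟ 3) ×-dec (z ℕₚ.≟ 2)))) 4) 4) (s≤s y≤3) (s≤s z≤3)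

open SmallSums

-- Order five with a deleted vertex.

module OrderFive (𝔽 : FinField) where
  open FinField 𝔽
  open FieldTheory 𝔽
  open SymmetricFunctions 𝔽
  open Configurations 𝔽
  open ConfigurationFacts 𝔽

  module _ (order : length elements ≡ 5) where
    abstract
      nonzero-four : length nonzero ≡ 4
      nonzero-four = cong ℕ.pred (≡.trans (sym nonzero-length) order)

      scaled-nonzero : ∀ {g} → g ≢ 0# → map (g *_) nonzero ↭ nonzero
      scaled-nonzero {g} g≢0 = ↭-sym (Unique-↭ (map (g *_) nonzero) nonzero
        (unique-map (g *_) nonzero (λ _ _ → scale-injective g≢0) nonzero-unique)
        (λ x∈ → let y , y∈ , e = ∈-map⁻ (g *_) x∈ in nonzero-complete (λ x≡0 → product-≢0 g≢0 (nonzero-≢0 y∈) (≡.trans (sym e) x≡0)))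
        (Listₚ.length-map (g *_) nonzero))

      inverse-nonzero : map _⁻¹ nonzero ↭ nonzero
      inverse-nonzero = ↭-sym (Unique-↭ (map _⁻¹ nonzero) nonzero
        (unique-map _⁻¹ nonzero (λ x∈ y∈ → ⁻¹-injective (nonzero-≢0 x∈) (nonzero-≢0 y∈)) nonzero-unique)
        (λ x∈ → let y , y∈ , e = ∈-map⁻ _⁻¹ x∈ in nonzero-complete (λ x≡0 → ⁻¹-≢0 (nonzero-≢0 y∈) (≡.trans (sym e) x≡0)))
        (Listₚ.length-map _⁻¹ nonzero))

      -- Multiplication by `g` permutes the nonzero elements, so e k of them is both unchanged and
      -- multiplied by the k-th power of `g`. It is zero as soon as some `g` has k-th power
      -- different from 1.
      homogeneous : ∀ k {g} → g ≢ 0# → e k nonzero ≡ pow g k * e k nonzero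
      homogeneous k {g} g≢0 = ≡.trans (sym (e-↭ k (scaled-nonzero g≢0))) (e-scale g k nonzero)

      -- Only 1 and -1 have square 1, whereas there are four nonzero elements.
      non-involution : ∃ λ g → g ≢ 0# × g * g ≢ 1#
      non-involution = decide (All.all? (λ g → (g * g) ≟ 1#) nonzero)
        where
        decide : Dec (All (λ g → g * g ≡ 1#) nonzero) → ∃ λ g → g ≢ 0# × g * g ≢ 1#
        decide (no ¬all) = let g , g∈ , h = find (Allₚ.¬All⇒Any¬ (λ g → (g * g) ≟ 1#) nonzero ¬all) in g , nonzero-≢0 g∈ , h
        decide (yes all) = ⊥-elim (impossible (subst (ℕ._≤ 2) nonzero-four (Unique-length-≤ nonzero (1# ∷ - 1# ∷ []) nonzero-unique
          (λ {x} x∈ → sign (zero-product (≡.trans (solve 1 (λ x → (x :- :1) :* (x :+ :1) := x :* x :- :1) ≡.refl x) (difference (All.lookup all x∈))))))))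
          where
          impossible : 4 ℕ.≤ 2 → ⊥
          impossible (s≤s (s≤s ()))
          sign : ∀ {x} → x - 1# ≡ 0# ⊎ x + 1# ≡ 0# → x ∈ 1# ∷ - 1# ∷ []
          sign (inj₁ h) = here (equal h)
          sign {x} (inj₂ h) = there (here (equal (≡.trans (solve 1 (λ x → x :- (:- :1) := x :+ :1) ≡.refl x) h)))

      e₁-nonzero : e 1 nonzero ≡ 0#
      e₁-nonzero = let g , g≢0 , g²≢1 = non-involution in
        cancelˡ (difference-≢0 (λ g≡1 → g²≢1 (≡.trans (cong₂ _*_ g≡1 g≡1) (*-identityˡ 1#))))
          (vanish₁ (- 1#) (solve 2 (λ g s → (g :- :1) :* s := (:- :1) :* (s :- (g :* :1) :* s)) ≡.refl g (e 1 nonzero)) (difference (homogeneous 1 g≢0)))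

      e₂-nonzero : e 2 nonzero ≡ 0#
      e₂-nonzero = let g , g≢0 , g²≢1 = non-involution in
        cancelˡ (difference-≢0 g²≢1)
          (vanish₁ (- 1#) (solve 2 (λ g s → (g :* g :- :1) :* s := (:- :1) :* (s :- (g :* (g :* :1)) :* s)) ≡.refl g (e 2 nonzero)) (difference (homogeneous 2 g≢0)))

      -- Homogeneity in degree four: e 4 is the product of all nonzero elements and can be
      -- cancelled.
      fourth-power : ∀ {x} → x ≢ 0# → x * x * x * x ≡ 1#
      fourth-power {x} x≢0 = equal (cancelˡ product≢0 (vanish₁ (- 1#)
        (solve 2 (λ x s → s :* (x :* x :* x :* x :- :1) := (:- :1) :* (s :- (x :* (x :* (x :* (x :* :1)))) :* s)) ≡.refl x (e 4 nonzero)) (difference (homogeneous 4 x≢0))))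
        where
        product≢0 : e 4 nonzero ≢ 0#
        product≢0 = let p , q , r , s , nz≡ = list₄ nonzero nonzero-four in go nz≡
          where
          go : ∀ {p q r s} → nonzero ≡ p ∷ q ∷ r ∷ s ∷ [] → e 4 nonzero ≢ 0#
          go {p} {q} {r} {s} nz≡ h = product-≢0 (product-≢0 (product-≢0 (nz (here ≡.refl)) (nz (there (here ≡.refl)))) (nz (there (there (here ≡.refl))))) (nz (there (there (there (here ≡.refl)))))
            (≡.trans (solve 4 (λ p q r s → p :* q :* r :* s := :e 4 (p ∷ q ∷ r ∷ s ∷ [])) ≡.refl p q r s) (≡.trans (cong (e 4) (sym nz≡)) h))
            where
            nz : ∀ {x} → x ∈ p ∷ q ∷ r ∷ s ∷ [] → x ≢ 0#
            nz x∈ = nonzero-≢0 (subst (_ ∈_) (sym nz≡) x∈)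

      e₁-shift : ∀ L → e 1 (map (λ x → x + 1#) L) ≡ e 1 L + e 1 (map (λ _ → 1#) L)
      e₁-shift [] = sym (+-identityˡ 0#)
      e₁-shift (x ∷ L) = ≡.trans (cong (_+ (x + 1#) * 1#) (e₁-shift L))
        (solve 3 (λ s t x → (s :+ t) :+ (x :+ :1) :* :1 := (s :+ x :* :1) :+ (t :+ :1 :* :1)) ≡.refl _ _ x)

      -- Adding 1 permutes the field and increases the sum of its five elements by five ones.
      five≡0 : 1# + 1# + 1# + 1# + 1# ≡ 0#
      five≡0 = vanish₂ 1# (- 1#) (solve 2 (λ s t → t := :1 :* ((s :+ t) :- s) :+ (:- :1) :* :0) ≡.refl (e 1 elements) (1# + 1# + 1# + 1# + 1#))
        (difference (≡.trans (cong (λ t → e 1 elements + t) (sym ones)) (≡.trans (sym (e₁-shift elements)) (e-↭ 1 shifted)))) ≡.refl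
        where
        shifted : map (λ x → x + 1#) elements ↭ elements
        shifted = ↭-sym (Unique-↭ (map (λ x → x + 1#) elements) elements
          (unique-map (λ x → x + 1#) elements (λ {x} {y} _ _ h → equal (vanish₁ 1# (solve 2 (λ x y → x :- y := :1 :* ((x :+ :1) :- (y :+ :1))) ≡.refl x y) (difference h))) elements-unique)
          (λ {x} _ → elements-complete x) (Listₚ.length-map _ elements))
        constant : ∀ (L : List K) → length L ≡ 5 → e 1 (map (λ _ → 1#) L) ≡ 1# + 1# + 1# + 1# + 1#
        constant (_ ∷ _ ∷ _ ∷ _ ∷ _ ∷ []) _ = solve 0 (:e 1 (:1 ∷ :1 ∷ :1 ∷ :1 ∷ :1 ∷ []) := :1 :+ :1 :+ :1 :+ :1 :+ :1) ≡.refl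
        ones : e 1 (map (λ _ → 1#) elements) ≡ 1# + 1# + 1# + 1# + 1#
        ones = constant elements order

      -- Ratios in a null triple are cube roots of unity; in a field of order 5 they are also fourth roots.
      no-null-triple : ∀ {x y z} → x ≢ 0# → y ≢ 0# → z ≢ 0# → x + y + z ≡ 0# → x * y + x * z + y * z ≡ 0# → ⊥
      no-null-triple {x} {y} {z} x≢0 y≢0 z≢0 s p = conclude (same x≢0 y≢0 s p) (same y≢0 z≢0 (rotate-sum s) (rotate-products p))
        where
        open TwoTwoTwo 𝔽 using (null-triple-cubes; rotate-sum; rotate-products)
        same : ∀ {x y z} → x ≢ 0# → y ≢ 0# → x + y + z ≡ 0# → x * y + x * z + y * z ≡ 0# → x ≡ y
        same {x} {y} x≢0 y≢0 s p = scale-injective (product-≢0 (product-≢0 x≢0 x≢0) x≢0)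
          (≡.trans (fourth-power x≢0) (≡.trans (sym (fourth-power y≢0)) (cong (_* y) (sym (null-triple-cubes s p)))))
        conclude : x ≡ y → y ≡ z → ⊥
        conclude ≡.refl ≡.refl = 1≢0 (vanish₂ (1# + 1#) (- 1#)
          (solve 0 (:1 := (:1 :+ :1) :* (:1 :+ :1 :+ :1) :+ (:- :1) :* (:1 :+ :1 :+ :1 :+ :1 :+ :1)) ≡.refl)
          (cancelˡ x≢0 (≡.trans (solve 1 (λ x → x :* (:1 :+ :1 :+ :1) := x :+ x :+ x) ≡.refl x) s)) five≡0)

  module VertexHole (order : length elements ≡ 5) where
    open Config
    open NoVertexHole 𝔽 using (shear-middle; shear-root; list-length₀)

    abstract
      full-e₁ : ∀ {L D} rest → L ↭ (nonzero ++ D) ++ rest → e 1 L ≡ e 1 D + e 1 rest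
      full-e₁ {L} {D} rest p = ≡.trans (e-↭ 1 p) (≡.trans (e₁-++ (nonzero ++ D) rest) (cong (_+ e 1 rest)
        (≡.trans (e₁-++ nonzero D) (≡.trans (cong (_+ e 1 D) (e₁-nonzero order)) (+-identityˡ _)))))

      full-e₂ : ∀ {L} x → L ↭ nonzero ++ x ∷ [] → e 2 L ≡ 0#
      full-e₂ x p = ≡.trans (e-↭ 2 p) (≡.trans (e₂-++ nonzero (x ∷ [])) (≡.trans
        (cong₂ (λ s t → s + t * e 1 (x ∷ []) + e 2 (x ∷ [])) (e₂-nonzero order) (e₁-nonzero order))
        (solve 1 (λ x → :0 :+ :0 :* :e 1 (x ∷ []) :+ :e 2 (x ∷ []) := :0) ≡.refl x)))

      inverse-full : ∀ {L} rest → L ↭ nonzero ++ rest → map _⁻¹ L ↭ nonzero ++ map _⁻¹ rest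
      inverse-full rest p = ↭-trans (↭ₚ.map⁺ _⁻¹ p) (↭-trans (↭-reflexive (Listₚ.map-++ _⁻¹ nonzero rest))
        (↭ₚ.++⁺ʳ (map _⁻¹ rest) (inverse-nonzero order)))

      corresponding-count : ∀ (f g : Fin 5 → K) {s t} → (∀ {m} → s ≡ f m → t ≡ g m) → (∀ {m} → t ≡ g m → s ≡ f m) →
        ∀ L → Counting.count _≟_ s (map f L) ≡ Counting.count _≟_ t (map g L)
      corresponding-count f g to from [] = ≡.refl
      corresponding-count f g {s} {t} to from (m ∷ L) = cong₂ ℕ._+_ (agree (s ≟ f m) (t ≟ g m)) (corresponding-count f g to from L)
        where
        agree : (d : Dec (s ≡ f m)) (d′ : Dec (t ≡ g m)) → Counting.indicator _≟_ d ≡ Counting.indicator _≟_ d′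
        agree (yes _) (yes _) = ≡.refl
        agree (no _) (no _) = ≡.refl
        agree (yes p) (no q) = ⊥-elim (q (to p))
        agree (no p) (yes q) = ⊥-elim (p (from q))

    full : ∀ Γ → a Γ ≡ true → length (A Γ) ℕ.≤ 1
    full Γ a≡ = ℕₚ.+-cancelˡ-≤ 4 _ _ (subst (λ n → n ℕ.+ length (A Γ) ℕ.≤ 5) (nonzero-four order) (ListFacts.full-vertex-bound Γ a≡))

    exact : ∀ Γ → a Γ ≡ true → length (A Γ) ≡ 1 → map (u Γ) five ↭ nonzero ++ A Γ
    exact Γ a≡ l = let rest , lr , p = ListFacts.full-vertex-rest Γ a≡ 0 (cong₂ (λ m n → m ℕ.+ n ℕ.+ 0) (nonzero-four order) l) in
      subst (map (u Γ) five ↭_) (≡.trans (cong ((nonzero ++ A Γ) ++_) (list-length₀ rest lr)) (Listₚ.++-identityʳ _)) p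

    member : ∀ {α} {L : List K} → L ≡ α ∷ [] → α ∈ L
    member L≡ = subst (_ ∈_) (sym L≡) (here ≡.refl)

    abstract
      -- Each coordinate list is the nonzero elements together with one deleted point, and the
      -- former sum to zero. Comparing sums in the pencil of α shows that the one slope left open is
      -- 0. Then three points of M lie on the line to the vertex, while α occurs at most twice as a
      -- first coordinate.
      three-vertices : ∀ Γ → a Γ ≡ true → b Γ ≡ true → c Γ ≡ true → length (A Γ) ≡ 1 → length (B Γ) ≡ 1 → length (C Γ) ≡ 1 → ⊥
      three-vertices Γ a≡ b≡ c≡ lA lB lC = let α , A≡ = list₁ (A Γ) lA in go A≡
        (ListFacts.pencil-rest Γ (member A≡) 1 (cong₂ (λ k n → suc (♯ k) ℕ.+ n ℕ.+ 1) a≡ (cong₂ ℕ._+_ lB lC)))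
        where
        open Counting _≟_
        e₁-w : e 1 (map (w Γ) five) ≡ e 1 (C Γ)
        e₁-w = ≡.trans (full-e₁ [] (↭-trans (exact (rot (rot Γ)) c≡ lC) (↭-reflexive (sym (Listₚ.++-identityʳ _))))) (+-identityʳ _)
        e₁-p : e 1 (map (λ m → u Γ m * w Γ m) five) ≡ e 1 (map _⁻¹ (B Γ))
        e₁-p = ≡.trans (cong (e 1) (ListFacts.inverse-image (rot Γ))) (≡.trans
          (full-e₁ [] (↭-trans (inverse-full (B Γ) (exact (rot Γ) b≡ lB)) (↭-reflexive (sym (Listₚ.++-identityʳ _))))) (+-identityʳ _))
        go : ∀ {α} → A Γ ≡ α ∷ [] → (∃ λ rest → length rest ≡ 1 × map (ρ (u Γ) (w Γ) α) five ↭ targets (suc (♯ (a Γ))) α (B Γ) (C Γ) ++ rest) → ⊥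
        go {α} A≡ (rest , lr , p) = let x , rest≡ = list₁ rest lr in
          conclude x (subst (λ z → map (ρ (u Γ) (w Γ) α) five ↭ targets (suc (♯ (a Γ))) α (B Γ) (C Γ) ++ z) rest≡ p)
          where
          count-u : count α (map (u Γ) five) ℕ.≤ 2
          count-u = ℕₚ.≤-trans (ℕₚ.≤-reflexive (≡.trans (count-↭ (exact Γ a≡ lA)) (count-++ α nonzero (A Γ))))
            (ℕₚ.+-mono-≤ (count-unique nonzero nonzero-unique) (count-unique (A Γ) (A! Γ)))
          conclude : ∀ x → map (ρ (u Γ) (w Γ) α) five ↭ targets (suc (♯ (a Γ))) α (B Γ) (C Γ) ++ x ∷ [] → ⊥
          conclude x p = impossible (ℕₚ.≤-trans (ℕₚ.≤-trans three (ℕₚ.≤-reflexive (sym (count-↭ p))))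
            (ℕₚ.≤-trans (ℕₚ.≤-reflexive (corresponding-count (ρ (u Γ) (w Γ) α) (u Γ)
              (λ h → sym (Pencils.ρ-vertex Γ (sym h))) (λ h → sym (Pencils.ρ-at-vertex Γ (sym h))) five)) count-u))
            where
            impossible : 3 ℕ.≤ 2 → ⊥
            impossible (s≤s (s≤s ()))
            x≡0 : x ≡ 0#
            x≡0 = vanish₃ (- 1#) 1# (- α) (solve 6 (λ α P W B C x → x :=
              (:- :1) :* ((P :- α :* W) :- (B :- α :* C :+ (:0 :+ x :* :1))) :+ :1 :* (P :- B) :+ (:- α) :* (W :- C)) ≡.refl α
              (e 1 (map (λ m → u Γ m * w Γ m) five)) (e 1 (map (w Γ) five)) (e 1 (map _⁻¹ (B Γ))) (e 1 (C Γ)) x)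
              (difference (ListFacts.pencil-e₁ Γ p)) (difference e₁-p) (difference e₁-w)
            three : 3 ℕ.≤ count 0# (targets (suc (♯ (a Γ))) α (B Γ) (C Γ) ++ x ∷ [])
            three = ℕₚ.≤-trans (ℕₚ.≤-reflexive (cong (λ k → suc (♯ k) ℕ.+ 1) (sym a≡))) (ℕₚ.≤-trans
              (ℕₚ.+-monoʳ-≤ (suc (♯ (a Γ))) (ℕₚ.≤-trans (∈-count {xs = x ∷ []} (here (sym x≡0))) (ℕₚ.≤-trans (ℕₚ.m≤n+m (count 0# (x ∷ [])) (count 0# (map _⁻¹ (B Γ) ++ map (λ γ → - (α * γ)) (C Γ)))) (ℕₚ.≤-reflexive (sym (count-++ 0# (map _⁻¹ (B Γ) ++ map (λ γ → - (α * γ)) (C Γ)) (x ∷ [])))))))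
              (ℕₚ.≤-reflexive (≡.trans (sym (count-zero-replicate (suc (♯ (a Γ))) ((map _⁻¹ (B Γ) ++ map (λ γ → - (α * γ)) (C Γ)) ++ x ∷ [])))
                (cong (count 0#) (sym (Listₚ.++-assoc (replicate (suc (♯ (a Γ))) 0#) (map _⁻¹ (B Γ) ++ map (λ γ → - (α * γ)) (C Γ)) (x ∷ [])))))))

      -- The pencils of the single deleted points on the first two sides are tight. Since the sums
      -- for `u` and for the inverses of `v` are known, they give that `w` and `C` have equal sums
      -- and equal sums of inverses. The three further values of `w` would be a null triple.
      two-vertices : ∀ Γ → a Γ ≡ true → b Γ ≡ true → length (A Γ) ≡ 1 → length (B Γ) ≡ 1 → length (C Γ) ≡ 2 → ⊥
      two-vertices Γ a≡ b≡ lA lB lC = let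
          α , A≡ = list₁ (A Γ) lA
          β , B≡ = list₁ (B Γ) lB
          rest , lr , p = ListFacts.vertex-rest (rot (rot Γ)) 3 (cong (ℕ._+ 3) lC)
          r₁ , r₂ , r₃ , rest≡ = list₃ rest lr
        in go (e₁-w A≡) (e₁-w⁻¹ B≡) (subst (λ z → map (w Γ) five ↭ C Γ ++ z) rest≡ p)
        where
        e₁-v⁻¹ : e 1 (map (λ m → u Γ m * w Γ m) five) ≡ e 1 (map _⁻¹ (B Γ))
        e₁-v⁻¹ = ≡.trans (cong (e 1) (ListFacts.inverse-image (rot Γ))) (≡.trans
          (full-e₁ [] (↭-trans (inverse-full (B Γ) (exact (rot Γ) b≡ lB)) (↭-reflexive (sym (Listₚ.++-identityʳ _))))) (+-identityʳ _))
        e₁-u : e 1 (map (u Γ) five) ≡ e 1 (A Γ)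
        e₁-u = ≡.trans (full-e₁ [] (↭-trans (exact Γ a≡ lA) (↭-reflexive (sym (Listₚ.++-identityʳ _))))) (+-identityʳ _)
        e₁-w : ∀ {α} → A Γ ≡ α ∷ [] → e 1 (map (w Γ) five) - e 1 (C Γ) ≡ 0#
        e₁-w {α} A≡ = cancelˡ (A≢0 Γ (member A≡)) (vanish₂ (- 1#) 1#
          (solve 3 (λ α x y → α :* x := (:- :1) :* (y :- α :* x) :+ :1 :* y) ≡.refl α (e 1 (map (w Γ) five) - e 1 (C Γ))
            (e 1 (map (λ m → u Γ m * w Γ m) five) - e 1 (map _⁻¹ (B Γ))))
          (ListFacts.tight-e₁ Γ (member A≡) (cong₂ (λ k n → suc (♯ k) ℕ.+ n) a≡ (cong₂ ℕ._+_ lB lC))) (difference e₁-v⁻¹))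
        e₁-w⁻¹ : ∀ {β} → B Γ ≡ β ∷ [] → e 1 (map (λ m → v Γ m * u Γ m) five) - e 1 (map _⁻¹ (C Γ)) ≡ 0#
        e₁-w⁻¹ {β} B≡ = vanish₂ 1# β
          (solve 3 (λ β x y → x := :1 :* (x :- β :* y) :+ β :* y) ≡.refl β (e 1 (map (λ m → v Γ m * u Γ m) five) - e 1 (map _⁻¹ (C Γ))) (e 1 (map (u Γ) five) - e 1 (A Γ)))
          (ListFacts.tight-e₁ (rot Γ) (member B≡) (cong₂ (λ k n → suc (♯ k) ℕ.+ n) b≡ (cong₂ ℕ._+_ lC lA))) (difference e₁-u)
        go : ∀ {r₁ r₂ r₃} → e 1 (map (w Γ) five) - e 1 (C Γ) ≡ 0# → e 1 (map (λ m → v Γ m * u Γ m) five) - e 1 (map _⁻¹ (C Γ)) ≡ 0# →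
          map (w Γ) five ↭ C Γ ++ r₁ ∷ r₂ ∷ r₃ ∷ [] → ⊥
        go {r₁} {r₂} {r₃} s s⁻¹ p = no-null-triple order (r≢0 (here ≡.refl)) (r≢0 (there (here ≡.refl))) (r≢0 (there (there (here ≡.refl))))
          (null s (≡.trans (e-↭ 1 p) (e₁-++ (C Γ) _)))
          (TwoTwoTwoFacts.inverse-triple 𝔽 (*-inverse r₁ (r≢0 (here ≡.refl))) (*-inverse r₂ (r≢0 (there (here ≡.refl)))) (*-inverse r₃ (r≢0 (there (there (here ≡.refl)))))
            (null s⁻¹ (≡.trans (cong (e 1) (ListFacts.inverse-image (rot (rot Γ)))) (≡.trans (e-↭ 1 (↭ₚ.map⁺ _⁻¹ p))
              (≡.trans (cong (e 1) (Listₚ.map-++ _⁻¹ (C Γ) (r₁ ∷ r₂ ∷ r₃ ∷ []))) (e₁-++ (map _⁻¹ (C Γ)) _))))))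
          where
          r≢0 : ∀ {r} → r ∈ r₁ ∷ r₂ ∷ r₃ ∷ [] → r ≢ 0#
          r≢0 r∈ = ListFacts.image-≢0 (rot (rot Γ)) (↭ₚ.∈-resp-↭ (↭-sym p) (∈-++⁺ʳ (C Γ) r∈))
          null : ∀ {X D x y z} → X - D ≡ 0# → X ≡ D + e 1 (x ∷ y ∷ z ∷ []) → x + y + z ≡ 0#
          null {X} {D} {x} {y} {z} h h′ = vanish₂ 1# (- 1#) (solve 5 (λ X D x y z → x :+ y :+ z := :1 :* (X :- D) :+ (:- :1) :* (X :- (D :+ :e 1 (x ∷ y ∷ z ∷ [])))) ≡.refl X D x y z) h (difference h′)

      two-root-contradiction : ∀ {c Z E g h} → g ≢ h → c ≢ 0# → E ≡ 0# → c - g * Z + g * g * E ≡ 0# → c - h * Z + h * h * E ≡ 0# → ⊥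
      two-root-contradiction {c} {Z} {E} {g} {h} g≢h c≢0 E≡0 hg hh = c≢0 (vanish₂ 1# (g * h)
        (solve 4 (λ c E g h → c := :1 :* (c :- g :* h :* E) :+ (g :* h) :* E) ≡.refl c E g h) (proj₂ (quadratic-roots g≢h hg hh)) E≡0)

      pair-distinct : ∀ {x y : K} → Unique (x ∷ y ∷ []) → x ≢ y
      pair-distinct ((p ∷ []) ∷ _) = p

      u-list : ∀ Γ → a Γ ≡ true → A Γ ≡ [] → ∃ λ x → map (u Γ) five ↭ nonzero ++ x ∷ []
      u-list Γ a≡ A≡ = let rest , lr , p = ListFacts.full-vertex-rest Γ a≡ 1 (cong₂ (λ m n → m ℕ.+ n ℕ.+ 1) (nonzero-four order) (cong length A≡))
                           x , rest≡ = list₁ rest lr in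
        x , ↭-trans p (↭-reflexive (≡.trans (cong₂ (λ D z → (nonzero ++ D) ++ z) A≡ rest≡) (cong (_++ x ∷ []) (Listₚ.++-identityʳ nonzero))))

      -- Here `u` runs through the nonzero elements and one more; the former have e₁ = e₂ = 0, so e₂
      -- of `u` is zero. The quadratic in β loses its leading term, and two roots suffice.
      one-vertex-23 : ∀ Γ → a Γ ≡ true → b Γ ≡ false → A Γ ≡ [] → length (B Γ) ≡ 2 → length (C Γ) ≡ 3 → ⊥
      one-vertex-23 Γ a≡ b≡ A≡ lB lC = let
          β₁ , β₂ , B≡ = list₂ (B Γ) lB
          rest , lr , p = ListFacts.vertex-rest (rot (rot Γ)) 2 (cong (ℕ._+ 2) lC)
          y₁ , y₂ , rest≡ = list₂ rest lr
        in go B≡ (subst Unique B≡ (B! Γ)) (subst (λ z → map (w Γ) five ↭ C Γ ++ z) rest≡ p)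
        where
        E≡0 : e 2 (map (u Γ) five) ≡ 0#
        E≡0 = let x , p = u-list Γ a≡ A≡ in full-e₂ x p
        go : ∀ {β₁ β₂ y₁ y₂} → B Γ ≡ β₁ ∷ β₂ ∷ [] → Unique (β₁ ∷ β₂ ∷ []) → map (w Γ) five ↭ C Γ ++ y₁ ∷ y₂ ∷ [] → ⊥
        go {y₁ = y₁} {y₂} B≡ B! p = two-root-contradiction (pair-distinct B!) (product-≢0 (⁻¹-≢0 (image (here ≡.refl))) (⁻¹-≢0 (image (there (here ≡.refl))))) E≡0
          (shear-root (rot Γ) b≡ lC (cong length A≡) (subst (_ ∈_) (sym B≡) (here ≡.refl)) p)
          (shear-root (rot Γ) b≡ lC (cong length A≡) (subst (_ ∈_) (sym B≡) (there (here ≡.refl))) p)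
          where
          image : ∀ {y} → y ∈ y₁ ∷ y₂ ∷ [] → y ≢ 0#
          image y∈ = ListFacts.image-≢0 (rot (rot Γ)) (↭ₚ.∈-resp-↭ (↭-sym p) (∈-++⁺ʳ (C Γ) y∈))

      -- Division by -γ turns the targets -γβ into β and the slopes into v - γ⁻¹(wv). The parameter
      -- is then γ⁻¹, and the leading coefficient is e₂ of the inverses of `u`, zero because
      -- inversion permutes the nonzero elements.
      one-vertex-32 : ∀ Γ → a Γ ≡ true → c Γ ≡ false → A Γ ≡ [] → length (B Γ) ≡ 3 → length (C Γ) ≡ 2 → ⊥
      one-vertex-32 Γ a≡ c≡ A≡ lB lC = let
          γ₁ , γ₂ , C≡ = list₂ (C Γ) lC
          rest , lr , p = ListFacts.vertex-rest (rot Γ) 2 (cong (ℕ._+ 2) lB)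
          y₁ , y₂ , rest≡ = list₂ rest lr
        in go C≡ (subst Unique C≡ (C! Γ)) (subst (λ z → map (v Γ) five ↭ B Γ ++ z) rest≡ p)
        where
        s : Fin 5 → K
        s m = w Γ m * v Γ m
        E≡0 : e 2 (map s five) ≡ 0#
        E≡0 = let x , p = u-list Γ a≡ A≡ in ≡.trans (cong (e 2) (ListFacts.inverse-image Γ)) (full-e₂ (x ⁻¹) (inverse-full (x ∷ []) p))
        sheared : ∀ {γ} → γ ∈ C Γ → ∃ λ x → map (λ m → v Γ m - γ ⁻¹ * s m) five ↭ 0# ∷ B Γ ++ x ∷ []
        sheared {γ} γ∈ = let
            rest , lr , p = ListFacts.pencil-rest (rot (rot Γ)) γ∈ 1 (cong₂ (λ k n → suc (♯ k) ℕ.+ n ℕ.+ 1) c≡ (cong₂ ℕ._+_ (cong length A≡) lB))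
            x , rest≡ = list₁ rest lr
          in - (γ ⁻¹) * x , ↭-trans (↭-reflexive (≡.trans (Listₚ.map-cong rescale five) (Listₚ.map-∘ five)))
            (↭-trans (↭ₚ.map⁺ (- (γ ⁻¹) *_) p) (↭-reflexive (≡.trans (cong (map (- (γ ⁻¹) *_)) (list≡ rest≡))
              (cong₂ _∷_ (zeroʳ _) (≡.trans (Listₚ.map-++ (- (γ ⁻¹) *_) (map (λ β → - (γ * β)) (B Γ)) (x ∷ [])) (cong (_++ - (γ ⁻¹) * x ∷ [])
                (≡.trans (sym (Listₚ.map-∘ (B Γ))) (≡.trans (Listₚ.map-cong unscale (B Γ)) (Listₚ.map-id (B Γ))))))))))
          where
          γγ⁻¹ : γ * γ ⁻¹ ≡ 1#
          γγ⁻¹ = *-inverse γ (C≢0 Γ γ∈)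
          list≡ : ∀ {rest x} → rest ≡ x ∷ [] → targets (suc (♯ (c Γ))) γ (A Γ) (B Γ) ++ rest ≡ 0# ∷ map (λ β → - (γ * β)) (B Γ) ++ x ∷ []
          list≡ {x = x} ≡.refl = cong₂ (λ k D → targets (suc (♯ k)) γ D (B Γ) ++ x ∷ []) c≡ A≡
          rescale : ∀ m → v Γ m - γ ⁻¹ * s m ≡ - (γ ⁻¹) * ρ (w Γ) (v Γ) γ m
          rescale m = equal (vanish₁ (- (v Γ m)) (solve 4 (λ v w γ γ′ → (v :- γ′ :* (w :* v)) :- (:- γ′) :* (w :* v :- γ :* v) := (:- v) :* (γ :* γ′ :- :1)) ≡.refl (v Γ m) (w Γ m) γ (γ ⁻¹)) (difference γγ⁻¹))
          unscale : ∀ β → - (γ ⁻¹) * - (γ * β) ≡ β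
          unscale β = equal (vanish₁ β (solve 3 (λ β γ γ′ → (:- γ′) :* (:- (γ :* β)) :- β := β :* (γ :* γ′ :- :1)) ≡.refl β γ (γ ⁻¹)) (difference γγ⁻¹))
        go : ∀ {γ₁ γ₂ y₁ y₂} → C Γ ≡ γ₁ ∷ γ₂ ∷ [] → Unique (γ₁ ∷ γ₂ ∷ []) → map (v Γ) five ↭ B Γ ++ y₁ ∷ y₂ ∷ [] → ⊥
        go {γ₁} {γ₂} {y₁} {y₂} C≡ C! p = two-root-contradiction (λ h → pair-distinct C! (⁻¹-injective (C≢0 Γ γ₁∈) (C≢0 Γ γ₂∈) h))
            (product-≢0 (image (here ≡.refl)) (image (there (here ≡.refl)))) E≡0
          (shear-quadratic (v Γ) s (B Γ) (proj₂ (sheared γ₁∈)) p) (shear-quadratic (v Γ) s (B Γ) (proj₂ (sheared γ₂∈)) p)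
          where
          γ₁∈ : γ₁ ∈ C Γ
          γ₁∈ = subst (_ ∈_) (sym C≡) (here ≡.refl)
          γ₂∈ : γ₂ ∈ C Γ
          γ₂∈ = subst (_ ∈_) (sym C≡) (there (here ≡.refl))
          image : ∀ {y} → y ∈ y₁ ∷ y₂ ∷ [] → y ≢ 0#
          image y∈ = ListFacts.image-≢0 (rot Γ) (↭ₚ.∈-resp-↭ (↭-sym p) (∈-++⁺ʳ (B Γ) y∈))

    vertex-hole : ∀ Γ → a Γ ≡ true → ⊥
    vertex-hole Γ a≡ = cases (b Γ) (c Γ) ≡.refl ≡.refl
      where
      size′ : ∀ {k l m} → a Γ ≡ k → b Γ ≡ l → c Γ ≡ m → length (A Γ) ℕ.+ length (B Γ) ℕ.+ length (C Γ) ℕ.+ (♯ k ℕ.+ ♯ l ℕ.+ ♯ m) ≡ 6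
      size′ ≡.refl ≡.refl ≡.refl = size Γ
      side : ∀ {n k l s t} → s ≡ k → t ≡ l → n ℕ.+ (♯ s ℕ.+ ♯ t) ℕ.< length elements → n ℕ.+ (♯ k ℕ.+ ♯ l) ℕ.≤ 4
      side ≡.refl ≡.refl h = ℕₚ.≤-pred (ℕₚ.≤-trans h (ℕₚ.≤-reflexive order))
      one-vertex : b Γ ≡ false → c Γ ≡ false → ∀ L → A Γ ≡ L → ⊥
      one-vertex b≡ c≡ [] A≡ = Sum.[ (λ h → one-vertex-23 Γ a≡ b≡ A≡ (proj₁ h) (proj₂ h)) , (λ h → one-vertex-32 Γ a≡ c≡ A≡ (proj₁ h) (proj₂ h)) ]
        (split-5 (ℕₚ.+-cancelʳ-≤ 1 _ _ (side c≡ a≡ (sideB Γ))) (ℕₚ.+-cancelʳ-≤ 1 _ _ (side a≡ b≡ (sideC Γ)))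
          (ℕₚ.+-cancelʳ-≡ 1 _ _ (subst (λ n → n ℕ.+ length (B Γ) ℕ.+ length (C Γ) ℕ.+ 1 ≡ 6) (cong length A≡) (size′ a≡ b≡ c≡))))
      -- The pencil of α spends two places on the deleted vertex, leaving at most three for the
      -- other sides. With at most one point on this side, that is at most four deleted points off
      -- the vertices, where five are needed.
      one-vertex b≡ c≡ (α ∷ L) A≡ = impossible (ℕₚ.≤-trans (ℕₚ.≤-reflexive (sym total)) (ℕₚ.+-mono-≤ (full Γ a≡) small))
        where
        small : length (B Γ) ℕ.+ length (C Γ) ℕ.≤ 3
        small = ℕₚ.≤-pred (ℕₚ.≤-pred (subst (λ k → suc (♯ k) ℕ.+ (length (B Γ) ℕ.+ length (C Γ)) ℕ.≤ 5) a≡ (ListFacts.pencil-bound Γ (subst (α ∈_) (sym A≡) (here ≡.refl)))))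
        total : length (A Γ) ℕ.+ (length (B Γ) ℕ.+ length (C Γ)) ≡ 5
        total = ≡.trans (sym (ℕₚ.+-assoc (length (A Γ)) _ _)) (ℕₚ.+-cancelʳ-≡ 1 _ _ (size′ a≡ b≡ c≡))
        impossible : 5 ℕ.≤ 4 → ⊥
        impossible (s≤s (s≤s (s≤s (s≤s ()))))
      cases : ∀ s t → b Γ ≡ s → c Γ ≡ t → ⊥
      cases false false b≡ c≡ = one-vertex b≡ c≡ (A Γ) ≡.refl
      cases true false b≡ c≡ =
        let lA , lB , lC = split-4 (full Γ a≡) (full (rot Γ) b≡) (ℕₚ.+-cancelʳ-≤ 2 _ _ (side a≡ b≡ (sideC Γ))) (ℕₚ.+-cancelʳ-≡ 2 _ _ (size′ a≡ b≡ c≡))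
        in two-vertices Γ a≡ b≡ lA lB lC
      cases false true b≡ c≡ =
        let lC , lA , lB = split-4 (full (rot (rot Γ)) c≡) (full Γ a≡) (ℕₚ.+-cancelʳ-≤ 2 _ _ (side c≡ a≡ (sideB Γ)))
              (≡.trans (≡.trans (ℕₚ.+-assoc (length (C Γ)) _ _) (ℕₚ.+-comm (length (C Γ)) _)) (ℕₚ.+-cancelʳ-≡ 2 _ _ (size′ a≡ b≡ c≡)))
        in two-vertices (rot (rot Γ)) c≡ a≡ lC lA lB
      cases true true b≡ c≡ =
        let lA , lB , lC = split-3 (full Γ a≡) (full (rot Γ) b≡) (full (rot (rot Γ)) c≡) (ℕₚ.+-cancelʳ-≡ 3 _ _ (size′ a≡ b≡ c≡))
        in three-vertices Γ a≡ b≡ c≡ lA lB lC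

-- Points of the plane in coordinates adapted to the triangle.

module TrianglePlane (𝔽 : FinField) where
  open FinField 𝔽
  open FieldTheory 𝔽

  -- Normalised coordinates (X : Y : Z) of the plane, with the triangle XYZ = 0: an edge point carries
  -- Z/Y, X/Z or Y/X, and an inner point carries u = Z/Y and v = X/Z.
  data Pt : Set where
    vertex : Fin 3 → Pt
    edge : Fin 3 → K → Pt
    inner : K → K → Pt

  Boundary : Pt → Set
  Boundary (vertex _) = ⊤
  Boundary (edge _ t) = t ≢ 0#
  Boundary (inner _ _) = ⊥

  X Y Z : Pt → K
  X (vertex 0F) = 1#
  X (vertex 1F) = 0#
  X (vertex 2F) = 0#
  X (edge 0F t) = 0#
  X (edge 1F t) = t
  X (edge 2F t) = 1#
  X (inner u v) = u * v
  Y (vertex 0F) = 0#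
  Y (vertex 1F) = 1#
  Y (vertex 2F) = 0#
  Y (edge 0F t) = 1#
  Y (edge 1F t) = 0#
  Y (edge 2F t) = t
  Y (inner u v) = 1#
  Z (vertex 0F) = 0#
  Z (vertex 1F) = 0#
  Z (vertex 2F) = 1#
  Z (edge 0F t) = t
  Z (edge 1F t) = 1#
  Z (edge 2F t) = 0#
  Z (inner u v) = u

  On : K → K → K → Pt → Set
  On a b c p = a * X p + b * Y p + c * Z p ≡ 0#

  record Blocking : Set where
    field
      H : List Pt
      H-length : length H ≡ 6
      H! : Unique H
      H-boundary : ∀ {p} → p ∈ H → Boundary p
      u v : Fin 5 → K
      u≢0 : ∀ m → u m ≢ 0#
      v≢0 : ∀ m → v m ≢ 0#
      separated : ∀ {m n} → u m ≡ u n → v m ≡ v n → m ≡ n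

    Member : Pt → Set
    Member p = (Boundary p × p ∉ H) ⊎ (∃ λ m → p ≡ inner (u m) (v m))

    field
      blocks : ∀ a b c → ¬ (a ≡ 0# × b ≡ 0# × c ≡ 0#) →
        ∃ λ p → ∃ λ r → p ≢ r × Member p × Member r × On a b c p × On a b c r

-- From a double blocking set to a configuration.

module FromBlocking (𝔽 : FinField) where
  open FinField 𝔽
  open FieldTheory 𝔽
  open TrianglePlane 𝔽
  open Configurations 𝔽 using (♯; TwoOf; AtVertex; Joins; Config; count-one)
  open ConfigurationFacts 𝔽 using (nonzero; nonzero-length; nonzero-complete)

  edges : Fin 3 → List Pt → List K
  edges i [] = []
  edges i (vertex _ ∷ L) = edges i L
  edges i (edge j t ∷ L) with i Fin.≟ j
  ... | yes _ = t ∷ edges i L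
  ... | no _ = edges i L
  edges i (inner _ _ ∷ L) = edges i L

  vertices : Fin 3 → List Pt → ℕ
  vertices i [] = 0
  vertices i (vertex j ∷ L) with i Fin.≟ j
  ... | yes _ = suc (vertices i L)
  ... | no _ = vertices i L
  vertices i (edge _ _ ∷ L) = vertices i L
  vertices i (inner _ _ ∷ L) = vertices i L

  flag : ℕ → Bool
  flag zero = false
  flag (suc _) = true

  edges-∈ : ∀ i L {t} → t ∈ edges i L → edge i t ∈ L
  edges-∈ i (vertex _ ∷ L) t∈ = there (edges-∈ i L t∈)
  edges-∈ i (edge j t ∷ L) t∈ with i Fin.≟ j
  edges-∈ i (edge i t ∷ L) (here ≡.refl) | yes ≡.refl = here ≡.refl
  edges-∈ i (edge i t ∷ L) (there t∈) | yes ≡.refl = there (edges-∈ i L t∈)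
  edges-∈ i (edge j t ∷ L) t∈ | no _ = there (edges-∈ i L t∈)
  edges-∈ i (inner _ _ ∷ L) t∈ = there (edges-∈ i L t∈)

  edges-unique : ∀ i L → Unique L → Unique (edges i L)
  edges-unique i [] _ = []
  edges-unique i (vertex _ ∷ L) (_ ∷ L!) = edges-unique i L L!
  edges-unique i (edge j t ∷ L) (p∉ ∷ L!) with i Fin.≟ j
  ... | yes ≡.refl = All.tabulate (λ { s∈ ≡.refl → All.lookup p∉ (edges-∈ i L s∈) ≡.refl }) ∷ edges-unique i L L!
  ... | no _ = edges-unique i L L!
  edges-unique i (inner _ _ ∷ L) (_ ∷ L!) = edges-unique i L L!

  vertices-∈ : ∀ i L → flag (vertices i L) ≡ true → vertex i ∈ L
  vertices-∈ i (vertex j ∷ L) h with i Fin.≟ j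
  ... | yes ≡.refl = here ≡.refl
  ... | no _ = there (vertices-∈ i L h)
  vertices-∈ i (edge _ _ ∷ L) h = there (vertices-∈ i L h)
  vertices-∈ i (inner _ _ ∷ L) h = there (vertices-∈ i L h)

  vertices-∉ : ∀ i L → vertex i ∉ L → vertices i L ≡ 0
  vertices-∉ i [] _ = ≡.refl
  vertices-∉ i (vertex j ∷ L) ∉ with i Fin.≟ j
  ... | yes ≡.refl = ⊥-elim (∉ (here ≡.refl))
  ... | no _ = vertices-∉ i L (∉ ∘ there)
  vertices-∉ i (edge _ _ ∷ L) ∉ = vertices-∉ i L (∉ ∘ there)
  vertices-∉ i (inner _ _ ∷ L) ∉ = vertices-∉ i L (∉ ∘ there)

  vertices-flag : ∀ i L → Unique L → ♯ (flag (vertices i L)) ≡ vertices i L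
  vertices-flag i [] _ = ≡.refl
  vertices-flag i (vertex j ∷ L) (p∉ ∷ L!) with i Fin.≟ j
  ... | yes ≡.refl = cong suc (sym (vertices-∉ i L (λ i∈ → All.lookup p∉ i∈ ≡.refl)))
  ... | no _ = vertices-flag i L L!
  vertices-flag i (edge _ _ ∷ L) (_ ∷ L!) = vertices-flag i L L!
  vertices-flag i (inner _ _ ∷ L) (_ ∷ L!) = vertices-flag i L L!

  total : List Pt → ℕ
  total L = length (edges 0F L) ℕ.+ length (edges 1F L) ℕ.+ length (edges 2F L) ℕ.+
    (vertices 0F L ℕ.+ vertices 1F L ℕ.+ vertices 2F L)

  total-length : ∀ L → (∀ {p} → p ∈ L → Boundary p) → total L ≡ length L
  total-length [] _ = ≡.refl
  total-length (vertex 0F ∷ L) b = ≡.trans (ℕₚ.+-suc (length (edges 0F L) ℕ.+ length (edges 1F L) ℕ.+ length (edges 2F L)) _) (cong suc (total-length L (b ∘ there)))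
  total-length (vertex 1F ∷ L) b = ≡.trans (cong (λ n → length (edges 0F L) ℕ.+ length (edges 1F L) ℕ.+ length (edges 2F L) ℕ.+ (n ℕ.+ vertices 2F L)) (ℕₚ.+-suc (vertices 0F L) _))
    (≡.trans (ℕₚ.+-suc (length (edges 0F L) ℕ.+ length (edges 1F L) ℕ.+ length (edges 2F L)) _) (cong suc (total-length L (b ∘ there))))
  total-length (vertex 2F ∷ L) b = ≡.trans (cong (length (edges 0F L) ℕ.+ length (edges 1F L) ℕ.+ length (edges 2F L) ℕ.+_) (ℕₚ.+-suc (vertices 0F L ℕ.+ vertices 1F L) _))
    (≡.trans (ℕₚ.+-suc (length (edges 0F L) ℕ.+ length (edges 1F L) ℕ.+ length (edges 2F L)) _) (cong suc (total-length L (b ∘ there))))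
  total-length (edge 0F t ∷ L) b = cong suc (total-length L (b ∘ there))
  total-length (edge 1F t ∷ L) b = ≡.trans (cong (λ n → n ℕ.+ length (edges 2F L) ℕ.+ (vertices 0F L ℕ.+ vertices 1F L ℕ.+ vertices 2F L)) (ℕₚ.+-suc (length (edges 0F L)) _))
    (cong suc (total-length L (b ∘ there)))
  total-length (edge 2F t ∷ L) b = ≡.trans (cong (ℕ._+ (vertices 0F L ℕ.+ vertices 1F L ℕ.+ vertices 2F L)) (ℕₚ.+-suc (length (edges 0F L) ℕ.+ length (edges 1F L)) _))
    (cong suc (total-length L (b ∘ there)))
  total-length (inner _ _ ∷ L) b = ⊥-elim (b (here ≡.refl))

  module _ (𝔅 : Blocking) where
    open Blocking 𝔅

    w : Fin 5 → K
    w m = (u m * v m) ⁻¹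

    module _ {a b c : K} (ℓ≢0 : ¬ (a ≡ 0# × b ≡ 0# × c ≡ 0#)) (T : List Pt)
      (T-complete : ∀ {p} → Boundary p → On a b c p → p ∈ T) where

      -- The list `T` contains every point in which the line meets the triangle. If no two different
      -- ones remain undeleted, one of the two points required on the line belongs to M.
      meets : (∀ {p r} → p ∈ T → r ∈ T → p ≢ r → p ∉ H → r ∉ H → ⊥) → ∃ λ m → On a b c (inner (u m) (v m))
      meets pairs = go (blocks a b c ℓ≢0)
        where
        go : (∃ λ p → ∃ λ r → p ≢ r × Member p × Member r × On a b c p × On a b c r) → ∃ λ m → On a b c (inner (u m) (v m))
        go (_ , _ , _ , inj₂ (m , ≡.refl) , _ , p-on , _) = m , p-on
        go (_ , _ , _ , inj₁ _ , inj₂ (m , ≡.refl) , _ , r-on) = m , r-on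
        go (p , r , p≢r , inj₁ (p-bd , p∉) , inj₁ (r-bd , r∉) , p-on , r-on) = ⊥-elim (pairs (T-complete p-bd p-on) (T-complete r-bd r-on) p≢r p∉ r∉)

      meets-twice : (∀ {p} → p ∈ T → p ∈ H) → ∃ λ m → ∃ λ n → m ≢ n × On a b c (inner (u m) (v m)) × On a b c (inner (u n) (v n))
      meets-twice T⊆H = go (blocks a b c ℓ≢0)
        where
        go : (∃ λ p → ∃ λ r → p ≢ r × Member p × Member r × On a b c p × On a b c r) →
          ∃ λ m → ∃ λ n → m ≢ n × On a b c (inner (u m) (v m)) × On a b c (inner (u n) (v n))
        go (_ , _ , p≢r , inj₂ (m , ≡.refl) , inj₂ (n , ≡.refl) , p-on , r-on) = m , n , (λ { ≡.refl → p≢r ≡.refl }) , p-on , r-on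
        go (_ , _ , _ , inj₁ (p-bd , p∉) , _ , p-on , _) = ⊥-elim (p∉ (T⊆H (T-complete p-bd p-on)))
        go (_ , _ , _ , inj₂ _ , inj₁ (r-bd , r∉) , _ , r-on) = ⊥-elim (r∉ (T⊆H (T-complete r-bd r-on)))

  abstract
    pairs₂ : ∀ {H : List Pt} {x y} → x ∈ H ⊎ y ∈ H → ∀ {p r} → p ∈ x ∷ y ∷ [] → r ∈ x ∷ y ∷ [] → p ≢ r → p ∉ H → r ∉ H → ⊥
    pairs₂ _ (here ≡.refl) (here ≡.refl) p≢r _ _ = p≢r ≡.refl
    pairs₂ _ (there (here ≡.refl)) (there (here ≡.refl)) p≢r _ _ = p≢r ≡.refl
    pairs₂ (inj₁ x∈) (here ≡.refl) _ _ p∉ _ = p∉ x∈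
    pairs₂ (inj₁ x∈) _ (here ≡.refl) _ _ r∉ = r∉ x∈
    pairs₂ (inj₂ y∈) (there (here ≡.refl)) _ _ p∉ _ = p∉ y∈
    pairs₂ (inj₂ y∈) _ (there (here ≡.refl)) _ _ r∉ = r∉ y∈

    both : ∀ {H : List Pt} {x y} → x ∈ H → y ∈ H → ∀ {p} → p ∈ x ∷ y ∷ [] → p ∈ H
    both x∈ y∈ (here ≡.refl) = x∈
    both x∈ y∈ (there (here ≡.refl)) = y∈

    triple : ∀ {H : List Pt} {x y z} → x ∈ H → y ∈ H → z ∈ H → ∀ {p} → p ∈ x ∷ y ∷ z ∷ [] → p ∈ H
    triple x∈ y∈ z∈ (here ≡.refl) = x∈
    triple x∈ y∈ z∈ (there p∈) = both y∈ z∈ p∈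

    pairs₃ : ∀ {H : List Pt} {x y z} → TwoOf (x ∈ H) (y ∈ H) (z ∈ H) → ∀ {p r} → p ∈ x ∷ y ∷ z ∷ [] → r ∈ x ∷ y ∷ z ∷ [] → p ≢ r → p ∉ H → r ∉ H → ⊥
    pairs₃ (inj₁ (x∈ , y∈)) = two x∈ y∈
      where
      two : ∀ {H : List Pt} {x y z} → x ∈ H → y ∈ H → ∀ {p r} → p ∈ x ∷ y ∷ z ∷ [] → r ∈ x ∷ y ∷ z ∷ [] → p ≢ r → p ∉ H → r ∉ H → ⊥
      two x∈ y∈ (here ≡.refl) _ _ p∉ _ = p∉ x∈
      two x∈ y∈ (there (here ≡.refl)) _ _ p∉ _ = p∉ y∈
      two x∈ y∈ _ (here ≡.refl) _ _ r∉ = r∉ x∈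
      two x∈ y∈ _ (there (here ≡.refl)) _ _ r∉ = r∉ y∈
      two x∈ y∈ (there (there (here ≡.refl))) (there (there (here ≡.refl))) p≢r _ _ = p≢r ≡.refl
    pairs₃ (inj₂ (inj₁ (y∈ , z∈))) (here ≡.refl) (here ≡.refl) p≢r _ _ = p≢r ≡.refl
    pairs₃ (inj₂ (inj₁ (y∈ , z∈))) (there p∈) _ _ p∉ _ = p∉ (both y∈ z∈ p∈)
    pairs₃ (inj₂ (inj₁ (y∈ , z∈))) _ (there r∈) _ _ r∉ = r∉ (both y∈ z∈ r∈)
    pairs₃ (inj₂ (inj₂ (z∈ , x∈))) (there (here ≡.refl)) (there (here ≡.refl)) p≢r _ _ = p≢r ≡.refl
    pairs₃ (inj₂ (inj₂ (z∈ , x∈))) (here ≡.refl) _ _ p∉ _ = p∉ x∈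
    pairs₃ (inj₂ (inj₂ (z∈ , x∈))) (there (there (here ≡.refl))) _ _ p∉ _ = p∉ z∈
    pairs₃ (inj₂ (inj₂ (z∈ , x∈))) _ (here ≡.refl) _ _ r∉ = r∉ x∈
    pairs₃ (inj₂ (inj₂ (z∈ , x∈))) _ (there (there (here ≡.refl))) _ _ r∉ = r∉ z∈

    minus-one≢0 : - 1# ≢ 0#
    minus-one≢0 h = 1≢0 (vanish₁ (- 1#) (solve 0 (:1 := (:- :1) :* (:- :1)) ≡.refl) h)

    negative≢0 : ∀ {t} → t ≢ 0# → - t ≢ 0#
    negative≢0 {t} t≢0 h = t≢0 (vanish₁ (- 1#) (solve 1 (λ t → t := (:- :1) :* (:- t)) ≡.refl t) h)

    vertex-line₀ : ∀ {t} → t ≢ 0# → ∀ {p} → Boundary p → On 0# t (- 1#) p → p ∈ vertex 0F ∷ edge 0F t ∷ []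
    vertex-line₀ {t} t≢0 {vertex 0F} _ _ = here ≡.refl
    vertex-line₀ {t} t≢0 {vertex 1F} _ h = ⊥-elim (t≢0 (vanish₁ 1# (solve 1 (λ t → t := :1 :* (:0 :* :0 :+ t :* :1 :+ (:- :1) :* :0)) ≡.refl t) h))
    vertex-line₀ {t} t≢0 {vertex 2F} _ h = ⊥-elim (minus-one≢0 (vanish₁ 1# (solve 1 (λ t → :- :1 := :1 :* (:0 :* :0 :+ t :* :0 :+ (:- :1) :* :1)) ≡.refl t) h))
    vertex-line₀ {t} t≢0 {edge 0F s} _ h = there (here (cong (edge 0F) (sym (equal (vanish₁ 1# (solve 2 (λ t s → t :- s := :1 :* (:0 :* :0 :+ t :* :1 :+ (:- :1) :* s)) ≡.refl t s) h)))))
    vertex-line₀ {t} t≢0 {edge 1F s} _ h = ⊥-elim (minus-one≢0 (vanish₁ 1# (solve 2 (λ t s → :- :1 := :1 :* (:0 :* s :+ t :* :0 :+ (:- :1) :* :1)) ≡.refl t s) h))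
    vertex-line₀ {t} t≢0 {edge 2F s} s≢0 h = ⊥-elim (product-≢0 t≢0 s≢0 (vanish₁ 1# (solve 2 (λ t s → t :* s := :1 :* (:0 :* :1 :+ t :* s :+ (:- :1) :* :0)) ≡.refl t s) h))

    vertex-line₁ : ∀ {t} → t ≢ 0# → ∀ {p} → Boundary p → On 1# 0# (- t) p → p ∈ vertex 1F ∷ edge 1F t ∷ []
    vertex-line₁ {t} t≢0 {vertex 0F} _ h = ⊥-elim (1≢0 (vanish₁ 1# (solve 1 (λ t → :1 := :1 :* (:1 :* :1 :+ :0 :* :0 :+ (:- t) :* :0)) ≡.refl t) h))
    vertex-line₁ {t} t≢0 {vertex 1F} _ _ = here ≡.refl
    vertex-line₁ {t} t≢0 {vertex 2F} _ h = ⊥-elim (negative≢0 t≢0 (vanish₁ 1# (solve 1 (λ t → :- t := :1 :* (:1 :* :0 :+ :0 :* :0 :+ (:- t) :* :1)) ≡.refl t) h))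
    vertex-line₁ {t} t≢0 {edge 0F s} s≢0 h = ⊥-elim (product-≢0 t≢0 s≢0 (vanish₁ (- 1#) (solve 2 (λ t s → t :* s := (:- :1) :* (:1 :* :0 :+ :0 :* :1 :+ (:- t) :* s)) ≡.refl t s) h))
    vertex-line₁ {t} t≢0 {edge 1F s} _ h = there (here (cong (edge 1F) (equal (vanish₁ 1# (solve 2 (λ t s → s :- t := :1 :* (:1 :* s :+ :0 :* :0 :+ (:- t) :* :1)) ≡.refl t s) h))))
    vertex-line₁ {t} t≢0 {edge 2F s} _ h = ⊥-elim (1≢0 (vanish₁ 1# (solve 2 (λ t s → :1 := :1 :* (:1 :* :1 :+ :0 :* s :+ (:- t) :* :0)) ≡.refl t s) h))

    vertex-line₂ : ∀ {t} → t ≢ 0# → ∀ {p} → Boundary p → On t (- 1#) 0# p → p ∈ vertex 2F ∷ edge 2F t ∷ []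
    vertex-line₂ {t} t≢0 {vertex 0F} _ h = ⊥-elim (t≢0 (vanish₁ 1# (solve 1 (λ t → t := :1 :* (t :* :1 :+ (:- :1) :* :0 :+ :0 :* :0)) ≡.refl t) h))
    vertex-line₂ {t} t≢0 {vertex 1F} _ h = ⊥-elim (minus-one≢0 (vanish₁ 1# (solve 1 (λ t → :- :1 := :1 :* (t :* :0 :+ (:- :1) :* :1 :+ :0 :* :0)) ≡.refl t) h))
    vertex-line₂ {t} t≢0 {vertex 2F} _ _ = here ≡.refl
    vertex-line₂ {t} t≢0 {edge 0F s} _ h = ⊥-elim (minus-one≢0 (vanish₁ 1# (solve 2 (λ t s → :- :1 := :1 :* (t :* :0 :+ (:- :1) :* :1 :+ :0 :* s)) ≡.refl t s) h))
    vertex-line₂ {t} t≢0 {edge 1F s} s≢0 h = ⊥-elim (product-≢0 t≢0 s≢0 (vanish₁ 1# (solve 2 (λ t s → t :* s := :1 :* (t :* s :+ (:- :1) :* :0 :+ :0 :* :1)) ≡.refl t s) h))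
    vertex-line₂ {t} t≢0 {edge 2F s} _ h = there (here (cong (edge 2F) (sym (equal (vanish₁ 1# (solve 2 (λ t s → t :- s := :1 :* (t :* :1 :+ (:- :1) :* s :+ :0 :* :0)) ≡.refl t s) h)))))

    -- X + αβY - βZ = 0 passes through (0,1,α) and (β,0,1), and through (1,γ,0) because αβγ = -1.
    generic-line : ∀ {α β γ} → α * β * γ ≡ - 1# → α ≢ 0# → β ≢ 0# → ∀ {p} → Boundary p → On 1# (α * β) (- β) p → p ∈ edge 0F α ∷ edge 1F β ∷ edge 2F γ ∷ []
    generic-line {α} {β} {γ} αβγ α≢0 β≢0 {vertex 0F} _ h = ⊥-elim (1≢0 (vanish₁ 1# (solve 2 (λ α β → :1 := :1 :* (:1 :* :1 :+ (α :* β) :* :0 :+ (:- β) :* :0)) ≡.refl α β) h))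
    generic-line {α} {β} {γ} αβγ α≢0 β≢0 {vertex 1F} _ h = ⊥-elim (product-≢0 α≢0 β≢0 (vanish₁ 1# (solve 2 (λ α β → α :* β := :1 :* (:1 :* :0 :+ (α :* β) :* :1 :+ (:- β) :* :0)) ≡.refl α β) h))
    generic-line {α} {β} {γ} αβγ α≢0 β≢0 {vertex 2F} _ h = ⊥-elim (β≢0 (vanish₁ (- 1#) (solve 2 (λ α β → β := (:- :1) :* (:1 :* :0 :+ (α :* β) :* :0 :+ (:- β) :* :1)) ≡.refl α β) h))
    generic-line {α} {β} {γ} αβγ α≢0 β≢0 {edge 0F s} _ h = here (cong (edge 0F) (equal (cancelˡ β≢0 (vanish₁ (- 1#) (solve 3 (λ α β s → β :* (s :- α) := (:- :1) :* (:1 :* :0 :+ (α :* β) :* :1 :+ (:- β) :* s)) ≡.refl α β s) h))))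
    generic-line {α} {β} {γ} αβγ α≢0 β≢0 {edge 1F s} _ h = there (here (cong (edge 1F) (equal (vanish₁ 1# (solve 3 (λ α β s → s :- β := :1 :* (:1 :* s :+ (α :* β) :* :0 :+ (:- β) :* :1)) ≡.refl α β s) h))))
    generic-line {α} {β} {γ} αβγ α≢0 β≢0 {edge 2F s} _ h = there (there (here (cong (edge 2F) (equal (cancelˡ (product-≢0 α≢0 β≢0) (vanish₂ 1# (- 1#)
      (solve 4 (λ α β γ s → α :* β :* (s :- γ) := :1 :* (:1 :* :1 :+ (α :* β) :* s :+ (:- β) :* :0) :+ (:- :1) :* (α :* β :* γ :- (:- :1))) ≡.refl α β γ s) h (difference αβγ)))))))

    on-vertex-line₀ : ∀ {t u v} → On 0# t (- 1#) (inner u v) → u ≡ t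
    on-vertex-line₀ {t} {u} {v} h = equal (vanish₁ (- 1#) (solve 3 (λ t u v → u :- t := (:- :1) :* (:0 :* (u :* v) :+ t :* :1 :+ (:- :1) :* u)) ≡.refl t u v) h)

    on-vertex-line₁ : ∀ {t u v} → u ≢ 0# → On 1# 0# (- t) (inner u v) → v ≡ t
    on-vertex-line₁ {t} {u} {v} u≢0 h = equal (cancelˡ u≢0 (vanish₁ 1# (solve 3 (λ t u v → u :* (v :- t) := :1 :* (:1 :* (u :* v) :+ :0 :* :1 :+ (:- t) :* u)) ≡.refl t u v) h))

    on-vertex-line₂ : ∀ {t u v} → On t (- 1#) 0# (inner u v) → (u * v) ⁻¹ ≡ t
    on-vertex-line₂ {t} {u} {v} h = sym (⁻¹-unique (equal (vanish₁ 1# (solve 3 (λ t u v → u :* v :* t :- :1 := :1 :* (t :* (u :* v) :+ (:- :1) :* :1 :+ :0 :* u)) ≡.refl t u v) h)))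

    on-generic-line : ∀ {α β u v} → On 1# (α * β) (- β) (inner u v) → β * u ≡ u * v + α * β
    on-generic-line {α} {β} {u} {v} h = equal (vanish₁ (- 1#) (solve 4 (λ α β u v → β :* u :- (u :* v :+ α :* β) := (:- :1) :* (:1 :* (u :* v) :+ (α :* β) :* :1 :+ (:- β) :* u)) ≡.refl α β u v) h)

  marked : Bool → Fin 3 → List Pt
  marked true j = vertex j ∷ []
  marked false _ = []

  marked-length : ∀ s j → length (marked s j) ≡ ♯ s
  marked-length true j = ≡.refl
  marked-length false j = ≡.refl

  marked-∈ : ∀ s j {p} → p ∈ marked s j → p ≡ vertex j × s ≡ true
  marked-∈ true j (here p≡) = p≡ , ≡.refl

  side-points : Fin 3 → Fin 3 → Fin 3 → List Pt
  side-points i j k = map (edge i) nonzero ++ vertex j ∷ vertex k ∷ []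

  module Sides (𝔅 : Blocking) where
    open Blocking 𝔅

    hole-flag : Fin 3 → Bool
    hole-flag i = flag (vertices i H)

    side-holes : Fin 3 → Fin 3 → Fin 3 → List Pt
    side-holes i j k = map (edge i) (edges i H) ++ marked (hole-flag j) j ++ marked (hole-flag k) k

    abstract
      edges-≢0 : ∀ i {t} → t ∈ edges i H → t ≢ 0#
      edges-≢0 i t∈ = H-boundary (edges-∈ i H t∈)

      side-holes⊆H : ∀ i j k {p} → p ∈ side-holes i j k → p ∈ H
      side-holes⊆H i j k p∈ = Sum.[ on-edge , (λ h → Sum.[ at j , at k ] (∈-++⁻ (marked (hole-flag j) j) h)) ] (∈-++⁻ (map (edge i) (edges i H)) p∈)
        where
        on-edge : ∀ {p} → p ∈ map (edge i) (edges i H) → p ∈ H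
        on-edge h = let t , t∈ , p≡ = ∈-map⁻ (edge i) h in subst (_∈ H) (sym p≡) (edges-∈ i H t∈)
        at : ∀ j {p} → p ∈ marked (hole-flag j) j → p ∈ H
        at j h = let p≡ , f = marked-∈ (hole-flag j) j h in subst (_∈ H) (sym p≡) (vertices-∈ j H f)

      side-holes⊆side : ∀ i j k {p} → p ∈ side-holes i j k → p ∈ side-points i j k
      side-holes⊆side i j k p∈ = Sum.[ on-edge , (λ h → ∈-++⁺ʳ (map (edge i) nonzero) (Sum.[ (λ q → here (proj₁ (marked-∈ (hole-flag j) j q))) , (λ q → there (here (proj₁ (marked-∈ (hole-flag k) k q)))) ] (∈-++⁻ (marked (hole-flag j) j) h))) ]
          (∈-++⁻ (map (edge i) (edges i H)) p∈)
        where
        on-edge : ∀ {p} → p ∈ map (edge i) (edges i H) → p ∈ side-points i j k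
        on-edge h = let t , t∈ , p≡ = ∈-map⁻ (edge i) h in ∈-++⁺ˡ (subst (_∈ map (edge i) nonzero) (sym p≡) (∈-map⁺ (edge i) (nonzero-complete (edges-≢0 i t∈))))

      side-holes-unique : ∀ i {j k} → j ≢ k → Unique (side-holes i j k)
      side-holes-unique i {j} {k} j≢k = Uniqueₚ.++⁺ (Uniqueₚ.map⁺ (λ { ≡.refl → ≡.refl }) (edges-unique i H H!)) (Uniqueₚ.++⁺ (single (hole-flag j) j) (single (hole-flag k) k) disjoint) disjoint′
        where
        single : ∀ s j → Unique (marked s j)
        single true j = [] ∷ []
        single false j = []
        same-vertex : ∀ {p} → p ≡ vertex j → p ≡ vertex k → ⊥
        same-vertex ≡.refl ≡.refl = j≢k ≡.refl
        disjoint : ∀ {p} → p ∈ marked (hole-flag j) j × p ∈ marked (hole-flag k) k → ⊥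
        disjoint (h , h′) = same-vertex (proj₁ (marked-∈ (hole-flag j) j h)) (proj₁ (marked-∈ (hole-flag k) k h′))
        edge-vertex : ∀ {p t l} → p ≡ edge i t → p ≡ vertex l → ⊥
        edge-vertex ≡.refl ()
        disjoint′ : ∀ {p} → p ∈ map (edge i) (edges i H) × p ∈ marked (hole-flag j) j ++ marked (hole-flag k) k → ⊥
        disjoint′ (h , h′) = let t , _ , p≡ = ∈-map⁻ (edge i) h in
          Sum.[ (λ q → edge-vertex p≡ (proj₁ (marked-∈ (hole-flag j) j q))) , (λ q → edge-vertex p≡ (proj₁ (marked-∈ (hole-flag k) k q))) ] (∈-++⁻ (marked (hole-flag j) j) h′)

      side-holes-length : ∀ i j k → length (side-holes i j k) ≡ length (edges i H) ℕ.+ (♯ (hole-flag j) ℕ.+ ♯ (hole-flag k))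
      side-holes-length i j k = ≡.trans (Listₚ.length-++ (map (edge i) (edges i H))) (cong₂ ℕ._+_ (Listₚ.length-map (edge i) (edges i H))
        (≡.trans (Listₚ.length-++ (marked (hole-flag j) j)) (cong₂ ℕ._+_ (marked-length (hole-flag j) j) (marked-length (hole-flag k) k))))

      side-points-length : ∀ i j k → length (side-points i j k) ≡ suc (length elements)
      side-points-length i j k = ≡.trans (Listₚ.length-++ (map (edge i) nonzero)) (≡.trans (cong (ℕ._+ 2) (Listₚ.length-map (edge i) nonzero))
        (≡.trans (ℕₚ.+-comm _ 2) (cong suc (sym nonzero-length))))

      -- Two undeleted points and all the deleted ones are different members of a list of q + 1
      -- points.
      side-bound : ∀ i {j k} → j ≢ k → ∀ {p r} → p ≢ r → p ∉ H → r ∉ H → p ∈ side-points i j k → r ∈ side-points i j k →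
        length (edges i H) ℕ.+ (♯ (hole-flag j) ℕ.+ ♯ (hole-flag k)) ℕ.< length elements
      side-bound i {j} {k} j≢k {p} {r} p≢r p∉ r∉ p∈ r∈ = ℕₚ.≤-pred (ℕₚ.≤-trans (ℕₚ.≤-reflexive (cong (λ n → suc (suc n)) (sym (side-holes-length i j k))))
        (ℕₚ.≤-trans (Unique-length-≤ (p ∷ r ∷ side-holes i j k) (side-points i j k)
          ((p≢r ∷ All.tabulate (λ { h ≡.refl → p∉ (side-holes⊆H i j k h) })) ∷ All.tabulate (λ { h ≡.refl → r∉ (side-holes⊆H i j k h) }) ∷ side-holes-unique i j≢k)
          inside) (ℕₚ.≤-reflexive (side-points-length i j k))))
        where
        inside : ∀ {x} → x ∈ p ∷ r ∷ side-holes i j k → x ∈ side-points i j k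
        inside (here ≡.refl) = p∈
        inside (there (here ≡.refl)) = r∈
        inside (there (there h)) = side-holes⊆side i j k h

      on-edge : ∀ i j k {t} → t ≢ 0# → edge i t ∈ side-points i j k
      on-edge i j k t≢0 = ∈-++⁺ˡ (∈-map⁺ (edge i) (nonzero-complete t≢0))

      first-end : ∀ i j k → vertex j ∈ side-points i j k
      first-end i j k = ∈-++⁺ʳ (map (edge i) nonzero) (here ≡.refl)

      second-end : ∀ i j k → vertex k ∈ side-points i j k
      second-end i j k = ∈-++⁺ʳ (map (edge i) nonzero) (there (here ≡.refl))

      only : ∀ {x y z} → 1# * x + 0# * y + 0# * z ≡ 0# → x ≡ 0#
      only {x} {y} {z} h = vanish₁ 1# (solve 3 (λ x y z → x := :1 :* (:1 :* x :+ :0 :* y :+ :0 :* z)) ≡.refl x y z) h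

      only₁ : ∀ {x y z} → 0# * x + 1# * y + 0# * z ≡ 0# → y ≡ 0#
      only₁ {x} {y} {z} h = vanish₁ 1# (solve 3 (λ x y z → y := :1 :* (:0 :* x :+ :1 :* y :+ :0 :* z)) ≡.refl x y z) h

      only₂ : ∀ {x y z} → 0# * x + 0# * y + 1# * z ≡ 0# → z ≡ 0#
      only₂ {x} {y} {z} h = vanish₁ 1# (solve 3 (λ x y z → z := :1 :* (:0 :* x :+ :0 :* y :+ :1 :* z)) ≡.refl x y z) h

      side₀ : ∀ {p} → Boundary p → X p ≡ 0# → p ∈ side-points 0F 1F 2F
      side₀ {vertex 0F} _ h = ⊥-elim (1≢0 h)
      side₀ {vertex 1F} _ _ = first-end 0F 1F 2F
      side₀ {vertex 2F} _ _ = second-end 0F 1F 2F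
      side₀ {edge 0F t} t≢0 _ = on-edge 0F 1F 2F t≢0
      side₀ {edge 1F t} t≢0 h = ⊥-elim (t≢0 h)
      side₀ {edge 2F t} _ h = ⊥-elim (1≢0 h)

      side₁ : ∀ {p} → Boundary p → Y p ≡ 0# → p ∈ side-points 1F 2F 0F
      side₁ {vertex 0F} _ _ = second-end 1F 2F 0F
      side₁ {vertex 1F} _ h = ⊥-elim (1≢0 h)
      side₁ {vertex 2F} _ _ = first-end 1F 2F 0F
      side₁ {edge 0F t} _ h = ⊥-elim (1≢0 h)
      side₁ {edge 1F t} t≢0 _ = on-edge 1F 2F 0F t≢0
      side₁ {edge 2F t} t≢0 h = ⊥-elim (t≢0 h)

      side₂ : ∀ {p} → Boundary p → Z p ≡ 0# → p ∈ side-points 2F 0F 1F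
      side₂ {vertex 0F} _ _ = first-end 2F 0F 1F
      side₂ {vertex 1F} _ _ = second-end 2F 0F 1F
      side₂ {vertex 2F} _ h = ⊥-elim (1≢0 h)
      side₂ {edge 0F t} t≢0 h = ⊥-elim (t≢0 h)
      side₂ {edge 1F t} _ h = ⊥-elim (1≢0 h)
      side₂ {edge 2F t} t≢0 _ = on-edge 2F 0F 1F t≢0

      module _ {a b c} (ℓ≢0 : ¬ (a ≡ 0# × b ≡ 0# × c ≡ 0#)) (avoids : ∀ m → ¬ On a b c (inner (u m) (v m))) where

        two-boundary-points : ∃ λ p → ∃ λ r → p ≢ r × (Boundary p × p ∉ H × On a b c p) × (Boundary r × r ∉ H × On a b c r)
        two-boundary-points = go (blocks a b c ℓ≢0)
          where
          go : (∃ λ p → ∃ λ r → p ≢ r × Member p × Member r × On a b c p × On a b c r) → _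
          go (_ , _ , _ , inj₂ (m , ≡.refl) , _ , p-on , _) = ⊥-elim (avoids m p-on)
          go (_ , _ , _ , _ , inj₂ (m , ≡.refl) , _ , r-on) = ⊥-elim (avoids m r-on)
          go (p , r , p≢r , inj₁ (p-bd , p∉) , inj₁ (r-bd , r∉) , p-on , r-on) = p , r , p≢r , (p-bd , p∉ , p-on) , (r-bd , r∉ , r-on)

      side₀-bound : length (edges 0F H) ℕ.+ (♯ (hole-flag 1F) ℕ.+ ♯ (hole-flag 2F)) ℕ.< length elements
      side₀-bound = let p , r , p≢r , (pb , p∉ , po) , (rb , r∉ , ro) = two-boundary-points {1#} {0#} {0#} (λ h → 1≢0 (proj₁ h)) (λ m h → product-≢0 (u≢0 m) (v≢0 m) (only h)) in
        side-bound 0F (λ ()) p≢r p∉ r∉ (side₀ pb (only po)) (side₀ rb (only ro))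

      side₁-bound : length (edges 1F H) ℕ.+ (♯ (hole-flag 2F) ℕ.+ ♯ (hole-flag 0F)) ℕ.< length elements
      side₁-bound = let p , r , p≢r , (pb , p∉ , po) , (rb , r∉ , ro) = two-boundary-points {0#} {1#} {0#} (λ h → 1≢0 (proj₁ (proj₂ h))) (λ m h → 1≢0 (only₁ h)) in
        side-bound 1F (λ ()) p≢r p∉ r∉ (side₁ pb (only₁ po)) (side₁ rb (only₁ ro))

      side₂-bound : length (edges 2F H) ℕ.+ (♯ (hole-flag 0F) ℕ.+ ♯ (hole-flag 1F)) ℕ.< length elements
      side₂-bound = let p , r , p≢r , (pb , p∉ , po) , (rb , r∉ , ro) = two-boundary-points {0#} {0#} {1#} (λ h → 1≢0 (proj₂ (proj₂ h))) (λ m h → u≢0 m (only₂ h)) in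
        side-bound 2F (λ ()) p≢r p∉ r∉ (side₂ pb (only₂ po)) (side₂ rb (only₂ ro))

    config : Config
    config = record
      { u = u ; v = v ; w = w 𝔅
      ; uvw = λ m → *-inverse (u m * v m) (product-≢0 (u≢0 m) (v≢0 m))
      ; separated = separated
      ; A = edges 0F H ; B = edges 1F H ; C = edges 2F H
      ; A! = edges-unique 0F H H! ; B! = edges-unique 1F H H! ; C! = edges-unique 2F H H!
      ; A≢0 = edges-≢0 0F ; B≢0 = edges-≢0 1F ; C≢0 = edges-≢0 2F
      ; a = hole-flag 0F ; b = hole-flag 1F ; c = hole-flag 2F
      ; size = ≡.trans (cong (length (edges 0F H) ℕ.+ length (edges 1F H) ℕ.+ length (edges 2F H) ℕ.+_)
          (cong₂ ℕ._+_ (cong₂ ℕ._+_ (vertices-flag 0F H H!) (vertices-flag 1F H H!)) (vertices-flag 2F H H!))) (≡.trans (total-length H H-boundary) H-length)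
      ; sideA = side₀-bound ; sideB = side₁-bound ; sideC = side₂-bound
      ; vertexA = (λ t≢0 h → Product.map₂ on-vertex-line₀ (meets 𝔅 (ℓ₀ t≢0) _ (vertex-line₀ t≢0) (pairs₂ (hole 0F h))))
                , (λ t∈ f → Product.map₂ (Product.map₂ (Product.map₂ (Product.map on-vertex-line₀ on-vertex-line₀)))
                    (meets-twice 𝔅 (ℓ₀ (edges-≢0 0F t∈)) _ (vertex-line₀ (edges-≢0 0F t∈)) (both (vertices-∈ 0F H f) (edges-∈ 0F H t∈))))
      ; vertexB = (λ t≢0 h → Product.map₂ (λ {m} → on-vertex-line₁ (u≢0 m)) (meets 𝔅 ℓ₁ _ (vertex-line₁ t≢0) (pairs₂ (hole 1F h))))
                , (λ t∈ f → let m , n , m≢n , h , h′ = meets-twice 𝔅 ℓ₁ _ (vertex-line₁ (edges-≢0 1F t∈)) (both (vertices-∈ 1F H f) (edges-∈ 1F H t∈)) in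
                    m , n , m≢n , on-vertex-line₁ (u≢0 m) h , on-vertex-line₁ (u≢0 n) h′)
      ; vertexC = (λ t≢0 h → Product.map₂ on-vertex-line₂ (meets 𝔅 ℓ₂ _ (vertex-line₂ t≢0) (pairs₂ (hole 2F h))))
                , (λ t∈ f → let m , n , m≢n , h , h′ = meets-twice 𝔅 ℓ₂ _ (vertex-line₂ (edges-≢0 2F t∈)) (both (vertices-∈ 2F H f) (edges-∈ 2F H t∈)) in
                    m , n , m≢n , on-vertex-line₂ h , on-vertex-line₂ h′)
      ; join = λ αβγ two → Product.map₂ on-generic-line
          (meets 𝔅 ℓ _ (generic-line αβγ (α≢0 αβγ) (β≢0 αβγ)) (pairs₃ (holes two)))
      ; join₃ = λ αβγ α∈ β∈ γ∈ → let m , n , m≢n , h , h′ = meets-twice 𝔅 ℓ _ (generic-line αβγ (α≢0 αβγ) (β≢0 αβγ))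
                                      (triple (edges-∈ 0F H α∈) (edges-∈ 1F H β∈) (edges-∈ 2F H γ∈)) in
          m , n , m≢n , on-generic-line h , on-generic-line h′ }
      where
      ℓ₀ : ∀ {t} → t ≢ 0# → ¬ (0# ≡ 0# × t ≡ 0# × - 1# ≡ 0#)
      ℓ₀ t≢0 h = t≢0 (proj₁ (proj₂ h))
      ℓ₁ : ∀ {t} → ¬ (1# ≡ 0# × 0# ≡ 0# × - t ≡ 0#)
      ℓ₁ h = 1≢0 (proj₁ h)
      ℓ₂ : ∀ {t} → ¬ (t ≡ 0# × - 1# ≡ 0# × 0# ≡ 0#)
      ℓ₂ h = minus-one≢0 (proj₁ (proj₂ h))
      ℓ : ∀ {s t} → ¬ (1# ≡ 0# × s ≡ 0# × t ≡ 0#)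
      ℓ h = 1≢0 (proj₁ h)
      hole : ∀ i {t} → t ∈ edges i H ⊎ hole-flag i ≡ true → vertex i ∈ H ⊎ edge i t ∈ H
      hole i (inj₁ t∈) = inj₂ (edges-∈ i H t∈)
      hole i (inj₂ f) = inj₁ (vertices-∈ i H f)
      holes : ∀ {α β γ} → TwoOf (α ∈ edges 0F H) (β ∈ edges 1F H) (γ ∈ edges 2F H) → TwoOf (edge 0F α ∈ H) (edge 1F β ∈ H) (edge 2F γ ∈ H)
      holes (inj₁ (p , q)) = inj₁ (edges-∈ 0F H p , edges-∈ 1F H q)
      holes (inj₂ (inj₁ (p , q))) = inj₂ (inj₁ (edges-∈ 1F H p , edges-∈ 2F H q))
      holes (inj₂ (inj₂ (p , q))) = inj₂ (inj₂ (edges-∈ 2F H p , edges-∈ 0F H q))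
      α≢0 : ∀ {α β γ} → α * β * γ ≡ - 1# → α ≢ 0#
      α≢0 {β = β} {γ} h ≡.refl = minus-one≢0 (≡.trans (sym h) (solve 2 (λ β γ → :0 :* β :* γ := :0) ≡.refl β γ))
      β≢0 : ∀ {α β γ} → α * β * γ ≡ - 1# → β ≢ 0#
      β≢0 {α} {γ = γ} h ≡.refl = minus-one≢0 (≡.trans (sym h) (solve 2 (λ α γ → α :* :0 :* γ := :0) ≡.refl α γ))

-- Linear algebra in three dimensions.

module LinearAlgebra (𝔽 : FinField) where
  open FinField 𝔽
  open FieldTheory 𝔽

  Vec₃ : Set
  Vec₃ = K × K × K

  infix 8 _∙_
  _∙_ : Vec₃ → Vec₃ → K
  (a , b , c) ∙ (x , y , z) = a * x + b * y + c * z

  det : Vec₃ → Vec₃ → Vec₃ → K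
  det (a , b , c) (a′ , b′ , c′) (a″ , b″ , c″) =
    a * (b′ * c″ - c′ * b″) + b * (c′ * a″ - a′ * c″) + c * (a′ * b″ - b′ * a″)

  _·_ : K → Vec₃ → Vec₃
  k · (x , y , z) = k * x , k * y , k * z

  abstract
    -- Cramer's rule: the cofactors are the entries of the adjugate matrix, so the determinant times
    -- each coordinate vanishes.
    frame-kernel : ∀ {f g h : Vec₃} → det f g h ≢ 0# → ∀ {x y z} → f ∙ (x , y , z) ≡ 0# → g ∙ (x , y , z) ≡ 0# → h ∙ (x , y , z) ≡ 0# →
      x ≡ 0# × y ≡ 0# × z ≡ 0#
    frame-kernel {a , b , c} {a′ , b′ , c′} {a″ , b″ , c″} d≢0 {x} {y} {z} h₁ h₂ h₃ =
      cancelˡ d≢0 (vanish₃ (b′ * c″ - c′ * b″) (c * b″ - b * c″) (b * c′ - c * b′)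
        (solve 12 (λ a b c a′ b′ c′ a″ b″ c″ x y z →
          (a :* (b′ :* c″ :- c′ :* b″) :+ b :* (c′ :* a″ :- a′ :* c″) :+ c :* (a′ :* b″ :- b′ :* a″)) :* x :=
          (b′ :* c″ :- c′ :* b″) :* (a :* x :+ b :* y :+ c :* z) :+ (c :* b″ :- b :* c″) :* (a′ :* x :+ b′ :* y :+ c′ :* z) :+
          (b :* c′ :- c :* b′) :* (a″ :* x :+ b″ :* y :+ c″ :* z)) ≡.refl a b c a′ b′ c′ a″ b″ c″ x y z) h₁ h₂ h₃) ,
      cancelˡ d≢0 (vanish₃ (c′ * a″ - a′ * c″) (a * c″ - c * a″) (c * a′ - a * c′)
        (solve 12 (λ a b c a′ b′ c′ a″ b″ c″ x y z →
          (a :* (b′ :* c″ :- c′ :* b″) :+ b :* (c′ :* a″ :- a′ :* c″) :+ c :* (a′ :* b″ :- b′ :* a″)) :* y :=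
          (c′ :* a″ :- a′ :* c″) :* (a :* x :+ b :* y :+ c :* z) :+ (a :* c″ :- c :* a″) :* (a′ :* x :+ b′ :* y :+ c′ :* z) :+
          (c :* a′ :- a :* c′) :* (a″ :* x :+ b″ :* y :+ c″ :* z)) ≡.refl a b c a′ b′ c′ a″ b″ c″ x y z) h₁ h₂ h₃) ,
      cancelˡ d≢0 (vanish₃ (a′ * b″ - b′ * a″) (b * a″ - a * b″) (a * b′ - b * a′)
        (solve 12 (λ a b c a′ b′ c′ a″ b″ c″ x y z →
          (a :* (b′ :* c″ :- c′ :* b″) :+ b :* (c′ :* a″ :- a′ :* c″) :+ c :* (a′ :* b″ :- b′ :* a″)) :* z :=
          (a′ :* b″ :- b′ :* a″) :* (a :* x :+ b :* y :+ c :* z) :+ (b :* a″ :- a :* b″) :* (a′ :* x :+ b′ :* y :+ c′ :* z) :+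
          (a :* b′ :- b :* a′) :* (a″ :* x :+ b″ :* y :+ c″ :* z)) ≡.refl a b c a′ b′ c′ a″ b″ c″ x y z) h₁ h₂ h₃)

    pairing-difference : ∀ f {k x y z x′ y′ z′} → f ∙ (x′ , y′ , z′) ≡ k * f ∙ (x , y , z) → f ∙ (x′ - k * x , y′ - k * y , z′ - k * z) ≡ 0#
    pairing-difference (a , b , c) {k} {x} {y} {z} {x′} {y′} {z′} h = vanish₁ 1#
      (solve 10 (λ a b c k x y z x′ y′ z′ → a :* (x′ :- k :* x) :+ b :* (y′ :- k :* y) :+ c :* (z′ :- k :* z) :=
        :1 :* ((a :* x′ :+ b :* y′ :+ c :* z′) :- k :* (a :* x :+ b :* y :+ c :* z))) ≡.refl a b c k x y z x′ y′ z′) (difference h)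

    frame-proportional : ∀ {f g h : Vec₃} → det f g h ≢ 0# → ∀ {k p r} → f ∙ r ≡ k * f ∙ p → g ∙ r ≡ k * g ∙ p → h ∙ r ≡ k * h ∙ p → r ≡ k · p
    frame-proportional {f} {g} {h} d≢0 {k} {x , y , z} {x′ , y′ , z′} h₁ h₂ h₃ =
      let dx , dy , dz = frame-kernel {f} {g} {h} d≢0 (pairing-difference f h₁) (pairing-difference g h₂) (pairing-difference h h₃)
      in cong₂ _,_ (equal dx) (cong₂ _,_ (equal dy) (equal dz))

    det-degenerate₁ : ∀ p r → det p p r ≡ 0#
    det-degenerate₁ (a , b , c) (x , y , z) = solve 6 (λ a b c x y z →
      a :* (b :* z :- c :* y) :+ b :* (c :* x :- a :* z) :+ c :* (a :* y :- b :* x) := :0) ≡.refl a b c x y z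

    det-cycle : ∀ p q r → det q r p ≡ det p q r
    det-cycle (a , b , c) (a′ , b′ , c′) (a″ , b″ , c″) = solve 9 (λ a b c a′ b′ c′ a″ b″ c″ →
      a′ :* (b″ :* c :- c″ :* b) :+ b′ :* (c″ :* a :- a″ :* c) :+ c′ :* (a″ :* b :- b″ :* a) :=
      a :* (b′ :* c″ :- c′ :* b″) :+ b :* (c′ :* a″ :- a′ :* c″) :+ c :* (a′ :* b″ :- b′ :* a″)) ≡.refl a b c a′ b′ c′ a″ b″ c″

    det-swap : ∀ p q r → det p r q ≡ - det p q r
    det-swap (a , b , c) (a′ , b′ , c′) (a″ , b″ , c″) = solve 9 (λ a b c a′ b′ c′ a″ b″ c″ →
      a :* (b″ :* c′ :- c″ :* b′) :+ b :* (c″ :* a′ :- a″ :* c′) :+ c :* (a″ :* b′ :- b″ :* a′) :=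
      :- (a :* (b′ :* c″ :- c′ :* b″) :+ b :* (c′ :* a″ :- a′ :* c″) :+ c :* (a′ :* b″ :- b′ :* a″))) ≡.refl a b c a′ b′ c′ a″ b″ c″

-- Canonical representatives of projective points.

module Normalisation (𝔽 : FinField) where
  open FinField 𝔽
  open FieldTheory 𝔽
  open TrianglePlane 𝔽
  open LinearAlgebra 𝔽

  vec : Pt → Vec₃
  vec p = X p , Y p , Z p

  Valid : Pt → Set
  Valid (vertex _) = ⊤
  Valid (edge _ t) = t ≢ 0#
  Valid (inner u v) = u ≢ 0# × v ≢ 0#

  NonZero : Vec₃ → Set
  NonZero (x , y , z) = ¬ (x ≡ 0# × y ≡ 0# × z ≡ 0#)

  -- The ratios that survive depend on which coordinates vanish. Recording only these makes
  -- proportional vectors equal as elements of `Pt`, so that points can be listed and counted. The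
  -- zero vector receives a dummy value.
  classify : ∀ x y z → Dec (x ≡ 0#) → Dec (y ≡ 0#) → Dec (z ≡ 0#) → Pt
  classify x y z (no _) (no _) (no _) = inner (z * y ⁻¹) (x * z ⁻¹)
  classify x y z (yes _) (no _) (no _) = edge 0F (z * y ⁻¹)
  classify x y z (no _) (yes _) (no _) = edge 1F (x * z ⁻¹)
  classify x y z (no _) (no _) (yes _) = edge 2F (y * x ⁻¹)
  classify x y z _ (yes _) (yes _) = vertex 0F
  classify x y z (yes _) (no _) (yes _) = vertex 1F
  classify x y z (yes _) (yes _) (no _) = vertex 2F

  point : Vec₃ → Pt
  point (x , y , z) = classify x y z (x ≟ 0#) (y ≟ 0#) (z ≟ 0#)

  abstract
    ratio-≢0 : ∀ {x y} → x ≢ 0# → y ≢ 0# → x * y ⁻¹ ≢ 0#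
    ratio-≢0 x≢0 y≢0 = product-≢0 x≢0 (⁻¹-≢0 y≢0)

    ratio-scale : ∀ {k x y} → k ≢ 0# → y ≢ 0# → (k * x) * (k * y) ⁻¹ ≡ x * y ⁻¹
    ratio-scale {k} {x} {y} k≢0 y≢0 = equal (cancelˡ (product-≢0 k≢0 y≢0) (vanish₂ (k * x) (- (k * x))
      (solve 5 (λ k x y y′ ky′ → k :* y :* ((k :* x) :* ky′ :- x :* y′) := (k :* x) :* (k :* y :* ky′ :- :1) :+ (:- (k :* x)) :* (y :* y′ :- :1)) ≡.refl k x y (y ⁻¹) ((k * y) ⁻¹))
      (difference (*-inverse (k * y) (product-≢0 k≢0 y≢0))) (difference (*-inverse y y≢0))))

    ratio-cancel : ∀ {x y} → y ≢ 0# → y * (x * y ⁻¹) ≡ x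
    ratio-cancel {x} {y} y≢0 = equal (vanish₁ x (solve 3 (λ x y y′ → y :* (x :* y′) :- x := x :* (y :* y′ :- :1)) ≡.refl x y (y ⁻¹)) (difference (*-inverse y y≢0)))

    divide-one : ∀ x → x * 1# ⁻¹ ≡ x
    divide-one x = ≡.trans (cong (x *_) (sym (⁻¹-unique (*-identityˡ 1#)))) (*-identityʳ x)

    classify-valid : ∀ {x y z} (d : Dec (x ≡ 0#)) (e : Dec (y ≡ 0#)) (f : Dec (z ≡ 0#)) → Valid (classify x y z d e f)
    classify-valid (no x≢0) (no y≢0) (no z≢0) = ratio-≢0 z≢0 y≢0 , ratio-≢0 x≢0 z≢0
    classify-valid (yes _) (no y≢0) (no z≢0) = ratio-≢0 z≢0 y≢0
    classify-valid (no x≢0) (yes _) (no z≢0) = ratio-≢0 x≢0 z≢0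
    classify-valid (no x≢0) (no y≢0) (yes _) = ratio-≢0 y≢0 x≢0
    classify-valid (yes _) (yes _) (yes _) = tt
    classify-valid (no _) (yes _) (yes _) = tt
    classify-valid (yes _) (no _) (yes _) = tt
    classify-valid (yes _) (yes _) (no _) = tt

    classify-scale : ∀ {k x y z} → k ≢ 0# → (d : Dec (x ≡ 0#)) (e : Dec (y ≡ 0#)) (f : Dec (z ≡ 0#))
      (d′ : Dec (k * x ≡ 0#)) (e′ : Dec (k * y ≡ 0#)) (f′ : Dec (k * z ≡ 0#)) →
      classify (k * x) (k * y) (k * z) d′ e′ f′ ≡ classify x y z d e f
    classify-scale {k} k≢0 (yes ≡.refl) e f (no n) e′ f′ = ⊥-elim (n (zeroʳ k))
    classify-scale {k} k≢0 d (yes ≡.refl) f d′ (no n) f′ = ⊥-elim (n (zeroʳ k))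
    classify-scale {k} k≢0 d e (yes ≡.refl) d′ e′ (no n) = ⊥-elim (n (zeroʳ k))
    classify-scale k≢0 (no x≢0) e f (yes h) e′ f′ = ⊥-elim (x≢0 (cancelˡ k≢0 h))
    classify-scale k≢0 d (no y≢0) f d′ (yes h) f′ = ⊥-elim (y≢0 (cancelˡ k≢0 h))
    classify-scale k≢0 d e (no z≢0) d′ e′ (yes h) = ⊥-elim (z≢0 (cancelˡ k≢0 h))
    classify-scale k≢0 (no x≢0) (no y≢0) (no z≢0) (no _) (no _) (no _) = cong₂ inner (ratio-scale k≢0 y≢0) (ratio-scale k≢0 z≢0)
    classify-scale k≢0 (yes _) (no y≢0) (no z≢0) (yes _) (no _) (no _) = cong (edge 0F) (ratio-scale k≢0 y≢0)
    classify-scale k≢0 (no x≢0) (yes _) (no z≢0) (no _) (yes _) (no _) = cong (edge 1F) (ratio-scale k≢0 z≢0)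
    classify-scale k≢0 (no x≢0) (no y≢0) (yes _) (no _) (no _) (yes _) = cong (edge 2F) (ratio-scale k≢0 x≢0)
    classify-scale k≢0 (yes _) (yes _) (yes _) (yes _) (yes _) (yes _) = ≡.refl
    classify-scale k≢0 (no _) (yes _) (yes _) (no _) (yes _) (yes _) = ≡.refl
    classify-scale k≢0 (yes _) (no _) (yes _) (yes _) (no _) (yes _) = ≡.refl
    classify-scale k≢0 (yes _) (yes _) (no _) (yes _) (yes _) (no _) = ≡.refl

    point-scale : ∀ {k} v → k ≢ 0# → point (k · v) ≡ point v
    point-scale (x , y , z) k≢0 = classify-scale k≢0 (x ≟ 0#) (y ≟ 0#) (z ≟ 0#) _ _ _

    classify-vec : ∀ {x y z} (d : Dec (x ≡ 0#)) (e : Dec (y ≡ 0#)) (f : Dec (z ≡ 0#)) → NonZero (x , y , z) →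
      ∃ λ k → k ≢ 0# × (x , y , z) ≡ k · vec (classify x y z d e f)
    classify-vec {x} {y} {z} (no x≢0) (no y≢0) (no z≢0) _ = y , y≢0 , triple
        (sym (equal (vanish₂ (x * (z * z ⁻¹)) x (solve 5 (λ x y z y′ z′ → y :* (z :* y′ :* (x :* z′)) :- x := (x :* (z :* z′)) :* (y :* y′ :- :1) :+ x :* (z :* z′ :- :1)) ≡.refl x y z (y ⁻¹) (z ⁻¹))
          (difference (*-inverse y y≢0)) (difference (*-inverse z z≢0)))))
        (sym (*-identityʳ y)) (sym (ratio-cancel y≢0))
      where
      triple : ∀ {a b c a′ b′ c′ : K} → a ≡ a′ → b ≡ b′ → c ≡ c′ → (a , b , c) ≡ (a′ , b′ , c′)
      triple ≡.refl ≡.refl ≡.refl = ≡.refl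
    classify-vec {x} {y} {z} (yes ≡.refl) (no y≢0) (no z≢0) _ = y , y≢0 , cong₂ _,_ (sym (zeroʳ y)) (cong₂ _,_ (sym (*-identityʳ y)) (sym (ratio-cancel y≢0)))
    classify-vec {x} {y} {z} (no x≢0) (yes ≡.refl) (no z≢0) _ = z , z≢0 , cong₂ _,_ (sym (ratio-cancel z≢0)) (cong₂ _,_ (sym (zeroʳ z)) (sym (*-identityʳ z)))
    classify-vec {x} {y} {z} (no x≢0) (no y≢0) (yes ≡.refl) _ = x , x≢0 , cong₂ _,_ (sym (*-identityʳ x)) (cong₂ _,_ (sym (ratio-cancel x≢0)) (sym (zeroʳ x)))
    classify-vec (yes x≡0) (yes y≡0) (yes z≡0) nz = ⊥-elim (nz (x≡0 , y≡0 , z≡0))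
    classify-vec {x} (no x≢0) (yes ≡.refl) (yes ≡.refl) _ = x , x≢0 , cong₂ _,_ (sym (*-identityʳ x)) (cong₂ _,_ (sym (zeroʳ x)) (sym (zeroʳ x)))
    classify-vec {y = y} (yes ≡.refl) (no y≢0) (yes ≡.refl) _ = y , y≢0 , cong₂ _,_ (sym (zeroʳ y)) (cong₂ _,_ (sym (*-identityʳ y)) (sym (zeroʳ y)))
    classify-vec {z = z} (yes ≡.refl) (yes ≡.refl) (no z≢0) _ = z , z≢0 , cong₂ _,_ (sym (zeroʳ z)) (cong₂ _,_ (sym (zeroʳ z)) (sym (*-identityʳ z)))

    point-vec : ∀ v → NonZero v → ∃ λ k → k ≢ 0# × v ≡ k · vec (point v)
    point-vec (x , y , z) = classify-vec (x ≟ 0#) (y ≟ 0#) (z ≟ 0#)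

    vec-point : ∀ {p} → Valid p → point (vec p) ≡ p
    vec-point {vertex 0F} _ = go (1# ≟ 0#) (0# ≟ 0#) (0# ≟ 0#)
      where
      go : ∀ d e f → classify 1# 0# 0# d e f ≡ vertex 0F
      go d (no n) f = ⊥-elim (n ≡.refl)
      go d (yes _) (no n) = ⊥-elim (n ≡.refl)
      go (yes h) (yes _) (yes _) = ≡.refl
      go (no _) (yes _) (yes _) = ≡.refl
    vec-point {vertex 1F} _ = go (0# ≟ 0#) (1# ≟ 0#) (0# ≟ 0#)
      where
      go : ∀ d e f → classify 0# 1# 0# d e f ≡ vertex 1F
      go (no n) e f = ⊥-elim (n ≡.refl)
      go (yes _) e (no n) = ⊥-elim (n ≡.refl)
      go (yes _) (yes h) (yes _) = ⊥-elim (1≢0 h)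
      go (yes _) (no _) (yes _) = ≡.refl
    vec-point {vertex 2F} _ = go (0# ≟ 0#) (0# ≟ 0#) (1# ≟ 0#)
      where
      go : ∀ d e f → classify 0# 0# 1# d e f ≡ vertex 2F
      go (no n) e f = ⊥-elim (n ≡.refl)
      go (yes _) (no n) f = ⊥-elim (n ≡.refl)
      go (yes _) (yes _) (yes h) = ⊥-elim (1≢0 h)
      go (yes _) (yes _) (no _) = ≡.refl
    vec-point {edge 0F t} t≢0 = go (0# ≟ 0#) (1# ≟ 0#) (t ≟ 0#)
      where
      go : ∀ d e f → classify 0# 1# t d e f ≡ edge 0F t
      go (no n) e f = ⊥-elim (n ≡.refl)
      go (yes _) (yes h) f = ⊥-elim (1≢0 h)
      go (yes _) (no _) (yes h) = ⊥-elim (t≢0 h)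
      go (yes _) (no _) (no _) = cong (edge 0F) (divide-one t)
    vec-point {edge 1F t} t≢0 = go (t ≟ 0#) (0# ≟ 0#) (1# ≟ 0#)
      where
      go : ∀ d e f → classify t 0# 1# d e f ≡ edge 1F t
      go d (no n) f = ⊥-elim (n ≡.refl)
      go d (yes _) (yes h) = ⊥-elim (1≢0 h)
      go (yes h) (yes _) (no _) = ⊥-elim (t≢0 h)
      go (no _) (yes _) (no _) = cong (edge 1F) (divide-one t)
    vec-point {edge 2F t} t≢0 = go (1# ≟ 0#) (t ≟ 0#) (0# ≟ 0#)
      where
      go : ∀ d e f → classify 1# t 0# d e f ≡ edge 2F t
      go d e (no n) = ⊥-elim (n ≡.refl)
      go (yes h) e (yes _) = ⊥-elim (1≢0 h)
      go (no _) (yes h) (yes _) = ⊥-elim (t≢0 h)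
      go (no _) (no _) (yes _) = cong (edge 2F) (divide-one t)
    vec-point {inner u v} (u≢0 , v≢0) = go ((u * v) ≟ 0#) (1# ≟ 0#) (u ≟ 0#)
      where
      go : ∀ d e f → classify (u * v) 1# u d e f ≡ inner u v
      go (yes h) e f = ⊥-elim (product-≢0 u≢0 v≢0 h)
      go (no _) (yes h) f = ⊥-elim (1≢0 h)
      go (no _) (no _) (yes h) = ⊥-elim (u≢0 h)
      go (no _) (no _) (no _) = cong₂ inner (divide-one u) (≡.trans (*-assoc u v (u ⁻¹)) (ratio-cancel u≢0))

    vec-proportional : ∀ {p r k} → Valid p → Valid r → k ≢ 0# → vec r ≡ k · vec p → r ≡ p
    vec-proportional {p} {r} {k} p-ok r-ok k≢0 h = ≡.trans (sym (vec-point r-ok)) (≡.trans (cong point h) (≡.trans (point-scale (vec p) k≢0) (vec-point p-ok)))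

    vec-nonzero : ∀ {p} → Valid p → NonZero (vec p)
    vec-nonzero {vertex 0F} _ h = 1≢0 (proj₁ h)
    vec-nonzero {vertex 1F} _ h = 1≢0 (proj₁ (proj₂ h))
    vec-nonzero {vertex 2F} _ h = 1≢0 (proj₂ (proj₂ h))
    vec-nonzero {edge 0F _} _ h = 1≢0 (proj₁ (proj₂ h))
    vec-nonzero {edge 1F _} _ h = 1≢0 (proj₂ (proj₂ h))
    vec-nonzero {edge 2F _} _ h = 1≢0 (proj₁ h)
    vec-nonzero {inner _ _} _ h = 1≢0 (proj₁ (proj₂ h))

-- Finite sums and triple sums modulo three.

module FiniteSums where

  ∑ : {A : Set} → List A → (A → ℕ) → ℕ
  ∑ [] f = 0
  ∑ (x ∷ L) f = f x ℕ.+ ∑ L f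

  abstract
    ∑-cong : {A : Set} (L : List A) {f g : A → ℕ} → (∀ {x} → x ∈ L → f x ≡ g x) → ∑ L f ≡ ∑ L g
    ∑-cong [] h = ≡.refl
    ∑-cong (x ∷ L) h = cong₂ ℕ._+_ (h (here ≡.refl)) (∑-cong L (h ∘ there))

    ∑-+ : {A : Set} (L : List A) (f g : A → ℕ) → ∑ L (λ x → f x ℕ.+ g x) ≡ ∑ L f ℕ.+ ∑ L g
    ∑-+ [] f g = ≡.refl
    ∑-+ (x ∷ L) f g = ≡.trans (cong (f x ℕ.+ g x ℕ.+_) (∑-+ L f g)) (shuffle (f x) (g x) (∑ L f) (∑ L g))
      where
      shuffle : ∀ a b c d → a ℕ.+ b ℕ.+ (c ℕ.+ d) ≡ a ℕ.+ c ℕ.+ (b ℕ.+ d)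
      shuffle = solve-∀

    ∑-const : {A : Set} (L : List A) {f : A → ℕ} {c : ℕ} → (∀ {x} → x ∈ L → f x ≡ c) → ∑ L f ≡ length L ℕ.* c
    ∑-const [] h = ≡.refl
    ∑-const (x ∷ L) h = cong₂ ℕ._+_ (h (here ≡.refl)) (∑-const L (h ∘ there))

    ∑-↭ : {A : Set} {L M : List A} (f : A → ℕ) → L ↭ M → ∑ L f ≡ ∑ M f
    ∑-↭ f refl = ≡.refl
    ∑-↭ f (prep x p) = cong (f x ℕ.+_) (∑-↭ f p)
    ∑-↭ f (swap {xs} {ys} x y p) = ≡.trans (cong (λ n → f x ℕ.+ (f y ℕ.+ n)) (∑-↭ f p)) (exchange (f x) (f y) (∑ ys f))
      where
      exchange : ∀ a b c → a ℕ.+ (b ℕ.+ c) ≡ b ℕ.+ (a ℕ.+ c)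
      exchange = solve-∀
    ∑-↭ f (trans p q) = ≡.trans (∑-↭ f p) (∑-↭ f q)

    ∑-map : {A B : Set} (g : A → B) (L : List A) (f : B → ℕ) → ∑ (map g L) f ≡ ∑ L (λ x → f (g x))
    ∑-map g [] f = ≡.refl
    ∑-map g (x ∷ L) f = cong (f (g x) ℕ.+_) (∑-map g L f)

    -- The cyclic group of order 3 acts freely on the triples off the diagonal.
    triple-sum : {A : Set} (T : A → A → A → ℕ) → (∀ x y z → T x y z ≡ T y z x) → (∀ x y z → T x y z ≡ T y x z) → (∀ x → T x x x ≡ 1) →
      ∀ L → ∃ λ k → ∑ L (λ x → ∑ L (λ y → ∑ L (T x y))) ≡ length L ℕ.+ 3 ℕ.* k
    triple-sum T cyc swp dia [] = 0 , ≡.refl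
    triple-sum {A} T cyc swp dia (x ∷ L) = let k , h = triple-sum T cyc swp dia L in d ℕ.+ P ℕ.+ k ,
      ≡.trans (cong₂ ℕ._+_ first rest) (collect (length L) d P k _ h)
      where
      d P : ℕ
      d = ∑ L (T x x)
      P = ∑ L (λ y → ∑ L (T x y))
      first : ∑ (x ∷ L) (λ y → ∑ (x ∷ L) (T x y)) ≡ 1 ℕ.+ d ℕ.+ (d ℕ.+ P)
      first = cong₂ ℕ._+_ (cong (ℕ._+ d) (dia x)) (≡.trans (∑-+ L (λ y → T x y x) (λ y → ∑ L (T x y)))
        (cong (ℕ._+ P) (∑-cong L (λ {y} _ → ≡.trans (cyc x y x) (cyc y x x)))))
      rest : ∑ L (λ a → ∑ (x ∷ L) (λ y → ∑ (x ∷ L) (T a y))) ≡ d ℕ.+ P ℕ.+ (P ℕ.+ ∑ L (λ a → ∑ L (λ y → ∑ L (T a y))))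
      rest = ≡.trans (∑-+ L (λ a → T a x x ℕ.+ ∑ L (T a x)) (λ a → ∑ L (λ y → T a y x ℕ.+ ∑ L (T a y)))) (cong₂ ℕ._+_
        (≡.trans (∑-+ L (λ a → T a x x) (λ a → ∑ L (T a x))) (cong₂ ℕ._+_ (∑-cong L (λ {a} _ → cyc a x x)) (∑-cong L (λ {a} _ → ∑-cong L (λ {z} _ → swp a x z)))))
        (≡.trans (∑-cong L (λ {a} _ → ∑-+ L (λ y → T a y x) (λ y → ∑ L (T a y)))) (≡.trans (∑-+ L (λ a → ∑ L (λ y → T a y x)) (λ a → ∑ L (λ y → ∑ L (T a y))))
          (cong (ℕ._+ ∑ L (λ a → ∑ L (λ y → ∑ L (T a y)))) (∑-cong L (λ {a} _ → ∑-cong L (λ {y} _ → ≡.trans (cyc a y x) (cyc y x a))))))))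
      collect : ∀ l d P k S → S ≡ l ℕ.+ 3 ℕ.* k → 1 ℕ.+ d ℕ.+ (d ℕ.+ P) ℕ.+ (d ℕ.+ P ℕ.+ (P ℕ.+ S)) ≡ suc l ℕ.+ 3 ℕ.* (d ℕ.+ P ℕ.+ k)
      collect l d P k _ ≡.refl = arithmetic l d P k
        where
        arithmetic : ∀ l d P k → 1 ℕ.+ d ℕ.+ (d ℕ.+ P) ℕ.+ (d ℕ.+ P ℕ.+ (P ℕ.+ (l ℕ.+ 3 ℕ.* k))) ≡ suc l ℕ.+ 3 ℕ.* (d ℕ.+ P ℕ.+ k)
        arithmetic = solve-∀

module NineInFive {A : Set} (_≟_ : ∀ (x y : A) → Dec (x ≡ y)) where
  open Counting _≟_
  open FiniteSums

  abstract
    indicator-sym : ∀ {x y : A} (d : Dec (x ≡ y)) (e : Dec (y ≡ x)) → indicator d ≡ indicator e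
    indicator-sym (yes _) (yes _) = ≡.refl
    indicator-sym (no _) (no _) = ≡.refl
    indicator-sym (yes p) (no q) = ⊥-elim (q (sym p))
    indicator-sym (no p) (yes q) = ⊥-elim (p (sym q))

    count-∑ : ∀ t L → count t L ≡ ∑ L (λ x → indicator (x ≟ t))
    count-∑ t [] = ≡.refl
    count-∑ t (x ∷ L) = cong₂ ℕ._+_ (indicator-sym (t ≟ x) (x ≟ t)) (count-∑ t L)

    -- Nine elements of a five-element set, at most two of each, leave exactly one free place out of ten.
    nine-in-five : ∀ (E L : List A) → Unique E → length E ≡ 5 → (∀ {x} → x ∈ L → x ∈ E) → length L ≡ 9 → (∀ t → count t L ℕ.≤ 2) →
      ∑ L (λ t → count t L) ≡ 17
    nine-in-five E L E! |E| L⊆E |L| c≤2 = let rest , p = embed L (E ++ E) bounded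
                                              s , rest≡ = list₁ rest (one rest p) in
      go s (subst (λ z → E ++ E ↭ L ++ z) rest≡ p)
      where
      twice : ∀ {t} → t ∈ E → count t (E ++ E) ≡ 2
      twice {t} t∈ = ≡.trans (count-++ t E E) (cong₂ ℕ._+_ once once)
        where
        once : count t E ≡ 1
        once = ℕₚ.≤-antisym (count-unique E E!) (∈-count t∈)
      bounded : ∀ t → count t L ℕ.≤ count t (E ++ E)
      bounded t = decide (1 ℕₚ.≤? count t L)
        where
        decide : Dec (1 ℕ.≤ count t L) → count t L ℕ.≤ count t (E ++ E)
        decide (yes h) = ℕₚ.≤-trans (c≤2 t) (ℕₚ.≤-reflexive (sym (twice (L⊆E (count-∈ L h)))))
        decide (no h) = ℕₚ.≤-trans (ℕₚ.≤-reflexive (ℕₚ.n<1⇒n≡0 (ℕₚ.≰⇒> h))) z≤n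
      one : ∀ (rest : List A) → E ++ E ↭ L ++ rest → length rest ≡ 1
      one rest p = ℕₚ.+-cancelˡ-≡ 9 _ _ (≡.trans (cong (ℕ._+ length rest) (sym |L|)) (≡.trans (sym (length-split rest p)) (≡.trans (Listₚ.length-++ E) (cong₂ ℕ._+_ |E| |E|))))
      go : ∀ (s : A) → E ++ E ↭ L ++ s ∷ [] → ∑ L (λ t → count t L) ≡ 17
      go s p = ℕₚ.+-cancelʳ-≡ 1 _ _ (≡.trans (cong (∑ L (λ t → count t L) ℕ.+_) (sym (≡.trans (sym (count-∑ s L)) count-s)))
        (≡.trans (sym (∑-+ L (λ t → count t L) (λ t → indicator (t ≟ s)))) (≡.trans (∑-const L (λ {t} t∈ → pointwise t (L⊆E t∈))) (cong (ℕ._* 2) |L|))))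
        where
        pointwise : ∀ t → t ∈ E → count t L ℕ.+ indicator (t ≟ s) ≡ 2
        pointwise t t∈ = ≡.trans (cong (count t L ℕ.+_) (sym (ℕₚ.+-identityʳ _))) (≡.trans (sym (count-++ t L (s ∷ []))) (≡.trans (sym (count-↭ p)) (twice t∈)))
        s∈E : s ∈ E
        s∈E = Sum.[ (λ h → h) , (λ h → h) ] (∈-++⁻ E (↭ₚ.∈-resp-↭ (↭-sym p) (∈-++⁺ʳ L (here ≡.refl))))
        count-s : count s L ≡ 1
        count-s = ℕₚ.+-cancelʳ-≡ 1 _ _ (≡.trans (cong (count s L ℕ.+_) (sym (self (s ≟ s)))) (pointwise s s∈E))
          where
          self : (d : Dec (s ≡ s)) → indicator d ≡ 1
          self (yes _) = ≡.refl
          self (no h) = ⊥-elim (h ≡.refl)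

-- Order four: collinear triples outside the double blocking set.

module OrderFour (𝔽 : FinField) where
  open FinField 𝔽
  open FieldTheory 𝔽
  open TrianglePlane 𝔽
  open LinearAlgebra 𝔽
  open Normalisation 𝔽
  open ConfigurationFacts 𝔽 using (nonzero; nonzero-length; nonzero-unique; nonzero-≢0; nonzero-complete)
  open FiniteSums

  -- The forms `f` and `g` are two lines through `p`, and `h` completes them to a basis. By
  -- `det-formula`, `q` and `r` are collinear with `p` exactly when the ratios of `f` to `g` agree
  -- at them.
  record Frame (p : Vec₃) : Set where
    field
      f g h : Vec₃
      independent : det f g h ≢ 0#
      f∙p : f ∙ p ≡ 0#
      g∙p : g ∙ p ≡ 0#
      factor : K
      factor≢0 : factor ≢ 0#
      det-formula : ∀ q r → factor * det p q r ≡ f ∙ q * g ∙ r - g ∙ q * f ∙ r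

  frame : ∀ p → NonZero p → Frame p
  frame (x , y , z) nz = choose (x ≟ 0#) (y ≟ 0#) (z ≟ 0#)
    where
    choose : Dec (x ≡ 0#) → Dec (y ≡ 0#) → Dec (z ≡ 0#) → Frame (x , y , z)
    choose (no x≢0) _ _ = record
      { f = - y , x , 0# ; g = - z , 0# , x ; h = 1# , 0# , 0#
      ; independent = λ e → product-≢0 x≢0 x≢0 (vanish₁ 1# (solve 3 (λ x y z → x :* x := :1 :*
          ((:- y) :* (:0 :* :0 :- x :* :0) :+ x :* (x :* :1 :- (:- z) :* :0) :+ :0 :* ((:- z) :* :0 :- :0 :* :1))) ≡.refl x y z) e)
      ; f∙p = solve 3 (λ x y z → (:- y) :* x :+ x :* y :+ :0 :* z := :0) ≡.refl x y z
      ; g∙p = solve 3 (λ x y z → (:- z) :* x :+ :0 :* y :+ x :* z := :0) ≡.refl x y z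
      ; factor = x ; factor≢0 = x≢0
      ; det-formula = λ { (a , b , c) (a′ , b′ , c′) → solve 9 (λ x y z a b c a′ b′ c′ →
          x :* (x :* (b :* c′ :- c :* b′) :+ y :* (c :* a′ :- a :* c′) :+ z :* (a :* b′ :- b :* a′)) :=
          ((:- y) :* a :+ x :* b :+ :0 :* c) :* ((:- z) :* a′ :+ :0 :* b′ :+ x :* c′) :-
          ((:- z) :* a :+ :0 :* b :+ x :* c) :* ((:- y) :* a′ :+ x :* b′ :+ :0 :* c′)) ≡.refl x y z a b c a′ b′ c′ } }
    choose _ (no y≢0) _ = record
      { f = 0# , - z , y ; g = y , - x , 0# ; h = 0# , 1# , 0#
      ; independent = λ e → product-≢0 y≢0 y≢0 (vanish₁ 1# (solve 3 (λ x y z → y :* y := :1 :*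
          (:0 :* ((:- x) :* :0 :- :0 :* :1) :+ (:- z) :* (:0 :* :0 :- y :* :0) :+ y :* (y :* :1 :- (:- x) :* :0))) ≡.refl x y z) e)
      ; f∙p = solve 3 (λ x y z → :0 :* x :+ (:- z) :* y :+ y :* z := :0) ≡.refl x y z
      ; g∙p = solve 3 (λ x y z → y :* x :+ (:- x) :* y :+ :0 :* z := :0) ≡.refl x y z
      ; factor = y ; factor≢0 = y≢0
      ; det-formula = λ { (a , b , c) (a′ , b′ , c′) → solve 9 (λ x y z a b c a′ b′ c′ →
          y :* (x :* (b :* c′ :- c :* b′) :+ y :* (c :* a′ :- a :* c′) :+ z :* (a :* b′ :- b :* a′)) :=
          (:0 :* a :+ (:- z) :* b :+ y :* c) :* (y :* a′ :+ (:- x) :* b′ :+ :0 :* c′) :-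
          (y :* a :+ (:- x) :* b :+ :0 :* c) :* (:0 :* a′ :+ (:- z) :* b′ :+ y :* c′)) ≡.refl x y z a b c a′ b′ c′ } }
    choose _ _ (no z≢0) = record
      { f = z , 0# , - x ; g = 0# , z , - y ; h = 0# , 0# , 1#
      ; independent = λ e → product-≢0 z≢0 z≢0 (vanish₁ 1# (solve 3 (λ x y z → z :* z := :1 :*
          (z :* (z :* :1 :- (:- y) :* :0) :+ :0 :* ((:- y) :* :0 :- :0 :* :1) :+ (:- x) :* (:0 :* :0 :- z :* :0))) ≡.refl x y z) e)
      ; f∙p = solve 3 (λ x y z → z :* x :+ :0 :* y :+ (:- x) :* z := :0) ≡.refl x y z
      ; g∙p = solve 3 (λ x y z → :0 :* x :+ z :* y :+ (:- y) :* z := :0) ≡.refl x y z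
      ; factor = z ; factor≢0 = z≢0
      ; det-formula = λ { (a , b , c) (a′ , b′ , c′) → solve 9 (λ x y z a b c a′ b′ c′ →
          z :* (x :* (b :* c′ :- c :* b′) :+ y :* (c :* a′ :- a :* c′) :+ z :* (a :* b′ :- b :* a′)) :=
          (z :* a :+ :0 :* b :+ (:- x) :* c) :* (:0 :* a′ :+ z :* b′ :+ (:- y) :* c′) :-
          (:0 :* a :+ z :* b :+ (:- y) :* c) :* (z :* a′ :+ :0 :* b′ :+ (:- x) :* c′)) ≡.refl x y z a b c a′ b′ c′ } }
    choose (yes x≡0) (yes y≡0) (yes z≡0) = ⊥-elim (nz (x≡0 , y≡0 , z≡0))

  _≟M_ : ∀ (s t : Maybe K) → Dec (s ≡ t)
  _≟M_ = Maybeₚ.≡-dec _≟_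

  -- A point of the projective line over the field; `nothing` is the point at infinity.
  quotient : ∀ x y → Dec (y ≡ 0#) → Maybe K
  quotient x y (yes _) = nothing
  quotient x y (no _) = just (x * y ⁻¹)

  abstract
    just-injective : ∀ {x y : K} → just x ≡ just y → x ≡ y
    just-injective ≡.refl = ≡.refl

    quotient-equal : ∀ {x y x′ y′} (d : Dec (y ≡ 0#)) (d′ : Dec (y′ ≡ 0#)) → ¬ (x ≡ 0# × y ≡ 0#) → ¬ (x′ ≡ 0# × y′ ≡ 0#) →
      x * y′ - y * x′ ≡ 0# → quotient x y d ≡ quotient x′ y′ d′
    quotient-equal (yes _) (yes _) _ _ _ = ≡.refl
    quotient-equal {x} {y} {x′} {y′} (yes ≡.refl) (no y′≢0) nz _ h = ⊥-elim (nz (cancelˡ y′≢0 (vanish₁ 1#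
      (solve 3 (λ x x′ y′ → y′ :* x := :1 :* (x :* y′ :- :0 :* x′)) ≡.refl x x′ y′) h) , ≡.refl))
    quotient-equal {x} {y} {x′} {y′} (no y≢0) (yes ≡.refl) _ nz′ h = ⊥-elim (nz′ (cancelˡ y≢0 (vanish₁ (- 1#)
      (solve 3 (λ x y x′ → y :* x′ := (:- :1) :* (x :* :0 :- y :* x′)) ≡.refl x y x′) h) , ≡.refl))
    quotient-equal {x} {y} {x′} {y′} (no y≢0) (no y′≢0) _ _ h = cong just (equal (cancelˡ (product-≢0 y≢0 y′≢0) (vanish₃ 1# (x * y′) (- (y * x′))
      (solve 6 (λ x y x′ y′ i i′ → y :* y′ :* (x :* i :- x′ :* i′) := :1 :* (x :* y′ :- y :* x′) :+ (x :* y′) :* (y :* i :- :1) :+ (:- (y :* x′)) :* (y′ :* i′ :- :1))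
        ≡.refl x y x′ y′ (y ⁻¹) (y′ ⁻¹)) h (difference (*-inverse y y≢0)) (difference (*-inverse y′ y′≢0)))))

    equal-quotient : ∀ {x y x′ y′} (d : Dec (y ≡ 0#)) (d′ : Dec (y′ ≡ 0#)) → quotient x y d ≡ quotient x′ y′ d′ → x * y′ - y * x′ ≡ 0#
    equal-quotient {x} {x′ = x′} (yes ≡.refl) (yes ≡.refl) _ = solve 2 (λ x x′ → x :* :0 :- :0 :* x′ := :0) ≡.refl x x′
    equal-quotient {x} {y} {x′} {y′} (no y≢0) (no y′≢0) h = vanish₃ (y * y′) (- (x * y′)) (y * x′)
      (solve 6 (λ x y x′ y′ i i′ → x :* y′ :- y :* x′ := (y :* y′) :* (x :* i :- x′ :* i′) :+ (:- (x :* y′)) :* (y :* i :- :1) :+ (y :* x′) :* (y′ :* i′ :- :1))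
        ≡.refl x y x′ y′ (y ⁻¹) (y′ ⁻¹)) (difference (just-injective h)) (difference (*-inverse y y≢0)) (difference (*-inverse y′ y′≢0))
    equal-quotient (yes _) (no _) ()
    equal-quotient (no _) (yes _) ()

  module Pencil {p : Pt} (p-ok : Valid p) where
    open Frame (frame (vec p) (vec-nonzero p-ok))

    slope : Pt → Maybe K
    slope q = quotient (f ∙ vec q) (g ∙ vec q) ((g ∙ vec q) ≟ 0#)

    abstract
      h∙p≢0 : h ∙ vec p ≢ 0#
      h∙p≢0 h∙p = vec-nonzero p-ok (frame-kernel {f} {g} {h} independent f∙p g∙p h∙p)

      off-centre : ∀ {q} → Valid q → q ≢ p → ¬ (f ∙ vec q ≡ 0# × g ∙ vec q ≡ 0#)
      off-centre {q} q-ok q≢p (fq , gq) = q≢p (vec-proportional p-ok q-ok k≢0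
        (frame-proportional {f} {g} {h} independent (≡.trans fq (sym (zero-multiple f∙p))) (≡.trans gq (sym (zero-multiple g∙p)))
          (sym (≡.trans (*-comm k _) (ratio-cancel h∙p≢0)))))
        where
        k : K
        k = h ∙ vec q * (h ∙ vec p) ⁻¹
        zero-multiple : ∀ {x} → x ≡ 0# → k * x ≡ 0#
        zero-multiple ≡.refl = zeroʳ k
        k≢0 : k ≢ 0#
        k≢0 = ratio-≢0 (λ hq → vec-nonzero q-ok (frame-kernel {f} {g} {h} independent fq gq hq)) h∙p≢0

      collinear⇒slope : ∀ {q r} → Valid q → q ≢ p → Valid r → r ≢ p → det (vec p) (vec q) (vec r) ≡ 0# → slope q ≡ slope r
      collinear⇒slope q-ok q≢p r-ok r≢p d = quotient-equal _ _ (off-centre q-ok q≢p) (off-centre r-ok r≢p)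
        (≡.trans (sym (det-formula _ _)) (≡.trans (cong (factor *_) d) (zeroʳ factor)))

      slope⇒collinear : ∀ {q r} → slope q ≡ slope r → det (vec p) (vec q) (vec r) ≡ 0#
      slope⇒collinear s = cancelˡ factor≢0 (≡.trans (det-formula _ _) (equal-quotient _ _ s))

    -- On the line of slope `t`, this form vanishes only at the centre `p`. The ratio of `h` to it,
    -- called `position`, is thus an affine coordinate on the line without `p`.
    weight : Maybe K → Pt → K
    weight nothing q = f ∙ vec q
    weight (just _) q = g ∙ vec q

    position : Maybe K → Pt → K
    position t q = h ∙ vec q * weight t q ⁻¹

    line : Maybe K → Vec₃
    line nothing = g
    line (just s) = proj₁ f - s * proj₁ g , proj₁ (proj₂ f) - s * proj₁ (proj₂ g) , proj₂ (proj₂ f) - s * proj₂ (proj₂ g)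

    abstract
      line-pairing : ∀ s q → line (just s) ∙ vec q ≡ f ∙ vec q - s * g ∙ vec q
      line-pairing s q = solve 10 (λ s a b c a′ b′ c′ x y z →
        (a :- s :* a′) :* x :+ (b :- s :* b′) :* y :+ (c :- s :* c′) :* z := (a :* x :+ b :* y :+ c :* z) :- s :* (a′ :* x :+ b′ :* y :+ c′ :* z)) ≡.refl
        s (proj₁ f) (proj₁ (proj₂ f)) (proj₂ (proj₂ f)) (proj₁ g) (proj₁ (proj₂ g)) (proj₂ (proj₂ g)) (X q) (Y q) (Z q)

      line-nonzero : ∀ t → NonZero (line t)
      line-nonzero nothing = go independent
        where
        go : ∀ {f g h} → det f g h ≢ 0# → NonZero g
        go {a , b , c} {h = a′ , b′ , c′} d≢0 (≡.refl , ≡.refl , ≡.refl) = d≢0 (solve 6 (λ a b c a′ b′ c′ →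
          a :* (:0 :* c′ :- :0 :* b′) :+ b :* (:0 :* a′ :- :0 :* c′) :+ c :* (:0 :* b′ :- :0 :* a′) := :0) ≡.refl a b c a′ b′ c′)
      line-nonzero (just s) (h₁ , h₂ , h₃) = go {f} {g} {h} independent (equal h₁) (equal h₂) (equal h₃)
        where
        go : ∀ {f g h} → det f g h ≢ 0# → proj₁ f ≡ s * proj₁ g → proj₁ (proj₂ f) ≡ s * proj₁ (proj₂ g) → proj₂ (proj₂ f) ≡ s * proj₂ (proj₂ g) → ⊥
        go {_ , _ , _} {a , b , c} {a′ , b′ , c′} d≢0 ≡.refl ≡.refl ≡.refl = d≢0 (solve 7 (λ s a b c a′ b′ c′ →
          (s :* a) :* (b :* c′ :- c :* b′) :+ (s :* b) :* (c :* a′ :- a :* c′) :+ (s :* c) :* (a :* b′ :- b :* a′) := :0) ≡.refl s a b c a′ b′ c′)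

      on-line⇒slope : ∀ t {q} → Valid q → q ≢ p → line t ∙ vec q ≡ 0# → slope q ≡ t
      on-line⇒slope nothing {q} q-ok q≢p h = go ((g ∙ vec q) ≟ 0#)
        where
        go : ∀ d → quotient (f ∙ vec q) (g ∙ vec q) d ≡ nothing
        go (yes _) = ≡.refl
        go (no n) = ⊥-elim (n h)
      on-line⇒slope (just s) {q} q-ok q≢p h = go ((g ∙ vec q) ≟ 0#)
        where
        f≡sg : f ∙ vec q ≡ s * g ∙ vec q
        f≡sg = equal (≡.trans (sym (line-pairing s q)) h)
        go : ∀ d → quotient (f ∙ vec q) (g ∙ vec q) d ≡ just s
        go (yes gq) = ⊥-elim (off-centre q-ok q≢p (≡.trans f≡sg (≡.trans (cong (s *_) gq) (zeroʳ s)) , gq))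
        go (no gq) = cong just (≡.trans (cong (_* (g ∙ vec q) ⁻¹) f≡sg) (≡.trans (*-assoc s _ _) (≡.trans (cong (s *_) (*-inverse _ gq)) (*-identityʳ s))))

      slope-weight : ∀ t {q} → Valid q → q ≢ p → slope q ≡ t → weight t q ≢ 0# × (∀ {r} → slope r ≡ t →
        ∃ λ c → ∃ λ d → f ∙ vec q ≡ c * weight t q × g ∙ vec q ≡ d * weight t q × f ∙ vec r ≡ c * weight t r × g ∙ vec r ≡ d * weight t r)
      slope-weight t {q} q-ok q≢p = go t ((g ∙ vec q) ≟ 0#)
        where
        go : ∀ t d → quotient (f ∙ vec q) (g ∙ vec q) d ≡ t → weight t q ≢ 0# × (∀ {r} → slope r ≡ t →
          ∃ λ c → ∃ λ d → f ∙ vec q ≡ c * weight t q × g ∙ vec q ≡ d * weight t q × f ∙ vec r ≡ c * weight t r × g ∙ vec r ≡ d * weight t r)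
        go nothing (yes gq) _ = (λ fq → off-centre q-ok q≢p (fq , gq)) , λ {r} → other r ((g ∙ vec r) ≟ 0#)
          where
          other : ∀ r d → quotient (f ∙ vec r) (g ∙ vec r) d ≡ nothing →
            ∃ λ c → ∃ λ d → f ∙ vec q ≡ c * f ∙ vec q × g ∙ vec q ≡ d * f ∙ vec q × f ∙ vec r ≡ c * f ∙ vec r × g ∙ vec r ≡ d * f ∙ vec r
          other r (yes gr) _ = 1# , 0# , sym (*-identityˡ _) , ≡.trans gq (sym (zeroˡ _)) , sym (*-identityˡ _) , ≡.trans gr (sym (zeroˡ _))
        go (just s) (no gq) eq = gq , λ {r} → other r ((g ∙ vec r) ≟ 0#)
          where
          slope-eq : ∀ {x y} → y ≢ 0# → x * y ⁻¹ ≡ s → x ≡ s * y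
          slope-eq {x} {y} y≢0 ≡.refl = sym (≡.trans (*-comm _ y) (ratio-cancel y≢0))
          other : ∀ r d → quotient (f ∙ vec r) (g ∙ vec r) d ≡ just s →
            ∃ λ c → ∃ λ d → f ∙ vec q ≡ c * g ∙ vec q × g ∙ vec q ≡ d * g ∙ vec q × f ∙ vec r ≡ c * g ∙ vec r × g ∙ vec r ≡ d * g ∙ vec r
          other r (no gr) eq′ = s , 1# , slope-eq gq (just-injective eq) , sym (*-identityˡ _) , slope-eq gr (just-injective eq′) , sym (*-identityˡ _)

      position-injective : ∀ t {q r} → Valid q → q ≢ p → slope q ≡ t → Valid r → r ≢ p → slope r ≡ t → position t q ≡ position t r → r ≡ q
      position-injective t {q} {r} q-ok q≢p sq r-ok r≢p sr e =
        let wq , hq = slope-weight t q-ok q≢p sq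
            wr , _ = slope-weight t r-ok r≢p sr
            c , d , fq , gq , fr , gr = hq sr
            k = weight t r * weight t q ⁻¹
        in vec-proportional q-ok r-ok (ratio-≢0 wr wq) (frame-proportional {f} {g} {h} independent
          (scaled wq fq fr) (scaled wq gq gr)
          (scaled wq (sym (≡.trans (*-comm _ (weight t q)) (ratio-cancel wq))) (≡.trans (sym (≡.trans (*-comm _ (weight t r)) (ratio-cancel wr))) (cong (_* weight t r) (sym e)))))
        where
        scaled : ∀ {x y a b c} → a ≢ 0# → x ≡ c * a → y ≡ c * b → y ≡ b * a ⁻¹ * x
        scaled {a = a} {b} {c} a≢0 ≡.refl ≡.refl = equal (vanish₁ (- (c * b)) (solve 4 (λ a a′ b c → c :* b :- b :* a′ :* (c :* a) := (:- (c :* b)) :* (a :* a′ :- :1)) ≡.refl a (a ⁻¹) b c) (difference (*-inverse a a≢0)))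

    select : Maybe K → List Pt → List Pt
    select t [] = []
    select t (q ∷ L) with t ≟M slope q
    ... | yes _ = q ∷ select t L
    ... | no _ = select t L

    select-∈ : ∀ t L {q} → q ∈ select t L → q ∈ L × slope q ≡ t
    select-∈ t (r ∷ L) q∈ with t ≟M slope r
    select-∈ t (r ∷ L) (here ≡.refl) | yes t≡ = here ≡.refl , sym t≡
    select-∈ t (r ∷ L) (there q∈) | yes _ = Product.map₁ there (select-∈ t L q∈)
    ... | no _ = Product.map₁ there (select-∈ t L q∈)

    select-unique : ∀ t L → Unique L → Unique (select t L)
    select-unique t [] _ = []
    select-unique t (q ∷ L) (q∉ ∷ L!) with t ≟M slope q
    ... | yes _ = All.tabulate (λ r∈ → All.lookup q∉ (proj₁ (select-∈ t L r∈))) ∷ select-unique t L L!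
    ... | no _ = select-unique t L L!

    select-length : ∀ t L → Counting.count _≟M_ t (map slope L) ≡ length (select t L)
    select-length t [] = ≡.refl
    select-length t (q ∷ L) with t ≟M slope q
    ... | yes _ = cong suc (select-length t L)
    ... | no _ = select-length t L

    abstract
      -- The affine coordinate `position` is injective on a line without its centre, so such a line
      -- has at most q further points.
      line-length : ∀ t Q → Unique Q → (∀ {q} → q ∈ Q → Valid q × q ≢ p × slope q ≡ t) → length Q ℕ.≤ length elements
      line-length t Q Q! on = ℕₚ.≤-trans (ℕₚ.≤-reflexive (sym (Listₚ.length-map (position t) Q)))
        (Unique-length-≤ (map (position t) Q) elements
          (unique-map (position t) Q (λ q∈ r∈ e → let q-ok , q≢p , sq = on q∈ ; r-ok , r≢p , sr = on r∈ in
            sym (position-injective t q-ok q≢p sq r-ok r≢p sr e)) Q!)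
          (λ {x} _ → elements-complete x))

  all-slopes : List (Maybe K)
  all-slopes = nothing ∷ map just elements

  abstract
    all-slopes-unique : Unique all-slopes
    all-slopes-unique = All.tabulate (λ t∈ → λ { ≡.refl → absurd t∈ }) ∷ unique-map just elements (λ _ _ → just-injective) elements-unique
      where
      absurd : nothing ∈ map just elements → ⊥
      absurd t∈ with ∈-map⁻ just t∈
      ... | _ , _ , ()

    all-slopes-complete : ∀ t → t ∈ all-slopes
    all-slopes-complete nothing = here ≡.refl
    all-slopes-complete (just s) = there (∈-map⁺ just (elements-complete s))

    product-length : {A B C : Set} (f : A → B → C) (xs : List A) (ys : List B) → length (cartesianProductWith f xs ys) ≡ length xs ℕ.* length ys
    product-length f [] ys = ≡.refl
    product-length f (x ∷ xs) ys = ≡.trans (Listₚ.length-++ (map (f x) ys)) (cong₂ ℕ._+_ (Listₚ.length-map (f x) ys) (product-length f xs ys))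

  indicate : {P : Set} → Dec P → ℕ
  indicate = Counting.indicator _≟_

  abstract
    indicate-⇔ : {P Q : Set} (d : Dec P) (e : Dec Q) → (P → Q) → (Q → P) → indicate d ≡ indicate e
    indicate-⇔ (yes _) (yes _) _ _ = ≡.refl
    indicate-⇔ (no _) (no _) _ _ = ≡.refl
    indicate-⇔ (yes p) (no q) to _ = ⊥-elim (q (to p))
    indicate-⇔ (no p) (yes q) _ from = ⊥-elim (p (from q))

    indicate-yes : {P : Set} (d : Dec P) → P → indicate d ≡ 1
    indicate-yes (yes _) _ = ≡.refl
    indicate-yes (no n) p = ⊥-elim (n p)

  -- Triples with repetitions count as collinear, since their determinant vanishes; this keeps the
  -- indicator symmetric and equal to 1 on the diagonal.
  collinear : Pt → Pt → Pt → ℕ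
  collinear p q r = indicate (det (vec p) (vec q) (vec r) ≟ 0#)

  abstract
    collinear-cycle : ∀ p q r → collinear p q r ≡ collinear q r p
    collinear-cycle p q r = indicate-⇔ _ _ (≡.trans (det-cycle (vec p) (vec q) (vec r))) (≡.trans (sym (det-cycle (vec p) (vec q) (vec r))))

    det-swap-zero : ∀ p q r → det p q r ≡ 0# → det q p r ≡ 0#
    det-swap-zero p q r d = ≡.trans (det-cycle r q p) (≡.trans (det-swap r p q) (≡.trans (cong -_ (≡.trans (sym (det-cycle r p q)) d)) (solve 0 (:- :0 := :0) ≡.refl)))

    collinear-swap : ∀ p q r → collinear p q r ≡ collinear q p r
    collinear-swap p q r = indicate-⇔ _ _ (det-swap-zero (vec p) (vec q) (vec r)) (det-swap-zero (vec q) (vec p) (vec r))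

    collinear-degenerate : ∀ p r → collinear p p r ≡ 1
    collinear-degenerate p r = indicate-yes _ (det-degenerate₁ (vec p) (vec r))

  module _ (order : length elements ≡ 4) (𝔅 : Blocking) where
    open Blocking 𝔅

    blocked : List Pt
    blocked = map (λ m → inner (u m) (v m)) five

    inner-points : List Pt
    inner-points = cartesianProductWith inner nonzero nonzero

    abstract
      inner-injective : ∀ {s t s′ t′} → inner s s′ ≡ inner t t′ → s ≡ t × s′ ≡ t′
      inner-injective ≡.refl = ≡.refl , ≡.refl

      blocked-unique : Unique blocked
      blocked-unique = unique-map _ five (λ _ _ e → separated (proj₁ (inner-injective e)) (proj₂ (inner-injective e))) five-unique

      inner-points-unique : Unique inner-points
      inner-points-unique = Uniqueₚ.cartesianProductWith⁺ inner inner-injective nonzero-unique nonzero-unique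

      missing : ∃ λ N → inner-points ↭ blocked ++ N
      missing = embed-unique blocked inner-points blocked-unique (λ p∈ → let m , _ , e = ∈-map⁻ (λ m → inner (u m) (v m)) p∈ in
        subst (_∈ inner-points) (sym e) (∈-cartesianProductWith⁺ inner (nonzero-complete (u≢0 m)) (nonzero-complete (v≢0 m))))

    -- The points off the triangle that are not in M. In order four there are 9 - 5 = 4 of them,
    -- which together with the six deleted points make the ten points outside the set.
    N : List Pt
    N = proj₁ missing

    outside : List Pt
    outside = H ++ N

    abstract
      nonzero-three : length nonzero ≡ 3
      nonzero-three = cong ℕ.pred (≡.trans (sym nonzero-length) order)

      N-length : length N ≡ 4
      N-length = ℕₚ.+-cancelˡ-≡ 5 _ _ (≡.trans (cong (ℕ._+ length N) (sym (≡.trans (Listₚ.length-map _ five) five-length)))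
        (≡.trans (sym (length-split N (proj₂ missing))) (≡.trans (product-length inner nonzero nonzero) (cong₂ ℕ._*_ nonzero-three nonzero-three))))

      outside-length : length outside ≡ 10
      outside-length = ≡.trans (Listₚ.length-++ H) (cong₂ ℕ._+_ H-length N-length)

      N-inner : ∀ {p} → p ∈ N → ∃ λ s → ∃ λ t → p ≡ inner s t × s ≢ 0# × t ≢ 0#
      N-inner p∈ = let s , t , s∈ , t∈ , e = ∈-cartesianProductWith⁻ inner nonzero nonzero (↭ₚ.∈-resp-↭ (↭-sym (proj₂ missing)) (∈-++⁺ʳ blocked p∈)) in
        s , t , e , nonzero-≢0 s∈ , nonzero-≢0 t∈

      boundary-valid : ∀ {p} → Boundary p → Valid p
      boundary-valid {vertex _} _ = tt
      boundary-valid {edge _ _} t≢0 = t≢0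

      member-valid : ∀ {p} → Member p → Valid p
      member-valid (inj₁ (b , _)) = boundary-valid b
      member-valid (inj₂ (m , ≡.refl)) = u≢0 m , v≢0 m

      not-boundary : ∀ {p} → p ∈ N → ¬ Boundary p
      not-boundary p∈ b = let _ , _ , e , _ = N-inner p∈ in subst Boundary e b

      outside-valid : ∀ {p} → p ∈ outside → Valid p
      outside-valid p∈ = Sum.[ (λ h → boundary-valid (H-boundary h)) , (λ h → let _ , _ , e , st = N-inner h in subst Valid (sym e) st) ] (∈-++⁻ H p∈)

      outside-¬member : ∀ {p} → p ∈ outside → ¬ Member p
      outside-¬member p∈ = Sum.[ in-H , in-N ] (∈-++⁻ H p∈)
        where
        in-H : ∀ {p} → p ∈ H → ¬ Member p
        in-H h (inj₁ (_ , p∉)) = p∉ h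
        in-H h (inj₂ (m , ≡.refl)) = H-boundary h
        in-N : ∀ {p} → p ∈ N → ¬ Member p
        in-N h (inj₁ (b , _)) = not-boundary h b
        in-N h (inj₂ (m , ≡.refl)) = ++-disjoint blocked (Unique-resp-↭ (proj₂ missing) inner-points-unique)
          (∈-map⁺ (λ m → inner (u m) (v m)) (five-complete m)) h

      outside-unique : Unique outside
      outside-unique = Uniqueₚ.++⁺ H! (++-Uniqueʳ blocked (Unique-resp-↭ (proj₂ missing) inner-points-unique))
        (λ { (h , h′) → not-boundary h′ (H-boundary h) })

    module _ {p : Pt} (p∈ : p ∈ outside) where
      private
        p-ok : Valid p
        p-ok = outside-valid p∈
        open module PencilAt = Pencil {p} p-ok

      others : List Pt
      others = proj₁ (∈-split p∈)

      abstract
        others-↭ : outside ↭ p ∷ others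
        others-↭ = proj₂ (∈-split p∈)

        p∷others-unique : Unique (p ∷ others)
        p∷others-unique = Unique-resp-↭ others-↭ outside-unique

        others-length : length others ≡ 9
        others-length = cong ℕ.pred (≡.trans (sym (↭ₚ.↭-length others-↭)) outside-length)

        other : ∀ {q} → q ∈ others → q ∈ outside × q ≢ p
        other q∈ = ↭ₚ.∈-resp-↭ (↭-sym others-↭) (there q∈) , (λ { ≡.refl → ++-disjoint (p ∷ []) p∷others-unique (here ≡.refl) q∈ })

        -- A line through `p` has at most four further points. Two of them belong to the double
        -- blocking set, so at most two others lie outside it.
        slope-bound : ∀ t → Counting.count _≟M_ t (map slope others) ℕ.≤ 2
        slope-bound t = go (blocks _ _ _ (line-nonzero t))
          where
          go : (∃ λ q → ∃ λ r → q ≢ r × Member q × Member r × line t ∙ vec q ≡ 0# × line t ∙ vec r ≡ 0#) → Counting.count _≟M_ t (map slope others) ℕ.≤ 2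
          go (q , r , q≢r , mq , mr , lq , lr) = ℕₚ.≤-trans (ℕₚ.≤-reflexive (select-length t others)) (ℕₚ.≤-pred (ℕₚ.≤-pred (ℕₚ.≤-trans
            (line-length t (q ∷ r ∷ select t others) ((q≢r ∷ away mq) ∷ away mr ∷ select-unique t others (++-Uniqueʳ (p ∷ []) p∷others-unique)) on)
            (ℕₚ.≤-reflexive order))))
            where
            away : ∀ {q} → Member q → All (q ≢_) (select t others)
            away mq = All.tabulate (λ { s∈ ≡.refl → outside-¬member (proj₁ (other (proj₁ (select-∈ t others s∈)))) mq })
            ≢p : ∀ {q} → Member q → q ≢ p
            ≢p mq ≡.refl = outside-¬member p∈ mq
            on : ∀ {s} → s ∈ q ∷ r ∷ select t others → Valid s × s ≢ p × slope s ≡ t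
            on (here ≡.refl) = member-valid mq , ≢p mq , on-line⇒slope t (member-valid mq) (≢p mq) lq
            on (there (here ≡.refl)) = member-valid mr , ≢p mr , on-line⇒slope t (member-valid mr) (≢p mr) lr
            on (there (there s∈)) = let s∈o , ss = select-∈ t others s∈ ; s∈out , s≢p = other s∈o in outside-valid s∈out , s≢p , ss

        slopes-sum : ∑ (map slope others) (λ t → Counting.count _≟M_ t (map slope others)) ≡ 17
        slopes-sum = NineInFive.nine-in-five _≟M_ all-slopes (map slope others) all-slopes-unique (cong suc (≡.trans (Listₚ.length-map just elements) order))
          (λ {t} _ → all-slopes-complete t) (≡.trans (Listₚ.length-map slope others) others-length) slope-bound

        count-slopes : ∀ t L → Counting.count _≟M_ t (map slope L) ≡ ∑ L (λ r → indicate (t ≟M slope r))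
        count-slopes t [] = ≡.refl
        count-slopes t (r ∷ L) = cong₂ ℕ._+_ (same (t ≟M slope r)) (count-slopes t L)
          where
          same : (d : Dec (t ≡ slope r)) → Counting.indicator _≟M_ d ≡ indicate d
          same (yes _) = ≡.refl
          same (no _) = ≡.refl

        others-sum : ∑ others (λ q → ∑ others (collinear p q)) ≡ 17
        others-sum = ≡.trans (∑-cong others (λ {q} q∈ → ≡.trans (∑-cong others (λ {r} r∈ →
            let q∈o , q≢p = other q∈ ; r∈o , r≢p = other r∈ in
            indicate-⇔ _ (slope q ≟M slope r) (collinear⇒slope (outside-valid q∈o) q≢p (outside-valid r∈o) r≢p) (slope⇒collinear {q} {r})))
            (sym (count-slopes (slope q) others))))
          (≡.trans (sym (∑-map slope others (λ t → Counting.count _≟M_ t (map slope others)))) slopes-sum)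

        -- The pair (p,p) counts 1, the pairs with `p` in just the first or just the second place
        -- count 9 each, and the pairs avoiding `p` count 17 = 4·2² + 1: four lines through `p` have
        -- two further outside points and one has a single one.
        point-sum : ∑ outside (λ q → ∑ outside (collinear p q)) ≡ 36
        point-sum = ≡.trans (∑-cong outside (λ {q} _ → ∑-↭ (collinear p q) others-↭)) (≡.trans (∑-↭ (λ q → ∑ (p ∷ others) (collinear p q)) others-↭)
          (cong₂ ℕ._+_ (cong₂ ℕ._+_ (collinear-degenerate p p) (nine (λ q → collinear-degenerate p q)))
            (≡.trans (∑-+ others (λ q → collinear p q p) (λ q → ∑ others (collinear p q)))
              (cong₂ ℕ._+_ (nine (λ q → ≡.trans (collinear-cycle p q p) (≡.trans (collinear-cycle q p p) (collinear-degenerate p q)))) others-sum))))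
          where
          nine : ∀ {f : Pt → ℕ} → (∀ q → f q ≡ 1) → ∑ others f ≡ 9
          nine h = ≡.trans (∑-const others (λ {q} _ → h q)) (cong (ℕ._* 1) others-length)

    abstract
      -- The ten points give 10·36 = 360 ordered collinear triples. Ten of these are constant; the
      -- other 350 would fall into cyclic orbits of size three.
      order-four-impossible : ⊥
      order-four-impossible = let k , h = triple-sum collinear collinear-cycle collinear-swap (λ p → collinear-degenerate p p) outside in
        from-no (3 ∣? 350) (divides k (ℕₚ.+-cancelˡ-≡ 10 _ _ (≡.trans (sym total) (≡.trans h (cong₂ ℕ._+_ outside-length (ℕₚ.*-comm 3 k))))))
        where
        total : ∑ outside (λ p → ∑ outside (λ q → ∑ outside (collinear p q))) ≡ 360
        total = ≡.trans (∑-const outside (λ p∈ → point-sum p∈)) (cong (λ n → n ℕ.* 36) outside-length)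

-- Orders between four and six.

module SmallOrders where
  abstract
    small-square : ∀ p → Prime p → ¬ (p ℕ.* p ∣ 6)
    small-square 0 p-prime d = from-no (prime? 0) p-prime
    small-square 1 p-prime d = from-no (prime? 1) p-prime
    small-square 2 _ d = from-no (4 ∣? 6) d
    small-square (suc (suc (suc p))) _ d = ℕₚ.<⇒≱ {6} {9} (s≤s (s≤s (s≤s (s≤s (s≤s (s≤s (s≤s z≤n)))))))
      (ℕₚ.≤-trans (ℕₚ.*-mono-≤ {3} {suc (suc (suc p))} {3} {suc (suc (suc p))} (s≤s (s≤s (s≤s z≤n))) (s≤s (s≤s (s≤s z≤n)))) (∣⇒≤ d))

    -- Exponent one would make 6 prime, and any larger exponent would make the square of a prime
    -- divide 6.
    six-not-prime-power : ¬ PrimePower 6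
    six-not-prime-power (p , zero , p-prime , e) = from-no (prime? 6) (subst Prime (sym (≡.trans e (ℕₚ.*-identityʳ p))) p-prime)
    six-not-prime-power (p , suc k , p-prime , e) = small-square p p-prime (divides (p ^ k) (≡.trans e (rearrange p (p ^ k))))
      where
      rearrange : ∀ p x → p ℕ.* (p ℕ.* x) ≡ x ℕ.* (p ℕ.* p)
      rearrange = solve-∀

    four-to-six : ∀ {q} → 10 ℕ.≤ 3 ℕ.* q → q ℕ.≤ 6 → q ≡ 4 ⊎ q ≡ 5 ⊎ q ≡ 6
    four-to-six {4} _ _ = inj₁ ≡.refl
    four-to-six {5} _ _ = inj₂ (inj₁ ≡.refl)
    four-to-six {6} _ _ = inj₂ (inj₂ ≡.refl)
    four-to-six {1} (s≤s (s≤s (s≤s ()))) _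
    four-to-six {2} (s≤s (s≤s (s≤s (s≤s (s≤s (s≤s ())))))) _
    four-to-six {3} (s≤s (s≤s (s≤s (s≤s (s≤s (s≤s (s≤s (s≤s (s≤s ()))))))))) _
    four-to-six {suc (suc (suc (suc (suc (suc (suc q))))))} _ (s≤s (s≤s (s≤s (s≤s (s≤s (s≤s ()))))))

-- Bounds on the order, and the final case distinction.

module BlockingImpossible (𝔽 : FinField) where
  open FinField 𝔽
  open Configurations 𝔽
  open ConfigurationFacts 𝔽
  open Config
  open TrianglePlane 𝔽
  open SmallOrders

  module _ (𝔅 : Blocking) (prime-power : PrimePower (length elements)) where

    abstract
      -- In the sum of the three side bounds a deleted vertex is counted on two sides. The six
      -- deleted points, the three strict inequalities and at least one vertex counted twice give 6
      -- + 3 + 1 = 10.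
      large : ∀ Γ → a Γ ≡ true → 10 ℕ.≤ 3 ℕ.* length elements
      large Γ a≡ = ℕₚ.≤-trans (count (♯ (a Γ)) (♯ (b Γ)) (♯ (c Γ)) {length (A Γ)} {length (B Γ)} {length (C Γ)} (subst (λ k → 1 ℕ.≤ ♯ k) (sym a≡) (s≤s z≤n)) (size Γ))
        (ℕₚ.≤-trans (ℕₚ.+-mono-≤ (ℕₚ.+-mono-≤ (sideA Γ) (sideB Γ)) (sideC Γ)) (ℕₚ.≤-reflexive (triple (length elements))))
        where
        triple : ∀ n → n ℕ.+ n ℕ.+ n ≡ 3 ℕ.* n
        triple = solve-∀
        regroup : ∀ x y z s t r → suc (x ℕ.+ (t ℕ.+ r)) ℕ.+ suc (y ℕ.+ (r ℕ.+ s)) ℕ.+ suc (z ℕ.+ (s ℕ.+ t)) ≡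
          (x ℕ.+ y ℕ.+ z ℕ.+ (s ℕ.+ t ℕ.+ r)) ℕ.+ 3 ℕ.+ (s ℕ.+ (t ℕ.+ r))
        regroup = solve-∀
        count : ∀ s t r {x y z} → 1 ℕ.≤ s → x ℕ.+ y ℕ.+ z ℕ.+ (s ℕ.+ t ℕ.+ r) ≡ 6 →
          10 ℕ.≤ suc (x ℕ.+ (t ℕ.+ r)) ℕ.+ suc (y ℕ.+ (r ℕ.+ s)) ℕ.+ suc (z ℕ.+ (s ℕ.+ t))
        count s t r {x} {y} {z} 1≤s total = ℕₚ.≤-trans (ℕₚ.+-monoʳ-≤ 9 (ℕₚ.≤-trans 1≤s (ℕₚ.m≤m+n s (t ℕ.+ r))))
          (ℕₚ.≤-reflexive (sym (≡.trans (regroup x y z s t r) (cong (λ n → n ℕ.+ 3 ℕ.+ (s ℕ.+ (t ℕ.+ r))) total))))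

      -- The q - 1 lines through the deleted vertex other than the sides contain different points of
      -- M.
      small : ∀ Γ → a Γ ≡ true → length elements ℕ.≤ 6
      small Γ a≡ = ℕₚ.≤-trans (ℕₚ.≤-reflexive nonzero-length) (s≤s (ℕₚ.≤-trans (ℕₚ.m≤m+n _ _) (ListFacts.full-vertex-bound Γ a≡)))

      vertex-case : ∀ Γ → a Γ ≡ true → ⊥
      vertex-case Γ a≡ = Sum.[ (λ four → OrderFour.order-four-impossible 𝔽 four 𝔅)
        , Sum.[ (λ five → OrderFive.VertexHole.vertex-hole 𝔽 five Γ a≡)
              , (λ six → six-not-prime-power (subst PrimePower six prime-power)) ] ] (four-to-six (large Γ a≡) (small Γ a≡))

      blocking-impossible : ⊥
      blocking-impossible = cases (a Γ) (b Γ) (c Γ) ≡.refl ≡.refl ≡.refl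
        where
        Γ : Config
        Γ = FromBlocking.Sides.config 𝔽 𝔅
        cases : ∀ r s t → a Γ ≡ r → b Γ ≡ s → c Γ ≡ t → ⊥
        cases true _ _ a≡ _ _ = vertex-case Γ a≡
        cases false true _ _ b≡ _ = vertex-case (rot Γ) b≡
        cases false false true _ _ c≡ = vertex-case (rot (rot Γ)) c≡
        cases false false false a≡ b≡ c≡ = NoVertexHole.no-vertex-hole 𝔽 Γ (a≡ , b≡ , c≡)

-- Replacing the given field by an isomorphic one on `Fin q`.

module Transport (F : CommutativeRing 0ℓ 0ℓ) (isField : IsField F) {q : ℕ} (order : HasOrder F q) where
  private
    module F = CommutativeRing F
    open F using (_≈_)

  value : Fin q → F.Carrier
  value = proj₁ order

  index : F.Carrier → Fin q
  index x = proj₁ (proj₂ (proj₂ order) x)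

  value-index : ∀ x → value (index x) ≈ x
  value-index x = proj₂ (proj₂ (proj₂ order) x)

  value-injective : ∀ {i j} → value i ≈ value j → i ≡ j
  value-injective {i} {j} = proj₁ (proj₂ order) i j

  index-value : ∀ i → index (value i) ≡ i
  index-value i = value-injective (value-index (value i))

  index-cong : ∀ {x y} → x ≈ y → index x ≡ index y
  index-cong x≈y = value-injective (F.trans (value-index _) (F.trans x≈y (F.sym (value-index _))))

  value-cong : ∀ {i j} → i ≡ j → value i ≈ value j
  value-cong ≡.refl = F.refl

  -- The operations are carried over along the enumeration, which makes equality propositional and
  -- decidable. The ring laws are pulled back along `value`.
  rawRing : RawRing 0ℓ 0ℓ
  rawRing = record
    { Carrier = Fin q ; _≈_ = _≡_
    ; _+_ = λ i j → index (value i F.+ value j) ; _*_ = λ i j → index (value i F.* value j)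
    ; -_ = λ i → index (F.- value i) ; 0# = index F.0# ; 1# = index F.1# }

  isMonomorphism : IsRingMonomorphism rawRing F.rawRing value
  isMonomorphism = record
    { isRingHomomorphism = record
      { isSemiringHomomorphism = record
        { isNearSemiringHomomorphism = record
          { +-isMonoidHomomorphism = record
            { isMagmaHomomorphism = record { isRelHomomorphism = record { cong = value-cong } ; homo = λ _ _ → value-index _ }
            ; ε-homo = value-index F.0# }
          ; *-homo = λ _ _ → value-index _ }
        ; 1#-homo = value-index F.1# }
      ; -‿homo = λ _ → value-index _ }
    ; injective = value-injective }

  -- Inversion is made total by sending zero to itself.
  reciprocal : ∀ i → Dec (i ≡ index F.0#) → Fin q
  reciprocal i (yes _) = i
  reciprocal i (no i≢0) = index (proj₁ (proj₂ isField (value i) (λ h → i≢0 (≡.trans (sym (index-value i)) (index-cong h)))))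

  field′ : FinField
  field′ = record
    { K = Fin q ; _+_ = RawRing._+_ rawRing ; _*_ = RawRing._*_ rawRing ; -_ = RawRing.-_ rawRing
    ; _⁻¹ = λ i → reciprocal i (i Fin.≟ index F.0#) ; 0# = index F.0# ; 1# = index F.1#
    ; isCommutativeRing = RingMonomorphism.isCommutativeRing isMonomorphism F.isCommutativeRing
    ; 1≢0 = λ h → proj₁ isField (F.trans (F.sym (value-index F.1#)) (F.trans (value-cong h) (value-index F.0#)))
    ; *-inverse = λ i i≢0 → inverse i (i Fin.≟ index F.0#) i≢0
    ; _≟_ = Fin._≟_
    ; elements = allFin q ; elements-unique = Uniqueₚ.allFin⁺ q ; elements-complete = ∈-allFin }
    where
    inverse : ∀ i d → i ≢ index F.0# → index (value i F.* value (reciprocal i d)) ≡ index F.1#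
    inverse i (yes i≡0) i≢0 = ⊥-elim (i≢0 i≡0)
    inverse i (no _) _ = index-cong (F.trans (F.*-congˡ (value-index _)) (proj₂ (proj₂ isField (value i) _)))

  open FinField field′
  open FieldTheory field′
  open LinearAlgebra field′
  open Normalisation field′ using (NonZero)
  open PG F using (NZVec; Point; Line; _~_; _I_)

  coordinates : NZVec → Vec₃
  coordinates p = index (NZVec.x p) , index (NZVec.y p) , index (NZVec.z p)

  vector : ∀ v → NonZero v → NZVec
  vector (x , y , z) nz = PG.vec (value x) (value y) (value z) (λ { (hx , hy , hz) → nz (is-zero hx , is-zero hy , is-zero hz) })
    where
    is-zero : ∀ {i} → value i ≈ F.0# → i ≡ 0#
    is-zero h = ≡.trans (sym (index-value _)) (index-cong h)

  abstract
    coordinates-vector : ∀ v nz → coordinates (vector v nz) ≡ v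
    coordinates-vector (x , y , z) nz = cong₂ _,_ (index-value x) (cong₂ _,_ (index-value y) (index-value z))

    coordinates-nonzero : ∀ p → NonZero (coordinates p)
    coordinates-nonzero p (hx , hy , hz) = NZVec.nonzero p (is-zero hx , is-zero hy , is-zero hz)
      where
      is-zero : ∀ {x} → index x ≡ 0# → x ≈ F.0#
      is-zero {x} h = F.trans (F.sym (value-index x)) (F.trans (value-cong h) (value-index F.0#))

    value-product : ∀ x y → value (index x * index y) ≈ x F.* y
    value-product x y = F.trans (value-index _) (F.*-cong (value-index x) (value-index y))

    value-pairing : ∀ ℓ p → value (coordinates ℓ ∙ coordinates p) ≈ NZVec.x ℓ F.* NZVec.x p F.+ NZVec.y ℓ F.* NZVec.y p F.+ NZVec.z ℓ F.* NZVec.z p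
    value-pairing ℓ p = F.trans (value-index _) (F.+-cong (F.trans (value-index _) (F.+-cong (value-product _ _) (value-product _ _))) (value-product _ _))

    incident⇒ : ∀ {p ℓ} → p I ℓ → coordinates ℓ ∙ coordinates p ≡ 0#
    incident⇒ {p} {ℓ} h = value-injective (F.trans (value-pairing ℓ p) (F.trans h (F.sym (value-index F.0#))))

    ⇒incident : ∀ {p ℓ} → coordinates ℓ ∙ coordinates p ≡ 0# → p I ℓ
    ⇒incident {p} {ℓ} h = F.trans (F.sym (value-pairing ℓ p)) (F.trans (value-cong h) (value-index F.0#))

    ~⇒proportional : ∀ {p r} → p ~ r → ∃ λ k → coordinates r ≡ k · coordinates p
    ~⇒proportional {p} {r} (c , hx , hy , hz) = index c , cong₂ _,_ (each hx) (cong₂ _,_ (each hy) (each hz))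
      where
      each : ∀ {x y} → y ≈ c F.* x → index y ≡ index c * index x
      each h = index-cong (F.trans h (F.*-cong (F.sym (value-index _)) (F.sym (value-index _))))

    proportional⇒~ : ∀ {p r k} → coordinates r ≡ k · coordinates p → p ~ r
    proportional⇒~ {p} {r} {k} h = value k , each (cong proj₁ h) , each (cong (λ v → proj₁ (proj₂ v)) h) , each (cong (λ v → proj₂ (proj₂ v)) h)
      where
      each : ∀ {x y} → index y ≡ k * index x → y ≈ value k F.* x
      each {x} {y} h = F.trans (F.sym (value-index y)) (F.trans (value-cong h) (F.trans (value-index _) (F.*-congˡ (value-index x))))

-- Coordinates in which the three given lines are the coordinate lines.

module TriangleCoordinates (F : CommutativeRing 0ℓ 0ℓ) (isField : IsField F) {q : ℕ} (order : HasOrder F q)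
  (l₁ l₂ l₃ : PG.Line F) (non-concurrent : PG.NonConcurrent F l₁ l₂ l₃) where
  open Transport F isField order
  open FinField field′
  open FieldTheory field′
  open LinearAlgebra field′
  open Normalisation field′ hiding (vec)
  open TrianglePlane field′
  open PG F using (NZVec; Point; Line; _~_; _I_; _∈ₚ_; Distinct; Triangle; Modify; DoubleBlocking)

  L₁ L₂ L₃ : Vec₃
  L₁ = coordinates l₁
  L₂ = coordinates l₂
  L₃ = coordinates l₃

  nonzero? : ∀ v → Dec (v ≡ (0# , 0# , 0#))
  nonzero? (x , y , z) = decide (x ≟ 0#) (y ≟ 0#) (z ≟ 0#)
    where
    decide : Dec (x ≡ 0#) → Dec (y ≡ 0#) → Dec (z ≡ 0#) → Dec ((x , y , z) ≡ (0# , 0# , 0#))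
    decide (yes ≡.refl) (yes ≡.refl) (yes ≡.refl) = yes ≡.refl
    decide (no n) _ _ = no (λ { ≡.refl → n ≡.refl })
    decide _ (no n) _ = no (λ { ≡.refl → n ≡.refl })
    decide _ _ (no n) = no (λ { ≡.refl → n ≡.refl })

  cross : Vec₃ → Vec₃ → Vec₃
  cross (a , b , c) (a′ , b′ , c′) = b * c′ - c * b′ , c * a′ - a * c′ , a * b′ - b * a′

  abstract
    no-common-zero : ∀ v → NonZero v → ¬ (L₁ ∙ v ≡ 0# × L₂ ∙ v ≡ 0# × L₃ ∙ v ≡ 0#)
    no-common-zero v nz (h₁ , h₂ , h₃) = non-concurrent (vector v nz) (at {l₁} h₁ , at {l₂} h₂ , at {l₃} h₃)
      where
      at : ∀ {l} → coordinates l ∙ v ≡ 0# → vector v nz I l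
      at {l} h = ⇒incident {vector v nz} {l} (≡.trans (cong (coordinates l ∙_) (coordinates-vector v nz)) h)

    no-common-zero′ : ∀ v → L₁ ∙ v ≡ 0# → L₂ ∙ v ≡ 0# → L₃ ∙ v ≡ 0# → v ≡ (0# , 0# , 0#)
    no-common-zero′ v h₁ h₂ h₃ = decide (nonzero? v)
      where
      decide : Dec (v ≡ (0# , 0# , 0#)) → v ≡ (0# , 0# , 0#)
      decide (yes e) = e
      decide (no n) = ⊥-elim (no-common-zero v (λ { (hx , hy , hz) → n (cong₂ _,_ hx (cong₂ _,_ hy hz)) }) (h₁ , h₂ , h₃))

    cross-left : ∀ f g → f ∙ cross f g ≡ 0#
    cross-left (a , b , c) (a′ , b′ , c′) = solve 6 (λ a b c a′ b′ c′ →
      a :* (b :* c′ :- c :* b′) :+ b :* (c :* a′ :- a :* c′) :+ c :* (a :* b′ :- b :* a′) := :0) ≡.refl a b c a′ b′ c′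

    cross-right : ∀ f g → g ∙ cross f g ≡ 0#
    cross-right (a , b , c) (a′ , b′ , c′) = solve 6 (λ a b c a′ b′ c′ →
      a′ :* (b :* c′ :- c :* b′) :+ b′ :* (c :* a′ :- a :* c′) :+ c′ :* (a :* b′ :- b :* a′) := :0) ≡.refl a b c a′ b′ c′

    det-cross : ∀ f g h → h ∙ cross f g ≡ det f g h
    det-cross (a , b , c) (a′ , b′ , c′) (a″ , b″ , c″) = solve 9 (λ a b c a′ b′ c′ a″ b″ c″ →
      a″ :* (b :* c′ :- c :* b′) :+ b″ :* (c :* a′ :- a :* c′) :+ c″ :* (a :* b′ :- b :* a′) :=
      a :* (b′ :* c″ :- c′ :* b″) :+ b :* (c′ :* a″ :- a′ :* c″) :+ c :* (a′ :* b″ :- b′ :* a″)) ≡.refl a b c a′ b′ c′ a″ b″ c″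

    -- If all three lines were parallel as vectors, any vector orthogonal to the first would be a common point.
    orthogonal-pair : ∀ {f g} → NonZero f → cross f g ≡ (0# , 0# , 0#) → ∀ {x y z} → f ∙ (x , y , z) ≡ 0# → g ∙ (x , y , z) ≡ 0#
    orthogonal-pair {a , b , c} {a′ , b′ , c′} nz e {x} {y} {z} h = choose (a ≟ 0#) (b ≟ 0#) (c ≟ 0#)
      where
      bc : b * c′ - c * b′ ≡ 0#
      bc = cong proj₁ e
      ca : c * a′ - a * c′ ≡ 0#
      ca = cong (λ v → proj₁ (proj₂ v)) e
      ab : a * b′ - b * a′ ≡ 0#
      ab = cong (λ v → proj₂ (proj₂ v)) e
      choose : Dec (a ≡ 0#) → Dec (b ≡ 0#) → Dec (c ≡ 0#) → a′ * x + b′ * y + c′ * z ≡ 0#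
      choose (no a≢0) _ _ = cancelˡ a≢0 (vanish₃ a′ y (- z) (solve 9 (λ a b c a′ b′ c′ x y z →
        a :* (a′ :* x :+ b′ :* y :+ c′ :* z) := a′ :* (a :* x :+ b :* y :+ c :* z) :+ y :* (a :* b′ :- b :* a′) :+ (:- z) :* (c :* a′ :- a :* c′)) ≡.refl a b c a′ b′ c′ x y z) h ab ca)
      choose _ (no b≢0) _ = cancelˡ b≢0 (vanish₃ b′ (- x) z (solve 9 (λ a b c a′ b′ c′ x y z →
        b :* (a′ :* x :+ b′ :* y :+ c′ :* z) := b′ :* (a :* x :+ b :* y :+ c :* z) :+ (:- x) :* (a :* b′ :- b :* a′) :+ z :* (b :* c′ :- c :* b′)) ≡.refl a b c a′ b′ c′ x y z) h ab bc)
      choose _ _ (no c≢0) = cancelˡ c≢0 (vanish₃ c′ x (- y) (solve 9 (λ a b c a′ b′ c′ x y z →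
        c :* (a′ :* x :+ b′ :* y :+ c′ :* z) := c′ :* (a :* x :+ b :* y :+ c :* z) :+ x :* (c :* a′ :- a :* c′) :+ (:- y) :* (b :* c′ :- c :* b′)) ≡.refl a b c a′ b′ c′ x y z) h ca bc)
      choose (yes a≡0) (yes b≡0) (yes c≡0) = ⊥-elim (nz (a≡0 , b≡0 , c≡0))

    orthogonal : ∀ f → ∃ λ v → NonZero v × f ∙ v ≡ 0#
    orthogonal (a , b , c) = choose (b ≟ 0#) (c ≟ 0#)
      where
      choose : Dec (b ≡ 0#) → Dec (c ≡ 0#) → ∃ λ v → NonZero v × (a , b , c) ∙ v ≡ 0#
      choose (yes b≡0) _ = (0# , 1# , 0#) , (λ h → 1≢0 (proj₁ (proj₂ h))) , vanish₁ 1# (solve 3 (λ a b c → a :* :0 :+ b :* :1 :+ c :* :0 := :1 :* b) ≡.refl a b c) b≡0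
      choose (no b≢0) _ = (0# , - c , b) , (λ h → b≢0 (proj₂ (proj₂ h))) , solve 3 (λ a b c → a :* :0 :+ b :* (:- c) :+ c :* b := :0) ≡.refl a b c

    -- If the determinant vanished, L₁ × L₂ and L₁ × L₃ would be annihilated by all three lines and
    -- hence be zero. Then `L₂` and `L₃` vanish wherever `L₁` does, and any point of the first line
    -- is common to all three.
    frame-det : det L₁ L₂ L₃ ≢ 0#
    frame-det d = let v , nz , h = orthogonal L₁ in
      no-common-zero v nz (h , orthogonal-pair (coordinates-nonzero l₁) c₁₂ h , orthogonal-pair (coordinates-nonzero l₁) c₁₃ h)
      where
      c₁₂ : cross L₁ L₂ ≡ (0# , 0# , 0#)
      c₁₂ = no-common-zero′ (cross L₁ L₂) (cross-left L₁ L₂) (cross-right L₁ L₂) (≡.trans (det-cross L₁ L₂ L₃) d)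
      c₁₃ : cross L₁ L₃ ≡ (0# , 0# , 0#)
      c₁₃ = no-common-zero′ (cross L₁ L₃) (cross-left L₁ L₃)
        (≡.trans (det-cross L₁ L₃ L₂) (≡.trans (det-swap L₁ L₂ L₃) (≡.trans (cong -_ d) (solve 0 (:- :0 := :0) ≡.refl))))
        (cross-right L₁ L₃)

  -- The new coordinates are the values of the three line equations, so the sides become X = 0, Y =
  -- 0 and Z = 0.
  relative : Point → Vec₃
  relative p = L₁ ∙ coordinates p , L₂ ∙ coordinates p , L₃ ∙ coordinates p

  code : Point → Pt
  code p = point (relative p)

  abstract
    relative-nonzero : ∀ p → NonZero (relative p)
    relative-nonzero p (h₁ , h₂ , h₃) = coordinates-nonzero p (frame-kernel {L₁} {L₂} {L₃} frame-det h₁ h₂ h₃)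

    pairing-scale : ∀ f k v → f ∙ (k · v) ≡ k * f ∙ v
    pairing-scale (a , b , c) k (x , y , z) = solve 7 (λ a b c k x y z →
      a :* (k :* x) :+ b :* (k :* y) :+ c :* (k :* z) := k :* (a :* x :+ b :* y :+ c :* z)) ≡.refl a b c k x y z

    ~⇒code : ∀ {p r} → p ~ r → code p ≡ code r
    ~⇒code {p} {r} p~r = let k , e = ~⇒proportional {p} {r} p~r in sym (≡.trans (cong point (relative-scale k e)) (point-scale (relative p) (k≢0 k e)))
      where
      relative-scale : ∀ k → coordinates r ≡ k · coordinates p → relative r ≡ k · relative p
      relative-scale k e = cong₂ _,_ (each L₁) (cong₂ _,_ (each L₂) (each L₃))
        where
        each : ∀ f → f ∙ coordinates r ≡ k * f ∙ coordinates p
        each f = ≡.trans (cong (f ∙_) e) (pairing-scale f k (coordinates p))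
      -- The relation `_~_` admits any scalar; zero is excluded because `r` is a nonzero vector.
      k≢0 : ∀ k → coordinates r ≡ k · coordinates p → k ≢ 0#
      k≢0 k e k≡0 = coordinates-nonzero r (vanishing (cong proj₁ e) , vanishing (cong (λ v → proj₁ (proj₂ v)) e) , vanishing (cong (λ v → proj₂ (proj₂ v)) e))
        where
        vanishing : ∀ {x y} → x ≡ k * y → x ≡ 0#
        vanishing {y = y} h = ≡.trans h (≡.trans (cong (_* y) k≡0) (zeroˡ y))

    code⇒~ : ∀ {p r} → code p ≡ code r → p ~ r
    code⇒~ {p} {r} e = let k , k≢0 , hp = point-vec (relative p) (relative-nonzero p)
                           k′ , k′≢0 , hr = point-vec (relative r) (relative-nonzero r)
                           scaled = relative-ratio k≢0 hp (≡.trans hr (cong (λ c → k′ · Normalisation.vec field′ c) (sym e)))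
      in proportional⇒~ {p} {r} (frame-proportional {L₁} {L₂} {L₃} frame-det (cong proj₁ scaled) (cong (λ v → proj₁ (proj₂ v)) scaled) (cong (λ v → proj₂ (proj₂ v)) scaled))
      where
      relative-ratio : ∀ {k k′ c v w} → k ≢ 0# → v ≡ k · c → w ≡ k′ · c → w ≡ (k′ * k ⁻¹) · v
      relative-ratio {k} {k′} {x , y , z} k≢0 ≡.refl ≡.refl = cong₂ _,_ (each x) (cong₂ _,_ (each y) (each z))
        where
        each : ∀ x → k′ * x ≡ k′ * k ⁻¹ * (k * x)
        each x = equal (vanish₁ (- (k′ * x)) (solve 4 (λ k i k′ x → k′ :* x :- k′ :* i :* (k :* x) := (:- (k′ :* x)) :* (k :* i :- :1)) ≡.refl k (k ⁻¹) k′ x) (difference (*-inverse k k≢0)))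

    code-valid : ∀ p → Valid (code p)
    code-valid p = classify-valid _ _ _

    boundary-code : ∀ p → Triangle l₁ l₂ l₃ p → Boundary (code p)
    boundary-code p t = zero-coordinate (Sum.map (incident⇒ {p} {l₁}) (Sum.map (incident⇒ {p} {l₂}) (incident⇒ {p} {l₃})) t)
      where
      classified : ∀ {x y z} (d : Dec (x ≡ 0#)) (e : Dec (y ≡ 0#)) (f : Dec (z ≡ 0#)) → x ≡ 0# ⊎ y ≡ 0# ⊎ z ≡ 0# →
        Valid (classify x y z d e f) → Boundary (classify x y z d e f)
      classified (no x≢0) (no y≢0) (no z≢0) h _ = Sum.[ x≢0 , Sum.[ y≢0 , z≢0 ] ] h
      classified (yes _) (no _) (no _) _ ok = ok
      classified (no _) (yes _) (no _) _ ok = ok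
      classified (no _) (no _) (yes _) _ ok = ok
      classified (yes _) (yes _) (yes _) _ _ = _
      classified (no _) (yes _) (yes _) _ _ = _
      classified (yes _) (no _) (yes _) _ _ = _
      classified (yes _) (yes _) (no _) _ _ = _
      zero-coordinate : L₁ ∙ coordinates p ≡ 0# ⊎ L₂ ∙ coordinates p ≡ 0# ⊎ L₃ ∙ coordinates p ≡ 0# → Boundary (code p)
      zero-coordinate h = classified _ _ _ h (code-valid p)

    inner-code : ∀ p → ¬ Triangle l₁ l₂ l₃ p → ∃ λ s → ∃ λ t → code p ≡ inner s t × s ≢ 0# × t ≢ 0#
    inner-code p ¬t = classified _ _ _ (λ h → ¬t (inj₁ (⇒incident {p} {l₁} h))) (λ h → ¬t (inj₂ (inj₁ (⇒incident {p} {l₂} h)))) (λ h → ¬t (inj₂ (inj₂ (⇒incident {p} {l₃} h))))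
      where
      classified : ∀ {x y z} (d : Dec (x ≡ 0#)) (e : Dec (y ≡ 0#)) (f : Dec (z ≡ 0#)) → x ≢ 0# → y ≢ 0# → z ≢ 0# →
        ∃ λ s → ∃ λ t → classify x y z d e f ≡ inner s t × s ≢ 0# × t ≢ 0#
      classified (yes h) _ _ n _ _ = ⊥-elim (n h)
      classified (no _) (yes h) _ _ n _ = ⊥-elim (n h)
      classified (no _) (no _) (yes h) _ _ n = ⊥-elim (n h)
      classified (no x≢0) (no y≢0) (no z≢0) _ _ _ = _ , _ , ≡.refl , ratio-≢0 z≢0 y≢0 , ratio-≢0 x≢0 z≢0

  -- The line aX + bY + cZ = 0 of the new coordinates, written as a line of the original plane.
  combined : K → K → K → Vec₃
  combined a b c = sum (proj₁) , sum (λ v → proj₁ (proj₂ v)) , sum (λ v → proj₂ (proj₂ v))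
    where
    sum : (Vec₃ → K) → K
    sum f = a * f L₁ + b * f L₂ + c * f L₃

  abstract
    combined-pairing : ∀ a b c v → combined a b c ∙ v ≡ (a , b , c) ∙ (L₁ ∙ v , L₂ ∙ v , L₃ ∙ v)
    combined-pairing a b c (x , y , z) = solve 15 (λ a b c x y z a₁ b₁ c₁ a₂ b₂ c₂ a₃ b₃ c₃ →
      (a :* a₁ :+ b :* a₂ :+ c :* a₃) :* x :+ (a :* b₁ :+ b :* b₂ :+ c :* b₃) :* y :+ (a :* c₁ :+ b :* c₂ :+ c :* c₃) :* z :=
      a :* (a₁ :* x :+ b₁ :* y :+ c₁ :* z) :+ b :* (a₂ :* x :+ b₂ :* y :+ c₂ :* z) :+ c :* (a₃ :* x :+ b₃ :* y :+ c₃ :* z)) ≡.refl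
      a b c x y z (proj₁ L₁) (proj₁ (proj₂ L₁)) (proj₂ (proj₂ L₁)) (proj₁ L₂) (proj₁ (proj₂ L₂)) (proj₂ (proj₂ L₂)) (proj₁ L₃) (proj₁ (proj₂ L₃)) (proj₂ (proj₂ L₃))

    -- The coordinates of `combined` are the pairings of (a,b,c) with the columns of the matrix of
    -- the three lines, whose determinant is that of its rows.
    combined-nonzero : ∀ a b c → ¬ (a ≡ 0# × b ≡ 0# × c ≡ 0#) → NonZero (combined a b c)
    combined-nonzero a b c nz (h₁ , h₂ , h₃) = nz (frame-kernel {column proj₁} {column (λ v → proj₁ (proj₂ v))} {column (λ v → proj₂ (proj₂ v))}
      (λ d → frame-det (≡.trans (sym transpose) d)) (≡.trans (commuted _ _ _) h₁) (≡.trans (commuted _ _ _) h₂) (≡.trans (commuted _ _ _) h₃))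
      where
      column : (Vec₃ → K) → Vec₃
      column f = f L₁ , f L₂ , f L₃
      commuted : ∀ x y z → x * a + y * b + z * c ≡ a * x + b * y + c * z
      commuted x y z = cong₂ _+_ (cong₂ _+_ (*-comm x a) (*-comm y b)) (*-comm z c)
      transpose : det (column proj₁) (column (λ v → proj₁ (proj₂ v))) (column (λ v → proj₂ (proj₂ v))) ≡ det L₁ L₂ L₃
      transpose = solve 9 (λ a b c a′ b′ c′ a″ b″ c″ →
        a :* (b′ :* c″ :- b″ :* c′) :+ a′ :* (b″ :* c :- b :* c″) :+ a″ :* (b :* c′ :- b′ :* c) :=
        a :* (b′ :* c″ :- c′ :* b″) :+ b :* (c′ :* a″ :- a′ :* c″) :+ c :* (a′ :* b″ :- b′ :* a″)) ≡.refl
        (proj₁ L₁) (proj₁ (proj₂ L₁)) (proj₂ (proj₂ L₁)) (proj₁ L₂) (proj₁ (proj₂ L₂)) (proj₂ (proj₂ L₂)) (proj₁ L₃) (proj₁ (proj₂ L₃)) (proj₂ (proj₂ L₃))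

    on-code : ∀ a b c p → combined a b c ∙ coordinates p ≡ 0# → On a b c (code p)
    on-code a b c p h = let k , k≢0 , e = point-vec (relative p) (relative-nonzero p) in
      cancelˡ k≢0 (≡.trans (sym (pairing-scale (a , b , c) k (Normalisation.vec field′ (code p)))) (≡.trans (cong ((a , b , c) ∙_) (sym e))
        (≡.trans (sym (combined-pairing a b c (coordinates p))) h)))

  abstract
    lookup-distinct : ∀ L → AllPairs (λ p r → code p ≢ code r) L → ∀ i j → code (lookup L i) ≡ code (lookup L j) → i ≡ j
    lookup-distinct (p ∷ L) (p∉ ∷ L!) Fin.zero Fin.zero e = ≡.refl
    lookup-distinct (p ∷ L) (p∉ ∷ L!) Fin.zero (Fin.suc j) e = ⊥-elim (All.lookup p∉ (∈-lookup j) e)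
    lookup-distinct (p ∷ L) (p∉ ∷ L!) (Fin.suc i) Fin.zero e = ⊥-elim (All.lookup p∉ (∈-lookup i) (sym e))
    lookup-distinct (p ∷ L) (p∉ ∷ L!) (Fin.suc i) (Fin.suc j) e = cong Fin.suc (lookup-distinct L L! i j e)

    distinct-codes : ∀ {L} → Distinct L → AllPairs (λ p r → code p ≢ code r) L
    distinct-codes = AllPairs.map (λ {p} {r} n e → n (code⇒~ {p} {r} e))

  module _ (H M : List Point) (H-length : length H ≡ 6) (H-distinct : Distinct H) (H⊆T : All (Triangle l₁ l₂ l₃) H)
    (M-length : length M ≡ 5) (M-distinct : Distinct M) (M∩T : All (λ p → ¬ Triangle l₁ l₂ l₃ p) M)
    (double-blocking : DoubleBlocking (Modify (Triangle l₁ l₂ l₃) H M)) where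

    added : Fin 5 → Point
    added m = lookup M (Fin.cast (sym M-length) m)

    added-inner : ∀ m → ∃ λ s → ∃ λ t → code (added m) ≡ inner s t × s ≢ 0# × t ≢ 0#
    added-inner m = inner-code (added m) (All.lookup M∩T (∈-lookup (Fin.cast (sym M-length) m)))

    added-u added-v : Fin 5 → K
    added-u m = proj₁ (added-inner m)
    added-v m = proj₁ (proj₂ (added-inner m))

    abstract
      added-code : ∀ m → code (added m) ≡ inner (added-u m) (added-v m)
      added-code m = proj₁ (proj₂ (proj₂ (added-inner m)))

      added-separated : ∀ {m n} → added-u m ≡ added-u n → added-v m ≡ added-v n → m ≡ n
      added-separated {m} {n} hu hv = ≡.trans (sym (Finₚ.cast-involutive M-length (sym M-length) m)) (≡.trans (cong (Fin.cast M-length)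
        (lookup-distinct M (distinct-codes M-distinct) _ _ (≡.trans (added-code m) (≡.trans (cong₂ inner hu hv) (sym (added-code n))))))
        (Finₚ.cast-involutive M-length (sym M-length) n))

      added-member : ∀ {p} → p ∈ₚ M → ∃ λ m → code p ≡ inner (added-u m) (added-v m)
      added-member {p} p∈ = Fin.cast M-length i , ≡.trans (~⇒code {p} {lookup M i} (lookup-index p∈))
        (≡.trans (cong (λ j → code (lookup M j)) (sym (Finₚ.cast-involutive (sym M-length) M-length i))) (added-code (Fin.cast M-length i)))
        where
        i : Fin (length M)
        i = Any.index p∈

    holes : List Pt
    holes = map code H

    abstract
      code∈holes : ∀ {p} → code p ∈ holes → p ∈ₚ H
      code∈holes {p} c∈ = Any.map (λ {r} e → code⇒~ {p} {r} e) (mapped c∈)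
        where
        mapped : ∀ {L} → code p ∈ map code L → Any (λ r → code p ≡ code r) L
        mapped {r ∷ L} (here e) = here e
        mapped {r ∷ L} (there h) = there (mapped h)

      blocking : Blocking
      blocking = record
        { H = holes
        ; H-length = ≡.trans (Listₚ.length-map code H) H-length
        ; H! = AllPairsₚ.map⁺ (distinct-codes H-distinct)
        ; H-boundary = λ p∈ → let r , r∈ , e = ∈-map⁻ code p∈ in subst Boundary (sym e) (boundary-code r (All.lookup H⊆T r∈))
        ; u = added-u ; v = added-v
        ; u≢0 = λ m → proj₁ (proj₂ (proj₂ (proj₂ (added-inner m))))
        ; v≢0 = λ m → proj₂ (proj₂ (proj₂ (proj₂ (added-inner m))))
        ; separated = added-separated
        ; blocks = λ a b c nz → let
              p , r , sp , sr , p-on , r-on , p≁r = double-blocking (vector (combined a b c) (combined-nonzero a b c nz))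
            in code p , code r , (λ e → p≁r (code⇒~ {p} {r} e)) , member {p} sp , member {r} sr , on a b c nz p p-on , on a b c nz r r-on }
        where
        member : ∀ {p} → Modify (Triangle l₁ l₂ l₃) H M p → (Boundary (code p) × code p ∉ holes) ⊎ (∃ λ m → code p ≡ inner (added-u m) (added-v m))
        member {p} (inj₁ (t , p∉)) = inj₁ (boundary-code p t , λ h → p∉ (code∈holes {p} h))
        member {p} (inj₂ p∈) = inj₂ (added-member {p} p∈)
        on : ∀ a b c nz p → p I vector (combined a b c) (combined-nonzero a b c nz) → On a b c (code p)
        on a b c nz p h = on-code a b c p (≡.trans (cong (_∙ coordinates p) (sym (coordinates-vector (combined a b c) (combined-nonzero a b c nz)))) (incident⇒ {p} {vector (combined a b c) (combined-nonzero a b c nz)} h))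

open PG

theorem1 : (q : ℕ) → PrimePower q →
    (F : CommutativeRing 0ℓ 0ℓ) → IsField F → HasOrder F q →
    (l₁ l₂ l₃ : Line F) → NonConcurrent F l₁ l₂ l₃ →
    (H M : List (Point F)) →
    length H ≡ 6 → Distinct F H → All (Triangle F l₁ l₂ l₃) H →
    length M ≡ 5 → Distinct F M → All (λ p → ¬ Triangle F l₁ l₂ l₃ p) M →
    ¬ DoubleBlocking F (Modify F (Triangle F l₁ l₂ l₃) H M)
theorem1 q prime-power F isField order l₁ l₂ l₃ nc H M lH dH tH lM dM tM db =
  BlockingImpossible.blocking-impossible (Transport.field′ F isField order)
    (TriangleCoordinates.blocking F isField order l₁ l₂ l₃ nc H M lH dH tH lM dM tM db)
    (subst PrimePower (sym (Listₚ.length-tabulate {n = q} (λ i → i))) prime-power)
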